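{- For every $\gamma\in(0,1)$ there exists $\epsilon=\epsilon(\gamma)>0$ such that the following holds. Let $p$ be a sufficiently large prime, let $P=A\times B\subseteq(\mathbb{F}_p^2\times\mathbb{F}_p^2)\setminus\{(0,0,0,0)\}$, and let $S$ be a symmetric subset of $SL_2(\mathbb{F}_p)$ with $p^\gamma<|S|<p^{3-2\gamma}$ and $|S\cap gH|<p^{ -\gamma/2}|S|$ for every proper subgroup $H\subsetneq SL_2(\mathbb{F}_p)$ and every $g\in SL_2(\mathbb{F}_p)$. Then \[I(P,S)\ll\frac{|A|^{1/2}|B||S|}{p}+p^{\frac{2-\epsilon}{4}}|A|^{1/2}|B|^{1/2}|S|^{3/4}.\] Moreover, if every line through the origin contains at most $k$ points of $B$, then \[I(P,S)\ll\frac{|A|^{1/2}|B||S|}{p}+k^{1/4}p^{\frac{1-\epsilon}{4}}|A|^{1/2}|B|^{1/2}|S|^{3/4}.\]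
   Context: $S$ symmetric means $S=S^{ -1}$. $I(P,S)$ is the number of pairs $((x,y),\theta)\in P\times S$ with $\theta y=x$ (matrices acting on column vectors). A line through the origin is a one-dimensional subspace of $\mathbb{F}_p^2$. $X\ll Y$ means $X\le CY$ for a constant $C$ independent of $p,A,B,S,k$. -}

module Defs where

open import Data.Nat using (ℕ; _+_; _*_; _∸_; _^_; _≤_; NonZero)
open import Data.Nat.DivMod using (_mod_)
open import Data.Fin using (Fin; toℕ)
open import Data.Fin.Properties using (_≟_)
open import Data.Bool using (Bool; true; false; _∧_)
open import Data.List using (List; allFin; cartesianProduct; filterᵇ; length; concatMap; map)
open import Data.Bool.ListAction using (any)
open import Data.Product using (_×_; _,_; proj₁; proj₂; Σ)
open import Relation.Nullary.Decidable using (⌊_⌋)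
open import Relation.Binary.PropositionalEquality using (_≡_)

F : ℕ → Set
F p = Fin p

module _ {p : ℕ} .{{_ : NonZero p}} where

  _+F_ : F p → F p → F p
  x +F y = (toℕ x + toℕ y) mod p

  _*F_ : F p → F p → F p
  x *F y = (toℕ x * toℕ y) mod p

  -F_ : F p → F p
  -F x = (p ∸ toℕ x) mod p

  0F : F p
  0F = 0 mod p

  1F : F p
  1F = 1 mod p

eqF : ∀ {p} → F p → F p → Bool
eqF x y = ⌊ x ≟ y ⌋

Pt : ℕ → Set
Pt p = F p × F p

eqPt : ∀ {p} → Pt p → Pt p → Bool
eqPt (x₁ , x₂) (y₁ , y₂) = eqF x₁ y₁ ∧ eqF x₂ y₂

origin : ∀ {p} .{{_ : NonZero p}} → Pt p
origin = 0F , 0F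

record Mat (p : ℕ) : Set where
  constructor mat
  field
    a b c d : F p

eqMat : ∀ {p} → Mat p → Mat p → Bool
eqMat (mat a b c d) (mat a' b' c' d') = eqF a a' ∧ eqF b b' ∧ eqF c c' ∧ eqF d d'

module _ {p : ℕ} .{{_ : NonZero p}} where

  act : Mat p → Pt p → Pt p
  act (mat a b c d) (x₁ , x₂) = ((a *F x₁) +F (b *F x₂)) , ((c *F x₁) +F (d *F x₂))

  scale : F p → Pt p → Pt p
  scale t (x₁ , x₂) = (t *F x₁) , (t *F x₂)

  mul : Mat p → Mat p → Mat p
  mul (mat a b c d) (mat a' b' c' d') =
    mat ((a *F a') +F (b *F c')) ((a *F b') +F (b *F d'))
        ((c *F a') +F (d *F c')) ((c *F b') +F (d *F d'))

  idM : Mat p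
  idM = mat 1F 0F 0F 1F

  det : Mat p → F p
  det (mat a b c d) = (a *F d) +F (-F (b *F c))

  -- inverse of a determinant-one matrix (the adjugate)
  inv : Mat p → Mat p
  inv (mat a b c d) = mat d (-F b) (-F c) a

  isSL : Mat p → Bool
  isSL θ = eqF (det θ) 1F

allF : ∀ p → List (F p)
allF p = allFin p

allPt : ∀ p → List (Pt p)
allPt p = cartesianProduct (allF p) (allF p)

allMat : ∀ p → List (Mat p)
allMat p = concatMap (λ a → concatMap (λ b → concatMap (λ c → map (λ d → mat a b c d)
             (allF p)) (allF p)) (allF p)) (allF p)

count : ∀ {X : Set} → (X → Bool) → List X → ℕ
count f xs = length (filterᵇ f xs)

-- Finite sets are given by their (Boolean) indicator functions.
cardPt : ∀ {p} → (Pt p → Bool) → ℕ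
cardPt {p} A = count A (allPt p)

cardMat : ∀ {p} → (Mat p → Bool) → ℕ
cardMat {p} S = count S (allMat p)

module _ {p : ℕ} .{{_ : NonZero p}} where

  incidences : (Pt p → Bool) → (Pt p → Bool) → (Mat p → Bool) → ℕ
  incidences A B S =
    count (λ t → A (proj₁ (proj₁ t)) ∧ B (proj₂ (proj₁ t)) ∧ S (proj₂ t)
                 ∧ eqPt (act (proj₂ t) (proj₂ (proj₁ t))) (proj₁ (proj₁ t)))
          (cartesianProduct (cartesianProduct (allPt p) (allPt p)) (allMat p))

  IsProperSubgroup : (Mat p → Bool) → Set
  IsProperSubgroup H =
    (∀ θ → H θ ≡ true → isSL θ ≡ true) ×
    (H idM ≡ true) ×
    (∀ θ η → H θ ≡ true → H η ≡ true → H (mul θ η) ≡ true) ×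
    (∀ θ → H θ ≡ true → H (inv θ) ≡ true) ×
    Σ (Mat p) (λ θ → (isSL θ ≡ true) × (H θ ≡ false))

  inCoset : Mat p → (Mat p → Bool) → Mat p → Bool
  inCoset g H θ = any (λ h → H h ∧ eqMat (mul g h) θ) (allMat p)

  cardCosetMeet : (Mat p → Bool) → Mat p → (Mat p → Bool) → ℕ
  cardCosetMeet S g H = count (λ θ → S θ ∧ inCoset g H θ) (allMat p)

  -- y lies on the line through the origin spanned by v (v ≠ 0)
  onLine : Pt p → Pt p → Bool
  onLine v y = any (λ t → eqPt (scale t v) y) (allF p)

  LinesBounded : (Pt p → Bool) → ℕ → Set
  LinesBounded B k = ∀ v → eqPt v origin ≡ false → count (λ y → B y ∧ onLine v y) (allPt p) ≤ k

{-# OPTIONS --safe #-}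
module Submission where

-- By Cauchy–Schwarz in the first coordinate and the symmetry of S, I(P,S)² is at most |A| times
-- Σ_g r(g) T(g), where r(g) counts the representations of g as a quotient of two elements of S and
-- T(g) = #(B ∩ g⁻¹B).  The mean of T is about |B|²/p², and its variance is bounded by counting the
-- solutions of det(y,u) = det(y,v) in B; one more Cauchy–Schwarz leaves the multiplicative energy
-- E(S) = Σ r(g)² in the error term.  So it suffices to save a power of p in E(S) ≤ |S|³.
-- If K E(S) > |S|³, the Balog–Szemerédi–Gowers argument and a theorem of Tao give a symmetric set D,
-- growing under multiplication only by powers of K, a translate of which contains a proportion of S
-- polynomial in 1/K.
-- In SL₂ such a D is either small or almost everything, or else concentrated on a coset of a proper
-- subgroup.  Here one escapes from the normalisers of tori, bounds the intersection of D with a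
-- centraliser by |D|^(1/3), and finds many elements of D in each centraliser it meets because traces
-- take few values; the set of "involved" tori is then invariant under D, hence under the whole group,
-- which makes D large.  Taking K to be a small power of p contradicts all three alternatives.

-- The trivial bound E(S) ≤ |S|³ already gives the second term of the theorem with ε = 0, so every
-- power of p saved in the energy is a saving in the theorem. The two estimates differ only in k,
-- the largest number of points of B on a line through the origin: a line has p points, so k = p
-- gives the first from the second. K is the integer part of the d-th root of p. Every constant of
-- the combinatorial and the group-theoretic part is polynomial in K, and d is chosen so large that
-- these constants, raised to the power 2b where γ = a/b, stay below p ≤ p^a; a saving of K is then
-- a saving of p^(1/d), up to a constant factor. The obstacle in the group part is that the
-- approximate group D need not inherit the nonconcentration of S. Only a subset E of D, a translate
-- of part of S, does. So elements in general position are always chosen in E, while all counting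
-- takes place in powers of D, up to the ninth. Everything is counted in natural numbers: roots are
-- cleared by powers, negative terms change sides, and variances take the place of character sums.

open import Level using (0ℓ)
open import Algebra.Bundles using (CommutativeRing; Group)

-- Polynomial identities over a commutative ring.

module RingSolving (R : CommutativeRing 0ℓ 0ℓ) where

  open import Data.Nat.Base as ℕ using (ℕ; zero; suc)
  open import Data.Integer.Base as ℤ using (ℤ; +_; -[1+_]; _⊖_)
  import Data.Integer.Properties as ℤₚ
  import Data.Nat.Properties as ℕₚ
  open import Data.Maybe.Base using (just; nothing)
  open import Relation.Nullary.Decidable using (yes; no)
  open import Relation.Binary.Definitions using (WeaklyDecidable)
  import Relation.Binary.PropositionalEquality as ≡
  open CommutativeRing R
  open import Algebra.Properties.Semiring.Mult semiring using (_×_; ×-homo-+; ×1-homo-*)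
  open import Algebra.Properties.Ring ring using (-‿distribˡ-*; -‿distribʳ-*; -‿+-comm; -‿involutive; -0#≈0#)
  open import Algebra.Solver.Ring.AlmostCommutativeRing using (fromCommutativeRing; _-Raw-AlmostCommutative⟶_; Induced-equivalence)
  open import Relation.Binary.Reasoning.Setoid setoid

  private
    ⟦_⟧ᶻ : ℤ → Carrier
    ⟦ + n ⟧ᶻ = n × 1#
    ⟦ -[1+ n ] ⟧ᶻ = - (suc n × 1#)

    ⟦-⟧ : ∀ i → ⟦ ℤ.- i ⟧ᶻ ≈ - ⟦ i ⟧ᶻ
    ⟦-⟧ (+ zero) = sym -0#≈0#
    ⟦-⟧ (+ suc n) = refl
    ⟦-⟧ -[1+ n ] = sym (-‿involutive _)

    ⟦⊖⟧ : ∀ m n → ⟦ m ⊖ n ⟧ᶻ ≈ m × 1# + - (n × 1#)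
    ⟦⊖⟧ m zero = trans (sym (+-identityʳ _)) (+-congˡ (sym -0#≈0#))
    ⟦⊖⟧ zero (suc n) = sym (+-identityˡ _)
    ⟦⊖⟧ (suc m) (suc n) = begin
      ⟦ suc m ⊖ suc n ⟧ᶻ                         ≡⟨ ≡.cong ⟦_⟧ᶻ (ℤₚ.[1+m]⊖[1+n]≡m⊖n m n) ⟩
      ⟦ m ⊖ n ⟧ᶻ                                 ≈⟨ ⟦⊖⟧ m n ⟩
      m × 1# + - (n × 1#)                        ≈⟨ +-congʳ (+-identityʳ _) ⟨
      m × 1# + 0# + - (n × 1#)                   ≈⟨ +-congʳ (+-congˡ (-‿inverseʳ 1#)) ⟨
      m × 1# + (1# + - 1#) + - (n × 1#)          ≈⟨ +-congʳ (+-assoc _ _ _) ⟨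
      m × 1# + 1# + - 1# + - (n × 1#)            ≈⟨ +-assoc _ _ _ ⟩
      m × 1# + 1# + (- 1# + - (n × 1#))          ≈⟨ +-cong (+-comm _ _) (-‿+-comm _ _) ⟩
      1# + m × 1# + - (1# + n × 1#)              ∎

    ⟦+⟧ : ∀ i j → ⟦ i ℤ.+ j ⟧ᶻ ≈ ⟦ i ⟧ᶻ + ⟦ j ⟧ᶻ
    ⟦+⟧ (+ m) (+ n) = ×-homo-+ 1# m n
    ⟦+⟧ (+ m) -[1+ n ] = ⟦⊖⟧ m (suc n)
    ⟦+⟧ -[1+ m ] (+ n) = trans (⟦⊖⟧ n (suc m)) (+-comm _ _)
    ⟦+⟧ -[1+ m ] -[1+ n ] = begin
      - (suc (suc (m ℕ.+ n)) × 1#)      ≡⟨ ≡.cong (λ k → - (k × 1#)) (≡.cong suc (ℕₚ.+-suc m n)) ⟨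
      - ((suc m ℕ.+ suc n) × 1#)        ≈⟨ -‿cong (×-homo-+ 1# (suc m) (suc n)) ⟩
      - (suc m × 1# + suc n × 1#)       ≈⟨ -‿+-comm _ _ ⟨
      - (suc m × 1#) + - (suc n × 1#)   ∎

    ⟦+*+⟧ : ∀ m n → ⟦ + m ℤ.* + n ⟧ᶻ ≈ (m × 1#) * (n × 1#)
    ⟦+*+⟧ m n = trans (reflexive (≡.cong ⟦_⟧ᶻ (≡.sym (ℤₚ.pos-* m n)))) (×1-homo-* m n)

    ⟦*⟧ : ∀ i j → ⟦ i ℤ.* j ⟧ᶻ ≈ ⟦ i ⟧ᶻ * ⟦ j ⟧ᶻ
    ⟦*⟧ (+ m) (+ n) = ⟦+*+⟧ m n
    ⟦*⟧ (+ m) -[1+ n ] = begin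
      ⟦ + m ℤ.* -[1+ n ] ⟧ᶻ         ≡⟨ ≡.cong ⟦_⟧ᶻ (ℤₚ.neg-distribʳ-* (+ m) (+ suc n)) ⟨
      ⟦ ℤ.- (+ m ℤ.* + suc n) ⟧ᶻ    ≈⟨ trans (⟦-⟧ (+ m ℤ.* + suc n)) (-‿cong (⟦+*+⟧ m (suc n))) ⟩
      - ((m × 1#) * (suc n × 1#))   ≈⟨ -‿distribʳ-* _ _ ⟩
      (m × 1#) * - (suc n × 1#)     ∎
    ⟦*⟧ -[1+ m ] (+ n) = begin
      ⟦ -[1+ m ] ℤ.* + n ⟧ᶻ         ≡⟨ ≡.cong ⟦_⟧ᶻ (ℤₚ.neg-distribˡ-* (+ suc m) (+ n)) ⟨
      ⟦ ℤ.- (+ suc m ℤ.* + n) ⟧ᶻ    ≈⟨ trans (⟦-⟧ (+ suc m ℤ.* + n)) (-‿cong (⟦+*+⟧ (suc m) n)) ⟩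
      - ((suc m × 1#) * (n × 1#))   ≈⟨ -‿distribˡ-* _ _ ⟩
      - (suc m × 1#) * (n × 1#)     ∎
    ⟦*⟧ -[1+ m ] -[1+ n ] = begin
      ⟦ + suc m ℤ.* + suc n ⟧ᶻ          ≈⟨ ⟦+*+⟧ (suc m) (suc n) ⟩
      (suc m × 1#) * (suc n × 1#)       ≈⟨ -‿involutive _ ⟨
      - - ((suc m × 1#) * (suc n × 1#)) ≈⟨ -‿cong (-‿distribʳ-* _ _) ⟩
      - ((suc m × 1#) * - (suc n × 1#)) ≈⟨ -‿distribˡ-* _ _ ⟩
      - (suc m × 1#) * - (suc n × 1#)   ∎

    morphism : ℤ.+-*-rawRing -Raw-AlmostCommutative⟶ fromCommutativeRing R
    morphism = record
      { ⟦_⟧ = ⟦_⟧ᶻ ; +-homo = ⟦+⟧ ; *-homo = ⟦*⟧ ; -‿homo = ⟦-⟧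
      ; 0-homo = refl ; 1-homo = +-identityʳ 1# }

    -- Terms cancel in normal forms only if equal coefficients are recognised. Equality in the ring
    -- is not assumed decidable, so the coefficients are integers, for which a test exists.
    _coeff≟_ : WeaklyDecidable (Induced-equivalence morphism)
    i coeff≟ j with i ℤₚ.≟ j
    ... | yes ≡.refl = just refl
    ... | no _ = nothing

  open import Algebra.Solver.Ring ℤ.+-*-rawRing (fromCommutativeRing R) morphism _coeff≟_
    using (Polynomial; solve; prove; con; var; _:+_; _:*_; :-_; _:-_; _:=_) public

  -- The integer 0 evaluates to `0#` definitionally, but 1 evaluates to `1# + 0#`. Goals containing
  -- `1#` therefore pass it to `solve` as one more variable, usually `o`, and the remaining factors
  -- `1#` are removed by hand.
  :0 : ∀ {n} → Polynomial n
  :0 = con (+ 0)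

open import Algebra.Structures using (IsGroup; IsCommutativeRing)
open import Data.Fin using (Fin; zero; suc; toℕ)
open import Data.Nat.Primality using (Prime)
open import Data.Nat.Tactic.RingSolver using (solve-∀)
open import Data.Product using (_×_; _,_; Σ; ∃; ∃₂; proj₁; proj₂)
open import Data.Sum using (_⊎_; inj₁; inj₂)
open import Data.Unit using (tt)
open import Function using (_∘_; id)
open import Relation.Binary.Definitions using (DecidableEquality)
open import Relation.Binary.PropositionalEquality hiding (J; [_])
open import Relation.Nullary using (Dec; yes; no; ¬_; does; contradiction)
open import Relation.Nullary.Decidable using (_×-dec_; _⊎-dec_; _→-dec_; ¬?; decidable-stable; map′; recompute; ⌊_⌋)

-- Finite sums, counting and Cauchy-Schwarz.

module FiniteSums where

  open import Data.Nat hiding (_≟_)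
  open import Data.Nat.Properties hiding (_≟_)
  open import Data.Bool using (if_then_else_)
  import Data.Fin.Properties as Finₚ
  open import Data.List using (List; []; _∷_; _++_; map; concatMap; cartesianProduct; allFin; tabulate; length)
  open import Data.List.Properties using (length-tabulate)
  open import Data.List.Membership.Propositional using (_∈_)
  open import Data.List.Relation.Unary.Any using (here; there)
  open import Data.Product.Properties using (≡-dec)

  private variable
    X Y : Set
    P Q : Set

  infixr 2 _×?_
  infixr 1 _⊎?_

  opaque
    _×?_ : Dec P → Dec Q → Dec (P × Q)
    _×?_ = _×-dec_

    _⊎?_ : Dec P → Dec Q → Dec (P ⊎ Q)
    _⊎?_ = _⊎-dec_

    -- The indicator of a decidable proposition. It is opaque, so that conversion checks do not run
    -- decision procedures; the lemmas that follow are its interface.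
    ⟦_⟧ : Dec P → ℕ
    ⟦ d ⟧ = if does d then 1 else 0

    ⟦⟧-yes : (d : Dec P) → P → ⟦ d ⟧ ≡ 1
    ⟦⟧-yes (yes _) p = refl
    ⟦⟧-yes (no ¬p) p = contradiction p ¬p

    ⟦⟧-no : (d : Dec P) → ¬ P → ⟦ d ⟧ ≡ 0
    ⟦⟧-no (no _) ¬p = refl
    ⟦⟧-no (yes p) ¬p = contradiction p ¬p

    ⟦⟧≤1 : (d : Dec P) → ⟦ d ⟧ ≤ 1
    ⟦⟧≤1 (yes _) = ≤-refl
    ⟦⟧≤1 (no _) = z≤n

    -- Allows a summand to be estimated under the condition that selects it; this is how hypotheses
    -- about x enter a sum over all x.
    ⟦⟧-gate : (d : Dec P) {m n : ℕ} → (P → m ≤ n) → ⟦ d ⟧ * m ≤ n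
    ⟦⟧-gate (yes p) h = ≤-trans (≤-reflexive (+-identityʳ _)) (h p)
    ⟦⟧-gate (no _) h = z≤n

    ⟦⟧-gate-mono : (d : Dec P) {m n : ℕ} → (P → m ≤ n) → ⟦ d ⟧ * m ≤ ⟦ d ⟧ * n
    ⟦⟧-gate-mono (yes p) h = *-monoʳ-≤ 1 (h p)
    ⟦⟧-gate-mono (no _) h = z≤n

    ⟦⟧-gate-cong : (d : Dec P) {m n : ℕ} → (P → m ≡ n) → ⟦ d ⟧ * m ≡ ⟦ d ⟧ * n
    ⟦⟧-gate-cong (yes p) h = cong (1 *_) (h p)
    ⟦⟧-gate-cong (no _) h = refl

    ⟦⟧-mono : (d : Dec P) (e : Dec Q) → (P → Q) → ⟦ d ⟧ ≤ ⟦ e ⟧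
    ⟦⟧-mono (yes p) e h = ≤-reflexive (sym (⟦⟧-yes e (h p)))
    ⟦⟧-mono (no _) e h = z≤n

    ⟦⟧-cong : (d : Dec P) (e : Dec Q) → (P → Q) → (Q → P) → ⟦ d ⟧ ≡ ⟦ e ⟧
    ⟦⟧-cong d e f g = ≤-antisym (⟦⟧-mono d e f) (⟦⟧-mono e d g)

    ⟦⟧-× : (d : Dec P) (e : Dec Q) → ⟦ d ×? e ⟧ ≡ ⟦ d ⟧ * ⟦ e ⟧
    ⟦⟧-× (yes _) (yes _) = refl
    ⟦⟧-× (yes _) (no _) = refl
    ⟦⟧-× (no _) e = refl

    ⟦⟧-sq : (d : Dec P) → ⟦ d ⟧ * ⟦ d ⟧ ≡ ⟦ d ⟧
    ⟦⟧-sq (yes _) = refl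
    ⟦⟧-sq (no _) = refl

    ⟦⟧-pos : (d : Dec P) → 0 < ⟦ d ⟧ → P
    ⟦⟧-pos (yes p) _ = p

  sumL : List X → (X → ℕ) → ℕ
  sumL [] f = 0
  sumL (x ∷ xs) f = f x + sumL xs f

  sumL-cong : (xs : List X) {f g : X → ℕ} → (∀ x → f x ≡ g x) → sumL xs f ≡ sumL xs g
  sumL-cong [] h = refl
  sumL-cong (x ∷ xs) h = cong₂ _+_ (h x) (sumL-cong xs h)

  sumL-mono : (xs : List X) {f g : X → ℕ} → (∀ x → f x ≤ g x) → sumL xs f ≤ sumL xs g
  sumL-mono [] h = z≤n
  sumL-mono (x ∷ xs) h = +-mono-≤ (h x) (sumL-mono xs h)

  private
    interchange : ∀ a b c d → (a + b) + (c + d) ≡ (a + c) + (b + d)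
    interchange = solve-∀

  sumL-+ : (xs : List X) (f g : X → ℕ) → sumL xs (λ x → f x + g x) ≡ sumL xs f + sumL xs g
  sumL-+ [] f g = refl
  sumL-+ (x ∷ xs) f g = trans (cong (f x + g x +_) (sumL-+ xs f g)) (interchange (f x) (g x) (sumL xs f) (sumL xs g))

  sumL-*ˡ : (xs : List X) (c : ℕ) (f : X → ℕ) → sumL xs (λ x → c * f x) ≡ c * sumL xs f
  sumL-*ˡ [] c f = sym (*-zeroʳ c)
  sumL-*ˡ (x ∷ xs) c f = trans (cong (c * f x +_) (sumL-*ˡ xs c f)) (sym (*-distribˡ-+ c (f x) _))

  sumL-0 : (xs : List X) → sumL xs (λ _ → 0) ≡ 0
  sumL-0 [] = refl
  sumL-0 (x ∷ xs) = sumL-0 xs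

  sumL-swap : (xs : List X) (ys : List Y) (f : X → Y → ℕ) →
    sumL xs (λ x → sumL ys (f x)) ≡ sumL ys (λ y → sumL xs (λ x → f x y))
  sumL-swap [] ys f = sym (sumL-0 ys)
  sumL-swap (x ∷ xs) ys f = trans (cong (sumL ys (f x) +_) (sumL-swap xs ys f)) (sym (sumL-+ ys (f x) _))

  sumL-++ : (xs ys : List X) (f : X → ℕ) → sumL (xs ++ ys) f ≡ sumL xs f + sumL ys f
  sumL-++ [] ys f = refl
  sumL-++ (x ∷ xs) ys f = trans (cong (f x +_) (sumL-++ xs ys f)) (sym (+-assoc (f x) _ _))

  sumL-map : (g : X → Y) (xs : List X) (f : Y → ℕ) → sumL (map g xs) f ≡ sumL xs (f ∘ g)
  sumL-map g [] f = refl
  sumL-map g (x ∷ xs) f = cong (f (g x) +_) (sumL-map g xs f)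

  sumL-concatMap : (g : X → List Y) (xs : List X) (f : Y → ℕ) →
    sumL (concatMap g xs) f ≡ sumL xs (λ x → sumL (g x) f)
  sumL-concatMap g [] f = refl
  sumL-concatMap g (x ∷ xs) f = trans (sumL-++ (g x) _ f) (cong (sumL (g x) f +_) (sumL-concatMap g xs f))

  sumL-cartesianProduct : (xs : List X) (ys : List Y) (f : X × Y → ℕ) →
    sumL (cartesianProduct xs ys) f ≡ sumL xs (λ x → sumL ys (λ y → f (x , y)))
  sumL-cartesianProduct [] ys f = refl
  sumL-cartesianProduct (x ∷ xs) ys f = trans (sumL-++ (map (x ,_) ys) _ f)
    (cong₂ _+_ (sumL-map (x ,_) ys f) (sumL-cartesianProduct xs ys f))

  -- `once` expresses that the list has neither omissions nor repetitions, in the one form that sums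
  -- over it need.
  record Finite (X : Set) : Set where
    infix 4 _≟_
    field
      elems : List X
      _≟_   : DecidableEquality X
      once  : ∀ x → sumL elems (λ y → ⟦ y ≟ x ⟧) ≡ 1

  open Finite {{...}} public

  opaque
    ∑ : {{_ : Finite X}} → (X → ℕ) → ℕ
    ∑ = sumL elems

    ∑-sumL : {{_ : Finite X}} (f : X → ℕ) → ∑ f ≡ sumL elems f
    ∑-sumL f = refl

  infix 9 #_
  #_ : {{_ : Finite X}} {P : X → Set} → (∀ x → Dec (P x)) → ℕ
  # P? = ∑ λ x → ⟦ P? x ⟧

  module _ {{_ : Finite X}} where

   opaque
    unfolding ∑

    ∑-cong : {f g : X → ℕ} → (∀ x → f x ≡ g x) → ∑ f ≡ ∑ g
    ∑-cong = sumL-cong elems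

    ∑-mono : {f g : X → ℕ} → (∀ x → f x ≤ g x) → ∑ f ≤ ∑ g
    ∑-mono = sumL-mono elems

    ∑-+ : (f g : X → ℕ) → ∑ (λ x → f x + g x) ≡ ∑ f + ∑ g
    ∑-+ = sumL-+ elems

    ∑-*ˡ : (c : ℕ) (f : X → ℕ) → ∑ (λ x → c * f x) ≡ c * ∑ f
    ∑-*ˡ = sumL-*ˡ elems

    ∑-*ʳ : (c : ℕ) (f : X → ℕ) → ∑ (λ x → f x * c) ≡ ∑ f * c
    ∑-*ʳ c f = trans (∑-cong λ x → *-comm (f x) c) (trans (∑-*ˡ c f) (*-comm c _))

    ∑-swap : {{_ : Finite Y}} (f : X → Y → ℕ) → ∑ (λ x → ∑ (f x)) ≡ ∑ (λ y → ∑ λ x → f x y)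
    ∑-swap = sumL-swap elems elems

    ∑-once : (x : X) → ∑ (λ y → ⟦ y ≟ x ⟧) ≡ 1
    ∑-once = once

    ∑0 : ∑ {X = X} (λ _ → 0) ≡ 0
    ∑0 = sumL-0 elems

    -- The averaging principle. Besides choosing good elements it makes existential statements
    -- decidable, and so allows the arguments by contradiction below.
    ∑<∑⇒∃< : (f g : X → ℕ) → ∑ f < ∑ g → ∃ λ x → f x < g x
    ∑<∑⇒∃< f g = go elems
      where
      go : ∀ xs → sumL xs f < sumL xs g → ∃ λ x → f x < g x
      go (x ∷ xs) h with f x <? g x
      ... | yes q = x , q
      ... | no q = go xs (+-cancelˡ-< (g x) _ _ (≤-<-trans (+-monoˡ-≤ _ (≮⇒≥ q)) h))

  module _ {{_ : Finite X}} where

    ∑-pick : (x : X) (f : X → ℕ) → ∑ (λ y → ⟦ y ≟ x ⟧ * f y) ≡ f x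
    ∑-pick x f = begin
      ∑ (λ y → ⟦ y ≟ x ⟧ * f y) ≡⟨ ∑-cong (λ y → ⟦⟧-gate-cong (y ≟ x) (cong f)) ⟩
      ∑ (λ y → ⟦ y ≟ x ⟧ * f x) ≡⟨ ∑-*ʳ (f x) _ ⟩
      ∑ (λ y → ⟦ y ≟ x ⟧) * f x ≡⟨ cong (_* f x) (∑-once x) ⟩
      1 * f x                   ≡⟨ *-identityˡ (f x) ⟩
      f x                       ∎
      where open ≡-Reasoning

    term≤∑ : (f : X → ℕ) (x : X) → f x ≤ ∑ f
    term≤∑ f x = ≤-trans (≤-reflexive (sym (∑-pick x f)))
      (∑-mono λ y → ⟦⟧-gate (y ≟ x) {f y} (λ _ → ≤-refl))

    module _ {P : X → Set} (P? : ∀ x → Dec (P x)) where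

      opaque
        ∃? : Dec (∃ P)
        ∃? with 0 <? # P?
        ... | yes h with ∑<∑⇒∃< (λ _ → 0) (λ x → ⟦ P? x ⟧) (subst (_< # P?) (sym ∑0) h)
        ... | x , q = yes (x , ⟦⟧-pos (P? x) q)
        ∃? | no h = no λ { (x , p) → h (≤-trans (≤-reflexive (sym (⟦⟧-yes (P? x) p))) (term≤∑ _ x)) }

      #-positive : ∀ x → P x → 0 < # P?
      #-positive x p = ≤-trans (≤-reflexive (sym (⟦⟧-yes (P? x) p))) (term≤∑ _ x)

    ∀? : {P : X → Set} → (∀ x → Dec (P x)) → Dec (∀ x → P x)
    ∀? P? with ∃? (λ x → ¬? (P? x))
    ... | yes (x , ¬p) = no λ h → ¬p (h x)
    ... | no ¬w = yes λ x → decidable-stable (P? x) λ ¬p → ¬w (x , ¬p)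

    module _ {P Q : X → Set} (P? : ∀ x → Dec (P x)) (Q? : ∀ x → Dec (Q x)) where

      #-mono : (∀ x → P x → Q x) → # P? ≤ # Q?
      #-mono h = ∑-mono λ x → ⟦⟧-mono (P? x) (Q? x) (h x)

      #-cong : (∀ x → P x → Q x) → (∀ x → Q x → P x) → # P? ≡ # Q?
      #-cong h k = ∑-cong λ x → ⟦⟧-cong (P? x) (Q? x) (h x) (k x)

    #-split : {P Q : X → Set} (P? : ∀ x → Dec (P x)) (Q? : ∀ x → Dec (Q x)) →
      # P? ≡ # (λ x → P? x ×? Q? x) + # (λ x → P? x ×? ¬? (Q? x))
    #-split P? Q? = trans (∑-cong λ x → case-split (P? x) (Q? x)) (∑-+ _ _)
      where
      case-split : ∀ {A B : Set} (d : Dec A) (e : Dec B) → ⟦ d ⟧ ≡ ⟦ d ×? e ⟧ + ⟦ d ×? ¬? e ⟧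
      case-split d e@(yes b) = sym (trans (cong₂ _+_ (⟦⟧-cong (d ×? e) d proj₁ (_, b)) (⟦⟧-no (d ×? ¬? e) λ (_ , ¬b) → ¬b b)) (+-identityʳ _))
      case-split d e@(no ¬b) = sym (cong₂ _+_ (⟦⟧-no (d ×? e) λ (_ , b) → ¬b b) (⟦⟧-cong (d ×? ¬? e) d proj₁ (_, ¬b)))

    #-list : {P : X → Set} (P? : ∀ x → Dec (P x)) (l : List X) → (∀ x → P x → x ∈ l) → # P? ≤ length l
    #-list P? l h = ≤-trans (∑-mono bound) (total l)
      where
      count-in : ∀ {x} l → x ∈ l → 1 ≤ sumL l (λ y → ⟦ x ≟ y ⟧)
      count-in {x} (y ∷ l) (here e) = ≤-trans (≤-reflexive (sym (⟦⟧-yes (x ≟ y) e))) (m≤m+n _ _)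
      count-in (y ∷ l) (there m) = ≤-trans (count-in l m) (m≤n+m _ _)
      bound : ∀ x → ⟦ P? x ⟧ ≤ sumL l (λ y → ⟦ x ≟ y ⟧)
      bound x with P? x
      ... | yes p = ≤-trans (⟦⟧≤1 (yes p)) (count-in l (h x p))
      ... | no ¬p = ≤-trans (≤-reflexive (⟦⟧-no (no ¬p) ¬p)) z≤n
      total : ∀ l → ∑ (λ x → sumL l (λ y → ⟦ x ≟ y ⟧)) ≤ length l
      total [] = ≤-reflexive ∑0
      total (y ∷ l) = ≤-trans (≤-reflexive (∑-+ (λ x → ⟦ x ≟ y ⟧) _)) (+-mono-≤ (≤-reflexive (∑-once y)) (total l))

    #-unique : {P : X → Set} (P? : ∀ x → Dec (P x)) → (∀ x x' → P x → P x' → x ≡ x') → # P? ≤ 1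
    #-unique P? h with ∃? P?
    ... | yes (x₀ , p₀) = #-list P? (x₀ ∷ []) λ x p → here (h x x₀ p p₀)
    ... | no ¬w = ≤-trans (#-list P? [] λ x p → contradiction (x , p) ¬w) z≤n

    #-inhabited : {P : X → Set} (P? : ∀ x → Dec (P x)) {k : ℕ} → (∀ x → P x → # P? ≤ k) → # P? ≤ k
    #-inhabited P? h with ∃? P?
    ... | yes (x , p) = h x p
    ... | no ¬w = ≤-trans (#-list P? [] λ x p → contradiction (x , p) ¬w) z≤n

    #-≤2 : {P : X → Set} (P? : ∀ x → Dec (P x)) →
      (∀ x y z → P x → P y → P z → x ≢ y → x ≢ z → y ≡ z) → # P? ≤ 2
    #-≤2 P? h with ∃? P?
    ... | no ¬w = ≤-trans (#-list P? [] λ x p → contradiction (x , p) ¬w) z≤n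
    ... | yes (x , p) with ∃? (λ y → P? y ×? ¬? (x ≟ y))
    ... | no ¬w = ≤-trans (#-unique P? λ y z q r → trans (sym (same y q)) (same z r)) (n≤1+n 1)
      where
      same : ∀ y → _ → x ≡ y
      same y q = decidable-stable (x ≟ y) λ ne → ¬w (y , q , ne)
    ... | yes (y , q , ne) = #-list P? (x ∷ y ∷ []) member
      where
      member : ∀ z → _ → z ∈ x ∷ y ∷ []
      member z r with z ≟ x
      ... | yes e = here e
      ... | no ne′ = there (here (sym (h x y z p q r ne λ e → ne′ (sym e))))

    #-∪ : {P Q R : X → Set} (P? : ∀ x → Dec (P x)) (Q? : ∀ x → Dec (Q x)) (R? : ∀ x → Dec (R x)) →
      (∀ x → P x → Q x ⊎ R x) → # P? ≤ # Q? + # R?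
    #-∪ P? Q? R? h = ≤-trans (∑-mono bound) (≤-reflexive (∑-+ (λ x → ⟦ Q? x ⟧) (λ x → ⟦ R? x ⟧)))
      where
      bound : ∀ x → ⟦ P? x ⟧ ≤ ⟦ Q? x ⟧ + ⟦ R? x ⟧
      bound x with P? x
      ... | no ¬p = ≤-trans (≤-reflexive (⟦⟧-no (no ¬p) ¬p)) z≤n
      ... | yes p with h x p
      ... | inj₁ q = ≤-trans (⟦⟧≤1 (yes p)) (≤-trans (≤-reflexive (sym (⟦⟧-yes (Q? x) q))) (m≤m+n _ _))
      ... | inj₂ r = ≤-trans (⟦⟧≤1 (yes p)) (≤-trans (≤-reflexive (sym (⟦⟧-yes (R? x) r))) (m≤n+m _ _))

  module _ {{_ : Finite X}} {{_ : Finite Y}} where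

    ∑-reindex : (φ : X → Y) (ψ : Y → X) → (∀ x → ψ (φ x) ≡ x) → (∀ y → φ (ψ y) ≡ y) →
      (f : Y → ℕ) → ∑ (f ∘ φ) ≡ ∑ f
    ∑-reindex φ ψ ψφ φψ f = begin
      ∑ (λ x → f (φ x))                          ≡⟨ ∑-cong (λ x → sym (∑-pick (φ x) f)) ⟩
      ∑ (λ x → ∑ λ y → ⟦ y ≟ φ x ⟧ * f y)        ≡⟨ ∑-swap _ ⟩
      ∑ (λ y → ∑ λ x → ⟦ y ≟ φ x ⟧ * f y)        ≡⟨ ∑-cong (λ y → ∑-*ʳ (f y) _) ⟩
      ∑ (λ y → ∑ (λ x → ⟦ y ≟ φ x ⟧) * f y)      ≡⟨ ∑-cong (λ y → cong (_* f y) (trans (∑-cong λ x →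
          ⟦⟧-cong (y ≟ φ x) (x ≟ ψ y) (λ e → trans (sym (ψφ x)) (cong ψ (sym e))) (λ e → trans (sym (φψ y)) (cong φ (sym e)))) (∑-once (ψ y)))) ⟩
      ∑ (λ y → 1 * f y)                          ≡⟨ ∑-cong (λ y → *-identityˡ (f y)) ⟩
      ∑ f                                        ∎
      where open ≡-Reasoning

    ∑*∑ : (f : X → ℕ) (h : Y → ℕ) → ∑ f * ∑ h ≡ ∑ λ x → ∑ λ y → f x * h y
    ∑*∑ f h = trans (sym (∑-*ʳ (∑ h) f)) (∑-cong λ x → sym (∑-*ˡ (f x) h))

    #-cover : {P : X → Set} {Q : Y → Set} {R : X → Y → Set}
      (P? : ∀ x → Dec (P x)) (Q? : ∀ y → Dec (Q y)) (R? : ∀ x y → Dec (R x y)) (k : ℕ) →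
      (∀ x → P x → ∃ λ y → Q y × R x y) →
      (∀ y → Q y → (# λ x → P? x ×? R? x y) ≤ k) →
      # P? ≤ (# Q?) * k
    #-cover P? Q? R? k c h = begin
      # P?                                                           ≤⟨ ∑-mono bound ⟩
      ∑ (λ x → ∑ λ y → ⟦ Q? y ⟧ * ⟦ P? x ×? R? x y ⟧)             ≡⟨ ∑-swap _ ⟩
      ∑ (λ y → ∑ λ x → ⟦ Q? y ⟧ * ⟦ P? x ×? R? x y ⟧)             ≡⟨ ∑-cong (λ y → ∑-*ˡ ⟦ Q? y ⟧ _) ⟩
      ∑ (λ y → ⟦ Q? y ⟧ * (# λ x → P? x ×? R? x y))               ≤⟨ ∑-mono (λ y → ⟦⟧-gate-mono (Q? y) (h y)) ⟩
      ∑ (λ y → ⟦ Q? y ⟧ * k)                                         ≡⟨ ∑-*ʳ k _ ⟩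
      (# Q?) * k                                                     ∎
      where
      open ≤-Reasoning
      bound : ∀ x → ⟦ P? x ⟧ ≤ ∑ (λ y → ⟦ Q? y ⟧ * ⟦ P? x ×? R? x y ⟧)
      bound x with P? x
      ... | no ¬p = ≤-trans (≤-reflexive (⟦⟧-no (no ¬p) ¬p)) z≤n
      ... | yes p with c x p
      ... | y , q , r = ≤-trans (⟦⟧≤1 (yes p)) (≤-trans (≤-reflexive (sym (cong₂ _*_ (⟦⟧-yes (Q? y) q) (⟦⟧-yes (yes p ×? R? x y) (p , r))))) (term≤∑ _ y))

    #-injection : {P : X → Set} {Q : Y → Set} (P? : ∀ x → Dec (P x)) (Q? : ∀ y → Dec (Q y)) (φ : X → Y) →
      (∀ x → P x → Q (φ x)) → (∀ x x' → P x → P x' → φ x ≡ φ x' → x ≡ x') → # P? ≤ # Q?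
    #-injection P? Q? φ h inj = ≤-trans
      (#-cover P? Q? (λ x y → φ x ≟ y) 1 (λ x p → φ x , h x p , refl)
        λ y _ → #-unique _ λ x x' (p , e) (p' , e') → inj x x' p p' (trans e (sym e')))
      (≤-reflexive (*-identityʳ _))

  am-gm : ∀ x y → 4 * (x * y) ≤ (x + y) * (x + y)
  am-gm x y with ≤-total x y
  ... | inj₁ h with m≤n⇒∃[o]m+o≡n h
  ... | k , refl = ≤-trans (m≤m+n _ (k * k)) (≤-reflexive (e x k))
    where
    e : ∀ x k → 4 * (x * (x + k)) + k * k ≡ (x + (x + k)) * (x + (x + k))
    e = solve-∀
  am-gm x y | inj₂ h with m≤n⇒∃[o]m+o≡n h
  ... | k , refl = ≤-trans (m≤m+n _ (k * k)) (≤-reflexive (e y k))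
    where
    e : ∀ y k → 4 * ((y + k) * y) + k * k ≡ (y + k + y) * (y + k + y)
    e = solve-∀

  sq-cancel-≤ : ∀ {m n} → m * m ≤ n * n → m ≤ n
  sq-cancel-≤ {m} {n} h with m ≤? n
  ... | yes q = q
  ... | no q = contradiction h (<⇒≱ (*-mono-< (≰⇒> q) (≰⇒> q)))

  ^-distribʳ-* : ∀ j x y → (x * y) ^ j ≡ x ^ j * y ^ j
  ^-distribʳ-* zero x y = refl
  ^-distribʳ-* (suc j) x y = trans (cong (x * y *_) (^-distribʳ-* j x y)) (e x y (x ^ j) (y ^ j))
    where
    e : ∀ a b c d → a * b * (c * d) ≡ a * c * (b * d)
    e = solve-∀

  private
    -- The induction step of Cauchy-Schwarz, where a, F and G are the three sums over the tail of
    -- the list. Only the cross term 2afg ≤ f²G + g²F needs an argument: it is the inequality of the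
    -- means for f²G and g²F.
    cauchy-schwarz-step : ∀ a f g F G → a * a ≤ F * G → (f * g + a) * (f * g + a) ≤ (f * f + F) * (g * g + G)
    cauchy-schwarz-step a f g F G h = begin
      (f * g + a) * (f * g + a)                         ≡⟨ e₁ a f g ⟩
      (f * f) * (g * g) + 2 * (a * (f * g)) + a * a     ≤⟨ +-mono-≤ (+-monoʳ-≤ ((f * f) * (g * g)) cross) h ⟩
      (f * f) * (g * g) + (f * f * G + g * g * F) + F * G ≡⟨ e₂ f g F G ⟩
      (f * f + F) * (g * g + G)                         ∎
      where
      open ≤-Reasoning
      e₁ : ∀ a f g → (f * g + a) * (f * g + a) ≡ (f * f) * (g * g) + 2 * (a * (f * g)) + a * a
      e₁ = solve-∀
      e₂ : ∀ f g F G → (f * f) * (g * g) + (f * f * G + g * g * F) + F * G ≡ (f * f + F) * (g * g + G)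
      e₂ = solve-∀
      e₃ : ∀ a f g → (2 * (a * (f * g))) * (2 * (a * (f * g))) ≡ (4 * ((f * f) * (g * g))) * (a * a)
      e₃ = solve-∀
      e₄ : ∀ f g F G → (4 * ((f * f) * (g * g))) * (F * G) ≡ 4 * ((f * f * G) * (g * g * F))
      e₄ = solve-∀
      cross : 2 * (a * (f * g)) ≤ f * f * G + g * g * F
      -- The hypothesis bounds a² and not a, so both sides are squared first.
      cross = sq-cancel-≤ (begin
        (2 * (a * (f * g))) * (2 * (a * (f * g)))  ≡⟨ e₃ a f g ⟩
        (4 * ((f * f) * (g * g))) * (a * a)        ≤⟨ *-monoʳ-≤ (4 * ((f * f) * (g * g))) h ⟩
        (4 * ((f * f) * (g * g))) * (F * G)        ≡⟨ e₄ f g F G ⟩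
        4 * ((f * f * G) * (g * g * F))            ≤⟨ am-gm (f * f * G) (g * g * F) ⟩
        (f * f * G + g * g * F) * (f * f * G + g * g * F) ∎)

  opaque
    unfolding ∑

    cauchy-schwarz : {{_ : Finite X}} (f g : X → ℕ) →
      ∑ (λ x → f x * g x) * ∑ (λ x → f x * g x) ≤ ∑ (λ x → f x * f x) * ∑ (λ x → g x * g x)
    cauchy-schwarz f g = go elems
      where
      go : ∀ xs → sumL xs (λ x → f x * g x) * sumL xs (λ x → f x * g x) ≤ sumL xs (λ x → f x * f x) * sumL xs (λ x → g x * g x)
      go [] = z≤n
      go (x ∷ xs) = cauchy-schwarz-step (sumL xs (λ x → f x * g x)) (f x) (g x) _ _ (go xs)

  cauchy-schwarz-on : {{_ : Finite X}} {P : X → Set} (P? : ∀ x → Dec (P x)) (f : X → ℕ) →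
    ∑ (λ x → ⟦ P? x ⟧ * f x) * ∑ (λ x → ⟦ P? x ⟧ * f x) ≤ (# P?) * ∑ (λ x → ⟦ P? x ⟧ * (f x * f x))
  cauchy-schwarz-on P? f = begin
    ∑ (λ x → ⟦ P? x ⟧ * f x) * ∑ (λ x → ⟦ P? x ⟧ * f x)
      ≡⟨ cong₂ _*_ (∑-cong e₁) (∑-cong e₁) ⟩
    ∑ (λ x → ⟦ P? x ⟧ * (⟦ P? x ⟧ * f x)) * ∑ (λ x → ⟦ P? x ⟧ * (⟦ P? x ⟧ * f x))
      ≤⟨ cauchy-schwarz (λ x → ⟦ P? x ⟧) (λ x → ⟦ P? x ⟧ * f x) ⟩
    ∑ (λ x → ⟦ P? x ⟧ * ⟦ P? x ⟧) * ∑ (λ x → ⟦ P? x ⟧ * f x * (⟦ P? x ⟧ * f x))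
      ≡⟨ cong₂ _*_ (∑-cong λ x → ⟦⟧-sq (P? x)) (∑-cong e₂) ⟩
    (# P?) * ∑ (λ x → ⟦ P? x ⟧ * (f x * f x)) ∎
    where
    open ≤-Reasoning
    e₁ : ∀ x → ⟦ P? x ⟧ * f x ≡ ⟦ P? x ⟧ * (⟦ P? x ⟧ * f x)
    e₁ x = trans (cong (_* f x) (sym (⟦⟧-sq (P? x)))) (*-assoc ⟦ P? x ⟧ _ _)
    e₃ : ∀ a b → a * b * (a * b) ≡ a * a * (b * b)
    e₃ = solve-∀
    e₂ : ∀ x → ⟦ P? x ⟧ * f x * (⟦ P? x ⟧ * f x) ≡ ⟦ P? x ⟧ * (f x * f x)
    e₂ x = trans (e₃ ⟦ P? x ⟧ (f x)) (cong (_* (f x * f x)) (⟦⟧-sq (P? x)))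

  fin-finite : ∀ n → Finite (Fin n)
  fin-finite n = record { elems = allFin n ; _≟_ = Finₚ._≟_ ; once = once′ }
    where
    tab : ∀ {k} (g : Fin k → X) (f : X → ℕ) → sumL (tabulate g) f ≡ sumL (allFin k) (f ∘ g)
    tab {k = zero} g f = refl
    tab {k = suc k} g f = cong (f (g zero) +_) (trans (tab (g ∘ suc) f) (sym (tab {k = k} suc (f ∘ g))))
    once′ : ∀ {k} (i : Fin k) → sumL (allFin k) (λ j → ⟦ j Finₚ.≟ i ⟧) ≡ 1
    once′ {suc k} zero = cong₂ _+_ (⟦⟧-yes (zero {k} Finₚ.≟ zero) refl)
      (trans (tab {k = k} suc _) (trans (sumL-cong (allFin k) λ j → ⟦⟧-no (suc j Finₚ.≟ zero) λ ()) (sumL-0 (allFin k))))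
    once′ {suc k} (suc i) = cong₂ _+_ (⟦⟧-no (zero Finₚ.≟ suc i) λ ()) (trans (tab {k = k} suc _)
      (trans (sumL-cong (allFin k) λ j → ⟦⟧-cong (suc j Finₚ.≟ suc i) (j Finₚ.≟ i) Finₚ.suc-injective (cong suc)) (once′ i)))

  ∑-Fin : ∀ n → ∑ {{fin-finite n}} (λ _ → 1) ≡ n
  ∑-Fin n = trans (∑-sumL {{fin-finite n}} (λ _ → 1)) (trans (ones (allFin n)) (length-tabulate id))
    where
    ones : (xs : List X) → sumL xs (λ _ → 1) ≡ length xs
    ones [] = refl
    ones (x ∷ xs) = cong suc (ones xs)

  ×-finite : Finite X → Finite Y → Finite (X × Y)
  ×-finite {X} {Y} FX FY = record
    { elems = cartesianProduct X.elems Y.elems ; _≟_ = ≟× ; once = once′ }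
    where
    module X = Finite FX
    module Y = Finite FY
    ≟× : DecidableEquality (X × Y)
    ≟× = ≡-dec X._≟_ Y._≟_
    once′ : ∀ z → sumL (cartesianProduct X.elems Y.elems) (λ w → ⟦ ≟× w z ⟧) ≡ 1
    once′ (x , y) = begin
      sumL (cartesianProduct X.elems Y.elems) (λ w → ⟦ ≟× w (x , y) ⟧)
        ≡⟨ sumL-cartesianProduct X.elems Y.elems _ ⟩
      sumL X.elems (λ x′ → sumL Y.elems (λ y′ → ⟦ ≟× (x′ , y′) (x , y) ⟧))
        ≡⟨ sumL-cong X.elems (λ x′ → sumL-cong Y.elems λ y′ → trans
            (⟦⟧-cong (≟× (x′ , y′) (x , y)) (x′ X.≟ x ×? y′ Y.≟ y) (λ { refl → refl , refl }) (λ { (refl , refl) → refl }))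
            (⟦⟧-× (x′ X.≟ x) (y′ Y.≟ y))) ⟩
      sumL X.elems (λ x′ → sumL Y.elems (λ y′ → ⟦ x′ X.≟ x ⟧ * ⟦ y′ Y.≟ y ⟧))
        ≡⟨ sumL-cong X.elems (λ x′ → trans (sumL-*ˡ Y.elems ⟦ x′ X.≟ x ⟧ _) (trans (cong (⟦ x′ X.≟ x ⟧ *_) (Y.once y)) (*-identityʳ _))) ⟩
      sumL X.elems (λ x′ → ⟦ x′ X.≟ x ⟧)
        ≡⟨ X.once x ⟩
      1 ∎
      where open ≡-Reasoning

  module _ {{FX : Finite X}} {{FY : Finite Y}} where

    opaque
      unfolding ∑

      ∑-× : (f : X × Y → ℕ) → ∑ {{×-finite FX FY}} f ≡ ∑ λ x → ∑ λ y → f (x , y)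
      ∑-× = sumL-cartesianProduct elems elems

    #-× : {P : X → Set} {Q : Y → Set} (P? : ∀ x → Dec (P x)) (Q? : ∀ y → Dec (Q y)) →
      #_ {{×-finite FX FY}} (λ (x , y) → P? x ×? Q? y) ≡ # P? * # Q?
    #-× P? Q? = begin
      ∑ {{×-finite FX FY}} (λ (x , y) → ⟦ P? x ×? Q? y ⟧)  ≡⟨ ∑-× (λ (x , y) → ⟦ P? x ×? Q? y ⟧) ⟩
      ∑ (λ x → ∑ λ y → ⟦ P? x ×? Q? y ⟧)                   ≡⟨ ∑-cong (λ x → ∑-cong λ y → ⟦⟧-× (P? x) (Q? y)) ⟩
      ∑ (λ x → ∑ λ y → ⟦ P? x ⟧ * ⟦ Q? y ⟧)                ≡⟨ ∑*∑ (λ x → ⟦ P? x ⟧) (λ y → ⟦ Q? y ⟧) ⟨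
      # P? * # Q?                                          ∎
      where open ≡-Reasoning

  -- Takes the place of real roots: of |D| in the centraliser bound and of p in the choice of K.
  -- Both inequalities are used in both places.
  integer-root : ∀ k M → ∃ λ r → r ^ suc k ≤ M × M < suc r ^ suc k
  integer-root k zero = 0 , z≤n , ≤-trans (s≤s z≤n) (≤-reflexive (sym (^-zeroˡ (suc k))))
  integer-root k (suc M) = step (integer-root k M)
    where
    step : (∃ λ r → r ^ suc k ≤ M × M < suc r ^ suc k) → ∃ λ r → r ^ suc k ≤ suc M × suc M < suc r ^ suc k
    step (r , l , u) with suc r ^ suc k ≤? suc M
    ... | no n = r , m≤n⇒m≤1+n l , ≰⇒> n
    ... | yes y = suc r , y , ≤-<-trans u (^-monoˡ-< (suc k) (n<1+n (suc r)))

  module _ {{_ : Finite X}} where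

    #-complement : {P : X → Set} (P? : ∀ x → Dec (P x)) → # P? + # (λ x → ¬? (P? x)) ≡ ∑ {X = X} (λ _ → 1)
    #-complement P? = trans (sym (∑-+ _ _)) (∑-cong λ x → case (P? x))
      where
      case : ∀ {A : Set} (d : Dec A) → ⟦ d ⟧ + ⟦ ¬? d ⟧ ≡ 1
      case d@(yes a) = cong₂ _+_ (⟦⟧-yes d a) (⟦⟧-no (¬? d) λ n → n a)
      case d@(no n) = cong₂ _+_ (⟦⟧-no d n) (⟦⟧-yes (¬? d) n)

    #-≟ : (x : X) → # (_≟ x) ≡ 1
    #-≟ = ∑-once

    ∑-const : (c : ℕ) → ∑ {X = X} (λ _ → c) ≡ ∑ {X = X} (λ _ → 1) * c
    ∑-const c = trans (∑-cong λ x → sym (*-identityˡ c)) (∑-*ʳ c (λ _ → 1))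

    #-true : # (λ (x : X) → yes tt) ≡ ∑ {X = X} (λ _ → 1)
    #-true = ∑-cong λ x → ⟦⟧-yes (yes tt) tt

    ∑-∣-∣ : (f g : X → ℕ) → ∣ ∑ f - ∑ g ∣ ≤ ∑ (λ x → ∣ f x - g x ∣)
    ∑-∣-∣ f g = ∣-∣≤ (bound f g (λ x → m≤n+∣m-n∣ (f x) (g x)))
      (bound g f (λ x → m≤n+∣n-m∣ (g x) (f x)))
      where
      bound : ∀ f g {h : X → ℕ} → (∀ x → f x ≤ g x + h x) → ∑ f ≤ ∑ g + ∑ h
      bound f g q = ≤-trans (∑-mono q) (≤-reflexive (∑-+ g _))
      ∣-∣≤ : ∀ {m n k} → m ≤ n + k → n ≤ m + k → ∣ m - n ∣ ≤ k
      ∣-∣≤ {m} {n} {k} p q = split (≤-total m n)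
        where
        split : m ≤ n ⊎ n ≤ m → ∣ m - n ∣ ≤ k
        split (inj₁ m≤n) = ≤-trans (≤-reflexive (m≤n⇒∣m-n∣≡n∸m m≤n)) (m≤n+o⇒m∸n≤o n m q)
        split (inj₂ n≤m) = ≤-trans (≤-reflexive (m≤n⇒∣n-m∣≡n∸m n≤m)) (m≤n+o⇒m∸n≤o m n p)

  ∣-∣² : ∀ a b → ∣ a - b ∣ * ∣ a - b ∣ + 2 * (a * b) ≡ a * a + b * b
  ∣-∣² a b = split (≤-total a b)
    where
    up : ∀ a k → k * k + 2 * (a * (a + k)) ≡ a * a + (a + k) * (a + k)
    up = solve-∀
    down : ∀ b k → k * k + 2 * ((b + k) * b) ≡ (b + k) * (b + k) + b * b
    down = solve-∀
    split : a ≤ b ⊎ b ≤ a → ∣ a - b ∣ * ∣ a - b ∣ + 2 * (a * b) ≡ a * a + b * b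
    split (inj₁ h) with m≤n⇒∃[o]m+o≡n h
    ... | k , refl = trans (cong (λ d → d * d + 2 * (a * (a + k))) (∣m-m+n∣≡n a k)) (up a k)
    split (inj₂ h) with m≤n⇒∃[o]m+o≡n h
    ... | k , refl = trans (cong (λ d → d * d + 2 * ((b + k) * b)) (trans (∣-∣-comm (b + k) b) (∣m-m+n∣≡n b k))) (down b k)

  -- Squared deviation of f from μ/q, scaled by q². The cross term stands on the left because
  -- subtraction of natural numbers truncates.
  variance : {{_ : Finite X}} (f : X → ℕ) (q μ : ℕ) →
    ∑ (λ x → ∣ q * f x - μ ∣ * ∣ q * f x - μ ∣) + 2 * (q * μ) * ∑ f ≡ q * q * ∑ (λ x → f x * f x) + ∑ {X = X} (λ _ → 1) * (μ * μ)
  variance {X} f q μ = begin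
    V + 2 * (q * μ) * ∑ f
      ≡⟨ cong (V +_) (∑-*ˡ (2 * (q * μ)) f) ⟨
    V + ∑ (λ x → 2 * (q * μ) * f x)
      ≡⟨ ∑-+ _ _ ⟨
    ∑ (λ x → ∣ q * f x - μ ∣ * ∣ q * f x - μ ∣ + 2 * (q * μ) * f x)
      ≡⟨ ∑-cong (λ x → trans (cong (∣ q * f x - μ ∣ * ∣ q * f x - μ ∣ +_) (e₁ q μ (f x))) (trans (∣-∣² (q * f x) μ) (cong (_+ μ * μ) (e₂ q (f x))))) ⟩
    ∑ (λ x → q * q * (f x * f x) + μ * μ)
      ≡⟨ trans (∑-+ _ _) (cong₂ _+_ (∑-*ˡ (q * q) _) (∑-const (μ * μ))) ⟩
    q * q * ∑ (λ x → f x * f x) + ∑ {X = X} (λ _ → 1) * (μ * μ) ∎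
    where
    open ≡-Reasoning
    V = ∑ (λ x → ∣ q * f x - μ ∣ * ∣ q * f x - μ ∣)
    e₁ : ∀ q μ f → 2 * (q * μ) * f ≡ 2 * (q * f * μ)
    e₁ = solve-∀
    e₂ : ∀ q f → q * f * (q * f) ≡ q * q * (f * f)
    e₂ = solve-∀

  -- Change of variables along φ. With f itself a fibre count it turns a number of collisions into a
  -- sum over one of the two colliding points.
  ∑-fibres : {{_ : Finite X}} {{_ : Finite Y}} {P : X → Set} (P? : ∀ x → Dec (P x)) (φ : X → Y) (f : Y → ℕ) →
    ∑ (λ y → f y * # (λ x → P? x ×? φ x ≟ y)) ≡ ∑ (λ x → ⟦ P? x ⟧ * f (φ x))
  ∑-fibres P? φ f = begin
    ∑ (λ y → f y * # (λ x → P? x ×? φ x ≟ y))            ≡⟨ ∑-cong (λ y → ∑-*ˡ (f y) _) ⟨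
    ∑ (λ y → ∑ λ x → f y * ⟦ P? x ×? φ x ≟ y ⟧)          ≡⟨ ∑-swap (λ y x → f y * ⟦ P? x ×? φ x ≟ y ⟧) ⟩
    ∑ (λ x → ∑ λ y → f y * ⟦ P? x ×? φ x ≟ y ⟧)          ≡⟨ ∑-cong (λ x → trans (∑-cong λ y → rearrange x y)
        (∑-pick (φ x) (λ y → ⟦ P? x ⟧ * f y))) ⟩
    ∑ (λ x → ⟦ P? x ⟧ * f (φ x))                         ∎
    where
    open ≡-Reasoning
    e : ∀ f p q → f * (p * q) ≡ q * (p * f)
    e = solve-∀
    rearrange : ∀ x y → f y * ⟦ P? x ×? φ x ≟ y ⟧ ≡ ⟦ y ≟ φ x ⟧ * (⟦ P? x ⟧ * f y)
    rearrange x y = trans (cong (f y *_) (trans (⟦⟧-× (P? x) (φ x ≟ y)) (cong (⟦ P? x ⟧ *_) (⟦⟧-cong (φ x ≟ y) (y ≟ φ x) sym sym))))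
      (e (f y) ⟦ P? x ⟧ ⟦ y ≟ φ x ⟧)

open FiniteSums

-- Sums over a finite group, convolution and popularity.

module GroupSums (G : Set) (finite : Finite G) (_∙_ : G → G → G) (ε : G) (_⁻¹ : G → G)
  (isGroup : IsGroup _≡_ _∙_ ε _⁻¹) where

  open import Data.Nat hiding (_≟_)
  open import Data.Nat.Properties hiding (_≟_)

  private instance
    finite-G : Finite G
    finite-G = finite

  group : Group 0ℓ 0ℓ
  group = record { isGroup = isGroup }

  open IsGroup isGroup using (assoc; identityˡ; identityʳ; inverseˡ; inverseʳ) public
  open import Algebra.Properties.Group group public
    using (⁻¹-involutive; ⁻¹-anti-homo-∙)

  x∙x⁻¹y : ∀ x y → x ∙ ((x ⁻¹) ∙ y) ≡ y
  x∙x⁻¹y x y = trans (sym (assoc x (x ⁻¹) y)) (trans (cong (_∙ y) (inverseʳ x)) (identityˡ y))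

  x⁻¹∙xy : ∀ x y → (x ⁻¹) ∙ (x ∙ y) ≡ y
  x⁻¹∙xy x y = trans (sym (assoc (x ⁻¹) x y)) (trans (cong (_∙ y) (inverseˡ x)) (identityˡ y))

  yx∙x⁻¹ : ∀ x y → (y ∙ x) ∙ (x ⁻¹) ≡ y
  yx∙x⁻¹ x y = trans (assoc y x (x ⁻¹)) (trans (cong (y ∙_) (inverseʳ x)) (identityʳ y))

  yx⁻¹∙x : ∀ x y → (y ∙ (x ⁻¹)) ∙ x ≡ y
  yx⁻¹∙x x y = trans (assoc y (x ⁻¹) x) (trans (cong (y ∙_) (inverseˡ x)) (identityʳ y))

  ∑-leftMul : ∀ g (f : G → ℕ) → ∑ (λ x → f (g ∙ x)) ≡ ∑ f
  ∑-leftMul g = ∑-reindex (g ∙_) ((g ⁻¹) ∙_) (x⁻¹∙xy g) (x∙x⁻¹y g)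

  ∑-rightMul : ∀ g (f : G → ℕ) → ∑ (λ x → f (x ∙ g)) ≡ ∑ f
  ∑-rightMul g = ∑-reindex (_∙ g) (_∙ (g ⁻¹)) (yx∙x⁻¹ g) (yx⁻¹∙x g)

  ∑-inverse : (f : G → ℕ) → ∑ (λ x → f (x ⁻¹)) ≡ ∑ f
  ∑-inverse = ∑-reindex _⁻¹ _⁻¹ ⁻¹-involutive ⁻¹-involutive

  ∑-quotient : ∀ g (f : G → ℕ) → ∑ (λ x → f (g ∙ (x ⁻¹))) ≡ ∑ f
  ∑-quotient g f = trans (∑-inverse (λ x → f (g ∙ x))) (∑-leftMul g f)

  _⋆_ : (G → ℕ) → (G → ℕ) → G → ℕ
  (f ⋆ h) g = ∑ λ x → f x * h ((x ⁻¹) ∙ g)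

  ∑-⋆ : ∀ f h → ∑ (f ⋆ h) ≡ ∑ f * ∑ h
  ∑-⋆ f h = begin
    ∑ (λ g → ∑ λ x → f x * h ((x ⁻¹) ∙ g))   ≡⟨ ∑-swap (λ g x → f x * h ((x ⁻¹) ∙ g)) ⟩
    ∑ (λ x → ∑ λ g → f x * h ((x ⁻¹) ∙ g))   ≡⟨ ∑-cong (λ x → ∑-*ˡ (f x) _) ⟩
    ∑ (λ x → f x * ∑ (λ g → h ((x ⁻¹) ∙ g))) ≡⟨ ∑-cong (λ x → cong (f x *_) (∑-leftMul (x ⁻¹) h)) ⟩
    ∑ (λ x → f x * ∑ h)                      ≡⟨ ∑-*ʳ (∑ h) f ⟩
    ∑ f * ∑ h                                ∎
    where open ≡-Reasoning

  -- The substitution v = x u⁻¹ turns the factorisations of x y⁻¹ into paths from x through u to y.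
  ⋆-quotient : ∀ f h x y → (f ⋆ h) (x ∙ (y ⁻¹)) ≡ ∑ λ u → f (x ∙ (u ⁻¹)) * h (u ∙ (y ⁻¹))
  ⋆-quotient f h x y = begin
    ∑ (λ v → f v * h ((v ⁻¹) ∙ (x ∙ (y ⁻¹))))
      ≡⟨ ∑-quotient x (λ v → f v * h ((v ⁻¹) ∙ (x ∙ (y ⁻¹)))) ⟨
    ∑ (λ u → f (x ∙ (u ⁻¹)) * h (((x ∙ (u ⁻¹)) ⁻¹) ∙ (x ∙ (y ⁻¹))))
      ≡⟨ ∑-cong (λ u → cong (λ w → f (x ∙ (u ⁻¹)) * h w) (e u)) ⟩
    ∑ (λ u → f (x ∙ (u ⁻¹)) * h (u ∙ (y ⁻¹))) ∎
    where
    open ≡-Reasoning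
    e : ∀ u → ((x ∙ (u ⁻¹)) ⁻¹) ∙ (x ∙ (y ⁻¹)) ≡ u ∙ (y ⁻¹)
    e u = begin
      ((x ∙ (u ⁻¹)) ⁻¹) ∙ (x ∙ (y ⁻¹))      ≡⟨ cong (_∙ (x ∙ (y ⁻¹))) (⁻¹-anti-homo-∙ x (u ⁻¹)) ⟩
      (((u ⁻¹) ⁻¹) ∙ (x ⁻¹)) ∙ (x ∙ (y ⁻¹)) ≡⟨ assoc _ _ _ ⟩
      ((u ⁻¹) ⁻¹) ∙ ((x ⁻¹) ∙ (x ∙ (y ⁻¹))) ≡⟨ cong₂ _∙_ (⁻¹-involutive u) (x⁻¹∙xy x (y ⁻¹)) ⟩
      u ∙ (y ⁻¹)                            ∎

  module Popularity {X : Set} {{_ : Finite X}} (K n : ℕ) (f : X → ℕ) (n>0 : 0 < n)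
    (f≤n : ∀ x → f x ≤ n) (∑f : ∑ f ≡ n * n) where

    Popular : X → Set
    Popular x = n ≤ 2 * K * f x

    Popular? : ∀ x → Dec (Popular x)
    Popular? x = n ≤? 2 * K * f x

    #Popular : # Popular? ≤ 2 * K * n
    #Popular = *-cancelʳ-≤ _ _ n {{>-nonZero n>0}} (begin
      # Popular? * n                  ≡⟨ ∑-*ʳ n _ ⟨
      ∑ (λ x → ⟦ Popular? x ⟧ * n)    ≤⟨ ∑-mono (λ x → ⟦⟧-gate (Popular? x) id) ⟩
      ∑ (λ x → 2 * K * f x)           ≡⟨ ∑-*ˡ (2 * K) f ⟩
      2 * K * ∑ f                     ≡⟨ cong (2 * K *_) ∑f ⟩
      2 * K * (n * n)                 ≡⟨ *-assoc (2 * K) n n ⟨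
      2 * K * n * n                   ∎)
      where open ≤-Reasoning

    -- Unpopular x have f x < n / 2K and contribute at most (n / 2K) ∑ f = n³ / 2K to ∑ f². So at
    -- least half of the assumed n³ / K comes from popular x, for which one of the two factors f x
    -- is bounded by n.
    popular-mass : n * n * n ≤ K * ∑ (λ x → f x * f x) → n * n ≤ 2 * K * ∑ (λ x → ⟦ Popular? x ⟧ * f x)
    popular-mass h = *-cancelˡ-≤ n {{>-nonZero n>0}} (+-cancelʳ-≤ (n * (n * n)) _ _ (begin
      n * (n * n) + n * (n * n)                                ≡⟨ e₁ n ⟩
      2 * (n * n * n)                                          ≤⟨ *-monoʳ-≤ 2 h ⟩
      2 * (K * ∑ (λ x → f x * f x))                            ≡⟨ *-assoc 2 K _ ⟨
      2 * K * ∑ (λ x → f x * f x)                              ≡⟨ ∑-*ˡ (2 * K) _ ⟨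
      ∑ (λ x → 2 * K * (f x * f x))                            ≤⟨ ∑-mono pointwise ⟩
      ∑ (λ x → 2 * K * n * (⟦ Popular? x ⟧ * f x) + n * f x)   ≡⟨ ∑-+ _ _ ⟩
      ∑ (λ x → 2 * K * n * (⟦ Popular? x ⟧ * f x)) + ∑ (λ x → n * f x)
        ≡⟨ cong₂ _+_ (∑-*ˡ (2 * K * n) _) (∑-*ˡ n f) ⟩
      2 * K * n * e + n * ∑ f                                  ≡⟨ cong₂ _+_ (e₂ K n e) (cong (n *_) ∑f) ⟩
      n * (2 * K * e) + n * (n * n)                            ∎))
      where
      open ≤-Reasoning
      e = ∑ (λ x → ⟦ Popular? x ⟧ * f x)
      e₁ : ∀ n → n * (n * n) + n * (n * n) ≡ 2 * (n * n * n)
      e₁ = solve-∀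
      e₂ : ∀ K n e → 2 * K * n * e ≡ n * (2 * K * e)
      e₂ = solve-∀
      e₃ : ∀ K f → 2 * K * (f * f) ≡ 2 * K * f * f
      e₃ = solve-∀
      e₄ : ∀ K n f → 2 * K * (n * f) ≡ 2 * K * n * (1 * f)
      e₄ = solve-∀
      pointwise : ∀ x → 2 * K * (f x * f x) ≤ 2 * K * n * (⟦ Popular? x ⟧ * f x) + n * f x
      pointwise x with Popular? x
      ... | no q = begin
        2 * K * (f x * f x)   ≡⟨ e₃ K (f x) ⟩
        2 * K * f x * f x     ≤⟨ *-monoˡ-≤ (f x) (<⇒≤ (≰⇒> q)) ⟩
        n * f x               ≤⟨ m≤n+m _ _ ⟩
        _                     ∎
      ... | yes q = begin
        2 * K * (f x * f x)            ≤⟨ *-monoʳ-≤ (2 * K) (*-monoˡ-≤ (f x) (f≤n x)) ⟩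
        2 * K * (n * f x)              ≡⟨ e₄ K n (f x) ⟩
        2 * K * n * (1 * f x)          ≡⟨ cong (λ i → 2 * K * n * (i * f x)) (⟦⟧-yes (yes q) q) ⟨
        2 * K * n * (⟦ yes q ⟧ * f x)  ≤⟨ m≤m+n _ _ ⟩
        _                              ∎

-- The Balog-Szemerédi-Gowers argument.

module BSG (G : Set) (finite : Finite G) (_∙_ : G → G → G) (ε : G) (_⁻¹ : G → G)
  (isGroup : IsGroup _≡_ _∙_ ε _⁻¹) where

  open import Data.Nat hiding (_≟_)
  open import Data.Nat.Properties hiding (_≟_)
  open GroupSums G finite _∙_ ε _⁻¹ isGroup

  private instance
    finite-G : Finite G
    finite-G = finite

  module _ {S : G → Set} (S? : ∀ x → Dec (S x)) where

    -- The number of representations g = y x⁻¹ with x and y in S.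
    quotients : G → ℕ
    quotients g = # λ x → S? x ×? S? (g ∙ x)

    energy : ℕ
    energy = ∑ λ g → quotients g * quotients g

    quotients≤ : ∀ g → quotients g ≤ # S?
    quotients≤ g = #-mono (λ x → S? x ×? S? (g ∙ x)) S? (λ x → proj₁)

    ∑-quotients : ∑ quotients ≡ # S? * # S?
    ∑-quotients = begin
      ∑ (λ g → ∑ λ x → ⟦ S? x ×? S? (g ∙ x) ⟧)   ≡⟨ ∑-swap (λ g x → ⟦ S? x ×? S? (g ∙ x) ⟧) ⟩
      ∑ (λ x → ∑ λ g → ⟦ S? x ×? S? (g ∙ x) ⟧)   ≡⟨ ∑-cong (λ x → ∑-cong λ g → ⟦⟧-× (S? x) (S? (g ∙ x))) ⟩
      ∑ (λ x → ∑ λ g → ⟦ S? x ⟧ * ⟦ S? (g ∙ x) ⟧)   ≡⟨ ∑-cong (λ x → trans (∑-*ˡ ⟦ S? x ⟧ _)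
                                                          (cong (⟦ S? x ⟧ *_) (∑-rightMul x (λ g → ⟦ S? g ⟧)))) ⟩
      ∑ (λ x → ⟦ S? x ⟧ * # S?)                     ≡⟨ ∑-*ʳ (# S?) _ ⟩
      # S? * # S?                                   ∎
      where open ≡-Reasoning

    quotients-⁻¹ : ∀ g → quotients (g ⁻¹) ≡ quotients g
    quotients-⁻¹ g = begin
      ∑ (λ x → ⟦ S? x ×? S? ((g ⁻¹) ∙ x) ⟧)              ≡⟨ ∑-leftMul g _ ⟨
      ∑ (λ x → ⟦ S? (g ∙ x) ×? S? ((g ⁻¹) ∙ (g ∙ x)) ⟧)  ≡⟨ ∑-cong (λ x → ⟦⟧-cong (_ ×? S? _) (S? x ×? _)
          (λ (p , q) → subst S (x⁻¹∙xy g x) q , p) (λ (p , q) → q , subst S (sym (x⁻¹∙xy g x)) p)) ⟩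
      ∑ (λ x → ⟦ S? x ×? S? (g ∙ x) ⟧)                   ∎
      where open ≡-Reasoning

  module Dense (K : ℕ) {S : G → Set} (S? : ∀ x → Dec (S x)) (S>0 : 0 < # S?)
    (large : # S? * # S? * # S? ≤ K * energy S?) where

    n : ℕ
    n = # S?

    open Popularity K n (quotients S?) S>0 (quotients≤ S?) (∑-quotients S?)

    s p : G → ℕ
    s x = ⟦ S? x ⟧
    p x = ⟦ Popular? x ⟧

    p-sym : ∀ x y → p (x ∙ (y ⁻¹)) ≡ p (y ∙ (x ⁻¹))
    p-sym x y = cong (λ w → ⟦ n ≤? 2 * K * w ⟧) (trans (sym (quotients-⁻¹ S? (x ∙ (y ⁻¹))))
      (cong (quotients S?) (trans (⁻¹-anti-homo-∙ x (y ⁻¹)) (cong (_∙ (x ⁻¹)) (⁻¹-involutive y)))))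

    -- The neighbourhood of z in the graph on S that joins x and z when x z⁻¹ is a popular quotient.
    -- The graph is undirected by `p-sym`.
    N? : ∀ z x → Dec (S x × Popular (x ∙ (z ⁻¹)))
    N? z x = S? x ×? Popular? (x ∙ (z ⁻¹))

    deg : G → ℕ
    deg z = # (N? z)

    edges : ∑ (λ z → s z * deg z) ≡ ∑ (λ g → p g * quotients S? g)
    edges = begin
      ∑ (λ z → s z * ∑ (λ x → ⟦ N? z x ⟧))
        ≡⟨ ∑-cong (λ z → trans (cong (s z *_) (sym (∑-rightMul z (λ x → ⟦ N? z x ⟧)))) (sym (∑-*ˡ (s z) _))) ⟩
      ∑ (λ z → ∑ λ g → s z * ⟦ N? z (g ∙ z) ⟧)
        ≡⟨ ∑-cong (λ z → ∑-cong (e z)) ⟩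
      ∑ (λ z → ∑ λ g → p g * ⟦ S? z ×? S? (g ∙ z) ⟧)
        ≡⟨ ∑-swap (λ z g → p g * ⟦ S? z ×? S? (g ∙ z) ⟧) ⟩
      ∑ (λ g → ∑ λ z → p g * ⟦ S? z ×? S? (g ∙ z) ⟧)
        ≡⟨ ∑-cong (λ g → ∑-*ˡ (p g) _) ⟩
      ∑ (λ g → p g * quotients S? g) ∎
      where
      open ≡-Reasoning
      e′ : ∀ a b c → a * (b * c) ≡ c * (a * b)
      e′ = solve-∀
      e : ∀ z g → s z * ⟦ N? z (g ∙ z) ⟧ ≡ p g * ⟦ S? z ×? S? (g ∙ z) ⟧
      e z g = begin
        s z * ⟦ N? z (g ∙ z) ⟧                       ≡⟨ cong (s z *_) (⟦⟧-× (S? (g ∙ z)) _) ⟩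
        s z * (s (g ∙ z) * p ((g ∙ z) ∙ (z ⁻¹)))     ≡⟨ cong (λ w → s z * (s (g ∙ z) * p w)) (yx∙x⁻¹ z g) ⟩
        s z * (s (g ∙ z) * p g)                      ≡⟨ e′ (s z) (s (g ∙ z)) (p g) ⟩
        p g * (s z * s (g ∙ z))                      ≡⟨ cong (p g *_) (⟦⟧-× (S? z) _) ⟨
        p g * ⟦ S? z ×? S? (g ∙ z) ⟧              ∎

    common : G → G → ℕ
    common x y = ∑ λ z → s z * (p (x ∙ (z ⁻¹)) * p (y ∙ (z ⁻¹)))

    common-sym : ∀ x y → common x y ≡ common y x
    common-sym x y = ∑-cong λ z → cong (s z *_) (*-comm (p (x ∙ (z ⁻¹))) _)

    -- A common neighbour z writes x y⁻¹ as (x z⁻¹)(z y⁻¹), a product of two popular elements.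
    common≤ : ∀ x y → common x y ≤ (p ⋆ p) (x ∙ (y ⁻¹))
    common≤ x y = begin
      ∑ (λ z → s z * (p (x ∙ (z ⁻¹)) * p (y ∙ (z ⁻¹))))  ≤⟨ ∑-mono (λ z → ⟦⟧-gate (S? z)
                                                                λ _ → ≤-reflexive (cong (p (x ∙ (z ⁻¹)) *_) (p-sym y z))) ⟩
      ∑ (λ z → p (x ∙ (z ⁻¹)) * p (z ∙ (y ⁻¹)))          ≡⟨ ⋆-quotient p p x y ⟨
      (p ⋆ p) (x ∙ (y ⁻¹))                               ∎
      where open ≤-Reasoning

    opaque
      -- 64K² = 8 · 8K². Averaging gives β · bad ≤ 8K² α² for the chosen vertex of degree α, and the
      -- spare factor 8 makes at most one pair in eight bad.
      β : ℕ
      β = 64 * (K * K)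

      β-def : β ≡ 64 * (K * K)
      β-def = refl

    Bad? : ∀ x y → Dec (β * common x y < n)
    Bad? x y = β * common x y <? n

    bad : G → ℕ
    bad z = ∑ λ x → ⟦ N? z x ⟧ * # λ y → N? z y ×? Bad? x y

    n²≤edges : n * n ≤ 2 * K * ∑ (λ z → s z * deg z)
    n²≤edges = subst (λ w → n * n ≤ 2 * K * w) (sym edges) (popular-mass large)

    -- Cauchy-Schwarz applied to `n²≤edges`. The factor 2 pays for the two summands in the averaging
    -- of `good-vertex`: one n³ for the bad pairs, one for the lower bound on the degree.
    degrees² : 2 * (n * n * n) ≤ 8 * (K * K) * ∑ (λ z → s z * (deg z * deg z))
    degrees² = *-cancelˡ-≤ n {{>-nonZero S>0}} (begin
      n * (2 * (n * n * n))                      ≡⟨ e₁ n ⟩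
      2 * ((n * n) * (n * n))                    ≤⟨ *-monoʳ-≤ 2 (*-mono-≤ n²≤edges n²≤edges) ⟩
      2 * (2 * K * m * (2 * K * m))              ≡⟨ e₂ K m ⟩
      8 * (K * K) * (m * m)                      ≤⟨ *-monoʳ-≤ (8 * (K * K)) (cauchy-schwarz-on S? deg) ⟩
      8 * (K * K) * (n * d)                      ≡⟨ e₃ (8 * (K * K)) n d ⟩
      n * (8 * (K * K) * d)                      ∎)
      where
      open ≤-Reasoning
      m = ∑ (λ z → s z * deg z)
      d = ∑ (λ z → s z * (deg z * deg z))
      e₁ : ∀ n → n * (2 * (n * n * n)) ≡ 2 * ((n * n) * (n * n))
      e₁ = solve-∀
      e₂ : ∀ K m → 2 * (2 * K * m * (2 * K * m)) ≡ 8 * (K * K) * (m * m)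
      e₂ = solve-∀
      e₃ : ∀ k n d → k * (n * d) ≡ n * (k * d)
      e₃ = solve-∀

    -- A bad pair lies in the neighbourhoods of fewer than n / β vertices of S, and there are at
    -- most n² pairs.
    ∑-bad : β * ∑ (λ z → s z * bad z) ≤ n * n * n
    ∑-bad = begin
      β * ∑ (λ z → s z * bad z)
        ≤⟨ *-monoʳ-≤ β (∑-mono expand) ⟩
      β * ∑ (λ z → ∑ λ x → ∑ λ y → s x * (s y * (b x y * t x y z)))
        ≡⟨ cong (β *_) (∑-swap (λ z x → ∑ λ y → s x * (s y * (b x y * t x y z)))) ⟩
      β * ∑ (λ x → ∑ λ z → ∑ λ y → s x * (s y * (b x y * t x y z)))
        ≡⟨ cong (β *_) (∑-cong λ x → ∑-swap (λ z y → s x * (s y * (b x y * t x y z)))) ⟩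
      β * ∑ (λ x → ∑ λ y → ∑ λ z → s x * (s y * (b x y * t x y z)))
        ≡⟨ cong (β *_) (∑-cong λ x → ∑-cong λ y → pull x y) ⟩
      β * ∑ (λ x → ∑ λ y → s x * (s y * (b x y * common x y)))
        ≡⟨ push ⟩
      ∑ (λ x → ∑ λ y → s x * (s y * (b x y * (β * common x y))))
        ≤⟨ ∑-mono (λ x → ∑-mono λ y → *-monoʳ-≤ (s x) (*-monoʳ-≤ (s y) (⟦⟧-gate (Bad? x y) <⇒≤))) ⟩
      ∑ (λ x → ∑ λ y → s x * (s y * n))
        ≡⟨ ∑-cong (λ x → trans (∑-*ˡ (s x) _) (cong (s x *_) (∑-*ʳ n s))) ⟩
      ∑ (λ x → s x * (n * n))
        ≡⟨ trans (∑-*ʳ (n * n) s) (sym (*-assoc n n n)) ⟩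
      n * n * n ∎
      where
      open ≤-Reasoning
      b : G → G → ℕ
      b x y = ⟦ Bad? x y ⟧
      t : G → G → G → ℕ
      t x y z = s z * (p (x ∙ (z ⁻¹)) * p (y ∙ (z ⁻¹)))
      e₁ : ∀ z x px y py b → z * ((x * px) * ((y * py) * b)) ≡ x * (y * (b * (z * (px * py))))
      e₁ = solve-∀
      e₂ : ∀ k x y b c → k * (x * (y * (b * c))) ≡ x * (y * (b * (k * c)))
      e₂ = solve-∀
      expand : ∀ z → s z * bad z ≤ ∑ (λ x → ∑ λ y → s x * (s y * (b x y * t x y z)))
      expand z = ≤-reflexive (trans (sym (∑-*ˡ (s z) _)) (∑-cong λ x → trans
        (cong (s z *_) (sym (∑-*ˡ ⟦ N? z x ⟧ _))) (trans (sym (∑-*ˡ (s z) _)) (∑-cong λ y → trans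
          (cong₂ (λ u v → s z * (u * v)) (⟦⟧-× (S? x) _) (trans (⟦⟧-× (N? z y) (Bad? x y)) (cong (_* b x y) (⟦⟧-× (S? y) _))))
          (e₁ (s z) (s x) (p (x ∙ (z ⁻¹))) (s y) (p (y ∙ (z ⁻¹))) (b x y))))))
      pull : ∀ x y → ∑ (λ z → s x * (s y * (b x y * t x y z))) ≡ s x * (s y * (b x y * common x y))
      pull x y = trans (∑-*ˡ (s x) _) (cong (s x *_) (trans (∑-*ˡ (s y) _) (cong (s y *_) (∑-*ˡ (b x y) _))))
      push : β * ∑ (λ x → ∑ λ y → s x * (s y * (b x y * common x y))) ≡ ∑ (λ x → ∑ λ y → s x * (s y * (b x y * (β * common x y))))
      push = trans (sym (∑-*ˡ β _)) (∑-cong λ x → trans (sym (∑-*ˡ β _)) (∑-cong λ y → e₂ β (s x) (s y) (b x y) (common x y)))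

    opaque
      good-vertex : ∃ λ z → β * bad z + n * n ≤ 8 * (K * K) * (deg z * deg z)
      good-vertex =
        -- Averaging needs a strict inequality between the sums. The added 1 contributes n > 0 in
        -- total, and `s≤s⁻¹` removes it again for the chosen z.
        let z , h = ∑<∑⇒∃< (λ z → s z * (β * bad z + n * n)) (λ z → s z * (8 * (K * K) * (deg z * deg z) + 1)) total
        in z , s≤s⁻¹ (subst (β * bad z + n * n <_) (+-comm (8 * (K * K) * (deg z * deg z)) 1) (*-cancelˡ-< (s z) _ _ h))
        where
        open ≤-Reasoning
        e₁ : ∀ k a x b → x * (k * a + b) ≡ k * (x * a) + x * b
        e₁ = solve-∀
        sumOf : ∀ k b (f : G → ℕ) → ∑ (λ z → s z * (k * f z + b)) ≡ k * ∑ (λ z → s z * f z) + n * b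
        sumOf k b f = trans (∑-cong λ z → e₁ k (f z) (s z) b)
          (trans (∑-+ _ _) (cong₂ _+_ (∑-*ˡ k _) (∑-*ʳ b s)))
        total : ∑ (λ z → s z * (β * bad z + n * n)) < ∑ (λ z → s z * (8 * (K * K) * (deg z * deg z) + 1))
        total = begin-strict
          ∑ (λ z → s z * (β * bad z + n * n))              ≡⟨ sumOf β (n * n) bad ⟩
          β * ∑ (λ z → s z * bad z) + n * (n * n)          ≤⟨ +-mono-≤ ∑-bad (≤-reflexive (sym (*-assoc n n n))) ⟩
          n * n * n + n * n * n                            ≡⟨ cong (n * n * n +_) (+-identityʳ _) ⟨
          2 * (n * n * n)                                  ≤⟨ degrees² ⟩
          8 * (K * K) * ∑ (λ z → s z * (deg z * deg z))    <⟨ m<m+n _ (≤-trans S>0 (≤-reflexive (sym (*-identityʳ n)))) ⟩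
          8 * (K * K) * ∑ (λ z → s z * (deg z * deg z)) + n * 1  ≡⟨ sumOf (8 * (K * K)) 1 (λ z → deg z * deg z) ⟨
          ∑ (λ z → s z * (8 * (K * K) * (deg z * deg z) + 1)) ∎

    z₀ : G
    z₀ = proj₁ good-vertex

    α : ℕ
    α = deg z₀

    A? : ∀ x → Dec (S x × Popular (x ∙ (z₀ ⁻¹)))
    A? = N? z₀

    n²≤α² : n * n ≤ 8 * (K * K) * (α * α)
    n²≤α² = ≤-trans (m≤n+m _ _) (proj₂ good-vertex)

    K>0 : 0 < K
    K>0 = n≢0⇒n>0 λ { refl → contradiction (≤-trans (*-mono-≤ S>0 S>0) n²≤α²) λ () }

    α>0 : 0 < α
    α>0 = n≢0⇒n>0 λ e → contradiction (≤-trans (*-mono-≤ S>0 S>0) (≤-trans n²≤α²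
      (≤-reflexive (trans (cong (λ w → 8 * (K * K) * (w * w)) e) (*-zeroʳ (8 * (K * K))))))) λ ()

    8bad≤α² : 8 * bad z₀ ≤ α * α
    8bad≤α² = *-cancelˡ-≤ (8 * (K * K)) {{>-nonZero (*-mono-≤ {1} {8} (s≤s z≤n) (*-mono-≤ K>0 K>0))}}
      (≤-trans (≤-reflexive (trans (e K (bad z₀)) (cong (_* bad z₀) (sym β-def)))) (≤-trans (m≤m+n _ _) (proj₂ good-vertex)))
      where
      e : ∀ K b → 8 * (K * K) * (8 * b) ≡ 64 * (K * K) * b
      e = solve-∀

    badDeg : G → ℕ
    badDeg x = # λ y → A? y ×? Bad? x y

    Core : G → Set
    Core x = (S x × Popular (x ∙ (z₀ ⁻¹))) × 4 * badDeg x ≤ α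

    Core? : ∀ x → Dec (Core x)
    Core? x = A? x ×? 4 * badDeg x ≤? α

    -- By Markov: a neighbour outside the core has more than α / 4 bad partners, and there are at
    -- most α² / 8 bad pairs.
    α≤2core : α ≤ 2 * # Core?
    α≤2core = +-cancelʳ-≤ α _ _ (begin
      α + α                                ≡⟨ e₂ α ⟩
      2 * # A?                             ≤⟨ *-monoʳ-≤ 2 (≤-reflexive (#-split A? (λ x → 4 * badDeg x ≤? α))) ⟩
      2 * (# Core? + # Out?)               ≡⟨ *-distribˡ-+ 2 (# Core?) (# Out?) ⟩
      2 * # Core? + 2 * # Out?             ≤⟨ +-monoʳ-≤ (2 * # Core?) out ⟩
      2 * # Core? + α                      ∎)
      where
      open ≤-Reasoning
      e₂ : ∀ α → α + α ≡ 2 * α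
      e₂ = solve-∀
      Out? = λ x → A? x ×? ¬? (4 * badDeg x ≤? α)
      e : ∀ b → 2 * (4 * b) ≡ 8 * b
      e = solve-∀
      out : 2 * # Out? ≤ α
      out = *-cancelʳ-≤ _ _ α {{>-nonZero α>0}} (begin
        2 * # Out? * α                               ≡⟨ *-assoc 2 (# Out?) α ⟩
        2 * (# Out? * α)                             ≡⟨ cong (2 *_) (∑-*ʳ α _) ⟨
        2 * ∑ (λ x → ⟦ Out? x ⟧ * α)                 ≤⟨ *-monoʳ-≤ 2 (∑-mono λ x → begin
            ⟦ Out? x ⟧ * α                           ≡⟨ cong (_* α) (⟦⟧-× (A? x) _) ⟩
            ⟦ A? x ⟧ * ⟦ ¬? (4 * badDeg x ≤? α) ⟧ * α     ≡⟨ *-assoc ⟦ A? x ⟧ _ α ⟩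
            ⟦ A? x ⟧ * (⟦ ¬? (4 * badDeg x ≤? α) ⟧ * α)   ≤⟨ *-monoʳ-≤ ⟦ A? x ⟧ (⟦⟧-gate (¬? (4 * badDeg x ≤? α)) (λ q → <⇒≤ (≰⇒> q))) ⟩
            ⟦ A? x ⟧ * (4 * badDeg x)                ≡⟨ e₃ ⟦ A? x ⟧ (badDeg x) ⟩
            4 * (⟦ A? x ⟧ * badDeg x)                ∎) ⟩
        2 * ∑ (λ x → 4 * (⟦ A? x ⟧ * badDeg x))      ≡⟨ cong (2 *_) (∑-*ˡ 4 _) ⟩
        2 * (4 * bad z₀)                             ≡⟨ e (bad z₀) ⟩
        8 * bad z₀                                   ≤⟨ 8bad≤α² ⟩
        α * α                                        ∎)
        where
        e₃ : ∀ a b → a * (4 * b) ≡ 4 * (a * b)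
        e₃ = solve-∀

    -- Each of x and x′ excludes at most a quarter of the neighbourhood, so half of it is left.
    good-neighbours : ∀ x x′ → Core x → Core x′ → α ≤ 2 * # λ y → (A? y ×? ¬? (Bad? x y)) ×? ¬? (Bad? x′ y)
    good-neighbours x x′ (_ , c) (_ , c′) = +-cancelʳ-≤ α _ _ (begin
      α + α                                   ≡⟨ e₂ α ⟩
      2 * # A?                                ≡⟨ cong (2 *_) (trans (#-split A? (Bad? x)) (cong (badDeg x +_) (#-split _ (Bad? x′)))) ⟩
      2 * (badDeg x + (# B? + # Good?))       ≤⟨ *-monoʳ-≤ 2 (+-monoʳ-≤ (badDeg x) (+-monoˡ-≤ (# Good?)
                                                   (#-mono B? (λ y → A? y ×? Bad? x′ y) λ y ((a , _) , b) → a , b))) ⟩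
      2 * (badDeg x + (badDeg x′ + # Good?))  ≡⟨ e₃ (# Good?) (badDeg x) (badDeg x′) ⟩
      2 * # Good? + (2 * badDeg x + 2 * badDeg x′)  ≤⟨ +-monoʳ-≤ (2 * # Good?) (*-cancelˡ-≤ 2 (begin
          2 * (2 * badDeg x + 2 * badDeg x′) ≡⟨ e₄ (badDeg x) (badDeg x′) ⟩
          4 * badDeg x + 4 * badDeg x′       ≤⟨ +-mono-≤ c c′ ⟩
          α + α                              ≡⟨ e₂ α ⟩
          2 * α                              ∎)) ⟩
      2 * # Good? + α                         ∎)
      where
      open ≤-Reasoning
      e₂ : ∀ α → α + α ≡ 2 * α
      e₂ = solve-∀
      e₃ : ∀ a b c → 2 * (b + (c + a)) ≡ 2 * a + (2 * b + 2 * c)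
      e₃ = solve-∀
      e₄ : ∀ b c → 2 * (2 * b + 2 * c) ≡ 4 * b + 4 * c
      e₄ = solve-∀
      B? = λ y → (A? y ×? ¬? (Bad? x y)) ×? Bad? x′ y
      Good? = λ y → (A? y ×? ¬? (Bad? x y)) ×? ¬? (Bad? x′ y)

    paths : G → ℕ
    paths = (p ⋆ p) ⋆ (p ⋆ p)

    -- Go from x to x′ through one of the α / 2 good y. Each half of the way has at least n / β
    -- middle points, and the four steps are popular elements.
    many-paths : ∀ x x′ → Core x → Core x′ → α * (n * n) ≤ 2 * (β * β) * paths (x ∙ (x′ ⁻¹))
    many-paths x x′ c c′ = begin
      α * (n * n)                              ≤⟨ *-monoˡ-≤ (n * n) (good-neighbours x x′ c c′) ⟩
      2 * # Good? * (n * n)                    ≡⟨ trans (*-assoc 2 (# Good?) (n * n)) (cong (2 *_) (sym (∑-*ʳ (n * n) (λ y → ⟦ Good? y ⟧)))) ⟩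
      2 * ∑ (λ y → ⟦ Good? y ⟧ * (n * n))      ≤⟨ *-monoʳ-≤ 2 (∑-mono λ y → ⟦⟧-gate (Good? y) λ ((_ , g) , g′) → begin
          n * n                                          ≤⟨ *-mono-≤ (≮⇒≥ g) (≮⇒≥ g′) ⟩
          β * common x y * (β * common x′ y)             ≡⟨ cong (λ w → β * common x y * (β * w)) (common-sym x′ y) ⟩
          β * common x y * (β * common y x′)             ≡⟨ e β (common x y) (common y x′) ⟩
          β * β * (common x y * common y x′)             ≤⟨ *-monoʳ-≤ (β * β) (*-mono-≤ (common≤ x y) (common≤ y x′)) ⟩
          β * β * ((p ⋆ p) (x ∙ (y ⁻¹)) * (p ⋆ p) (y ∙ (x′ ⁻¹))) ∎) ⟩
      2 * ∑ (λ y → β * β * ((p ⋆ p) (x ∙ (y ⁻¹)) * (p ⋆ p) (y ∙ (x′ ⁻¹))))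
        ≡⟨ trans (cong (2 *_) (∑-*ˡ (β * β) _)) (sym (*-assoc 2 (β * β) _)) ⟩
      2 * (β * β) * ∑ (λ y → (p ⋆ p) (x ∙ (y ⁻¹)) * (p ⋆ p) (y ∙ (x′ ⁻¹)))
        ≡⟨ cong (2 * (β * β) *_) (⋆-quotient (p ⋆ p) (p ⋆ p) x x′) ⟨
      2 * (β * β) * paths (x ∙ (x′ ⁻¹)) ∎
      where
      open ≤-Reasoning
      Good? = λ y → (A? y ×? ¬? (Bad? x y)) ×? ¬? (Bad? x′ y)
      e : ∀ β c d → β * c * (β * d) ≡ β * β * (c * d)
      e = solve-∀

    Quotient : G → Set
    Quotient g = ∃ λ x → Core x × Core (g ∙ x)

    Quotient? : ∀ g → Dec (Quotient g)
    Quotient? g = ∃? λ x → Core? x ×? Core? (g ∙ x)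

    -- The factor 2β² comes from `many-paths` and (2K)⁴ from four sets of popular elements. The
    -- rest, 8K² · 2, is the price of replacing one n² by α times the size of the core.
    K₁ : ℕ
    K₁ = 2 * (β * β) * (2 * K * (2 * K) * (2 * K * (2 * K))) * (8 * (K * K)) * 2

    small-quotients : # Quotient? ≤ K₁ * # Core?
    small-quotients = *-cancelʳ-≤ _ _ α {{>-nonZero α>0}} (*-cancelʳ-≤ _ _ (n * n) {{>-nonZero (*-mono-≤ S>0 S>0)}} (begin
      # Quotient? * α * (n * n)                    ≡⟨ trans (*-assoc (# Quotient?) α _) (sym (∑-*ʳ (α * (n * n)) _)) ⟩
      ∑ (λ g → ⟦ Quotient? g ⟧ * (α * (n * n)))    ≤⟨ ∑-mono (λ g → ⟦⟧-gate (Quotient? g) λ (x , c , c′) →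
          subst (λ w → α * (n * n) ≤ 2 * (β * β) * paths w) (yx∙x⁻¹ x g) (many-paths (g ∙ x) x c′ c)) ⟩
      ∑ (λ g → 2 * (β * β) * paths g)              ≡⟨ ∑-*ˡ (2 * (β * β)) paths ⟩
      2 * (β * β) * ∑ paths                        ≡⟨ cong (2 * (β * β) *_) (trans (∑-⋆ (p ⋆ p) (p ⋆ p)) (cong₂ _*_ (∑-⋆ p p) (∑-⋆ p p))) ⟩
      2 * (β * β) * (P * P * (P * P))              ≤⟨ *-monoʳ-≤ (2 * (β * β)) (*-mono-≤ (*-mono-≤ #Popular #Popular) (*-mono-≤ #Popular #Popular)) ⟩
      2 * (β * β) * (2 * K * n * (2 * K * n) * (2 * K * n * (2 * K * n))) ≡⟨ e₁ (2 * (β * β)) (2 * K) n ⟩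
      c * (n * n) * (n * n)                        ≤⟨ *-monoˡ-≤ (n * n) (*-monoʳ-≤ c n²≤α²) ⟩
      c * (8 * (K * K) * (α * α)) * (n * n)
        ≤⟨ *-monoˡ-≤ (n * n) (*-monoʳ-≤ c (*-monoʳ-≤ (8 * (K * K)) (*-monoʳ-≤ α α≤2core))) ⟩
      c * (8 * (K * K) * (α * (2 * # Core?))) * (n * n)
        ≡⟨ cong (_* (n * n)) (e₂ c (8 * (K * K)) 2 α (# Core?)) ⟩
      K₁ * # Core? * α * (n * n) ∎))
      where
      open ≤-Reasoning
      P = # Popular?
      c = 2 * (β * β) * (2 * K * (2 * K) * (2 * K * (2 * K)))
      e₁ : ∀ b k n → b * (k * n * (k * n) * (k * n * (k * n))) ≡ b * (k * k * (k * k)) * (n * n) * (n * n)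
      e₁ = solve-∀
      e₂ : ∀ c k t α m → c * (k * (α * (t * m))) ≡ c * k * t * m * α
      e₂ = solve-∀

    core-large : n * n ≤ 32 * (K * K) * (# Core? * # Core?)
    core-large = begin
      n * n                                      ≤⟨ n²≤α² ⟩
      8 * (K * K) * (α * α)                      ≤⟨ *-monoʳ-≤ (8 * (K * K)) (*-mono-≤ α≤2core α≤2core) ⟩
      8 * (K * K) * (2 * # Core? * (2 * # Core?)) ≡⟨ e (K * K) (# Core?) ⟩
      32 * (K * K) * (# Core? * # Core?)         ∎
      where
      open ≤-Reasoning
      e : ∀ k c → 8 * k * (2 * c * (2 * c)) ≡ 32 * k * (c * c)
      e = solve-∀

-- Tao's theorem: from a small quotient set to an approximate group.

module SmallQuotients (G : Set) (finite : Finite G) (_∙_ : G → G → G) (ε : G) (_⁻¹ : G → G)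
  (isGroup : IsGroup _≡_ _∙_ ε _⁻¹) where

  open import Data.Nat hiding (_≟_)
  open import Data.Nat.Properties hiding (_≟_)
  open GroupSums G finite _∙_ ε _⁻¹ isGroup
  open BSG G finite _∙_ ε _⁻¹ isGroup

  private instance
    finite-G : Finite G
    finite-G = finite

  module Powers {D : G → Set} (D? : ∀ x → Dec (D x)) (ε∈D : D ε) (D⁻¹ : ∀ x → D x → D (x ⁻¹)) where

    -- The j-fold product set of D, with the last factor split off so that membership is decided by
    -- one search over the group at each level.
    Pow : ℕ → G → Set
    Pow zero g = g ≡ ε
    Pow (suc j) g = ∃ λ h → Pow j (g ∙ (h ⁻¹)) × D h

    Pow? : ∀ j g → Dec (Pow j g)
    Pow? zero g = g ≟ ε
    Pow? (suc j) g = ∃? λ h → Pow? j (g ∙ (h ⁻¹)) ×? D? h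

    Pow-∙D : ∀ j {g h} → Pow j g → D h → Pow (suc j) (g ∙ h)
    Pow-∙D j {g} {h} p d = h , subst (Pow j) (sym (yx∙x⁻¹ h g)) p , d

    Pow-1 : ∀ {g} → D g → Pow 1 g
    Pow-1 {g} d = g , inverseʳ g , d

    Pow-1⁻ : ∀ {g} → Pow 1 g → D g
    Pow-1⁻ {g} (h , e , d) = subst D (trans (sym (identityˡ h)) (trans (cong (_∙ h) (sym e)) (yx⁻¹∙x h g))) d

    Pow-∙ : ∀ i j {g h} → Pow i g → Pow j h → Pow (i + j) (g ∙ h)
    Pow-∙ i zero {g} p refl = subst₂ Pow (sym (+-identityʳ i)) (sym (identityʳ g)) p
    Pow-∙ i (suc j) {g} {h} p (d , q , dd) = subst (λ k → Pow k (g ∙ h)) (sym (+-suc i j))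
      (d , subst (Pow (i + j)) (sym (assoc g h (d ⁻¹))) (Pow-∙ i j p q) , dd)

    Pow-⁻¹ : ∀ j {g} → Pow j g → Pow j (g ⁻¹)
    Pow-⁻¹ zero refl = trans (sym (identityˡ (ε ⁻¹))) (inverseʳ ε)
    Pow-⁻¹ (suc j) {g} (d , p , dd) = subst (Pow (suc j)) e (Pow-∙ 1 j (Pow-1 (D⁻¹ d dd)) (Pow-⁻¹ j p))
      where
      e : (d ⁻¹) ∙ ((g ∙ (d ⁻¹)) ⁻¹) ≡ g ⁻¹
      e = trans (cong ((d ⁻¹) ∙_) (trans (⁻¹-anti-homo-∙ g (d ⁻¹)) (cong (_∙ (g ⁻¹)) (⁻¹-involutive d)))) (x⁻¹∙xy d (g ⁻¹))

    Pow-+ : ∀ i j {g} → Pow j g → Pow (i + j) g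
    Pow-+ zero j p = p
    Pow-+ (suc i) j {g} p = subst (Pow (suc (i + j))) (identityʳ g) (Pow-∙D (i + j) (Pow-+ i j p) ε∈D)

  module ApproximateGroup (K : ℕ) {A : G → Set} (A? : ∀ x → Dec (A x)) (A>0 : 0 < # A?)
    (small : # (λ g → ∃? λ x → A? x ×? A? (g ∙ x)) ≤ K * # A?) where

    private
      m : ℕ
      m = # A?

      a : G → ℕ
      a x = ⟦ A? x ⟧

      Q? : ∀ g → Dec (∃ λ x → A x × A (g ∙ x))
      Q? g = ∃? λ x → A? x ×? A? (g ∙ x)

      q : G → ℕ
      q g = ⟦ Q? g ⟧

    -- Counts g = x⁻¹ y with x, y ∈ A, whereas `quotients` counts g = y x⁻¹. The set `D` consists of
    -- the popular elements of A⁻¹A, although the hypothesis concerns AA⁻¹.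
    translates : G → ℕ
    translates g = # λ x → A? x ×? A? (x ∙ g)

    translates≤ : ∀ g → translates g ≤ m
    translates≤ g = #-mono _ A? (λ x → proj₁)

    translates-⁻¹ : ∀ g → translates (g ⁻¹) ≡ translates g
    translates-⁻¹ g = begin
      ∑ (λ x → ⟦ A? x ×? A? (x ∙ (g ⁻¹)) ⟧)              ≡⟨ ∑-rightMul g (λ x → ⟦ A? x ×? A? (x ∙ (g ⁻¹)) ⟧) ⟨
      ∑ (λ x → ⟦ A? (x ∙ g) ×? A? ((x ∙ g) ∙ (g ⁻¹)) ⟧)  ≡⟨ ∑-cong (λ x → ⟦⟧-cong (A? (x ∙ g) ×? A? ((x ∙ g) ∙ (g ⁻¹))) (A? x ×? A? (x ∙ g))
          (λ (u , v) → subst A (yx∙x⁻¹ g x) v , u) (λ (u , v) → v , subst A (sym (yx∙x⁻¹ g x)) u)) ⟩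
      ∑ (λ x → ⟦ A? x ×? A? (x ∙ g) ⟧)                   ∎
      where open ≡-Reasoning

    ∑-translates : ∑ translates ≡ m * m
    ∑-translates = begin
      ∑ (λ g → ∑ λ x → ⟦ A? x ×? A? (x ∙ g) ⟧)   ≡⟨ ∑-swap (λ g x → ⟦ A? x ×? A? (x ∙ g) ⟧) ⟩
      ∑ (λ x → ∑ λ g → ⟦ A? x ×? A? (x ∙ g) ⟧)   ≡⟨ ∑-cong (λ x → ∑-cong λ g → ⟦⟧-× (A? x) (A? (x ∙ g))) ⟩
      ∑ (λ x → ∑ λ g → a x * a (x ∙ g))          ≡⟨ ∑-cong (λ x → trans (∑-*ˡ (a x) _) (cong (a x *_) (∑-leftMul x a))) ⟩
      ∑ (λ x → a x * m)                          ≡⟨ ∑-*ʳ m a ⟩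
      m * m                                      ∎
      where open ≡-Reasoning

    -- Both sides count the solutions of x⁻¹ y = b⁻¹ z in A.
    translates²≡energy : ∑ (λ g → translates g * translates g) ≡ energy A?
    translates²≡energy = begin
      ∑ (λ g → translates g * translates g)
        ≡⟨ ∑-cong (λ g → trans (∑*∑ (λ x → ⟦ A? x ×? A? (x ∙ g) ⟧) (λ x → ⟦ A? x ×? A? (x ∙ g) ⟧))
             (∑-cong λ x → ∑-cong λ b → cong₂ _*_ (⟦⟧-× (A? x) (A? (x ∙ g))) (⟦⟧-× (A? b) (A? (b ∙ g))))) ⟩
      ∑ (λ g → ∑ λ x → ∑ λ b → a x * a (x ∙ g) * (a b * a (b ∙ g)))
        ≡⟨ ∑-swap (λ g x → ∑ λ b → a x * a (x ∙ g) * (a b * a (b ∙ g))) ⟩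
      ∑ (λ x → ∑ λ g → ∑ λ b → a x * a (x ∙ g) * (a b * a (b ∙ g)))
        ≡⟨ ∑-cong (λ x → sym (∑-leftMul (x ⁻¹) (λ g → ∑ λ b → a x * a (x ∙ g) * (a b * a (b ∙ g))))) ⟩
      ∑ (λ x → ∑ λ y → ∑ λ b → a x * a (x ∙ ((x ⁻¹) ∙ y)) * (a b * a (b ∙ ((x ⁻¹) ∙ y))))
        ≡⟨ ∑-cong (λ x → ∑-cong λ y → ∑-cong λ b → cong₂ (λ u v → a x * a u * (a b * a v)) (x∙x⁻¹y x y) (sym (assoc b (x ⁻¹) y))) ⟩
      ∑ (λ x → ∑ λ y → ∑ λ b → a x * a y * (a b * a ((b ∙ (x ⁻¹)) ∙ y)))
        ≡⟨ ∑-cong (λ x → ∑-cong λ y → ∑-cong λ b → e (a x) (a y) (a b) (a ((b ∙ (x ⁻¹)) ∙ y))) ⟩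
      ∑ (λ x → ∑ λ y → ∑ λ b → a x * a b * (a y * a ((b ∙ (x ⁻¹)) ∙ y)))
        ≡⟨ ∑-cong (λ x → ∑-swap (λ y b → a x * a b * (a y * a ((b ∙ (x ⁻¹)) ∙ y)))) ⟩
      ∑ (λ x → ∑ λ b → ∑ λ y → a x * a b * (a y * a ((b ∙ (x ⁻¹)) ∙ y)))
        ≡⟨ ∑-cong (λ x → ∑-cong λ b → ∑-cong λ y → cong (λ u → a x * a u * (a y * a ((b ∙ (x ⁻¹)) ∙ y))) (sym (yx⁻¹∙x x b))) ⟩
      ∑ (λ x → ∑ λ b → ∑ λ y → a x * a ((b ∙ (x ⁻¹)) ∙ x) * (a y * a ((b ∙ (x ⁻¹)) ∙ y)))
        ≡⟨ ∑-cong (λ x → ∑-rightMul (x ⁻¹) (λ g → ∑ λ y → a x * a (g ∙ x) * (a y * a (g ∙ y)))) ⟩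
      ∑ (λ x → ∑ λ g → ∑ λ y → a x * a (g ∙ x) * (a y * a (g ∙ y)))
        ≡⟨ ∑-swap (λ x g → ∑ λ y → a x * a (g ∙ x) * (a y * a (g ∙ y))) ⟩
      ∑ (λ g → ∑ λ x → ∑ λ y → a x * a (g ∙ x) * (a y * a (g ∙ y)))
        ≡⟨ ∑-cong (λ g → sym (trans (∑*∑ (λ x → ⟦ A? x ×? A? (g ∙ x) ⟧) (λ x → ⟦ A? x ×? A? (g ∙ x) ⟧))
             (∑-cong λ x → ∑-cong λ y → cong₂ _*_ (⟦⟧-× (A? x) (A? (g ∙ x))) (⟦⟧-× (A? y) (A? (g ∙ y)))))) ⟩
      energy A? ∎
      where
      open ≡-Reasoning
      e : ∀ x y b z → x * y * (b * z) ≡ x * b * (y * z)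
      e = solve-∀

    -- The m² pairs have all their quotients among at most K m elements, so by Cauchy-Schwarz many
    -- quotients coincide.
    energy-large : m * m * m ≤ K * energy A?
    energy-large = *-cancelˡ-≤ m {{>-nonZero A>0}} (begin
      m * (m * m * m)                                    ≡⟨ e₁ m ⟩
      m * m * (m * m)                                    ≡⟨ cong₂ _*_ supported supported ⟩
      ∑ (λ g → q g * quotients A? g) * ∑ (λ g → q g * quotients A? g)
                                                         ≤⟨ cauchy-schwarz-on Q? (quotients A?) ⟩
      # Q? * ∑ (λ g → q g * (quotients A? g * quotients A? g))
                                                         ≤⟨ *-mono-≤ small (∑-mono λ g → ⟦⟧-gate (Q? g) λ _ → ≤-refl) ⟩
      K * m * energy A?                                  ≡⟨ e₂ K m (energy A?) ⟩
      m * (K * energy A?)                                ∎)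
      where
      open ≤-Reasoning
      e₁ : ∀ m → m * (m * m * m) ≡ m * m * (m * m)
      e₁ = solve-∀
      e₂ : ∀ K m e → K * m * e ≡ m * (K * e)
      e₂ = solve-∀
      gated : ∀ g → quotients A? g ≡ q g * quotients A? g
      gated g = sym (trans (sym (∑-*ˡ (q g) _)) (∑-cong λ x → trans (sym (⟦⟧-× (Q? g) (A? x ×? A? (g ∙ x))))
        (⟦⟧-cong (Q? g ×? (A? x ×? A? (g ∙ x))) (A? x ×? A? (g ∙ x)) proj₂ (λ u → (x , u) , u))))
      supported : m * m ≡ ∑ (λ g → q g * quotients A? g)
      supported = trans (sym (∑-quotients A?)) (∑-cong gated)

    open Popularity K m translates A>0 translates≤ ∑-translates public
      renaming (Popular to D; Popular? to D?; #Popular to #D≤)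

    private
      K>0 : 0 < K
      K>0 = n≢0⇒n>0 λ { refl → contradiction (≤-trans (*-mono-≤ (*-mono-≤ A>0 A>0) A>0) energy-large) λ () }

      m≤2Km : m ≤ 2 * K * m
      m≤2Km = ≤-trans (≤-reflexive (sym (*-identityˡ m))) (*-monoˡ-≤ m (*-mono-≤ {1} {2} (s≤s z≤n) K>0))

    ε∈D : D ε
    ε∈D = ≤-trans m≤2Km (*-monoʳ-≤ (2 * K) (#-mono A? (λ x → A? x ×? A? (x ∙ ε)) λ x u → u , subst A (sym (identityʳ x)) u))

    D⁻¹ : ∀ x → D x → D (x ⁻¹)
    D⁻¹ x = subst (λ w → m ≤ 2 * K * w) (sym (translates-⁻¹ x))

    m²≤mass : m * m ≤ 2 * K * ∑ (λ g → ⟦ D? g ⟧ * translates g)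
    m²≤mass = popular-mass (subst (λ w → m * m * m ≤ K * w) (sym translates²≡energy) energy-large)

    m≤2K#D : m ≤ 2 * K * # D?
    m≤2K#D = *-cancelʳ-≤ _ _ m {{>-nonZero A>0}} (begin
      m * m                                      ≤⟨ m²≤mass ⟩
      2 * K * ∑ (λ g → ⟦ D? g ⟧ * translates g)  ≤⟨ *-monoʳ-≤ (2 * K) (∑-mono λ g → *-monoʳ-≤ ⟦ D? g ⟧ (translates≤ g)) ⟩
      2 * K * ∑ (λ g → ⟦ D? g ⟧ * m)             ≡⟨ cong (2 * K *_) (∑-*ʳ m _) ⟩
      2 * K * (# D? * m)                         ≡⟨ *-assoc (2 * K) (# D?) m ⟨
      2 * K * # D? * m                           ∎)
      where open ≤-Reasoning

    opaque
      -- Averages the mass of D over the first coordinate x ∈ A. The resulting part of D inside x⁻¹A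
      -- is what later inherits the nonconcentration of S.
      rich-translate : ∃ λ x → A x × m ≤ 2 * K * # λ g → D? g ×? A? (x ∙ g)
      rich-translate =
        let x , h = ∑<∑⇒∃< (λ x → a x * m) (λ x → a x * (2 * K * t x + 1)) total
            x∈A = ⟦⟧-pos (A? x) (n≢0⇒n>0 λ e → contradiction (subst (λ w → w * m < w * (2 * K * t x + 1)) e h) λ ())
        in x , x∈A , s≤s⁻¹ (subst (m <_) (+-comm (2 * K * t x) 1) (*-cancelˡ-< (a x) _ _ h))
        where
        open ≤-Reasoning
        t : G → ℕ
        t x = # λ g → D? g ×? A? (x ∙ g)
        e₁ : ∀ a k t → a * (k * t + 1) ≡ k * (a * t) + a * 1
        e₁ = solve-∀
        e₂ : ∀ a d x → d * (a * x) ≡ a * (d * x)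
        e₂ = solve-∀
        mass : ∑ (λ g → ⟦ D? g ⟧ * translates g) ≡ ∑ (λ x → a x * t x)
        mass = trans (∑-cong λ g → sym (∑-*ˡ ⟦ D? g ⟧ _)) (trans (∑-swap (λ g x → ⟦ D? g ⟧ * ⟦ A? x ×? A? (x ∙ g) ⟧))
          (∑-cong λ x → trans (∑-cong λ g → trans (cong (⟦ D? g ⟧ *_) (⟦⟧-× (A? x) (A? (x ∙ g))))
            (trans (e₂ (a x) ⟦ D? g ⟧ (a (x ∙ g))) (cong (a x *_) (sym (⟦⟧-× (D? g) (A? (x ∙ g))))))) (∑-*ˡ (a x) _)))
        total : ∑ (λ x → a x * m) < ∑ (λ x → a x * (2 * K * t x + 1))
        total = begin-strict
          ∑ (λ x → a x * m)                                ≡⟨ ∑-*ʳ m a ⟩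
          m * m                                            ≤⟨ m²≤mass ⟩
          2 * K * ∑ (λ g → ⟦ D? g ⟧ * translates g)        ≡⟨ cong (2 * K *_) mass ⟩
          2 * K * ∑ (λ x → a x * t x)                      <⟨ m<m+n _ (≤-trans A>0 (≤-reflexive (sym (*-identityʳ m)))) ⟩
          2 * K * ∑ (λ x → a x * t x) + m * 1              ≡⟨ cong₂ _+_ (∑-*ˡ (2 * K) _) (∑-*ʳ 1 a) ⟨
          ∑ (λ x → 2 * K * (a x * t x)) + ∑ (λ x → a x * 1) ≡⟨ ∑-+ _ _ ⟨
          ∑ (λ x → 2 * K * (a x * t x) + a x * 1)          ≡⟨ ∑-cong (λ x → e₁ (a x) (2 * K) (t x)) ⟨
          ∑ (λ x → a x * (2 * K * t x + 1))                ∎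

    open Powers D? ε∈D D⁻¹ public

    private
      -- `f j g` counts the representations of g as x⁻¹ q₁ ⋯ qⱼ y with x, y ∈ A and every qᵢ ∈ AA⁻¹;
      -- `F j` counts the products without the last factor y.
      F : ℕ → G → ℕ
      F zero x = a (x ⁻¹)
      F (suc j) = F j ⋆ q

      f : ℕ → G → ℕ
      f j = F j ⋆ a

      ⋆-right : ∀ u v x → (u ⋆ v) x ≡ ∑ λ y → u (x ∙ (y ⁻¹)) * v y
      ⋆-right u v x = trans (sym (∑-quotient x (λ y → u y * v ((y ⁻¹) ∙ x)))) (∑-cong λ y → cong (λ w → u (x ∙ (y ⁻¹)) * v w) (e y))
        where
        e : ∀ y → ((x ∙ (y ⁻¹)) ⁻¹) ∙ x ≡ y
        e y = trans (cong (_∙ x) (trans (⁻¹-anti-homo-∙ x (y ⁻¹)) (cong (_∙ (x ⁻¹)) (⁻¹-involutive y)))) (yx⁻¹∙x x y)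

      f-zero : ∀ g → f 0 g ≡ translates g
      f-zero g = trans (⋆-right (F 0) a g) (trans (∑-cong λ y → trans (cong (λ w → a w * a y)
        (trans (⁻¹-anti-homo-∙ g (y ⁻¹)) (cong (_∙ (g ⁻¹)) (⁻¹-involutive y))))
        (trans (*-comm (a (y ∙ (g ⁻¹))) (a y)) (sym (⟦⟧-× (A? y) (A? (y ∙ (g ⁻¹))))))) (translates-⁻¹ g))

      -- For h = x⁻¹ y with x, y ∈ A and u ∈ A, the element u x⁻¹ is a quotient of A.
      f-suc : ∀ j g h → translates h * f j g ≤ f (suc j) (g ∙ h)
      f-suc j g h = begin
        translates h * f j g
          ≡⟨ cong (_* f j g) (translates-⁻¹ h) ⟨
        translates (h ⁻¹) * f j g
          ≡⟨ ∑-*ʳ (f j g) _ ⟨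
        ∑ (λ b → ⟦ A? b ×? A? (b ∙ (h ⁻¹)) ⟧ * f j g)
          ≤⟨ ∑-mono (λ b → ≤-trans (⟦⟧-gate-mono (A? b ×? A? (b ∙ (h ⁻¹))) (λ (_ , u) → inner b u))
               (≤-trans (*-monoˡ-≤ (F (suc j) ((g ∙ h) ∙ (b ⁻¹))) (⟦⟧-mono (A? b ×? A? (b ∙ (h ⁻¹))) (A? b) proj₁))
                 (≤-reflexive (*-comm (a b) _)))) ⟩
        ∑ (λ b → F (suc j) ((g ∙ h) ∙ (b ⁻¹)) * a b)
          ≡⟨ ⋆-right (F (suc j)) a (g ∙ h) ⟨
        f (suc j) (g ∙ h) ∎
        where
        open ≤-Reasoning
        e : ∀ b → g ∙ ((b ∙ (h ⁻¹)) ⁻¹) ≡ (g ∙ h) ∙ (b ⁻¹)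
        e b = trans (cong (g ∙_) (trans (⁻¹-anti-homo-∙ b (h ⁻¹)) (cong (_∙ (b ⁻¹)) (⁻¹-involutive h)))) (sym (assoc g h (b ⁻¹)))
        inner : ∀ b → A (b ∙ (h ⁻¹)) → f j g ≤ F (suc j) ((g ∙ h) ∙ (b ⁻¹))
        inner b u = begin
          f j g                                                    ≡⟨ ⋆-right (F j) a g ⟩
          ∑ (λ y → F j (g ∙ (y ⁻¹)) * a y)                         ≤⟨ ∑-mono (λ y → *-monoʳ-≤ (F j (g ∙ (y ⁻¹)))
              (⟦⟧-mono (A? y) (Q? (y ∙ ((b ∙ (h ⁻¹)) ⁻¹))) λ v → (b ∙ (h ⁻¹)) , u , subst A (sym (yx⁻¹∙x (b ∙ (h ⁻¹)) y)) v)) ⟩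
          ∑ (λ y → F j (g ∙ (y ⁻¹)) * q (y ∙ ((b ∙ (h ⁻¹)) ⁻¹)))   ≡⟨ ⋆-quotient (F j) q g (b ∙ (h ⁻¹)) ⟨
          F (suc j) (g ∙ ((b ∙ (h ⁻¹)) ⁻¹))                        ≡⟨ cong (F (suc j)) (e b) ⟩
          F (suc j) ((g ∙ h) ∙ (b ⁻¹))                             ∎

      -- Each of the j + 1 factors from D is x⁻¹ y in at least m / 2K ways. Between neighbouring
      -- factors the pair y x⁻¹ is regrouped into an element of AA⁻¹, so all choices are
      -- representations counted by `f j`.
      f-Pow : ∀ j {g} → Pow (suc j) g → m ^ suc j ≤ (2 * K) ^ suc j * f j g
      f-Pow zero {g} p = begin
        m * 1                  ≡⟨ *-identityʳ m ⟩
        m                      ≤⟨ Pow-1⁻ p ⟩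
        2 * K * translates g   ≡⟨ cong₂ _*_ (*-identityʳ (2 * K)) (f-zero g) ⟨
        (2 * K) ^ 1 * f 0 g    ∎
        where open ≤-Reasoning
      f-Pow (suc j) {g} (h , p , d) = begin
        m * m ^ suc j                                     ≤⟨ *-mono-≤ d (f-Pow j p) ⟩
        2 * K * translates h * ((2 * K) ^ suc j * f j (g ∙ (h ⁻¹)))  ≡⟨ e (2 * K) (translates h) ((2 * K) ^ suc j) (f j (g ∙ (h ⁻¹))) ⟩
        (2 * K) ^ suc (suc j) * (translates h * f j (g ∙ (h ⁻¹)))    ≤⟨ *-monoʳ-≤ ((2 * K) ^ suc (suc j)) (f-suc j (g ∙ (h ⁻¹)) h) ⟩
        (2 * K) ^ suc (suc j) * f (suc j) ((g ∙ (h ⁻¹)) ∙ h)         ≡⟨ cong (λ w → (2 * K) ^ suc (suc j) * f (suc j) w) (yx⁻¹∙x h g) ⟩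
        (2 * K) ^ suc (suc j) * f (suc j) g               ∎
        where
        open ≤-Reasoning
        e : ∀ k t p f → k * t * (p * f) ≡ k * p * (t * f)
        e = solve-∀

      ∑F : ∀ j → ∑ (F j) ≤ (K * m) ^ j * m
      ∑F zero = ≤-reflexive (trans (∑-inverse a) (sym (*-identityˡ m)))
      ∑F (suc j) = begin
        ∑ (F j ⋆ q)                  ≡⟨ ∑-⋆ (F j) q ⟩
        ∑ (F j) * # Q?               ≤⟨ *-mono-≤ (∑F j) small ⟩
        (K * m) ^ j * m * (K * m)    ≡⟨ e ((K * m) ^ j) m (K * m) ⟩
        (K * m) ^ suc j * m          ∎
        where
        open ≤-Reasoning
        e : ∀ p m k → p * m * k ≡ k * p * m
        e = solve-∀

    -- Compares the lower bound of `f-Pow`, valid at every element of the product set, with the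
    -- total mass (K m)^j m² of `f j`.
    #Pow : ∀ j → # Pow? (suc j) ≤ (2 * K) ^ suc j * K ^ j * m
    #Pow j = *-cancelʳ-≤ _ _ (m ^ suc j) {{m^n≢0 m (suc j) {{>-nonZero A>0}}}} (begin
      # Pow? (suc j) * m ^ suc j                          ≡⟨ ∑-*ʳ (m ^ suc j) _ ⟨
      ∑ (λ g → ⟦ Pow? (suc j) g ⟧ * m ^ suc j)            ≤⟨ ∑-mono (λ g → ⟦⟧-gate (Pow? (suc j) g) (f-Pow j)) ⟩
      ∑ (λ g → (2 * K) ^ suc j * f j g)                   ≡⟨ ∑-*ˡ ((2 * K) ^ suc j) (f j) ⟩
      (2 * K) ^ suc j * ∑ (f j)                           ≡⟨ cong ((2 * K) ^ suc j *_) (∑-⋆ (F j) a) ⟩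
      (2 * K) ^ suc j * (∑ (F j) * m)                     ≤⟨ *-monoʳ-≤ ((2 * K) ^ suc j) (*-monoˡ-≤ m (∑F j)) ⟩
      (2 * K) ^ suc j * ((K * m) ^ j * m * m)             ≡⟨ cong (λ w → (2 * K) ^ suc j * (w * m * m)) (^-distribʳ-* j K m) ⟩
      (2 * K) ^ suc j * (K ^ j * m ^ j * m * m)           ≡⟨ e ((2 * K) ^ suc j) (K ^ j) (m ^ j) m ⟩
      (2 * K) ^ suc j * K ^ j * m * m ^ suc j             ∎)
      where
      open ≤-Reasoning
      e : ∀ k l p m → k * (l * p * m * m) ≡ k * l * m * (m * p)
      e = solve-∀

-- Finite fields of odd characteristic.

module Fields where

  record FiniteField : Set₁ where
    infixl 6 _+_
    infixl 7 _*_
    infix 8 -_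
    field
      F         : Set
      finite-F  : Finite F
      _+_ _*_   : F → F → F
      -_        : F → F
      0# 1#     : F
      isCommutativeRing : IsCommutativeRing _≡_ _+_ _*_ -_ 0# 1#
      inverse   : ∀ x → x ≢ 0# → ∃ λ y → x * y ≡ 1#
      2≢0       : 1# + 1# ≢ 0#

    commutativeRing : CommutativeRing 0ℓ 0ℓ
    commutativeRing = record { isCommutativeRing = isCommutativeRing }

    open CommutativeRing commutativeRing public
      using (+-identityʳ; +-identityˡ; *-identityˡ; *-identityʳ; +-comm; *-comm; +-assoc; *-assoc; -‿inverseʳ; -‿inverseˡ; zeroˡ; zeroʳ; distribˡ; distribʳ)
    open RingSolving commutativeRing public

    instance
      F-finite : Finite F
      F-finite = finite-F

    1≢0 : 1# ≢ 0#
    1≢0 e = 2≢0 (trans (cong₂ _+_ e e) (+-identityʳ 0#))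

    +-cancelʳ : ∀ {x y} z → x + z ≡ y + z → x ≡ y
    +-cancelʳ {x} {y} z e = trans (sym (f x)) (trans (cong (_+ - z) e) (f y))
      where
      f : ∀ x → x + z + - z ≡ x
      f x = trans (+-assoc x z (- z)) (trans (cong (x +_) (-‿inverseʳ z)) (+-identityʳ x))

    -- To prove x ≡ y from a combination l ≡ r of hypotheses it suffices to check a ring identity.
    by : ∀ {l r x y} → l ≡ r → x + r ≡ y + l → x ≡ y
    by {l} {r} h e = +-cancelʳ r (trans e (cong (_ +_) h))

    infixl 6 _⊞_
    infixr 7 _⊡_
    -- With `_⊡_` this forms linear combinations of equations, to be handed to `by`.
    _⊞_ : ∀ {a b c d} → a ≡ b → c ≡ d → a + c ≡ b + d
    _⊞_ = cong₂ _+_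

    _⊡_ : ∀ {a b} c → a ≡ b → c * a ≡ c * b
    c ⊡ e = cong (c *_) e

    *-cancelˡ : ∀ {x y} z → z ≢ 0# → z * x ≡ z * y → x ≡ y
    *-cancelˡ {x} {y} z z≢0 e with inverse z z≢0
    ... | w , zw = trans (sym (f x)) (trans (cong (w *_) e) (f y))
      where
      f : ∀ x → w * (z * x) ≡ x
      f x = trans (sym (*-assoc w z x)) (trans (cong (_* x) (trans (*-comm w z) zw)) (*-identityˡ x))

    zero-product : ∀ {x y} → x * y ≡ 0# → x ≡ 0# ⊎ y ≡ 0#
    zero-product {x} {y} e with x ≟ 0#
    ... | yes x≡0 = inj₁ x≡0
    ... | no x≢0 = inj₂ (*-cancelˡ x x≢0 (trans e (sym (zeroʳ x))))

    x²≡0 : ∀ {x} → x * x ≡ 0# → x ≡ 0#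
    x²≡0 e with zero-product e
    ... | inj₁ h = h
    ... | inj₂ h = h

    difference≡0 : ∀ {x y} → x + - y ≡ 0# → x ≡ y
    difference≡0 {x} {y} e = by e (trans (+-identityʳ x) (solve 2 (λ x y → x := y :+ (x :+ :- y)) refl x y))

    double-cancel : ∀ {x y} → x + x ≡ y + y → x ≡ y
    double-cancel {x} {y} e = *-cancelˡ (1# + 1#) 2≢0 (trans (f x) (trans e (sym (f y))))
      where
      f : ∀ x → (1# + 1#) * x ≡ x + x
      f x = trans (distribʳ x 1# 1#) (cong₂ _+_ (*-identityˡ x) (*-identityˡ x))

open Fields using (FiniteField)

-- Two by two matrices and SL₂ as a finite group.

module Matrices (𝔽 : FiniteField) where

  open import Data.Nat as ℕ using (ℕ)
  open import Data.List using (List; []; _∷_)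
  import Data.List as List
  open FiniteField 𝔽

  -- Entries of arbitrary type allow the same formulas to act on field elements and, under the name
  -- `P`, on the polynomials given to the solver.
  record Matrix (A : Set) : Set where
    constructor mat
    field
      m₁₁ m₁₂ m₂₁ m₂₂ : A

  mat-≡ : ∀ {A : Set} {a b c d a′ b′ c′ d′ : A} → a ≡ a′ → b ≡ b′ → c ≡ c′ → d ≡ d′ → mat a b c d ≡ mat a′ b′ c′ d′
  mat-≡ refl refl refl refl = refl

  module MatrixOperations {A : Set} (_+′_ _*′_ : A → A → A) (-′_ : A → A) where

    mul : Matrix A → Matrix A → Matrix A
    mul (mat a b c d) (mat a′ b′ c′ d′) =
      mat ((a *′ a′) +′ (b *′ c′)) ((a *′ b′) +′ (b *′ d′)) ((c *′ a′) +′ (d *′ c′)) ((c *′ b′) +′ (d *′ d′))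

    add : Matrix A → Matrix A → Matrix A
    add (mat a b c d) (mat a′ b′ c′ d′) = mat (a +′ a′) (b +′ b′) (c +′ c′) (d +′ d′)

    neg : Matrix A → Matrix A
    neg (mat a b c d) = mat (-′ a) (-′ b) (-′ c) (-′ d)

    scalar : A → Matrix A → Matrix A
    scalar k (mat a b c d) = mat (k *′ a) (k *′ b) (k *′ c) (k *′ d)

    adj : Matrix A → Matrix A
    adj (mat a b c d) = mat d (-′ b) (-′ c) a

    det : Matrix A → A
    det (mat a b c d) = (a *′ d) +′ (-′ (b *′ c))

    tr : Matrix A → A
    tr (mat a b c d) = a +′ d

    commutator : Matrix A → Matrix A → Matrix A
    commutator X Y = add (mul X Y) (neg (mul Y X))

    act : Matrix A → A × A → A × A
    act (mat a b c d) (x , y) = ((a *′ x) +′ (b *′ y)) , ((c *′ x) +′ (d *′ y))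

    cross : A × A → A × A → A
    cross (x , y) (x′ , y′) = (x *′ y′) +′ (-′ (y *′ x′))

  open MatrixOperations _+_ _*_ (-_) public
  module P {n : ℕ} = MatrixOperations {A = Polynomial n} _:+_ _:*_ :-_

  Pt : Set
  Pt = F × F

  I : Matrix F
  I = mat 1# 0# 0# 1#

  opaque
    det-mul : ∀ X Y → det (mul X Y) ≡ det X * det Y
    det-mul (mat a b c d) (mat e f g h) = solve 8 (λ a b c d e f g h →
      P.det (P.mul (mat a b c d) (mat e f g h)) := P.det (mat a b c d) :* P.det (mat e f g h)) refl a b c d e f g h

  mul-assoc : ∀ X Y Z → mul (mul X Y) Z ≡ mul X (mul Y Z)
  mul-assoc (mat a b c d) (mat e f g h) (mat i j k l) = mat-≡ (entry a b i k) (entry a b j l) (entry c d i k) (entry c d j l)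
    where
    entry : ∀ a b i k → (a * e + b * g) * i + (a * f + b * h) * k ≡ a * (e * i + f * k) + b * (g * i + h * k)
    entry = λ a b i k → solve 8 (λ a b e f g h i k →
      (a :* e :+ b :* g) :* i :+ (a :* f :+ b :* h) :* k := a :* (e :* i :+ f :* k) :+ b :* (g :* i :+ h :* k)) refl a b e f g h i k

  private
    unit₁ : ∀ x y → 1# * x + 0# * y ≡ x
    unit₁ x y = trans (cong₂ _+_ (*-identityˡ x) (zeroˡ y)) (+-identityʳ x)
    unit₂ : ∀ x y → 0# * x + 1# * y ≡ y
    unit₂ x y = trans (cong₂ _+_ (zeroˡ x) (*-identityˡ y)) (+-identityˡ y)
    unit₃ : ∀ x y → x * 1# + y * 0# ≡ x
    unit₃ x y = trans (cong₂ _+_ (*-identityʳ x) (zeroʳ y)) (+-identityʳ x)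
    unit₄ : ∀ x y → x * 0# + y * 1# ≡ y
    unit₄ x y = trans (cong₂ _+_ (zeroʳ x) (*-identityʳ y)) (+-identityˡ y)

  mul-identityˡ : ∀ X → mul I X ≡ X
  mul-identityˡ (mat a b c d) = mat-≡ (unit₁ a c) (unit₁ b d) (unit₂ a c) (unit₂ b d)

  mul-identityʳ : ∀ X → mul X I ≡ X
  mul-identityʳ (mat a b c d) = mat-≡ (unit₃ a b) (unit₄ a b) (unit₃ c d) (unit₄ c d)

  mul-adjʳ : ∀ X → mul X (adj X) ≡ scalar (det X) I
  mul-adjʳ (mat a b c d) = mat-≡
    (trans (solve 4 (λ a b c d → a :* d :+ b :* :- c := a :* d :+ :- (b :* c)) refl a b c d) (sym (*-identityʳ _)))
    (trans (solve 2 (λ a b → a :* :- b :+ b :* a := :0) refl a b) (sym (zeroʳ _)))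
    (trans (solve 2 (λ c d → c :* d :+ d :* :- c := :0) refl c d) (sym (zeroʳ _)))
    (trans (solve 4 (λ a b c d → c :* :- b :+ d :* a := a :* d :+ :- (b :* c)) refl a b c d) (sym (*-identityʳ _)))

  mul-adjˡ : ∀ X → mul (adj X) X ≡ scalar (det X) I
  mul-adjˡ (mat a b c d) = mat-≡
    (trans (solve 4 (λ a b c d → d :* a :+ :- b :* c := a :* d :+ :- (b :* c)) refl a b c d) (sym (*-identityʳ _)))
    (trans (solve 2 (λ b d → d :* b :+ :- b :* d := :0) refl b d) (sym (zeroʳ _)))
    (trans (solve 2 (λ a c → :- c :* a :+ a :* c := :0) refl a c) (sym (zeroʳ _)))
    (trans (solve 4 (λ a b c d → :- c :* b :+ a :* d := a :* d :+ :- (b :* c)) refl a b c d) (sym (*-identityʳ _)))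

  opaque
    det-adj : ∀ X → det (adj X) ≡ det X
    det-adj (mat a b c d) = solve 4 (λ a b c d → P.det (P.adj (mat a b c d)) := P.det (mat a b c d)) refl a b c d

    det-I : det I ≡ 1#
    det-I = trans (cong₂ _+_ (*-identityʳ 1#) (cong -_ (zeroʳ 0#))) (trans (+-comm 1# (- 0#)) (trans (cong (_+ 1#) -0≡0) (+-identityˡ 1#)))
      where
      -0≡0 : - 0# ≡ 0#
      -0≡0 = trans (sym (+-identityˡ (- 0#))) (-‿inverseʳ 0#)

  scalar-1 : ∀ {k} X → k ≡ 1# → scalar k X ≡ X
  scalar-1 (mat a b c d) refl = mat-≡ (*-identityˡ a) (*-identityˡ b) (*-identityˡ c) (*-identityˡ d)

  -- The determinant equation is irrelevant, so elements are equal as soon as their matrices are;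
  -- `det≡1` recovers the equation because it is decidable.
  record SL₂ : Set where
    constructor ⟨_⟩
    field
      matrix : Matrix F
      .{det-1} : det matrix ≡ 1#

  open SL₂ public

  det≡1 : ∀ g → det (matrix g) ≡ 1#
  det≡1 (⟨ X ⟩ {e}) = recompute (det X ≟ 1#) e

  SL₂-≡ : ∀ {g h} → matrix g ≡ matrix h → g ≡ h
  SL₂-≡ refl = refl

  infixl 7 _∙_
  _∙_ : SL₂ → SL₂ → SL₂
  ⟨ X ⟩ {e} ∙ ⟨ Y ⟩ {f} = ⟨ mul X Y ⟩ {trans (det-mul X Y) (trans (cong₂ _*_ e f) (*-identityˡ 1#))}

  ε : SL₂
  ε = ⟨ I ⟩ {det-I}

  infix 9 _⁻¹
  _⁻¹ : SL₂ → SL₂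
  ⟨ X ⟩ {e} ⁻¹ = ⟨ adj X ⟩ {trans (det-adj X) e}

  isGroup : IsGroup _≡_ _∙_ ε _⁻¹
  isGroup = record
    { isMonoid = record
      { isSemigroup = record
        { isMagma = record { isEquivalence = isEquivalence ; ∙-cong = cong₂ _∙_ }
        ; assoc = λ g h k → SL₂-≡ (mul-assoc (matrix g) (matrix h) (matrix k)) }
      ; identity = (λ g → SL₂-≡ (mul-identityˡ (matrix g))) , (λ g → SL₂-≡ (mul-identityʳ (matrix g))) }
    ; inverse = (λ g → SL₂-≡ (trans (mul-adjˡ (matrix g)) (scalar-1 I (det≡1 g))))
              , (λ g → SL₂-≡ (trans (mul-adjʳ (matrix g)) (scalar-1 I (det≡1 g))))
    ; ⁻¹-cong = cong _⁻¹ }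

  private
    toTuple : Matrix F → (F × F) × (F × F)
    toTuple (mat a b c d) = (a , b) , (c , d)

    fromTuple : (F × F) × (F × F) → Matrix F
    fromTuple ((a , b) , (c , d)) = mat a b c d

    F×F : Finite (F × F)
    F×F = ×-finite finite-F finite-F

  matrix-finite : Finite (Matrix F)
  matrix-finite = record
    { elems = List.map fromTuple (elems {{T}})
    ; _≟_ = ≟ᴹ
    ; once = λ X → trans (sumL-map fromTuple (elems {{T}}) _) (trans
        (sumL-cong (elems {{T}}) λ t → ⟦⟧-cong (≟ᴹ (fromTuple t) X) (Finite._≟_ T t (toTuple X)) (cong toTuple) (cong fromTuple))
        (Finite.once T (toTuple X))) }
    where
    T : Finite ((F × F) × (F × F))
    T = ×-finite F×F F×F
    ≟ᴹ : DecidableEquality (Matrix F)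
    ≟ᴹ X Y = map′ (cong fromTuple) (cong toTuple) (Finite._≟_ T (toTuple X) (toTuple Y))

  private
    lift : Matrix F → List SL₂
    lift X with det X ≟ 1#
    ... | yes e = ⟨ X ⟩ {e} ∷ []
    ... | no _ = []

    sumL-lift : ∀ X (f : Matrix F → ℕ) → sumL (lift X) (f ∘ matrix) ≡ ⟦ det X ≟ 1# ⟧ ℕ.* f X
    sumL-lift X f with det X ≟ 1#
    ... | yes e = trans (+-identityʳ′ (f X)) (sym (trans (cong (ℕ._* f X) (⟦⟧-yes (yes e) e)) (+-identityʳ′ (f X))))
      where open import Data.Nat.Properties using () renaming (+-identityʳ to +-identityʳ′)
    ... | no n = sym (cong (ℕ._* f X) (⟦⟧-no (no n) n))

  SL₂-elems : List SL₂
  SL₂-elems = List.concatMap lift (elems {{matrix-finite}})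

  sumL-SL₂ : ∀ (f : Matrix F → ℕ) → sumL SL₂-elems (f ∘ matrix) ≡ sumL (elems {{matrix-finite}}) (λ X → ⟦ det X ≟ 1# ⟧ ℕ.* f X)
  sumL-SL₂ f = trans (sumL-concatMap lift (elems {{matrix-finite}}) _) (sumL-cong (elems {{matrix-finite}}) λ X → sumL-lift X f)

  SL₂-finite : Finite SL₂
  SL₂-finite = record
    { elems = SL₂-elems
    ; _≟_ = ≟ᴳ
    ; once = λ g → begin
        sumL SL₂-elems (λ h → ⟦ ≟ᴳ h g ⟧)
          ≡⟨ sumL-cong SL₂-elems (λ h → ⟦⟧-cong (≟ᴳ h g) (matrix h ≟ᴹ matrix g) (cong matrix) SL₂-≡) ⟩
        sumL SL₂-elems (λ h → ⟦ matrix h ≟ᴹ matrix g ⟧)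
          ≡⟨ sumL-SL₂ (λ X → ⟦ X ≟ᴹ matrix g ⟧) ⟩
        sumL (elems {{matrix-finite}}) (λ X → ⟦ det X ≟ 1# ⟧ ℕ.* ⟦ X ≟ᴹ matrix g ⟧)
          ≡⟨ sumL-cong (elems {{matrix-finite}}) (λ X → trans (sym (⟦⟧-× (det X ≟ 1#) (X ≟ᴹ matrix g)))
               (⟦⟧-cong (det X ≟ 1# ×? X ≟ᴹ matrix g) (X ≟ᴹ matrix g) proj₂ (λ { refl → det≡1 g , refl }))) ⟩
        sumL (elems {{matrix-finite}}) (λ X → ⟦ X ≟ᴹ matrix g ⟧)
          ≡⟨ Finite.once matrix-finite (matrix g) ⟩
        1 ∎ }
    where
    open ≡-Reasoning
    open Finite matrix-finite using () renaming (_≟_ to _≟ᴹ_)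
    ≟ᴳ : DecidableEquality SL₂
    ≟ᴳ g h = map′ SL₂-≡ (cong matrix) (matrix g ≟ᴹ matrix h)

-- Centralisers in SL₂.

module Centralizers (𝔽 : FiniteField) where

  open import Data.Fin.Patterns using (0F; 1F; 2F)
  import Data.Fin.Properties as Finₚ
  open FiniteField 𝔽
  open Matrices 𝔽
  open Matrix

  instance
    finite-SL₂ : Finite SL₂
    finite-SL₂ = SL₂-finite

  open GroupSums SL₂ SL₂-finite _∙_ ε _⁻¹ isGroup public

  Commute : SL₂ → SL₂ → Set
  Commute g h = g ∙ h ≡ h ∙ g

  Commute? : ∀ g h → Dec (Commute g h)
  Commute? g h = g ∙ h ≟ h ∙ g

  conj : SL₂ → SL₂ → SL₂
  conj g a = (g ∙ a) ∙ g ⁻¹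

  -- The coordinates of X modulo scalar matrices; their cross product is the commutator.
  offScalar : Matrix F → Fin 3 → F
  offScalar (mat a b c d) 0F = b
  offScalar (mat a b c d) 1F = c
  offScalar (mat a b c d) 2F = a + - d

  Parallel : (u v : Fin 3 → F) → Set
  Parallel u v = ∀ i j → u i * v j ≡ u j * v i

  Parallel-trans : ∀ {u v w} i → v i ≢ 0# → Parallel u v → Parallel v w → Parallel u w
  Parallel-trans {u} {v} {w} i vᵢ≢0 uv vw j k = *-cancelˡ (v i) vᵢ≢0 (begin
    v i * (u j * w k)   ≡⟨ solve 3 (λ a b c → a :* (b :* c) := b :* a :* c) refl (v i) (u j) (w k) ⟩
    u j * v i * w k     ≡⟨ cong (_* w k) (uv j i) ⟩
    u i * v j * w k     ≡⟨ *-assoc (u i) (v j) (w k) ⟩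
    u i * (v j * w k)   ≡⟨ cong (u i *_) (vw j k) ⟩
    u i * (v k * w j)   ≡⟨ *-assoc (u i) (v k) (w j) ⟨
    u i * v k * w j     ≡⟨ cong (_* w j) (uv i k) ⟩
    u k * v i * w j     ≡⟨ solve 3 (λ a b c → b :* a :* c := a :* (b :* c)) refl (v i) (u k) (w j) ⟩
    v i * (u k * w j)   ∎)
    where open ≡-Reasoning

  Parallel⇒multiple : ∀ {u v} i → v i ≢ 0# → Parallel u v → ∃ λ y → ∀ j → u j ≡ y * v j
  Parallel⇒multiple {u} {v} i vᵢ≢0 uv with inverse (v i) vᵢ≢0
  ... | w , e = u i * w , λ j → *-cancelˡ (v i) vᵢ≢0 (begin
    v i * u j             ≡⟨ trans (*-comm (v i) (u j)) (uv j i) ⟩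
    u i * v j             ≡⟨ *-identityˡ (u i * v j) ⟨
    1# * (u i * v j)      ≡⟨ cong (_* (u i * v j)) e ⟨
    v i * w * (u i * v j) ≡⟨ solve 4 (λ a b c d → a :* b :* (c :* d) := a :* (c :* b :* d)) refl (v i) w (u i) (v j) ⟩
    v i * (u i * w * v j) ∎)
    where open ≡-Reasoning

  mul-comm⇒Parallel : ∀ X Y → mul X Y ≡ mul Y X → Parallel (offScalar X) (offScalar Y)
  mul-comm⇒Parallel (mat a b c d) (mat e f g h) q = λ where
      0F 0F → refl
      1F 1F → refl
      2F 2F → refl
      0F 1F → p₀₁
      1F 0F → sym p₀₁
      0F 2F → p₀₂
      2F 0F → sym p₀₂
      1F 2F → p₁₂
      2F 1F → sym p₁₂
    where
    p₀₁ : b * g ≡ c * f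
    p₀₁ = by (cong m₁₁ q) (solve 6 (λ a b c e f g → b :* g :+ (e :* a :+ f :* c) := c :* f :+ (a :* e :+ b :* g)) refl a b c e f g)
    p₀₂ : b * (e + - h) ≡ (a + - d) * f
    p₀₂ = by (sym (cong m₁₂ q)) (solve 6 (λ a b d e f h → b :* (e :+ :- h) :+ (a :* f :+ b :* h) := (a :+ :- d) :* f :+ (e :* b :+ f :* d)) refl a b d e f h)
    p₁₂ : c * (e + - h) ≡ (a + - d) * g
    p₁₂ = by (cong m₂₁ q) (solve 6 (λ a c d e g h → c :* (e :+ :- h) :+ (g :* a :+ h :* c) := (a :+ :- d) :* g :+ (c :* e :+ d :* g)) refl a c d e g h)

  Parallel⇒mul-comm : ∀ X Y → Parallel (offScalar X) (offScalar Y) → mul X Y ≡ mul Y X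
  Parallel⇒mul-comm (mat a b c d) (mat e f g h) p = mat-≡
    (by (p 0F 1F) (solve 6 (λ a b c e f g → a :* e :+ b :* g :+ c :* f := e :* a :+ f :* c :+ b :* g) refl a b c e f g))
    (by (sym (p 0F 2F)) (solve 6 (λ a b d e f h → a :* f :+ b :* h :+ b :* (e :+ :- h) := e :* b :+ f :* d :+ (a :+ :- d) :* f) refl a b d e f h))
    (by (p 1F 2F) (solve 6 (λ a c d e g h → c :* e :+ d :* g :+ (a :+ :- d) :* g := g :* a :+ h :* c :+ c :* (e :+ :- h)) refl a c d e g h))
    (by (sym (p 0F 1F)) (solve 6 (λ b c d f g h → c :* f :+ d :* h :+ b :* g := g :* b :+ h :* d :+ c :* f) refl b c d f g h))

  Commute⇒Parallel : ∀ g h → Commute g h → Parallel (offScalar (matrix g)) (offScalar (matrix h))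
  Commute⇒Parallel g h e = mul-comm⇒Parallel (matrix g) (matrix h) (cong matrix e)

  Central : SL₂ → Set
  Central g = ∀ i → offScalar (matrix g) i ≡ 0#

  Central? : ∀ g → Dec (Central g)
  Central? g = Finₚ.all? λ i → offScalar (matrix g) i ≟ 0#

  nonCentral⇒∃ : ∀ g → ¬ Central g → ∃ λ i → offScalar (matrix g) i ≢ 0#
  nonCentral⇒∃ g n with Finₚ.any? (λ i → ¬? (offScalar (matrix g) i ≟ 0#))
  ... | yes w = w
  ... | no ¬w = contradiction (λ i → decidable (offScalar (matrix g) i ≟ 0#) λ z → ¬w (i , z)) n
    where
    open import Relation.Nullary.Decidable using () renaming (decidable-stable to decidable)

  Central⇒Commute : ∀ g h → Central g → Commute g h
  Central⇒Commute g h z = SL₂-≡ (Parallel⇒mul-comm (matrix g) (matrix h) λ i j →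
    trans (trans (cong (_* offScalar (matrix h) j) (z i)) (zeroˡ _)) (sym (trans (cong (_* offScalar (matrix h) i) (z j)) (zeroˡ _))))

  -- Modulo scalars, commuting means being proportional in F³, and proportionality to the nonzero
  -- vector of h is transitive.
  Commute-trans : ∀ {g h k} → ¬ Central h → Commute g h → Commute h k → Commute g k
  Commute-trans {g} {h} {k} n p q with nonCentral⇒∃ h n
  ... | i , hᵢ = SL₂-≡ (Parallel⇒mul-comm (matrix g) (matrix k)
    (Parallel-trans i hᵢ (Commute⇒Parallel g h p) (Commute⇒Parallel h k q)))

  affine : F → F → Matrix F → Matrix F
  affine x y (mat a b c d) = mat (x + y * a) (y * b) (y * c) (x + y * d)

  -- Modulo scalars t is a multiple y of a, hence t - y a is a scalar x.
  centralizer-affine : ∀ t a → ¬ Central a → Commute t a → ∃₂ λ x y → matrix t ≡ affine x y (matrix a)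
  centralizer-affine t@(⟨ mat p q r s ⟩) a@(⟨ mat e f g h ⟩) n c with nonCentral⇒∃ a n
  ... | i , aᵢ with Parallel⇒multiple {offScalar (matrix t)} i aᵢ (Commute⇒Parallel t a c)
  ... | y , m = p + - (y * e) , y , mat-≡
    (solve 3 (λ p y e → p := p :+ :- (y :* e) :+ y :* e) refl p y e) (m 0F) (m 1F)
    (by (sym (m 2F)) (solve 5 (λ p s y e h → s :+ (p :+ :- s) := p :+ :- (y :* e) :+ y :* h :+ y :* (e :+ :- h)) refl p s y e h))

  det-affine : ∀ x y A → det (affine x y A) ≡ x * x + x * y * tr A + y * y * det A
  det-affine x y (mat a b c d) = solve 6 (λ x y a b c d →
    P.det (mat (x :+ y :* a) (y :* b) (y :* c) (x :+ y :* d)) := x :* x :+ x :* y :* (a :+ d) :+ y :* y :* (a :* d :+ :- (b :* c))) refl x y a b c d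

  norm-affine : ∀ x y t a → matrix t ≡ affine x y (matrix a) → x * x + x * y * tr (matrix a) + y * y ≡ 1#
  norm-affine x y t a e = trans (cong (x * x + x * y * tr (matrix a) +_) (sym (trans (cong (y * y *_) (det≡1 a)) (*-identityʳ (y * y)))))
    (trans (sym (det-affine x y (matrix a))) (trans (cong det (sym e)) (det≡1 t)))

  opaque
    det-neg : ∀ X → det (neg X) ≡ det X
    det-neg (mat a b c d) = solve 4 (λ a b c d → P.det (P.neg (mat a b c d)) := P.det (mat a b c d)) refl a b c d

  negate : SL₂ → SL₂
  negate (⟨ X ⟩ {e}) = ⟨ neg X ⟩ {trans (det-neg X) e}

  Central⇒±ε : ∀ g → Central g → g ≡ ε ⊎ g ≡ negate ε
  Central⇒±ε g@(⟨ mat a b c d ⟩) z = cases (zero-product {a + - 1#} {a + 1#} q)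
    where
    a≡d : a ≡ d
    a≡d = difference≡0 (z 2F)
    a² : a * a ≡ 1#
    a² = by (det≡1 g ⊞ a ⊡ a≡d ⊞ trans (c ⊡ z 0F) (zeroʳ c))
      (solve 5 (λ a b c d o → a :* a :+ (o :+ a :* d :+ :0) := o :+ (a :* d :+ :- (b :* c) :+ a :* a :+ c :* b)) refl a b c d 1#)
    q : (a + - 1#) * (a + 1#) ≡ 0#
    q = by (a² ⊞ sym (*-identityˡ 1#)) (solve 2 (λ a o → (a :+ :- o) :* (a :+ o) :+ (o :+ o :* o) := :0 :+ (a :* a :+ o)) refl a 1#)
    -0≡0 : - 0# ≡ 0#
    -0≡0 = trans (sym (+-identityˡ (- 0#))) (-‿inverseʳ 0#)
    cases : a + - 1# ≡ 0# ⊎ a + 1# ≡ 0# → g ≡ ε ⊎ g ≡ negate ε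
    cases (inj₁ e) = inj₁ (SL₂-≡ (mat-≡ (difference≡0 e) (z 0F) (z 1F) (trans (sym a≡d) (difference≡0 e))))
    cases (inj₂ e) = inj₂ (SL₂-≡ (mat-≡ a≡-1 (trans (z 0F) (sym -0≡0)) (trans (z 1F) (sym -0≡0)) (trans (sym a≡d) a≡-1)))
      where
      a≡-1 : a ≡ - 1#
      a≡-1 = by e (solve 2 (λ a o → a :+ :0 := :- o :+ (a :+ o)) refl a 1#)

  negate-∙ : ∀ g h → negate g ∙ h ≡ negate (g ∙ h)
  negate-∙ (⟨ mat a b c d ⟩) (⟨ mat e f g h ⟩) = SL₂-≡ (mat-≡ (s a b e g) (s a b f h) (s c d e g) (s c d f h))
    where
    s : ∀ a b e g → - a * e + - b * g ≡ - (a * e + b * g)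
    s = solve 4 (λ a b e g → :- a :* e :+ :- b :* g := :- (a :* e :+ b :* g)) refl

  ∙⁻¹-central : ∀ g h → Central (g ∙ h ⁻¹) → g ≡ h ⊎ g ≡ negate h
  ∙⁻¹-central g h z with Central⇒±ε (g ∙ h ⁻¹) z
  ... | inj₁ e = inj₁ (trans (sym (yx⁻¹∙x h g)) (trans (cong (_∙ h) e) (identityˡ h)))
  ... | inj₂ e = inj₂ (trans (sym (yx⁻¹∙x h g)) (trans (cong (_∙ h) e) (trans (negate-∙ ε h) (cong negate (identityˡ h)))))

  -- For given y the norm equation is quadratic in x, with roots x and -(x + yτ), where τ is the
  -- trace of a. Since t⁻¹ = x + yτ - y a, the second root belongs to -t⁻¹; the opposite sign of y
  -- gives -t and t⁻¹.
  affine-±y : ∀ {x y x′ y′} t t′ a → matrix t ≡ affine x y (matrix a) → matrix t′ ≡ affine x′ y′ (matrix a) →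
    y′ * y′ ≡ y * y → t′ ≡ t ⊎ t′ ≡ negate t ⊎ t′ ≡ t ⁻¹ ⊎ t′ ≡ negate (t ⁻¹)
  affine-±y {x} {y} {x′} {y′} t@(⟨ .(affine x y (matrix a)) ⟩) t′@(⟨ .(affine x′ y′ (matrix a)) ⟩) a@(⟨ mat p q r s ⟩) refl refl y² =
    cases (zero-product {y′ + - y} {y′ + y} (by y² (solve 2 (λ y z → (z :+ :- y) :* (z :+ y) :+ y :* y := :0 :+ z :* z) refl y y′)))
    where
    τ = p + s
    N : x′ * x′ + x′ * y′ * τ + y′ * y′ ≡ x * x + x * y * τ + y * y
    N = trans (norm-affine x′ y′ t′ a refl) (sym (norm-affine x y t a refl))
    cases : y′ + - y ≡ 0# ⊎ y′ + y ≡ 0# → t′ ≡ t ⊎ t′ ≡ negate t ⊎ t′ ≡ t ⁻¹ ⊎ t′ ≡ negate (t ⁻¹)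
    cases (inj₁ e) = sub (zero-product {x′ + - x} {x′ + x + y * τ} (by (N ⊞ sym y² ⊞ (x′ * τ) ⊡ y≡)
        (solve 5 (λ x y z w t → (z :+ :- x) :* (z :+ x :+ y :* t) :+ (x :* x :+ x :* y :* t :+ y :* y :+ w :* w :+ z :* t :* w) :=
           :0 :+ (z :* z :+ z :* w :* t :+ w :* w :+ y :* y :+ z :* t :* y)) refl x y x′ y′ τ)))
      where
      y≡ : y ≡ y′
      y≡ = sym (difference≡0 e)
      sub : x′ + - x ≡ 0# ⊎ x′ + x + y * τ ≡ 0# → t′ ≡ t ⊎ t′ ≡ negate t ⊎ t′ ≡ t ⁻¹ ⊎ t′ ≡ negate (t ⁻¹)
      sub (inj₁ f) = inj₁ (SL₂-≡ (cong₂ (λ u v → affine u v (matrix a)) (difference≡0 f) (sym y≡)))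
      sub (inj₂ f) = inj₂ (inj₂ (inj₂ (SL₂-≡ (mat-≡
        (by (f ⊞ p ⊡ sym y≡) (solve 6 (λ x y z w p s → z :+ w :* p :+ (:0 :+ p :* y) := :- (x :+ y :* s) :+ (z :+ x :+ y :* (p :+ s) :+ p :* w)) refl x y x′ y′ p s))
        (by (q ⊡ sym y≡) (solve 3 (λ q y w → w :* q :+ q :* y := :- :- (y :* q) :+ q :* w) refl q y y′))
        (by (r ⊡ sym y≡) (solve 3 (λ q y w → w :* q :+ q :* y := :- :- (y :* q) :+ q :* w) refl r y y′))
        (by (f ⊞ s ⊡ sym y≡) (solve 6 (λ x y z w p s → z :+ w :* s :+ (:0 :+ s :* y) := :- (x :+ y :* p) :+ (z :+ x :+ y :* (p :+ s) :+ s :* w)) refl x y x′ y′ p s))))))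
    cases (inj₂ e) = sub (zero-product {x′ + x} {x′ + - (x + y * τ)} (by (N ⊞ sym y² ⊞ (x′ * τ) ⊡ sym e)
        (solve 5 (λ x y z w t → (z :+ x) :* (z :+ :- (x :+ y :* t)) :+ (x :* x :+ x :* y :* t :+ y :* y :+ w :* w :+ z :* t :* (w :+ y)) :=
           :0 :+ (z :* z :+ z :* w :* t :+ w :* w :+ y :* y :+ z :* t :* :0)) refl x y x′ y′ τ)))
      where
      sub : x′ + x ≡ 0# ⊎ x′ + - (x + y * τ) ≡ 0# → t′ ≡ t ⊎ t′ ≡ negate t ⊎ t′ ≡ t ⁻¹ ⊎ t′ ≡ negate (t ⁻¹)
      sub (inj₁ f) = inj₂ (inj₁ (SL₂-≡ (mat-≡ (diag p) (off q) (off r) (diag s))))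
        where
        diag : ∀ p → x′ + y′ * p ≡ - (x + y * p)
        diag p = by (f ⊞ p ⊡ e) (solve 5 (λ x y z w p → z :+ w :* p :+ (:0 :+ p :* :0) := :- (x :+ y :* p) :+ (z :+ x :+ p :* (w :+ y))) refl x y x′ y′ p)
        off : ∀ q → y′ * q ≡ - (y * q)
        off q = by (q ⊡ e) (solve 3 (λ q y w → w :* q :+ q :* :0 := :- (y :* q) :+ q :* (w :+ y)) refl q y y′)
      sub (inj₂ f) = inj₂ (inj₂ (inj₁ (SL₂-≡ (mat-≡
          (by (f ⊞ p ⊡ e) (solve 6 (λ x y z w p s → z :+ w :* p :+ (:0 :+ p :* :0) := x :+ y :* s :+ (z :+ :- (x :+ y :* (p :+ s)) :+ p :* (w :+ y))) refl x y x′ y′ p s))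
          (off q) (off r)
          (by (f ⊞ s ⊡ e) (solve 6 (λ x y z w p s → z :+ w :* s :+ (:0 :+ s :* :0) := x :+ y :* p :+ (z :+ :- (x :+ y :* (p :+ s)) :+ s :* (w :+ y))) refl x y x′ y′ p s))))))
        where
        off : ∀ q → y′ * q ≡ - (y * q)
        off q = by (q ⊡ e) (solve 3 (λ q y w → w :* q :+ q :* :0 := :- (y :* q) :+ q :* (w :+ y)) refl q y y′)

-- Conjugation, the centre and traces.

module Conjugation (𝔽 : FiniteField) where

  open import Data.Fin.Patterns using (0F; 1F; 2F)
  open FiniteField 𝔽
  open Matrices 𝔽
  open Matrix
  open Centralizers 𝔽

  conj-ε : ∀ a → conj ε a ≡ a
  conj-ε a = trans (cong₂ _∙_ (identityˡ a) ε⁻¹≈ε) (identityʳ a)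
    where open import Algebra.Properties.Group group using (ε⁻¹≈ε)

  conj-∙ : ∀ g h a → conj (g ∙ h) a ≡ conj g (conj h a)
  conj-∙ g h a = begin
    ((g ∙ h) ∙ a) ∙ (g ∙ h) ⁻¹      ≡⟨ cong₂ _∙_ (assoc g h a) (⁻¹-anti-homo-∙ g h) ⟩
    (g ∙ (h ∙ a)) ∙ (h ⁻¹ ∙ g ⁻¹)   ≡⟨ assoc (g ∙ (h ∙ a)) (h ⁻¹) (g ⁻¹) ⟨
    ((g ∙ (h ∙ a)) ∙ h ⁻¹) ∙ g ⁻¹   ≡⟨ cong (_∙ g ⁻¹) (assoc g (h ∙ a) (h ⁻¹)) ⟩
    (g ∙ ((h ∙ a) ∙ h ⁻¹)) ∙ g ⁻¹   ∎
    where open ≡-Reasoning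

  conj-homo : ∀ g a b → conj g (a ∙ b) ≡ conj g a ∙ conj g b
  conj-homo g a b = begin
    (g ∙ (a ∙ b)) ∙ g ⁻¹             ≡⟨ cong (_∙ g ⁻¹) (assoc g a b) ⟨
    ((g ∙ a) ∙ b) ∙ g ⁻¹             ≡⟨ cong (λ w → (w ∙ b) ∙ g ⁻¹) (yx⁻¹∙x g (g ∙ a)) ⟨
    ((((g ∙ a) ∙ g ⁻¹) ∙ g) ∙ b) ∙ g ⁻¹ ≡⟨ cong (_∙ g ⁻¹) (assoc (conj g a) g b) ⟩
    (conj g a ∙ (g ∙ b)) ∙ g ⁻¹      ≡⟨ assoc (conj g a) (g ∙ b) (g ⁻¹) ⟩
    conj g a ∙ conj g b              ∎
    where open ≡-Reasoning

  conj-inverse : ∀ g a → conj (g ⁻¹) (conj g a) ≡ a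
  conj-inverse g a = trans (sym (conj-∙ (g ⁻¹) g a)) (trans (cong (λ w → conj w a) (inverseˡ g)) (conj-ε a))

  conj-inverse′ : ∀ g a → conj g (conj (g ⁻¹) a) ≡ a
  conj-inverse′ g a = trans (sym (conj-∙ g (g ⁻¹) a)) (trans (cong (λ w → conj w a) (inverseʳ g)) (conj-ε a))

  conj-⁻¹ : ∀ g a → conj g (a ⁻¹) ≡ conj g a ⁻¹
  conj-⁻¹ g a = inverseˡ-unique (conj g (a ⁻¹)) (conj g a)
    (trans (sym (conj-homo g (a ⁻¹) a)) (trans (cong (conj g) (inverseˡ a)) (trans (cong (_∙ g ⁻¹) (identityʳ g)) (inverseʳ g))))
    where open import Algebra.Properties.Group group using (inverseˡ-unique)

  Commute-conj : ∀ g {a b} → Commute a b → Commute (conj g a) (conj g b)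
  Commute-conj g {a} {b} e = trans (sym (conj-homo g a b)) (trans (cong (conj g) e) (conj-homo g b a))

  Commute-∙ : ∀ {g h a} → Commute g a → Commute h a → Commute (g ∙ h) a
  Commute-∙ {g} {h} {a} p q = begin
    (g ∙ h) ∙ a ≡⟨ assoc g h a ⟩
    g ∙ (h ∙ a) ≡⟨ cong (g ∙_) q ⟩
    g ∙ (a ∙ h) ≡⟨ assoc g a h ⟨
    (g ∙ a) ∙ h ≡⟨ cong (_∙ h) p ⟩
    (a ∙ g) ∙ h ≡⟨ assoc a g h ⟩
    a ∙ (g ∙ h) ∎
    where open ≡-Reasoning

  Commute-⁻¹ : ∀ {g a} → Commute g a → Commute (g ⁻¹) a
  Commute-⁻¹ {g} {a} p = begin
    g ⁻¹ ∙ a                 ≡⟨ cong (g ⁻¹ ∙_) (yx∙x⁻¹ g a) ⟨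
    g ⁻¹ ∙ ((a ∙ g) ∙ g ⁻¹)  ≡⟨ cong (λ w → g ⁻¹ ∙ (w ∙ g ⁻¹)) p ⟨
    g ⁻¹ ∙ ((g ∙ a) ∙ g ⁻¹)  ≡⟨ cong (g ⁻¹ ∙_) (assoc g a (g ⁻¹)) ⟩
    g ⁻¹ ∙ (g ∙ (a ∙ g ⁻¹))  ≡⟨ x⁻¹∙xy g (a ∙ g ⁻¹) ⟩
    a ∙ g ⁻¹                 ∎
    where open ≡-Reasoning

  upper lower : SL₂
  upper = ⟨ mat 1# 1# 0# 1# ⟩ {det-unipotent}
    where
    opaque
      det-unipotent : det (mat 1# 1# 0# 1#) ≡ 1#
      det-unipotent = trans (solve 1 (λ o → o :* o :+ :- (o :* :0) := o :* o) refl 1#) (*-identityˡ 1#)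
  lower = ⟨ mat 1# 0# 1# 1# ⟩ {det-unipotent}
    where
    opaque
      det-unipotent : det (mat 1# 0# 1# 1#) ≡ 1#
      det-unipotent = trans (solve 1 (λ o → o :* o :+ :- (:0 :* o) := o :* o) refl 1#) (*-identityˡ 1#)

  private
    1*-cancel : ∀ {x y} → 1# * x ≡ 1# * y → x ≡ y
    1*-cancel {x} {y} e = trans (sym (*-identityˡ x)) (trans e (*-identityˡ y))

  Commute-generators⇒Central : ∀ g → Commute g upper → Commute g lower → Central g
  Commute-generators⇒Central g@(⟨ mat a b c d ⟩) p q = λ where
    0F → 1*-cancel (by (cong m₁₁ (cong matrix q)) (solve 4 (λ a b c o → o :* b :+ (o :* a :+ :0 :* c) := o :* :0 :+ (a :* o :+ b :* o)) refl a b c 1#))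
    1F → 1*-cancel (by (sym (cong m₁₁ (cong matrix p))) (solve 4 (λ a b c o → o :* c :+ (a :* o :+ b :* :0) := o :* :0 :+ (o :* a :+ o :* c)) refl a b c 1#))
    2F → 1*-cancel (by (cong m₁₂ (cong matrix p)) (solve 4 (λ a b d o → o :* (a :+ :- d) :+ (o :* b :+ o :* d) := o :* :0 :+ (a :* o :+ b :* o)) refl a b d 1#))

  Central-conj : ∀ g a → Central (conj g a) → Central a
  Central-conj g a z = Commute-generators⇒Central a (f upper) (f lower)
    where
    f : ∀ x → Commute a x
    f x = subst₂ Commute (conj-inverse g a) (conj-inverse g x) (Commute-conj (g ⁻¹) {conj g a} {conj g x} (Central⇒Commute (conj g a) (conj g x) z))

  trace : SL₂ → F
  trace g = tr (matrix g)

  tr-mul-comm : ∀ X Y → tr (mul X Y) ≡ tr (mul Y X)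
  tr-mul-comm (mat a b c d) (mat e f g h) = solve 8 (λ a b c d e f g h →
    P.tr (P.mul (mat a b c d) (mat e f g h)) := P.tr (P.mul (mat e f g h) (mat a b c d))) refl a b c d e f g h

  trace-conj : ∀ g a → trace (conj g a) ≡ trace a
  trace-conj g a = trans (tr-mul-comm (matrix (g ∙ a)) (matrix (g ⁻¹))) (cong trace (x⁻¹∙xy g a))

  tr-affine : ∀ x y A → tr (affine x y A) ≡ x + x + y * tr A
  tr-affine x y (mat a b c d) = solve 4 (λ x y a d → x :+ y :* a :+ (x :+ y :* d) := x :+ x :+ y :* (a :+ d)) refl x y a d

  -- Trace ±2 is the case of a repeated eigenvalue. The centraliser of a regular element is a torus,
  -- split or not, on which the trace separates elements up to inversion.
  Regular : SL₂ → Set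
  Regular a = trace a * trace a ≢ (1# + 1#) * (1# + 1#)

  -- Completing the square, 4 = τ(s)² + (4 - τ(a)²) y² for s = x + y a of determinant one.
  same-trace : ∀ s s′ a → Regular a → ¬ Central a → Commute s a → Commute s′ a → trace s ≡ trace s′ → s′ ≡ s ⊎ s′ ≡ s ⁻¹
  same-trace s s′ a reg n c c′ e = helper (centralizer-affine s a n c) (centralizer-affine s′ a n c′)
    where
    τ = trace a
    helper : (∃₂ λ x y → matrix s ≡ affine x y (matrix a)) → (∃₂ λ x y → matrix s′ ≡ affine x y (matrix a)) → s′ ≡ s ⊎ s′ ≡ s ⁻¹
    helper (x , y , f) (x′ , y′ , f′) = cases (affine-±y s s′ a f f′ y²)
      where
      four = (1# + 1#) * (1# + 1#)
      T : x + x + y * τ ≡ x′ + x′ + y′ * τ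
      T = trans (sym (tr-affine x y (matrix a))) (trans (trans (cong tr (sym f)) (trans e (cong tr f′))) (tr-affine x′ y′ (matrix a)))
      N : x * x + x * y * τ + y * y ≡ x′ * x′ + x′ * y′ * τ + y′ * y′
      N = trans (norm-affine x y s a f) (sym (norm-affine x′ y′ s′ a f′))
      4-τ² : four + - (τ * τ) ≢ 0#
      4-τ² z = reg (sym (difference≡0 z))
      k : ∀ z → (1# + 1#) * (1# + 1#) * z ≡ z + z + z + z
      k z = trans (solve 2 (λ o z → (o :+ o) :* (o :+ o) :* z := o :* (o :* z) :+ o :* (o :* z) :+ o :* (o :* z) :+ o :* (o :* z)) refl 1# z)
        (cong (λ w → w + w + w + w) (trans (*-identityˡ (1# * z)) (*-identityˡ z)))
      y² : y′ * y′ ≡ y * y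
      y² = sym (*-cancelˡ (four + - (τ * τ)) 4-τ² (by
        (k (y * y) ⊞ sym (k (y′ * y′)) ⊞ (N ⊞ N ⊞ N ⊞ N) ⊞ (x + x + y * τ) ⊡ sym T ⊞ (x′ + x′ + y′ * τ) ⊡ sym T)
        (solve 6 (λ x y z w t q →
          (q :+ :- (t :* t)) :* (y :* y) :+ (y :* y :+ y :* y :+ y :* y :+ y :* y :+ q :* (w :* w)
            :+ ((z :* z :+ z :* w :* t :+ w :* w) :+ (z :* z :+ z :* w :* t :+ w :* w) :+ (z :* z :+ z :* w :* t :+ w :* w) :+ (z :* z :+ z :* w :* t :+ w :* w))
            :+ (x :+ x :+ y :* t) :* (x :+ x :+ y :* t) :+ (z :+ z :+ w :* t) :* (x :+ x :+ y :* t))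
          := (q :+ :- (t :* t)) :* (w :* w) :+ (q :* (y :* y) :+ (w :* w :+ w :* w :+ w :* w :+ w :* w)
            :+ ((x :* x :+ x :* y :* t :+ y :* y) :+ (x :* x :+ x :* y :* t :+ y :* y) :+ (x :* x :+ x :* y :* t :+ y :* y) :+ (x :* x :+ x :* y :* t :+ y :* y))
            :+ (x :+ x :+ y :* t) :* (z :+ z :+ w :* t) :+ (z :+ z :+ w :* t) :* (z :+ z :+ w :* t))) refl x y x′ y′ τ four)))
      tr-negate : ∀ g → trace (negate g) ≡ - trace g
      tr-negate (⟨ mat a b c d ⟩) = solve 2 (λ a d → :- a :+ :- d := :- (a :+ d)) refl a d
      tr-⁻¹ : ∀ g → trace (g ⁻¹) ≡ trace g
      tr-⁻¹ (⟨ mat a b c d ⟩) = +-comm d a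
      -- By Cayley-Hamilton g + g⁻¹ is the trace times the identity. This disposes of the two
      -- candidates with a minus sign: equal traces force their trace to vanish.
      zero-trace : ∀ g → trace g ≡ 0# → negate g ≡ g ⁻¹
      zero-trace g@(⟨ mat a b c d ⟩) z = SL₂-≡ (mat-≡ (by (sym z) (solve 2 (λ a d → :- a :+ (a :+ d) := d :+ :0) refl a d)) refl refl
        (by (sym z) (solve 2 (λ a d → :- d :+ (a :+ d) := a :+ :0) refl a d)))
      negated : trace s ≡ - trace s → trace s ≡ 0#
      negated z = double-cancel (by z (solve 1 (λ t → t :+ t :+ :- t := :0 :+ :0 :+ t) refl (trace s)))
      cases : s′ ≡ s ⊎ s′ ≡ negate s ⊎ s′ ≡ s ⁻¹ ⊎ s′ ≡ negate (s ⁻¹) → s′ ≡ s ⊎ s′ ≡ s ⁻¹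
      cases (inj₁ q) = inj₁ q
      cases (inj₂ (inj₁ q)) = inj₂ (trans q (zero-trace s (negated (trans e (trans (cong trace q) (tr-negate s))))))
      cases (inj₂ (inj₂ (inj₁ q))) = inj₂ q
      cases (inj₂ (inj₂ (inj₂ q))) = inj₁ (trans q (trans (zero-trace (s ⁻¹) (trans (tr-⁻¹ s)
        (negated (trans e (trans (cong trace q) (trans (tr-negate (s ⁻¹)) (cong -_ (tr-⁻¹ s)))))))) (⁻¹-involutive s)))

-- Stabilisers of lines, normalisers of centralisers and common eigenvectors.

module Escape (𝔽 : FiniteField) where

  open import Data.Fin.Patterns using (0F; 1F; 2F)
  open FiniteField 𝔽
  open Matrices 𝔽
  open Matrix
  open Centralizers 𝔽
  open Conjugation 𝔽

  instance
    finite-Pt : Finite Pt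
    finite-Pt = ×-finite finite-F finite-F

  0ₚ : Pt
  0ₚ = 0# , 0#

  infixr 8 _▷_
  _▷_ : SL₂ → Pt → Pt
  g ▷ v = act (matrix g) v

  infix 4 _∥_
  _∥_ : Pt → Pt → Set
  v ∥ w = cross v w ≡ 0#

  cross-act : ∀ X v w → cross (act X v) (act X w) ≡ det X * cross v w
  cross-act (mat a b c d) (x , y) (z , w) = solve 8 (λ a b c d x y z w →
    P.cross (P.act (mat a b c d) (x , y)) (P.act (mat a b c d) (z , w)) := P.det (mat a b c d) :* P.cross (x , y) (z , w)) refl a b c d x y z w

  cross-▷ : ∀ g v w → cross (g ▷ v) (g ▷ w) ≡ cross v w
  cross-▷ g v w = trans (cross-act (matrix g) v w) (trans (cong (_* cross v w) (det≡1 g)) (*-identityˡ _))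

  act-mul : ∀ X Y v → act (mul X Y) v ≡ act X (act Y v)
  act-mul (mat a b c d) (mat e f g h) (x , y) = cong₂ _,_ (entry a b) (entry c d)
    where
    entry : ∀ a b → (a * e + b * g) * x + (a * f + b * h) * y ≡ a * (e * x + f * y) + b * (g * x + h * y)
    entry a b = solve 8 (λ a b e f g h x y →
      (a :* e :+ b :* g) :* x :+ (a :* f :+ b :* h) :* y := a :* (e :* x :+ f :* y) :+ b :* (g :* x :+ h :* y)) refl a b e f g h x y

  ∙-▷ : ∀ g h v → (g ∙ h) ▷ v ≡ g ▷ h ▷ v
  ∙-▷ g h v = act-mul (matrix g) (matrix h) v

  ε-▷ : ∀ v → ε ▷ v ≡ v
  ε-▷ (x , y) = cong₂ _,_ (trans (cong₂ _+_ (*-identityˡ x) (zeroˡ y)) (+-identityʳ x)) (trans (cong₂ _+_ (zeroˡ x) (*-identityˡ y)) (+-identityˡ y))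

  ⁻¹-▷ : ∀ g v → g ⁻¹ ▷ g ▷ v ≡ v
  ⁻¹-▷ g v = trans (sym (∙-▷ (g ⁻¹) g v)) (trans (cong (_▷ v) (inverseˡ g)) (ε-▷ v))

  ▷-⁻¹ : ∀ g v → g ▷ g ⁻¹ ▷ v ≡ v
  ▷-⁻¹ g v = trans (sym (∙-▷ g (g ⁻¹) v)) (trans (cong (_▷ v) (inverseʳ g)) (ε-▷ v))

  ▷-0 : ∀ g → g ▷ 0ₚ ≡ 0ₚ
  ▷-0 (⟨ mat a b c d ⟩) = cong₂ _,_ (z a b) (z c d)
    where
    z : ∀ a b → a * 0# + b * 0# ≡ 0#
    z a b = trans (cong₂ _+_ (zeroʳ a) (zeroʳ b)) (+-identityʳ 0#)

  ▷-nonzero : ∀ g {v} → v ≢ 0ₚ → g ▷ v ≢ 0ₚ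
  ▷-nonzero g {v} n e = n (trans (sym (⁻¹-▷ g v)) (trans (cong (g ⁻¹ ▷_) e) (▷-0 (g ⁻¹))))

  ∥-sym : ∀ v w → v ∥ w → w ∥ v
  ∥-sym (a , b) (c , d) e = by (sym e) (solve 4 (λ a b c d → c :* b :+ :- (d :* a) :+ (a :* d :+ :- (b :* c)) := :0 :+ :0) refl a b c d)

  ∥-refl : ∀ v → v ∥ v
  ∥-refl (a , b) = solve 2 (λ a b → a :* b :+ :- (b :* a) := :0) refl a b

  ∥-trans : ∀ u v w → v ≢ 0ₚ → u ∥ v → v ∥ w → u ∥ w
  ∥-trans (a , b) (c , d) (e , f) n p q = split (c ≟ 0#)
    where
    split : Dec (c ≡ 0#) → a * f + - (b * e) ≡ 0#
    split (no c≢0) = *-cancelˡ c c≢0 (by (e ⊡ p ⊞ a ⊡ q)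
      (solve 6 (λ a b c d e f → c :* (a :* f :+ :- (b :* e)) :+ (e :* :0 :+ a :* :0) := c :* :0 :+ (e :* (a :* d :+ :- (b :* c)) :+ a :* (c :* f :+ :- (d :* e)))) refl a b c d e f))
    split (yes c≡0) = *-cancelˡ d (λ d≡0 → n (cong₂ _,_ c≡0 d≡0)) (by (f ⊡ p ⊞ b ⊡ q)
      (solve 6 (λ a b c d e f → d :* (a :* f :+ :- (b :* e)) :+ (f :* :0 :+ b :* :0) := d :* :0 :+ (f :* (a :* d :+ :- (b :* c)) :+ b :* (c :* f :+ :- (d :* e)))) refl a b c d e f))

  record IsProper (H : SL₂ → Set) : Set where
    field
      ε∈       : H ε
      ∙-closed : ∀ {g h} → H g → H h → H (g ∙ h)
      ⁻¹-closed : ∀ {g} → H g → H (g ⁻¹)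
      missing  : ∃ λ g → ¬ H g

  Stabilizer : Pt → SL₂ → Set
  Stabilizer v g = v ∥ g ▷ v

  Stabilizer? : ∀ v g → Dec (Stabilizer v g)
  Stabilizer? v g = cross v (g ▷ v) ≟ 0#

  -- A line preserved by both unipotent matrices would be spanned by a vector with x² = 0 and y² =
  -- 0.
  Stabilizer-proper : ∀ v → v ≢ 0ₚ → IsProper (Stabilizer v)
  Stabilizer-proper v@(x , y) n = record
    { ε∈ = subst (v ∥_) (sym (ε-▷ v)) (∥-refl v)
    ; ∙-closed = λ {g} {h} p q → subst (v ∥_) (sym (∙-▷ g h v))
        (∥-trans v (g ▷ v) (g ▷ h ▷ v) (▷-nonzero g n) p (trans (cross-▷ g v (h ▷ v)) q))
    ; ⁻¹-closed = λ {g} p → trans (sym (cross-▷ g v (g ⁻¹ ▷ v))) (subst (g ▷ v ∥_) (sym (▷-⁻¹ g v)) (∥-sym v (g ▷ v) p))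
    ; missing = helper (Stabilizer? v upper) (Stabilizer? v lower) }
    where
    1-square : ∀ {x} → 1# * (x * x) ≡ 0# → x ≡ 0#
    1-square {x} e = x²≡0 (trans (sym (*-identityˡ (x * x))) e)
    helper : Dec (Stabilizer v upper) → Dec (Stabilizer v lower) → ∃ λ g → ¬ Stabilizer v g
    helper (no p) _ = upper , p
    helper _ (no q) = lower , q
    helper (yes p) (yes q) = contradiction (cong₂ _,_
      (1-square (by q (solve 3 (λ x y o → o :* (x :* x) :+ :0 := :0 :+ (x :* (o :* x :+ o :* y) :+ :- (y :* (o :* x :+ :0 :* y)))) refl x y 1#)))
      (1-square (by (sym p) (solve 3 (λ x y o → o :* (y :* y) :+ (x :* (:0 :* x :+ o :* y) :+ :- (y :* (o :* x :+ o :* y))) := :0 :+ :0) refl x y 1#)))) n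

  -- For noncentral a this is the normaliser of the centraliser of a: as soon as conj g a commutes
  -- with a, both have the same centraliser.
  Normalizer : SL₂ → SL₂ → Set
  Normalizer a g = Commute a (conj g a)

  Normalizer? : ∀ a g → Dec (Normalizer a g)
  Normalizer? a g = Commute? a (conj g a)

  -- Closure under products is transitivity of commutation. If both unipotent matrices belonged to
  -- it, comparing entries would give 2r² = 0 and 2q² = 0, then (p - s)² = 0, and a would be
  -- central; here the characteristic must be odd.
  Normalizer-proper : ∀ a → ¬ Central a → IsProper (Normalizer a)
  Normalizer-proper a@(⟨ mat p q r s ⟩) n = record
    { ε∈ = cong (a ∙_) (conj-ε a) ⟨≡⟩ sym (cong (_∙ a) (conj-ε a))
    ; ∙-closed = λ {g} {h} x y → subst (Commute a) (sym (conj-∙ g h a))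
        (Commute-trans {a} {conj g a} {conj g (conj h a)} (n ∘ Central-conj g a) x (Commute-conj g {a} {conj h a} y))
    ; ⁻¹-closed = λ {g} x → sym (subst (Commute (conj (g ⁻¹) a)) (conj-inverse g a) (Commute-conj (g ⁻¹) {a} {conj g a} x))
    ; missing = helper (Normalizer? a upper) (Normalizer? a lower) }
    where
    infixl 1 _⟨≡⟩_
    _⟨≡⟩_ : ∀ {A : Set} {x y z : A} → x ≡ y → y ≡ z → x ≡ z
    _⟨≡⟩_ = trans
    par : ∀ g → Normalizer a g → Parallel (offScalar (matrix a)) (offScalar (matrix (conj g a)))
    par g = Commute⇒Parallel a (conj g a)
    oo : ∀ z → 1# * (1# * z) ≡ z
    oo z = trans (*-identityˡ _) (*-identityˡ z)
    helper : Dec (Normalizer a upper) → Dec (Normalizer a lower) → ∃ λ g → ¬ Normalizer a g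
    helper (no x) _ = upper , x
    helper _ (no y) = lower , y
    helper (yes x) (yes y) = contradiction central n
      where
      r≡0 : r ≡ 0#
      r≡0 = x²≡0 (double-cancel (trans (sym (cong₂ _+_ (oo (r * r)) (oo (r * r)))) (by (par upper x 1F 2F)
        (solve 5 (λ p q r s o → let V = P.mul (P.mul (mat o o :0 o) (mat p q r s)) (P.adj (mat o o :0 o)) in
          o :* (o :* (r :* r)) :+ o :* (o :* (r :* r)) :+ (p :+ :- s) :* m₂₁ V := :0 :+ :0 :+ r :* (m₁₁ V :+ :- m₂₂ V)) refl p q r s 1#))))
      q≡0 : q ≡ 0#
      q≡0 = x²≡0 (double-cancel (trans (sym (cong₂ _+_ (oo (q * q)) (oo (q * q)))) (by (sym (par lower y 0F 2F))
        (solve 5 (λ p q r s o → let V = P.mul (P.mul (mat o :0 o o) (mat p q r s)) (P.adj (mat o :0 o o)) in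
          o :* (o :* (q :* q)) :+ o :* (o :* (q :* q)) :+ q :* (m₁₁ V :+ :- m₂₂ V) := :0 :+ :0 :+ (p :+ :- s) :* m₁₂ V) refl p q r s 1#))))
      e≡0 : p + - s ≡ 0#
      e≡0 = x²≡0 (trans (sym (oo ((p + - s) * (p + - s)))) (by (par upper x 0F 2F ⊞ (- (1# * (1# * (p + - s + (q + q))))) ⊡ r≡0)
        (solve 5 (λ p q r s o → let V = P.mul (P.mul (mat o o :0 o) (mat p q r s)) (P.adj (mat o o :0 o)) ; k = :- (o :* (o :* (p :+ :- s :+ (q :+ q)))) in
          o :* (o :* ((p :+ :- s) :* (p :+ :- s))) :+ ((p :+ :- s) :* m₁₂ V :+ k :* :0) := :0 :+ (q :* (m₁₁ V :+ :- m₂₂ V) :+ k :* r)) refl p q r s 1#)))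
      central : Central a
      central 0F = q≡0
      central 1F = r≡0
      central 2F = e≡0

  -- A nonzero N of trace and determinant zero has rank one, N = v wᵀ with w orthogonal to v. Then
  -- tr (A N) = wᵀ A v vanishes exactly when A v is parallel to v.
  det-trace-column : ∀ A N → tr N ≡ 0# → det N ≡ 0# → tr (mul A N) ≡ 0# →
    (m₁₁ N , m₂₁ N) ∥ act A (m₁₁ N , m₂₁ N) × (m₁₂ N , m₂₂ N) ∥ act A (m₁₂ N , m₂₂ N)
  det-trace-column (mat a b c d) (mat e f g h) t z k =
    by ((- g) ⊡ k ⊞ (c * e + d * g) ⊡ t ⊞ (- c) ⊡ z)
      (solve 8 (λ a b c d e f g h →
        P.cross (e , g) (P.act (mat a b c d) (e , g)) :+ (:- g :* :0 :+ (c :* e :+ d :* g) :* :0 :+ :- c :* :0)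
        := :0 :+ (:- g :* P.tr (P.mul (mat a b c d) (mat e f g h)) :+ (c :* e :+ d :* g) :* (e :+ h) :+ :- c :* P.det (mat e f g h))) refl a b c d e f g h) ,
    by (f ⊡ k ⊞ (- (a * f + b * h)) ⊡ t ⊞ b ⊡ z)
      (solve 8 (λ a b c d e f g h →
        P.cross (f , h) (P.act (mat a b c d) (f , h)) :+ (f :* :0 :+ :- (a :* f :+ b :* h) :* :0 :+ b :* :0)
        := :0 :+ (f :* P.tr (P.mul (mat a b c d) (mat e f g h)) :+ :- (a :* f :+ b :* h) :* (e :+ h) :+ b :* P.det (mat e f g h))) refl a b c d e f g h)

  tr-commutator : ∀ X Y → tr (commutator X Y) ≡ 0#
  tr-commutator (mat a b c d) (mat e f g h) = solve 8 (λ a b c d e f g h →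
    P.tr (P.commutator (mat a b c d) (mat e f g h)) := :0) refl a b c d e f g h

  tr-mul-commutator₁ : ∀ X Y → tr (mul X (commutator X Y)) ≡ 0#
  tr-mul-commutator₁ (mat a b c d) (mat e f g h) = solve 8 (λ a b c d e f g h →
    P.tr (P.mul (mat a b c d) (P.commutator (mat a b c d) (mat e f g h))) := :0) refl a b c d e f g h

  tr-mul-commutator₂ : ∀ X Y → tr (mul Y (commutator X Y)) ≡ 0#
  tr-mul-commutator₂ (mat a b c d) (mat e f g h) = solve 8 (λ a b c d e f g h →
    P.tr (P.mul (mat e f g h) (P.commutator (mat a b c d) (mat e f g h))) := :0) refl a b c d e f g h

  -- Vanishes exactly when a and x have a common eigenvector over an algebraic closure; a nonzero
  -- value is the general position required of a pair.
  disc : SL₂ → SL₂ → F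
  disc a x = det (commutator (matrix a) (matrix x))

  Eigenvector : SL₂ → Pt → Set
  Eigenvector a v = v ≢ 0ₚ × v ∥ a ▷ v

  commutator≡0 : ∀ X Y → commutator X Y ≡ mat 0# 0# 0# 0# → mul X Y ≡ mul Y X
  commutator≡0 (mat a b c d) (mat e f g h) q = mat-≡ (difference≡0 (cong m₁₁ q)) (difference≡0 (cong m₁₂ q)) (difference≡0 (cong m₂₁ q)) (difference≡0 (cong m₂₂ q))

  -- The commutator is orthogonal to 1, a and b for the trace form. If it is singular and nonzero,
  -- `det-trace-column` makes any nonzero column of it an eigenvector of both.
  common-eigenvector : ∀ a b → disc a b ≡ 0# → Commute a b ⊎ ∃ λ v → Eigenvector a v × Eigenvector b v
  common-eigenvector a b z = choose
    (det-trace-column (matrix a) N (tr-commutator (matrix a) (matrix b)) z (tr-mul-commutator₁ (matrix a) (matrix b)))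
    (det-trace-column (matrix b) N (tr-commutator (matrix a) (matrix b)) z (tr-mul-commutator₂ (matrix a) (matrix b)))
    ((m₁₁ N , m₂₁ N) ≟ 0ₚ) ((m₁₂ N , m₂₂ N) ≟ 0ₚ)
    where
    N = commutator (matrix a) (matrix b)
    choose : (m₁₁ N , m₂₁ N) ∥ a ▷ (m₁₁ N , m₂₁ N) × (m₁₂ N , m₂₂ N) ∥ a ▷ (m₁₂ N , m₂₂ N) →
      (m₁₁ N , m₂₁ N) ∥ b ▷ (m₁₁ N , m₂₁ N) × (m₁₂ N , m₂₂ N) ∥ b ▷ (m₁₂ N , m₂₂ N) →
      Dec ((m₁₁ N , m₂₁ N) ≡ 0ₚ) → Dec ((m₁₂ N , m₂₂ N) ≡ 0ₚ) → Commute a b ⊎ ∃ λ v → Eigenvector a v × Eigenvector b v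
    choose (p , _) (q , _) (no n) _ = inj₂ (_ , (n , p) , (n , q))
    choose (_ , p) (_ , q) (yes _) (no n) = inj₂ (_ , (n , p) , (n , q))
    choose _ _ (yes e) (yes f) = inj₁ (SL₂-≡ (commutator≡0 (matrix a) (matrix b)
      (mat-≡ (cong proj₁ e) (cong proj₁ f) (cong proj₂ e) (cong proj₂ f))))

  private
    -- The binary quadratic form whose nontrivial zeros are the eigenvectors of A.
    form : Matrix F → F → F → F
    form A x y = cross (x , y) (act A (x , y))

    form-scale : ∀ A k x y → form A (k * x) (k * y) ≡ k * k * form A x y
    form-scale (mat a b c d) k x y = solve 7 (λ a b c d k x y →
      P.cross (k :* x , k :* y) (P.act (mat a b c d) (k :* x , k :* y)) := k :* k :* P.cross (x , y) (P.act (mat a b c d) (x , y))) refl a b c d k x y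

    form-sum : ∀ A α β x y z w → form A (α * x + β * z) (α * y + β * w) ≡
      α * α * form A x y + α * β * (cross (x , y) (act A (z , w)) + cross (z , w) (act A (x , y))) + β * β * form A z w
    form-sum (mat a b c d) α β x y z w = solve 10 (λ a b c d α β x y z w →
      P.cross (α :* x :+ β :* z , α :* y :+ β :* w) (P.act (mat a b c d) (α :* x :+ β :* z , α :* y :+ β :* w)) :=
      α :* α :* P.cross (x , y) (P.act (mat a b c d) (x , y)) :+ α :* β :* (P.cross (x , y) (P.act (mat a b c d) (z , w)) :+ P.cross (z , w) (P.act (mat a b c d) (x , y)))
        :+ β :* β :* P.cross (z , w) (P.act (mat a b c d) (z , w))) refl a b c d α β x y z w

    cramer : ∀ x y z w u v → cross (x , y) (z , w) * u ≡ cross (u , v) (z , w) * x + cross (x , y) (u , v) * z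
    cramer = solve 6 (λ x y z w u v → (x :* w :+ :- (y :* z)) :* u := (u :* w :+ :- (v :* z)) :* x :+ (x :* v :+ :- (y :* u)) :* z) refl

    cramer′ : ∀ x y z w u v → cross (x , y) (z , w) * v ≡ cross (u , v) (z , w) * y + cross (x , y) (u , v) * w
    cramer′ = solve 6 (λ x y z w u v → (x :* w :+ :- (y :* z)) :* v := (u :* w :+ :- (v :* z)) :* y :+ (x :* v :+ :- (y :* u)) :* w) refl

    form≡0⇒Central : ∀ a → (∀ x y → form (matrix a) x y ≡ 0#) → Central a
    form≡0⇒Central (⟨ mat a b c d ⟩) f = λ where
        0F → b≡0
        1F → c≡0
        2F → oo (by (sym (f 1# 1#) ⊞ (1# * 1#) ⊡ c≡0 ⊞ (1# * 1#) ⊡ sym b≡0) (solve 5 (λ a b c d o →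
          o :* (o :* (a :+ :- d)) :+ (P.cross (o , o) (P.act (mat a b c d) (o , o)) :+ o :* o :* :0 :+ o :* o :* b) := :0 :+ (:0 :+ o :* o :* c :+ o :* o :* :0)) refl a b c d 1#))
      where
      oo : ∀ {z} → 1# * (1# * z) ≡ 0# → z ≡ 0#
      oo {z} e = trans (sym (trans (*-identityˡ _) (*-identityˡ z))) e
      b≡0 : b ≡ 0#
      b≡0 = oo (by (sym (f 0# 1#)) (solve 5 (λ a b c d o →
        o :* (o :* b) :+ P.cross (:0 , o) (P.act (mat a b c d) (:0 , o)) := :0 :+ :0) refl a b c d 1#))
      c≡0 : c ≡ 0#
      c≡0 = oo (by (f 1# 0#) (solve 5 (λ a b c d o →
        o :* (o :* c) :+ :0 := :0 :+ P.cross (o , :0) (P.act (mat a b c d) (o , :0))) refl a b c d 1#))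

  -- In coordinates with respect to the eigenvectors v and v′ the form is a constant B times the
  -- product of the two coordinates. If B = 0, every vector is an eigenvector and a is scalar.
  third-eigenvector : ∀ a → ¬ Central a → ∀ v v′ w → v ∥ a ▷ v → v′ ∥ a ▷ v′ → ¬ (v ∥ v′) → w ∥ a ▷ w → w ∥ v ⊎ w ∥ v′
  third-eigenvector a n v@(x , y) v′@(z , w) u@(p , q) e e′ v∦v′ f = cases (zero-product αβB)
    where
    A = matrix a
    Δ = cross v v′
    B = cross v (a ▷ v′) + cross v′ (a ▷ v)
    expand : ∀ p q → Δ * Δ * form A p q ≡ cross (p , q) v′ * cross v (p , q) * B
    expand p q = begin
      Δ * Δ * form A p q               ≡⟨ form-scale A Δ p q ⟨
      form A (Δ * p) (Δ * q)           ≡⟨ cong₂ (form A) (cramer x y z w p q) (cramer′ x y z w p q) ⟩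
      form A (α * x + β * z) (α * y + β * w)  ≡⟨ form-sum A α β x y z w ⟩
      α * α * form A x y + α * β * B + β * β * form A z w
        ≡⟨ cong₂ (λ s t → α * α * s + α * β * B + β * β * t) e e′ ⟩
      α * α * 0# + α * β * B + β * β * 0#  ≡⟨ solve 3 (λ α β B → α :* α :* :0 :+ α :* β :* B :+ β :* β :* :0 := α :* β :* B) refl α β B ⟩
      α * β * B                        ∎
      where
      open ≡-Reasoning
      α = cross (p , q) v′
      β = cross v (p , q)
    αβB : cross u v′ * cross v u * B ≡ 0#
    αβB = trans (sym (expand p q)) (trans (cong (Δ * Δ *_) f) (zeroʳ _))
    B≡0⇒ : B ≡ 0# → Central a
    B≡0⇒ b = form≡0⇒Central a λ p q → *-cancelˡ (Δ * Δ) (λ d → v∦v′ (x²≡0 d))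
      (trans (expand p q) (trans (cong (cross (p , q) v′ * cross v (p , q) *_) b) (trans (zeroʳ _) (sym (zeroʳ _)))))
    cases : cross u v′ * cross v u ≡ 0# ⊎ B ≡ 0# → u ∥ v ⊎ u ∥ v′
    cases (inj₂ b) = contradiction (B≡0⇒ b) n
    cases (inj₁ αβ) with zero-product αβ
    ... | inj₁ α = inj₂ α
    ... | inj₂ β = inj₁ (∥-sym v u β)

  opaque
    two-eigenlines : ∀ a → ¬ Central a → ∃₂ λ v v′ → v ≢ 0ₚ × v′ ≢ 0ₚ × (∀ w → Eigenvector a w → w ∥ v ⊎ w ∥ v′)
    two-eigenlines a n = first (∃? E?)
      where
      E? : ∀ v → Dec (Eigenvector a v)
      E? v = ¬? (v ≟ 0ₚ) ×? (cross v (a ▷ v) ≟ 0#)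
      e₁ : Pt
      e₁ = 1# , 0#
      first : Dec (∃ (Eigenvector a)) → ∃₂ λ v v′ → v ≢ 0ₚ × v′ ≢ 0ₚ × (∀ w → Eigenvector a w → w ∥ v ⊎ w ∥ v′)
      -- Without an eigenvector over F any nonzero vector will do, the covering condition being
      -- vacuous; with a single eigenline, that line is listed twice.
      first (no ¬w) = e₁ , e₁ , e₁≢0 , e₁≢0 , λ w e → contradiction (w , e) ¬w
        where
        e₁≢0 : e₁ ≢ 0ₚ
        e₁≢0 z = 1≢0 (cong proj₁ z)
      first (yes (v , v≢0 , e)) = second (∃? λ w → E? w ×? ¬? (cross v w ≟ 0#))
        where
        second : Dec (∃ λ w → Eigenvector a w × ¬ (v ∥ w)) → ∃₂ λ v v′ → v ≢ 0ₚ × v′ ≢ 0ₚ × (∀ w → Eigenvector a w → w ∥ v ⊎ w ∥ v′)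
        second (no ¬w) = v , v , v≢0 , v≢0 , λ w e′ → inj₁ (∥-sym v w (decidable-stable (cross v w ≟ 0#) λ n′ → ¬w (w , e′ , n′)))
        second (yes (v′ , (v′≢0 , e′) , v∦v′)) = v , v′ , v≢0 , v′≢0 , λ w (_ , f) → third-eigenvector a n v v′ w e e′ v∦v′ f

-- Commutators with a fixed element, as coordinates for counting.

module Twist (𝔽 : FiniteField) where

  open import Data.Fin.Patterns using (0F; 1F; 2F)
  open FiniteField 𝔽
  open Matrices 𝔽
  open Matrix
  open Centralizers 𝔽
  open Conjugation 𝔽
  open Escape 𝔽

  mul-adj-cancel : ∀ T Y → mul (mul T Y) (adj Y) ≡ scalar (det Y) T
  mul-adj-cancel (mat a b c d) (mat e f g h) = mat-≡ (left a b) (right a b) (left c d) (right c d)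
    where
    left : ∀ a b → (a * e + b * g) * h + (a * f + b * h) * - g ≡ (e * h + - (f * g)) * a
    left a b = solve 6 (λ a b e f g h → (a :* e :+ b :* g) :* h :+ (a :* f :+ b :* h) :* :- g := (e :* h :+ :- (f :* g)) :* a) refl a b e f g h
    right : ∀ a b → (a * e + b * g) * - f + (a * f + b * h) * e ≡ (e * h + - (f * g)) * b
    right a b = solve 6 (λ a b e f g h → (a :* e :+ b :* g) :* :- f :+ (a :* f :+ b :* h) :* e := (e :* h :+ :- (f :* g)) :* b) refl a b e f g h

  mul-cancelʳ : ∀ T U Y → det Y ≢ 0# → mul T Y ≡ mul U Y → T ≡ U
  mul-cancelʳ T@(mat _ _ _ _) U@(mat _ _ _ _) Y n e = mat-≡ (f (cong m₁₁ q)) (f (cong m₁₂ q)) (f (cong m₂₁ q)) (f (cong m₂₂ q))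
    where
    q : scalar (det Y) T ≡ scalar (det Y) U
    q = trans (sym (mul-adj-cancel T Y)) (trans (cong (λ W → mul W (adj Y)) e) (mul-adj-cancel U Y))
    f : ∀ {x y} → det Y * x ≡ det Y * y → x ≡ y
    f = *-cancelˡ (det Y) n

  mul-sub-distribˡ : ∀ T U V → add (mul T U) (neg (mul T V)) ≡ mul T (add U (neg V))
  mul-sub-distribˡ (mat a b c d) (mat e f g h) (mat i j k l) = mat-≡ (s a b e g i k) (s a b f h j l) (s c d e g i k) (s c d f h j l)
    where
    s : ∀ a b e g i k → a * e + b * g + - (a * i + b * k) ≡ a * (e + - i) + b * (g + - k)
    s = solve 6 (λ a b e g i k → a :* e :+ b :* g :+ :- (a :* i :+ b :* k) := a :* (e :+ :- i) :+ b :* (g :+ :- k)) refl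

  mul-sub-distribʳ : ∀ T U V → add (mul U T) (neg (mul V T)) ≡ mul (add U (neg V)) T
  mul-sub-distribʳ (mat a b c d) (mat e f g h) (mat i j k l) = mat-≡ (s e f i j a c) (s e f i j b d) (s g h k l a c) (s g h k l b d)
    where
    s : ∀ e f i j a c → e * a + f * c + - (i * a + j * c) ≡ (e + - i) * a + (f + - j) * c
    s = solve 6 (λ e f i j a c → e :* a :+ f :* c :+ :- (i :* a :+ j :* c) := (e :+ :- i) :* a :+ (f :+ :- j) :* c) refl

  commutator-mulˡ : ∀ A T X → mul T A ≡ mul A T → commutator A (mul T X) ≡ mul T (commutator A X)
  commutator-mulˡ A T X c = trans (cong₂ (λ U V → add U (neg V))
    (trans (sym (mul-assoc A T X)) (trans (cong (λ W → mul W X) (sym c)) (mul-assoc T A X))) (mul-assoc T X A))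
    (mul-sub-distribˡ T (mul A X) (mul X A))

  commutator-mulʳ : ∀ A T X → mul T A ≡ mul A T → commutator A (mul X T) ≡ mul (commutator A X) T
  commutator-mulʳ A T X c = trans (cong₂ (λ U V → add U (neg V))
    (sym (mul-assoc A X T)) (trans (mul-assoc X T A) (trans (cong (mul X) c) (sym (mul-assoc X A T)))))
    (mul-sub-distribʳ T (mul A X) (mul X A))

  -- For t and t′ in the centraliser of a, [a, t x t′] = t [a, x] t′, and both have determinant one.
  disc-sandwich : ∀ a t x t′ → Commute t a → Commute t′ a → disc a ((t ∙ x) ∙ t′) ≡ disc a x
  disc-sandwich a t x t′ c c′ = begin
    det (commutator A (mul (mul T X) T′))   ≡⟨ cong det (commutator-mulʳ A T′ (mul T X) (cong matrix c′)) ⟩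
    det (mul (commutator A (mul T X)) T′)   ≡⟨ cong (λ W → det (mul W T′)) (commutator-mulˡ A T X (cong matrix c)) ⟩
    det (mul (mul T (commutator A X)) T′)   ≡⟨ trans (det-mul (mul T (commutator A X)) T′) (cong₂ _*_ (det-mul T (commutator A X)) (det≡1 t′)) ⟩
    det T * det (commutator A X) * 1#       ≡⟨ trans (*-identityʳ _) (trans (cong (_* det (commutator A X)) (det≡1 t)) (*-identityˡ _)) ⟩
    det (commutator A X)                    ∎
    where
    open ≡-Reasoning
    A = matrix a
    T = matrix t
    T′ = matrix t′
    X = matrix x

  conj-affine : ∀ g t a x y → matrix t ≡ affine x y (matrix a) → matrix (conj g t) ≡ affine x y (matrix (conj g a))
  conj-affine g@(⟨ mat p q r s ⟩) t@(⟨ .(affine x y (matrix a)) ⟩) a@(⟨ mat e f k h ⟩) x y refl = mat-≡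
    (by (trans (x ⊡ det≡1 g) (*-identityʳ x)) (solve 10 (λ p q r s e f k h x y → let G = mat p q r s ; V = P.mul (P.mul G (mat e f k h)) (P.adj G) in
      m₁₁ (P.mul (P.mul G (mat (x :+ y :* e) (y :* f) (y :* k) (x :+ y :* h))) (P.adj G)) :+ x := x :+ y :* m₁₁ V :+ x :* P.det G) refl p q r s e f k h x y))
    (solve 10 (λ p q r s e f k h x y → let G = mat p q r s ; V = P.mul (P.mul G (mat e f k h)) (P.adj G) in
      m₁₂ (P.mul (P.mul G (mat (x :+ y :* e) (y :* f) (y :* k) (x :+ y :* h))) (P.adj G)) := y :* m₁₂ V) refl p q r s e f k h x y)
    (solve 10 (λ p q r s e f k h x y → let G = mat p q r s ; V = P.mul (P.mul G (mat e f k h)) (P.adj G) in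
      m₂₁ (P.mul (P.mul G (mat (x :+ y :* e) (y :* f) (y :* k) (x :+ y :* h))) (P.adj G)) := y :* m₂₁ V) refl p q r s e f k h x y)
    (by (trans (x ⊡ det≡1 g) (*-identityʳ x)) (solve 10 (λ p q r s e f k h x y → let G = mat p q r s ; V = P.mul (P.mul G (mat e f k h)) (P.adj G) in
      m₂₂ (P.mul (P.mul G (mat (x :+ y :* e) (y :* f) (y :* k) (x :+ y :* h))) (P.adj G)) :+ x := x :+ y :* m₂₂ V :+ x :* P.det G) refl p q r s e f k h x y))

  commutator-affine : ∀ A B x y → commutator A (affine x y B) ≡ scalar y (commutator A B)
  commutator-affine (mat a b c d) (mat e f g h) x y = mat-≡
    (solve 10 (λ a b c d e f g h x y → m₁₁ (P.commutator (mat a b c d) (mat (x :+ y :* e) (y :* f) (y :* g) (x :+ y :* h)))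
      := y :* m₁₁ (P.commutator (mat a b c d) (mat e f g h))) refl a b c d e f g h x y)
    (solve 10 (λ a b c d e f g h x y → m₁₂ (P.commutator (mat a b c d) (mat (x :+ y :* e) (y :* f) (y :* g) (x :+ y :* h)))
      := y :* m₁₂ (P.commutator (mat a b c d) (mat e f g h))) refl a b c d e f g h x y)
    (solve 10 (λ a b c d e f g h x y → m₂₁ (P.commutator (mat a b c d) (mat (x :+ y :* e) (y :* f) (y :* g) (x :+ y :* h)))
      := y :* m₂₁ (P.commutator (mat a b c d) (mat e f g h))) refl a b c d e f g h x y)
    (solve 10 (λ a b c d e f g h x y → m₂₂ (P.commutator (mat a b c d) (mat (x :+ y :* e) (y :* f) (y :* g) (x :+ y :* h)))
      := y :* m₂₂ (P.commutator (mat a b c d) (mat e f g h))) refl a b c d e f g h x y)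

  det-scalar : ∀ k X → det (scalar k X) ≡ k * k * det X
  det-scalar k (mat a b c d) = solve 5 (λ k a b c d → P.det (P.scalar k (mat a b c d)) := k :* k :* P.det (mat a b c d)) refl k a b c d

  -- The scalar part x of t drops out of the commutator, and y comes out of the determinant squared.
  disc-conj : ∀ a g t x y → matrix t ≡ affine x y (matrix a) → disc a (conj g t) ≡ y * y * disc a (conj g a)
  disc-conj a g t x y e = trans (cong (λ W → det (commutator (matrix a) W)) (conj-affine g t a x y e))
    (trans (cong det (commutator-affine (matrix a) (matrix (conj g a)) x y)) (det-scalar y _))

  -- The discriminant determines y² by `disc-conj`, and `affine-±y` leaves four elements with that
  -- y².
  same-disc : ∀ a g t t′ → ¬ Central a → disc a (conj g a) ≢ 0# → Commute t a → Commute t′ a →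
    disc a (conj g t′) ≡ disc a (conj g t) → t′ ≡ t ⊎ t′ ≡ negate t ⊎ t′ ≡ t ⁻¹ ⊎ t′ ≡ negate (t ⁻¹)
  same-disc a g t t′ n Δ≢0 c c′ e = helper (centralizer-affine t a n c) (centralizer-affine t′ a n c′)
    where
    Δ = disc a (conj g a)
    helper : (∃₂ λ x y → matrix t ≡ affine x y (matrix a)) → (∃₂ λ x y → matrix t′ ≡ affine x y (matrix a)) →
      t′ ≡ t ⊎ t′ ≡ negate t ⊎ t′ ≡ t ⁻¹ ⊎ t′ ≡ negate (t ⁻¹)
    helper (x , y , f) (x′ , y′ , f′) = affine-±y t t′ a f f′ (*-cancelˡ Δ Δ≢0
      (trans (*-comm Δ _) (trans (sym (disc-conj a g t′ x′ y′ f′)) (trans e (trans (disc-conj a g t x y f) (*-comm _ Δ))))))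

  affine-0-central : ∀ t a x → matrix t ≡ affine x 0# (matrix a) → Central t
  affine-0-central (⟨ _ ⟩) (⟨ mat a b c d ⟩) x refl = λ where
    0F → zeroˡ b
    1F → zeroˡ c
    2F → solve 3 (λ x a d → x :+ :0 :* a :+ :- (x :+ :0 :* d) := :0) refl x a d

  disc-nonzero : ∀ a g t → ¬ Central a → disc a (conj g a) ≢ 0# → Commute t a → ¬ Central t → disc a (conj g t) ≢ 0#
  disc-nonzero a g t n Δ≢0 c nt e = helper (centralizer-affine t a n c)
    where
    helper : ¬ ∃₂ λ x y → matrix t ≡ affine x y (matrix a)
    helper (x , y , f) = cases (zero-product (trans (sym (disc-conj a g t x y f)) e))
      where
      cases : ¬ (y * y ≡ 0# ⊎ disc a (conj g a) ≡ 0#)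
      cases (inj₁ z) = nt (affine-0-central t a x (trans f (cong (λ w → affine x w (matrix a)) (x²≡0 z))))
      cases (inj₂ z) = Δ≢0 z

  -- The commutator Y = [a, x] satisfies Y a = adj(a) Y.
  commutator-twist : ∀ A X x y → mul (commutator A X) (affine x y A) ≡ mul (adj (affine x y A)) (commutator A X)
  commutator-twist (mat a b c d) (mat e f g h) x y = mat-≡
    (solve 10 (λ a b c d e f g h x y → let A = mat a b c d ; T = mat (x :+ y :* a) (y :* b) (y :* c) (x :+ y :* d) ; Y = P.commutator A (mat e f g h) in
      m₁₁ (P.mul Y T) := m₁₁ (P.mul (P.adj T) Y)) refl a b c d e f g h x y)
    (solve 10 (λ a b c d e f g h x y → let A = mat a b c d ; T = mat (x :+ y :* a) (y :* b) (y :* c) (x :+ y :* d) ; Y = P.commutator A (mat e f g h) in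
      m₁₂ (P.mul Y T) := m₁₂ (P.mul (P.adj T) Y)) refl a b c d e f g h x y)
    (solve 10 (λ a b c d e f g h x y → let A = mat a b c d ; T = mat (x :+ y :* a) (y :* b) (y :* c) (x :+ y :* d) ; Y = P.commutator A (mat e f g h) in
      m₂₁ (P.mul Y T) := m₂₁ (P.mul (P.adj T) Y)) refl a b c d e f g h x y)
    (solve 10 (λ a b c d e f g h x y → let A = mat a b c d ; T = mat (x :+ y :* a) (y :* b) (y :* c) (x :+ y :* d) ; Y = P.commutator A (mat e f g h) in
      m₂₂ (P.mul Y T) := m₂₂ (P.mul (P.adj T) Y)) refl a b c d e f g h x y)

  -- For Y = [a, x] the relation t x = x t′ gives t Y = Y t′ = t′⁻¹ Y. As Y is invertible, t = t′⁻¹.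
  -- Written as u + v a, t is central if v = 0; otherwise u cancels from the relation and v can be
  -- divided out, which leaves a relation for a itself.
  twist : ∀ a x t t′ → ¬ Central a → disc a x ≢ 0# → Commute t a → Commute t′ a → t ∙ x ≡ x ∙ t′ → Central t ⊎ a ∙ x ≡ x ∙ a ⁻¹
  twist a x t t′ n d c c′ e = helper (centralizer-affine t a n c) (centralizer-affine t′ a n c′)
    where
    A = matrix a
    Y = commutator A (matrix x)
    t≡t′⁻¹ : (∃₂ λ x y → matrix t′ ≡ affine x y A) → t ≡ t′ ⁻¹
    t≡t′⁻¹ (u , v , f) = SL₂-≡ (mul-cancelʳ (matrix t) (adj (matrix t′)) Y d (begin
      mul (matrix t) Y                     ≡⟨ commutator-mulˡ A (matrix t) (matrix x) (cong matrix c) ⟨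
      commutator A (mul (matrix t) (matrix x))  ≡⟨ cong (commutator A) (cong matrix e) ⟩
      commutator A (mul (matrix x) (matrix t′)) ≡⟨ commutator-mulʳ A (matrix t′) (matrix x) (cong matrix c′) ⟩
      mul Y (matrix t′)                    ≡⟨ cong (mul Y) f ⟩
      mul Y (affine u v A)                 ≡⟨ commutator-twist A (matrix x) u v ⟩
      mul (adj (affine u v A)) Y           ≡⟨ cong (λ W → mul (adj W) Y) f ⟨
      mul (adj (matrix t′)) Y              ∎))
      where open ≡-Reasoning
    entries : ∀ A X u v → mul (affine u v A) X ≡ mul X (adj (affine u v A)) → v ≢ 0# → mul A X ≡ mul X (adj A)
    entries (mat a b c d) (mat e f g h) u v q v≢0 = mat-≡
      (*-cancelˡ v v≢0 (by (cong m₁₁ q) (solve 10 (λ a b c d e f g h u v → goal m₁₁ a b c d e f g h u v) refl a b c d e f g h u v)))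
      (*-cancelˡ v v≢0 (by (cong m₁₂ q) (solve 10 (λ a b c d e f g h u v → goal m₁₂ a b c d e f g h u v) refl a b c d e f g h u v)))
      (*-cancelˡ v v≢0 (by (cong m₂₁ q) (solve 10 (λ a b c d e f g h u v → goal m₂₁ a b c d e f g h u v) refl a b c d e f g h u v)))
      (*-cancelˡ v v≢0 (by (cong m₂₂ q) (solve 10 (λ a b c d e f g h u v → goal m₂₂ a b c d e f g h u v) refl a b c d e f g h u v)))
      where
      goal : ∀ {n} → (Matrix (Polynomial n) → Polynomial n) → (a b c d e f g h u v : Polynomial n) → Polynomial n × Polynomial n
      goal entry a b c d e f g h u v =
        let A = mat a b c d ; X = mat e f g h ; T = mat (u :+ v :* a) (v :* b) (v :* c) (u :+ v :* d) in
        v :* entry (P.mul A X) :+ entry (P.mul X (P.adj T)) := v :* entry (P.mul X (P.adj A)) :+ entry (P.mul T X)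
    helper : (∃₂ λ x y → matrix t ≡ affine x y A) → (∃₂ λ x y → matrix t′ ≡ affine x y A) → Central t ⊎ a ∙ x ≡ x ∙ a ⁻¹
    helper (u , v , f) w = split (v ≟ 0#)
      where
      t′≡ : t′ ≡ t ⁻¹
      t′≡ = trans (sym (⁻¹-involutive t′)) (cong _⁻¹ (sym (t≡t′⁻¹ w)))
      q : mul (affine u v A) (matrix x) ≡ mul (matrix x) (adj (affine u v A))
      q = subst (λ W → mul W (matrix x) ≡ mul (matrix x) (adj W)) f (cong matrix (trans e (cong (x ∙_) t′≡)))
      split : Dec (v ≡ 0#) → Central t ⊎ a ∙ x ≡ x ∙ a ⁻¹
      split (yes z) = inj₁ (affine-0-central t a u (trans f (cong (λ w → affine u w A) z)))
      split (no z) = inj₂ (SL₂-≡ (entries A (matrix x) u v q z))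

  -- Conjugation by x inverts a. By `twist` this is the only noncentral way in which the
  -- decomposition u x v, with u and v in the centraliser of a, can fail to be unique.
  Exceptional : SL₂ → SL₂ → Set
  Exceptional a x = a ∙ x ≡ x ∙ a ⁻¹

  Exceptional-quotient : ∀ a x x′ → Exceptional a x → Exceptional a x′ → Commute (x ∙ x′ ⁻¹) a
  Exceptional-quotient a x x′ p q = sym (begin
    a ∙ (x ∙ x′ ⁻¹)        ≡⟨ assoc a x (x′ ⁻¹) ⟨
    (a ∙ x) ∙ x′ ⁻¹        ≡⟨ cong (_∙ x′ ⁻¹) p ⟩
    (x ∙ a ⁻¹) ∙ x′ ⁻¹     ≡⟨ assoc x (a ⁻¹) (x′ ⁻¹) ⟩
    x ∙ (a ⁻¹ ∙ x′ ⁻¹)     ≡⟨ cong (x ∙_) (⁻¹-anti-homo-∙ x′ a) ⟨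
    x ∙ (x′ ∙ a) ⁻¹        ≡⟨ cong (λ w → x ∙ w ⁻¹) x′a ⟩
    x ∙ (a ⁻¹ ∙ x′) ⁻¹     ≡⟨ cong (x ∙_) (⁻¹-anti-homo-∙ (a ⁻¹) x′) ⟩
    x ∙ (x′ ⁻¹ ∙ (a ⁻¹) ⁻¹) ≡⟨ cong (λ w → x ∙ (x′ ⁻¹ ∙ w)) (⁻¹-involutive a) ⟩
    x ∙ (x′ ⁻¹ ∙ a)        ≡⟨ assoc x (x′ ⁻¹) a ⟨
    (x ∙ x′ ⁻¹) ∙ a        ∎)
    where
    open ≡-Reasoning
    x′a : x′ ∙ a ≡ a ⁻¹ ∙ x′
    x′a = begin
      x′ ∙ a                       ≡⟨ x⁻¹∙xy a (x′ ∙ a) ⟨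
      a ⁻¹ ∙ (a ∙ (x′ ∙ a))        ≡⟨ cong (a ⁻¹ ∙_) (assoc a x′ a) ⟨
      a ⁻¹ ∙ ((a ∙ x′) ∙ a)        ≡⟨ cong (λ w → a ⁻¹ ∙ (w ∙ a)) q ⟩
      a ⁻¹ ∙ ((x′ ∙ a ⁻¹) ∙ a)     ≡⟨ cong (a ⁻¹ ∙_) (yx⁻¹∙x a x′) ⟩
      a ⁻¹ ∙ x′                    ∎

  Commute⇒disc≡0 : ∀ a b → Commute a b → disc a b ≡ 0#
  Commute⇒disc≡0 a b e = trans (cong (λ W → det (add (mul (matrix a) (matrix b)) (neg W))) (sym (cong matrix e))) (vanishes (mul (matrix a) (matrix b)))
    where
    vanishes : ∀ X → det (add X (neg X)) ≡ 0#
    vanishes (mat a b c d) = solve 4 (λ a b c d → P.det (P.add (mat a b c d) (P.neg (mat a b c d))) := :0) refl a b c d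

  -- The conjugate by g of t t′⁻¹ commutes with a, as a quotient of exceptional elements, and also
  -- with conj g a. If it were noncentral, a and conj g a would commute and their discriminant would
  -- vanish.
  few-exceptional : ∀ a g t t′ → ¬ Central a → disc a (conj g a) ≢ 0# → Commute t a → Commute t′ a →
    Exceptional a (conj g t) → Exceptional a (conj g t′) → t ≡ t′ ⊎ t ≡ negate t′
  few-exceptional a g t t′ n Δ≢0 c c′ p q = ∙⁻¹-central t t′ (decidable-stable (Central? (t ∙ t′ ⁻¹)) λ nc →
    Δ≢0 (Commute⇒disc≡0 a (conj g a) (Commute-trans {a} {conj g (t ∙ t′ ⁻¹)} {conj g a} (nc ∘ Central-conj g (t ∙ t′ ⁻¹))
      (sym (subst (λ w → Commute w a) (sym (trans (conj-homo g t (t′ ⁻¹)) (cong (conj g t ∙_) (conj-⁻¹ g t′))))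
        (Exceptional-quotient a (conj g t) (conj g t′) p q)))
      (Commute-conj g {t ∙ t′ ⁻¹} {a} (Commute-∙ {t} {t′ ⁻¹} {a} c (Commute-⁻¹ {t′} {a} c′))))))

-- Escape from proper subgroups.

module Nonconcentration (𝔽 : FiniteField) where

  open import Data.Nat hiding (_≟_)
  open import Data.Nat.Properties hiding (_≟_)
  open import Data.Fin.Patterns using (1F)
  open import Data.List using ([])
  open FiniteField 𝔽 using (0#; 1#; 1≢0; by; _⊡_; solve; _:=_; _:+_; _:*_; :0; F-finite) renaming (_*_ to _*ᶠ_)
  open Matrices 𝔽
  open Centralizers 𝔽
  open Escape 𝔽

  -- The constant 8 only has to exceed 5, the number of cosets that `escape` must avoid at the same
  -- time.
  Nonconcentrated : {E : SL₂ → Set} → (∀ g → Dec (E g)) → Set₁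
  Nonconcentrated E? = ∀ {H : SL₂ → Set} (H? : ∀ g → Dec (H g)) → IsProper H → ∀ x →
    8 * # (λ g → E? g ×? H? (x ⁻¹ ∙ g)) < # E?

  module _ {E : SL₂ → Set} (E? : ∀ g → Dec (E g)) (nc : Nonconcentrated E?) where

    E>0 : 0 < # E?
    E>0 = ≤-<-trans z≤n (nc (Stabilizer? (1# , 0#)) (Stabilizer-proper (1# , 0#) (1≢0 ∘ cong proj₁)) ε)

    -- R lies in one left coset of H; any element of E in R represents it.
    coset-bound : ∀ {R H : SL₂ → Set} (R? : ∀ g → Dec (R g)) (H? : ∀ g → Dec (H g)) → IsProper H →
      (∀ {g h} → R g → R h → H (g ⁻¹ ∙ h)) → 8 * # (λ g → E? g ×? R? g) ≤ # E?
    coset-bound {R} R? H? proper h = cases (∃? λ g → E? g ×? R? g)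
      where
      cases : Dec (∃ λ g → E g × R g) → 8 * # (λ g → E? g ×? R? g) ≤ # E?
      cases (yes (x , _ , r)) = ≤-trans (*-monoʳ-≤ 8 (#-mono (λ g → E? g ×? R? g) (λ g → E? g ×? H? (x ⁻¹ ∙ g)) λ g (e , r′) → e , h r r′))
        (<⇒≤ (nc H? proper x))
      cases (no ¬w) = ≤-trans (*-monoʳ-≤ 8 (#-list (λ g → E? g ×? R? g) [] λ g w → contradiction (g , w) ¬w)) z≤n

    proper-escape : ∀ {H : SL₂ → Set} (H? : ∀ g → Dec (H g)) → IsProper H → ∃ λ g → E g × ¬ H g
    proper-escape {H} H? proper = extract (∃? λ g → E? g ×? ¬? (H? g))
      where
      extract : Dec (∃ λ g → E g × ¬ H g) → ∃ λ g → E g × ¬ H g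
      extract (yes w) = w
      extract (no ¬w) = contradiction (nc H? proper ε) (<⇒≱ (s≤s (≤-trans
        (#-mono E? (λ g → E? g ×? H? (ε ⁻¹ ∙ g)) λ g e → e , subst H (sym (trans (cong (_∙ g) ε⁻¹≈ε) (identityˡ g)))
          (decidable-stable (H? g) λ n → ¬w (g , e , n))) (m≤m+n _ _))))
        where open import Algebra.Properties.Group group using (ε⁻¹≈ε)

    opaque
      nonCentral-element : ∃ λ g → E g × ¬ Central g
      nonCentral-element =
        let g , e , n = proper-escape (Stabilizer? v) (Stabilizer-proper v (1≢0 ∘ cong proj₁)) in g , e , n ∘ stabilizes g
        where
        v : Pt
        v = 1# , 0#
        stabilizes : ∀ g → Central g → Stabilizer v g
        stabilizes (⟨ mat a b c d ⟩) z = by ((1# *ᶠ 1#) ⊡ z 1F)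
          (solve 5 (λ a b c d o → P.cross (o , :0) (P.act (mat a b c d) (o , :0)) :+ o :* o :* :0 := :0 :+ o :* o :* c) refl a b c d 1#)

      -- If the discriminant vanishes, a and conj g a commute or share an eigenvector v. In the
      -- first case g normalises the centraliser of a. In the second, g⁻¹ v is an eigenvector of a
      -- too, so g maps one of at most two eigenlines of a to one of them. These are five cosets,
      -- which together hold at most five eighths of E.
      escape : ∀ a → ¬ Central a → ∃ λ g → E g × disc a (conj g a) ≢ 0#
      escape a n = separate (two-eigenlines a n)
        where
        separate : (∃₂ λ v v′ → v ≢ 0ₚ × v′ ≢ 0ₚ × (∀ w → Eigenvector a w → w ∥ v ⊎ w ∥ v′)) → ∃ λ g → E g × disc a (conj g a) ≢ 0#
        separate (v₁ , v₂ , v₁≢0 , v₂≢0 , covers) = extract (∃? λ g → E? g ×? ¬? (disc a (conj g a) ≟ 0#))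
          where
            Line : Pt → Pt → SL₂ → Set
            Line v w g = v ∥ g ▷ w
            Line? : ∀ v w g → Dec (Line v w g)
            Line? v w g = cross v (g ▷ w) ≟ 0#
            line-bound : ∀ v w → v ≢ 0ₚ → w ≢ 0ₚ → 8 * # (λ g → E? g ×? Line? v w g) ≤ # E?
            line-bound v w v≢0 w≢0 = coset-bound (Line? v w) (Stabilizer? w) (Stabilizer-proper w w≢0) λ {g} {h} p q →
              trans (sym (cross-▷ g w ((g ⁻¹ ∙ h) ▷ w))) (subst (λ u → g ▷ w ∥ u)
                (sym (trans (cong (g ▷_) (∙-▷ (g ⁻¹) h w)) (▷-⁻¹ g (h ▷ w))))
                (∥-trans (g ▷ w) v (h ▷ w) v≢0 (∥-sym v (g ▷ w) p) q))
            N? : ∀ g → Dec (E g × Normalizer a g)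
            N? g = E? g ×? Normalizer? a g
            L? : ∀ v w g → Dec (E g × Line v w g)
            L? v w g = E? g ×? Line? v w g
            normalizer-bound : 8 * # N? ≤ # E?
            normalizer-bound = coset-bound (Normalizer? a) (Normalizer? a) proper λ {g} {h} p q → IsProper.∙-closed proper {g ⁻¹} {h} (IsProper.⁻¹-closed proper {g} p) q
              where
              proper : IsProper (Normalizer a)
              proper = Normalizer-proper a n
            Cover : SL₂ → Set
            Cover g = (E g × Normalizer a g) ⊎ ((E g × Line v₁ v₁ g) ⊎ (E g × Line v₁ v₂ g)) ⊎ ((E g × Line v₂ v₁ g) ⊎ (E g × Line v₂ v₂ g))
            Lines₁? : ∀ g → Dec ((E g × Line v₁ v₁ g) ⊎ (E g × Line v₁ v₂ g))
            Lines₁? = λ g → L? v₁ v₁ g ⊎? L? v₁ v₂ g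
            Lines₂? : ∀ g → Dec ((E g × Line v₂ v₁ g) ⊎ (E g × Line v₂ v₂ g))
            Lines₂? = λ g → L? v₂ v₁ g ⊎? L? v₂ v₂ g
            bad : ∀ g → E g → disc a (conj g a) ≡ 0# → Cover g
            bad g e z = case (common-eigenvector a (conj g a) z)
              where
              case : Commute a (conj g a) ⊎ (∃ λ v → Eigenvector a v × Eigenvector (conj g a) v) → Cover g
              case (inj₁ c) = inj₁ (e , c)
              case (inj₂ (v , ea@(v≢0 , _) , (_ , eb))) = inj₂ (choose (covers v ea) (covers w (w≢0 , ew)))
                where
                w : Pt
                w = g ⁻¹ ▷ v
                w≢0 : w ≢ 0ₚ
                w≢0 = ▷-nonzero (g ⁻¹) v≢0
                gw : g ▷ w ≡ v
                gw = ▷-⁻¹ g v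
                ew : w ∥ a ▷ w
                ew = trans (sym (cross-▷ g w (a ▷ w))) (subst₂ _∥_ (sym gw)
                  (trans (∙-▷ (g ∙ a) (g ⁻¹) v) (∙-▷ g a (g ⁻¹ ▷ v))) eb)
                on : ∀ u u′ → v ∥ u → w ∥ u′ → Line u u′ g
                on u u′ p q = ∥-trans u v (g ▷ u′) v≢0 (∥-sym v u p) (subst (_∥ g ▷ u′) gw (trans (cross-▷ g w u′) q))
                choose : v ∥ v₁ ⊎ v ∥ v₂ → w ∥ v₁ ⊎ w ∥ v₂ → ((E g × Line v₁ v₁ g) ⊎ (E g × Line v₁ v₂ g)) ⊎ ((E g × Line v₂ v₁ g) ⊎ (E g × Line v₂ v₂ g))
                choose (inj₁ p) (inj₁ q) = inj₁ (inj₁ (e , on v₁ v₁ p q))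
                choose (inj₁ p) (inj₂ q) = inj₁ (inj₂ (e , on v₁ v₂ p q))
                choose (inj₂ p) (inj₁ q) = inj₂ (inj₁ (e , on v₂ v₁ p q))
                choose (inj₂ p) (inj₂ q) = inj₂ (inj₂ (e , on v₂ v₂ p q))
            extract : Dec (∃ λ g → E g × disc a (conj g a) ≢ 0#) → ∃ λ g → E g × disc a (conj g a) ≢ 0#
            extract (yes w) = w
            extract (no ¬w) = contradiction total (<⇒≱ (*-monoˡ-< (# E?) {{>-nonZero E>0}} {5} {8} (s≤s (s≤s (s≤s (s≤s (s≤s (s≤s z≤n))))))))
              where
              open ≤-Reasoning
              e₅ : ∀ x → x + ((x + x) + (x + x)) ≡ 5 * x
              e₅ = solve-∀
              e₈ : ∀ a b c d e → 8 * (a + ((b + c) + (d + e))) ≡ 8 * a + ((8 * b + 8 * c) + (8 * d + 8 * e))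
              e₈ = solve-∀
              total : 8 * # E? ≤ 5 * # E?
              total = begin
                8 * # E?
                  ≤⟨ *-monoʳ-≤ 8 (≤-trans (#-∪ E? N? (λ g → Lines₁? g ⊎? Lines₂? g) λ g e →
                       bad g e (decidable-stable (disc a (conj g a) ≟ 0#) λ z → ¬w (g , e , z)))
                       (+-monoʳ-≤ (# N?) (≤-trans (#-∪ _ Lines₁? Lines₂? λ _ → id)
                         (+-mono-≤ (#-∪ Lines₁? (L? v₁ v₁) (L? v₁ v₂) λ _ → id) (#-∪ Lines₂? (L? v₂ v₁) (L? v₂ v₂) λ _ → id))))) ⟩
                8 * (# N? + ((# (L? v₁ v₁) + # (L? v₁ v₂)) + (# (L? v₂ v₁) + # (L? v₂ v₂))))
                  ≡⟨ e₈ (# N?) (# (L? v₁ v₁)) (# (L? v₁ v₂)) (# (L? v₂ v₁)) (# (L? v₂ v₂)) ⟩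
                8 * # N? + ((8 * # (L? v₁ v₁) + 8 * # (L? v₁ v₂)) + (8 * # (L? v₂ v₁) + 8 * # (L? v₂ v₂)))
                  ≤⟨ +-mono-≤ normalizer-bound (+-mono-≤ (+-mono-≤ (line-bound v₁ v₁ v₁≢0 v₁≢0) (line-bound v₁ v₂ v₁≢0 v₂≢0))
                       (+-mono-≤ (line-bound v₂ v₁ v₂≢0 v₁≢0) (line-bound v₂ v₂ v₂≢0 v₂≢0))) ⟩
                # E? + ((# E? + # E?) + (# E? + # E?))
                  ≡⟨ e₅ (# E?) ⟩
                5 * # E? ∎

-- Sizes of centralisers and of trace fibres.

module CentralizerCount (𝔽 : FiniteField) where

  open import Data.Nat hiding (_≟_)
  open import Data.Nat.Properties hiding (_≟_)
  open import Data.List using ([]; _∷_)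
  open import Data.List.Relation.Unary.Any using (here; there)
  open import Data.Fin.Patterns using (0F; 1F; 2F)
  import Data.Fin.Properties as Finₚ
  open FiniteField 𝔽 using (F; 0#; 1#; F-finite; by; _⊡_; _⊞_; solve; _:=_; _:+_; _:*_; :-_; :0; zero-product; difference≡0)
    renaming (_+_ to _+ᶠ_; _*_ to _*ᶠ_; -_ to -ᶠ_)
  open Matrices 𝔽
  open Matrix
  open Centralizers 𝔽
  open Conjugation 𝔽
  open Escape 𝔽
  open Twist 𝔽

  p : ℕ
  p = # λ (x : F) → yes tt

  #Central : # Central? ≤ 2
  #Central = #-list Central? (ε ∷ negate ε ∷ []) λ g z → cases g (Central⇒±ε g z)
    where
    cases : ∀ g → g ≡ ε ⊎ g ≡ negate ε → _
    cases g (inj₁ e) = here e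
    cases g (inj₂ e) = there (here e)

  -- In t = x + y a the norm equation leaves at most two x for each y.
  #centralizer : ∀ a → ¬ Central a → # (λ g → Commute? g a) ≤ p * 2
  #centralizer a n = #-cover (λ g → Commute? g a) (λ (y : F) → yes tt) R? 2
    (λ g c → let x , y , e = centralizer-affine g a n c in y , tt , x , e)
    λ y _ → #-≤2 (λ g → Commute? g a ×? R? g y) λ g h k (_ , u , e) (_ , v , f) (_ , w , k≡) g≢h g≢k →
      same y g h k u v w e f k≡ g≢h g≢k
    where
    R : SL₂ → F → Set
    R g y = ∃ λ x → matrix g ≡ affine x y (matrix a)
    R? : ∀ g y → Dec (R g y)
    R? g y = ∃? λ x → Finite._≟_ matrix-finite (matrix g) (affine x y (matrix a))
    -- Two solutions x of x² + τ y x + y² = 1 sum to - τ y.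
    sum : ∀ y g h u v → matrix g ≡ affine u y (matrix a) → matrix h ≡ affine v y (matrix a) → g ≢ h → u +ᶠ v +ᶠ y *ᶠ trace a ≡ 0#
    sum y g h u v e f g≢h = cases (zero-product {u +ᶠ -ᶠ v} {u +ᶠ v +ᶠ y *ᶠ trace a}
      (by (trans (norm-affine u y g a e) (sym (norm-affine v y h a f)))
        (solve 4 (λ u v y t → (u :+ :- v) :* (u :+ v :+ y :* t) :+ (v :* v :+ v :* y :* t :+ y :* y) := :0 :+ (u :* u :+ u :* y :* t :+ y :* y)) refl u v y (trace a))))
      where
      cases : u +ᶠ -ᶠ v ≡ 0# ⊎ u +ᶠ v +ᶠ y *ᶠ trace a ≡ 0# → u +ᶠ v +ᶠ y *ᶠ trace a ≡ 0#
      cases (inj₁ z) = contradiction (SL₂-≡ (trans e (trans (cong (λ w → affine w y (matrix a)) (difference≡0 z)) (sym f)))) g≢h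
      cases (inj₂ z) = z
    same : ∀ y g h k u v w → matrix g ≡ affine u y (matrix a) → matrix h ≡ affine v y (matrix a) → matrix k ≡ affine w y (matrix a) →
      g ≢ h → g ≢ k → h ≡ k
    same y g h k u v w e f k≡ g≢h g≢k = SL₂-≡ (trans f (trans (cong (λ z → affine z y (matrix a)) v≡w) (sym k≡)))
      where
      v≡w : v ≡ w
      v≡w = by (sum y g h u v e f g≢h ⊞ sym (sum y g k u w e k≡ g≢k))
        (solve 5 (λ u v w y t → v :+ (:0 :+ (u :+ w :+ y :* t)) := w :+ (u :+ v :+ y :* t :+ :0)) refl u v w y (trace a))

  conj-fixed⇒Commute : ∀ g t → conj g t ≡ t → Commute g t
  conj-fixed⇒Commute g t e = trans (sym (yx⁻¹∙x g (g ∙ t))) (cong (_∙ g) e)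

  -- The fibre is empty or a coset of the centraliser of t.
  #conj-fibre : ∀ t s → ¬ Central t → # (λ g → conj (g ⁻¹) t ≟ s) ≤ p * 2
  #conj-fibre t s n = #-inhabited (λ g → conj (g ⁻¹) t ≟ s) λ g₀ e₀ → ≤-trans
    (#-injection (λ g → conj (g ⁻¹) t ≟ s) (λ g → Commute? g t) (_∙ g₀ ⁻¹)
      (λ g e → commutes g g₀ (trans e (sym e₀))) (λ g h _ _ q → trans (sym (yx⁻¹∙x g₀ g)) (trans (cong (_∙ g₀) q) (yx⁻¹∙x g₀ h))))
    (#centralizer t n)
    where
    commutes : ∀ g h → conj (g ⁻¹) t ≡ conj (h ⁻¹) t → Commute (g ∙ h ⁻¹) t
    commutes g h e = conj-fixed⇒Commute (g ∙ h ⁻¹) t (trans (conj-∙ g (h ⁻¹) t) (trans (cong (conj g) (sym e)) (conj-inverse′ g t)))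

  -- The conjugate of t by g⁻¹ lies in the centraliser of a and has the trace of t. By `same-trace`
  -- it is one of two elements, and each is attained on a fibre of at most 2p elements.
  #conjugators : ∀ a t → Regular a → ¬ Central a → ¬ Central t → # (λ g → Commute? t (conj g a)) ≤ p * 4
  #conjugators a t reg na nt = #-inhabited (λ g → Commute? t (conj g a)) λ g₀ c₀ → ≤-trans
    (#-∪ (λ g → Commute? t (conj g a)) (λ g → conj (g ⁻¹) t ≟ conj (g₀ ⁻¹) t) (λ g → conj (g ⁻¹) t ≟ conj (g₀ ⁻¹) t ⁻¹)
      λ g c → same-trace (conj (g₀ ⁻¹) t) (conj (g ⁻¹) t) a reg na (back g₀ c₀) (back g c)
        (trans (trace-conj (g₀ ⁻¹) t) (sym (trace-conj (g ⁻¹) t))))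
    (≤-trans (+-mono-≤ (#conj-fibre t _ nt) (#conj-fibre t _ nt)) (≤-reflexive (e p)))
    where
    e : ∀ p → p * 2 + p * 2 ≡ p * 4
    e = solve-∀
    back : ∀ g → Commute t (conj g a) → Commute (conj (g ⁻¹) t) a
    back g c = subst (Commute (conj (g ⁻¹) t)) (conj-inverse g a) (Commute-conj (g ⁻¹) {t} {conj g a} c)

  Central⇒¬Regular : ∀ a → Central a → ¬ Regular a
  Central⇒¬Regular a z r = r (cases (Central⇒±ε a z))
    where
    cases : a ≡ ε ⊎ a ≡ negate ε → trace a *ᶠ trace a ≡ (1# +ᶠ 1#) *ᶠ (1# +ᶠ 1#)
    cases (inj₁ refl) = refl
    cases (inj₂ refl) = solve 1 (λ o → (:- o :+ :- o) :* (:- o :+ :- o) := (o :+ o) :* (o :+ o)) refl 1#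

  ¬Regular⇒trace : ∀ a → trace a *ᶠ trace a ≡ (1# +ᶠ 1#) *ᶠ (1# +ᶠ 1#) → trace a ≡ 1# +ᶠ 1# ⊎ trace a ≡ -ᶠ (1# +ᶠ 1#)
  ¬Regular⇒trace a e = cases (zero-product {t +ᶠ -ᶠ (1# +ᶠ 1#)} {t +ᶠ (1# +ᶠ 1#)}
    (by e (solve 2 (λ t o → (t :+ :- (o :+ o)) :* (t :+ (o :+ o)) :+ (o :+ o) :* (o :+ o) := :0 :+ t :* t) refl t 1#)))
    where
    t = trace a
    cases : t +ᶠ -ᶠ (1# +ᶠ 1#) ≡ 0# ⊎ t +ᶠ (1# +ᶠ 1#) ≡ 0# → t ≡ 1# +ᶠ 1# ⊎ t ≡ -ᶠ (1# +ᶠ 1#)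
    cases (inj₁ z) = inj₁ (difference≡0 z)
    cases (inj₂ z) = inj₂ (by z (solve 2 (λ t o → t :+ :0 := :- (o :+ o) :+ (t :+ (o :+ o))) refl t 1#))

  -- y ↦ (tr y, tr (g y), tr (h y)) is at most two-to-one: differences are multiples of [g, h], which is invertible.
  #trace-fibre : ∀ g h → disc g h ≢ 0# → ∀ {Y : SL₂ → Set} (Y? : ∀ y → Dec (Y y)) τ σ σ′ →
    (∀ y → Y y → trace y ≡ τ) → # (λ y → Y? y ×? ((trace (g ∙ y) ≟ σ) ×? (trace (h ∙ y) ≟ σ′))) ≤ 2
  #trace-fibre g h d Y? τ σ σ′ tr≡ = #-≤2 _ λ x y z (x∈ , x₁ , x₂) (y∈ , y₁ , y₂) (z∈ , z₁ , z₂) x≢y x≢z →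
    third x y z (multiple x y (trans (tr≡ x x∈) (sym (tr≡ y y∈))) (trans x₁ (sym y₁)) (trans x₂ (sym y₂)))
                (multiple x z (trans (tr≡ x x∈) (sym (tr≡ z z∈))) (trans x₁ (sym z₁)) (trans x₂ (sym z₂))) x≢y x≢z
    where
    N = commutator (matrix g) (matrix h)
    open FiniteField 𝔽 using (*-cancelˡ)

    N≢0 : N ≢ mat 0# 0# 0# 0#
    N≢0 e = d (trans (cong det e) (solve 0 (:0 :* :0 :+ :- (:0 :* :0) := :0) refl))

    Multiple : SL₂ → SL₂ → Set
    Multiple x y = ∃ λ k → matrix y ≡ add (matrix x) (scalar k N)

    first₃ : Matrix F → Fin 3 → F
    first₃ (mat a b c d) 0F = a
    first₃ (mat a b c d) 1F = b
    first₃ (mat a b c d) 2F = c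

    nonzero-entry : ∃ λ i → first₃ N i ≢ 0#
    nonzero-entry = extract (Finₚ.any? λ i → ¬? (first₃ N i ≟ 0#))
      where
      extract : Dec (∃ λ i → first₃ N i ≢ 0#) → ∃ λ i → first₃ N i ≢ 0#
      extract (yes w) = w
      extract (no ¬w) = contradiction (mat-≡ (z 0F) (z 1F) (z 2F)
        (by (tr-commutator (matrix g) (matrix h) ⊞ sym (z 0F)) (solve 2 (λ a d → d :+ (:0 :+ a) := :0 :+ (a :+ d :+ :0)) refl (m₁₁ N) (m₂₂ N)))) N≢0
        where
        z : ∀ i → first₃ N i ≡ 0#
        z i = decidable-stable (first₃ N i ≟ 0#) λ n → ¬w (i , n)

    -- For the trace form n is orthogonal to 1, G and H. So is [G, H], and if it is nonzero the
    -- three matrices are independent and their orthogonal complement is a line.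
    orthogonal : ∀ G H (n : Matrix F) → tr n ≡ 0# → tr (mul G n) ≡ 0# → tr (mul H n) ≡ 0# → Parallel (first₃ n) (first₃ (commutator G H))
    orthogonal G@(mat a b c d) H@(mat e f k l) n@(mat q r s t) T P Q = λ where
        0F 0F → refl
        1F 1F → refl
        2F 2F → refl
        0F 1F → p₀₁
        1F 0F → sym p₀₁
        0F 2F → p₀₂
        2F 0F → sym p₀₂
        1F 2F → p₁₂
        2F 1F → sym p₁₂
      where
      p₀₁ : q *ᶠ m₁₂ (commutator G H) ≡ r *ᶠ m₁₁ (commutator G H)
      p₀₁ = by (b ⊡ sym Q ⊞ (-ᶠ f) ⊡ sym P ⊞ (f *ᶠ d +ᶠ -ᶠ (b *ᶠ l)) ⊡ sym T) (solve 12 (λ a b c d e f k l q r s t →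
        let G = mat a b c d ; H = mat e f k l ; n = mat q r s t ; N = P.commutator G H in
        q :* m₁₂ N :+ (b :* P.tr (P.mul H n) :+ :- f :* P.tr (P.mul G n) :+ (f :* d :+ :- (b :* l)) :* P.tr n)
        := r :* m₁₁ N :+ (b :* :0 :+ :- f :* :0 :+ (f :* d :+ :- (b :* l)) :* :0)) refl a b c d e f k l q r s t)
      p₀₂ : q *ᶠ m₂₁ (commutator G H) ≡ s *ᶠ m₁₁ (commutator G H)
      p₀₂ = by (k ⊡ sym P ⊞ (-ᶠ c) ⊡ sym Q ⊞ (c *ᶠ l +ᶠ -ᶠ (k *ᶠ d)) ⊡ sym T) (solve 12 (λ a b c d e f k l q r s t →
        let G = mat a b c d ; H = mat e f k l ; n = mat q r s t ; N = P.commutator G H in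
        q :* m₂₁ N :+ (k :* P.tr (P.mul G n) :+ :- c :* P.tr (P.mul H n) :+ (c :* l :+ :- (k :* d)) :* P.tr n)
        := s :* m₁₁ N :+ (k :* :0 :+ :- c :* :0 :+ (c :* l :+ :- (k :* d)) :* :0)) refl a b c d e f k l q r s t)
      p₁₂ : r *ᶠ m₂₁ (commutator G H) ≡ s *ᶠ m₁₂ (commutator G H)
      p₁₂ = by ((e +ᶠ -ᶠ l) ⊡ P ⊞ (-ᶠ (a +ᶠ -ᶠ d)) ⊡ Q ⊞ ((a +ᶠ -ᶠ d) *ᶠ l +ᶠ -ᶠ ((e +ᶠ -ᶠ l) *ᶠ d)) ⊡ T) (solve 12 (λ a b c d e f k l q r s t →
        let G = mat a b c d ; H = mat e f k l ; n = mat q r s t ; N = P.commutator G H in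
        r :* m₂₁ N :+ ((e :+ :- l) :* :0 :+ :- (a :+ :- d) :* :0 :+ ((a :+ :- d) :* l :+ :- ((e :+ :- l) :* d)) :* :0)
        := s :* m₁₂ N :+ ((e :+ :- l) :* P.tr (P.mul G n) :+ :- (a :+ :- d) :* P.tr (P.mul H n) :+ ((a :+ :- d) :* l :+ :- ((e :+ :- l) :* d)) :* P.tr n)) refl a b c d e f k l q r s t)

    tr-sub : ∀ X Y → tr X ≡ tr Y → tr (add Y (neg X)) ≡ 0#
    tr-sub (mat a _ _ d) (mat e _ _ h) q = by (sym q) (solve 4 (λ a d e h → e :+ :- a :+ (h :+ :- d) :+ (a :+ d) := :0 :+ (e :+ h)) refl a d e h)

    multiple : ∀ x y → trace x ≡ trace y → trace (g ∙ x) ≡ trace (g ∙ y) → trace (h ∙ x) ≡ trace (h ∙ y) → Multiple x y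
    multiple x y t u v = build (Parallel⇒multiple {first₃ n} (proj₁ nonzero-entry) (proj₂ nonzero-entry)
      (orthogonal (matrix g) (matrix h) n (tr-sub (matrix x) (matrix y) t)
        (trans (cong tr (sym (mul-sub-distribˡ (matrix g) (matrix y) (matrix x)))) (tr-sub (matrix (g ∙ x)) (matrix (g ∙ y)) u))
        (trans (cong tr (sym (mul-sub-distribˡ (matrix h) (matrix y) (matrix x)))) (tr-sub (matrix (h ∙ x)) (matrix (h ∙ y)) v))))
      where
      n = add (matrix y) (neg (matrix x))
      shift : ∀ a b c → b +ᶠ -ᶠ a ≡ c → b ≡ a +ᶠ c
      shift a b c e = by e (solve 3 (λ a b c → b :+ c := a :+ c :+ (b :+ :- a)) refl a b c)
      build : (∃ λ k → ∀ j → first₃ n j ≡ k *ᶠ first₃ N j) → Multiple x y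
      build (k , e) = k , mat-≡ (shift (m₁₁ (matrix x)) _ _ (e 0F)) (shift (m₁₂ (matrix x)) _ _ (e 1F)) (shift (m₂₁ (matrix x)) _ _ (e 2F))
        (by (sym t ⊞ sym (e 0F) ⊞ k ⊡ sym (tr-commutator (matrix g) (matrix h)))
          (solve 7 (λ a d e h k s t → h :+ (a :+ d :+ (e :+ :- a) :+ k :* (s :+ t)) := d :+ k :* t :+ (e :+ h :+ k :* s :+ k :* :0))
            refl (m₁₁ (matrix x)) (m₂₂ (matrix x)) (m₁₁ (matrix y)) (m₂₂ (matrix y)) k (m₁₁ N) (m₂₂ N)))

    det-line : ∀ X M k → det (add X (scalar k M)) ≡ det X +ᶠ k *ᶠ (m₁₁ X *ᶠ m₂₂ M +ᶠ m₁₁ M *ᶠ m₂₂ X +ᶠ -ᶠ (m₁₂ X *ᶠ m₂₁ M +ᶠ m₂₁ X *ᶠ m₁₂ M) +ᶠ k *ᶠ det M)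
    det-line (mat a b c d) (mat e f s t) k = solve 9 (λ a b c d e f s t k → P.det (P.add (mat a b c d) (P.scalar k (mat e f s t))) :=
      P.det (mat a b c d) :+ k :* (a :* t :+ e :* d :+ :- (b :* s :+ c :* f) :+ k :* P.det (mat e f s t))) refl a b c d e f s t k

    step : ∀ x y ((k , _) : Multiple x y) → x ≢ y →
      m₁₁ (matrix x) *ᶠ m₂₂ N +ᶠ m₁₁ N *ᶠ m₂₂ (matrix x) +ᶠ -ᶠ (m₁₂ (matrix x) *ᶠ m₂₁ N +ᶠ m₂₁ (matrix x) *ᶠ m₁₂ N) +ᶠ k *ᶠ det N ≡ 0#
    step x y (k , e) x≢y = cases (zero-product (by (trans (sym (det-line (matrix x) N k)) (trans (cong det (sym e)) (trans (det≡1 y) (sym (det≡1 x)))))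
        (solve 2 (λ a b → b :+ a := :0 :+ (a :+ b)) refl (det (matrix x)) _)))
      where
      add-0 : ∀ X M → add X (scalar 0# M) ≡ X
      add-0 (mat a b c d) (mat e f s t) = mat-≡ (z a e) (z b f) (z c s) (z d t)
        where
        z : ∀ a e → a +ᶠ 0# *ᶠ e ≡ a
        z = solve 2 (λ a e → a :+ :0 :* e := a) refl
      cases : k ≡ 0# ⊎ _ ≡ 0# → _ ≡ 0#
      cases (inj₁ z) = contradiction (SL₂-≡ (sym (trans e (trans (cong (λ w → add (matrix x) (scalar w N)) z) (add-0 (matrix x) N))))) x≢y
      cases (inj₂ z) = z

    -- On the line x + k N the equation det = 1 is quadratic in k with leading coefficient det N ≠
    -- 0. One root is k = 0, which leaves one other.
    third : ∀ x y z → Multiple x y → Multiple x z → x ≢ y → x ≢ z → y ≡ z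
    third x y z m@(k , e) m′@(l , f) x≢y x≢z = SL₂-≡ (trans e (trans (cong (λ w → add (matrix x) (scalar w N)) k≡l) (sym f)))
      where
      k≡l : k ≡ l
      k≡l = *-cancelˡ (det N) d (by (trans (step x y m x≢y) (sym (step x z m′ x≢z)))
        (solve 4 (λ D k l b → D :* k :+ (b :+ l :* D) := D :* l :+ (b :+ k :* D)) refl (det N) k l _))

-- Growth in SL₂: centralisers, traces and involved tori.

module Expansion (𝔽 : FiniteField) where

  open import Data.Nat hiding (_≟_)
  open import Data.Nat.Properties hiding (_≟_)
  open import Data.List using ([]; _∷_)
  open import Data.List.Membership.Propositional using (_∈_)
  open import Data.List.Relation.Unary.Any using (here; there)
  open FiniteField 𝔽 using (0#; 1#; F-finite) renaming (_+_ to _+ᶠ_; _*_ to _*ᶠ_; -_ to -ᶠ_)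
  open Matrices 𝔽
  open Centralizers 𝔽
  open Conjugation 𝔽
  open Escape 𝔽
  open Twist 𝔽
  open Nonconcentration 𝔽
  open CentralizerCount 𝔽
  open SmallQuotients SL₂ SL₂-finite _∙_ ε _⁻¹ isGroup

  -- If x > 8, the 4 lost in passing to y is less than half of x. Otherwise x³ ≤ 8³ = 512.
  cube-bound : ∀ x y M → 0 < M → x ≤ y + 4 → y * (x * x) ≤ 8 * M → x ^ 3 ≤ 512 * M
  cube-bound x y M M>0 h k with x ≤? 8
  ... | yes x≤8 = ≤-trans (^-monoˡ-≤ 3 x≤8) (≤-trans (≤-reflexive (sym (*-identityʳ 512))) (*-monoʳ-≤ 512 M>0))
  ... | no x≰8 = ≤-trans (+-cancelʳ-≤ (x * (x * x)) _ _ (begin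
      x ^ 3 + x * (x * x)                    ≡⟨ e₁ x ⟩
      2 * (x * (x * x))                      ≤⟨ *-monoʳ-≤ 2 (*-monoˡ-≤ (x * x) h) ⟩
      2 * ((y + 4) * (x * x))                ≡⟨ e₂ y (x * x) ⟩
      2 * (y * (x * x)) + 8 * (x * x)        ≤⟨ +-mono-≤ (*-monoʳ-≤ 2 k) (*-monoˡ-≤ (x * x) (<⇒≤ (≰⇒> x≰8))) ⟩
      2 * (8 * M) + x * (x * x)              ∎))
    (≤-trans (≤-reflexive (sym (*-assoc 2 8 M))) (*-monoˡ-≤ M (m≤m+n 16 496)))
    where
    open ≤-Reasoning
    e₁ : ∀ x → x * (x * (x * 1)) + x * (x * x) ≡ 2 * (x * (x * x))
    e₁ = solve-∀
    e₂ : ∀ y s → 2 * ((y + 4) * s) ≡ 2 * (y * s) + 8 * s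
    e₂ = solve-∀

  -- E is the part of D known not to concentrate on cosets, and L measures the growth of D. The
  -- highest powers needed are the eighth, for `product`, and the ninth, for the conjugates of
  -- elements of D⁷ in `θ≤`.
  module Growth {D E : SL₂ → Set} (D? : ∀ g → Dec (D g)) (E? : ∀ g → Dec (E g)) (ε∈D : D ε) (D⁻¹ : ∀ g → D g → D (g ⁻¹))
    (E⊆D : ∀ g → E g → D g) (nc : Nonconcentrated E?) (L : ℕ)
    (bounded : ∀ j → j ≤ 9 → # (Powers.Pow? D? ε∈D D⁻¹ j) ≤ L * # D?) where

    open Powers D? ε∈D D⁻¹

    N : ℕ
    N = # D?

    N>0 : 0 < N
    N>0 = #-positive D? ε ε∈D

    Pow-conj : ∀ i j {g a} → Pow i g → Pow j a → Pow (i + j + i) (conj g a)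
    Pow-conj i j u v = Pow-∙ (i + j) i (Pow-∙ i j u v) (Pow-⁻¹ i u)

    L>0 : 0 < L
    L>0 = n≢0⇒n>0 λ { refl → contradiction (≤-trans (#-positive (Pow? 0) ε refl) (bounded 0 z≤n)) λ () }

    C? : ∀ a t → Dec (Pow 2 t × Commute t a)
    C? a t = Pow? 2 t ×? Commute? t a

    -- The centraliser is met with D² because two elements of D with the same effect on a give a
    -- quotient b₀⁻¹ b, as in `orbit`.
    χ : SL₂ → ℕ
    χ a = # (C? a)

    instance
      finite-SL₂² : Finite (SL₂ × SL₂)
      finite-SL₂² = ×-finite SL₂-finite SL₂-finite

      finite-SL₂³ : Finite (SL₂ × (SL₂ × SL₂))
      finite-SL₂³ = ×-finite SL₂-finite finite-SL₂²

    module _ (a : SL₂) (na : ¬ Central a) (g : SL₂) (g∈D : D g) (Δ≢0 : disc a (conj g a) ≢ 0#) where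

      private
        Good : SL₂ → Set
        Good t = ((Pow 2 t × Commute t a) × ¬ Central t) × ¬ Exceptional a (conj g t)

        Good? : ∀ t → Dec (Good t)
        Good? t = (C? a t ×? ¬? (Central? t)) ×? ¬? (a ∙ conj g t ≟ conj g t ∙ a ⁻¹)

        γ : ℕ
        γ = # Good?

      -- The loss consists of two central elements and at most two exceptional ones.
      χ≤good : χ a ≤ γ + 4
      χ≤good = begin
        χ a                                          ≡⟨ #-split (C? a) Central? ⟩
        # Z? + # NZ?                                 ≡⟨ cong (# Z? +_) (#-split NZ? E₀?) ⟩
        # Z? + (# (λ t → NZ? t ×? E₀? t) + γ)        ≤⟨ +-mono-≤ (≤-trans (#-mono Z? Central? (λ _ → proj₂)) #Central) (+-monoˡ-≤ γ exceptional) ⟩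
        2 + (2 + γ)                                  ≡⟨ e γ ⟩
        γ + 4                                        ∎
        where
        open ≤-Reasoning
        e : ∀ γ → 2 + (2 + γ) ≡ γ + 4
        e = solve-∀
        Z? = λ t → C? a t ×? Central? t
        NZ? = λ t → C? a t ×? ¬? (Central? t)
        E₀? = λ t → a ∙ conj g t ≟ conj g t ∙ a ⁻¹
        exceptional : # (λ t → NZ? t ×? E₀? t) ≤ 2
        exceptional = #-inhabited _ λ t₀ (((_ , c₀) , _) , e₀) → #-list _ (t₀ ∷ negate t₀ ∷ []) λ t (((_ , c) , _) , e₁) →
          member (few-exceptional a g t t₀ na Δ≢0 c c₀ e₁ e₀)
          where
          member : ∀ {t t₀} → t ≡ t₀ ⊎ t ≡ negate t₀ → t ∈ t₀ ∷ negate t₀ ∷ []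
          member (inj₁ e) = here e
          member (inj₂ e) = there (here e)

      private
        product : SL₂ × (SL₂ × SL₂) → SL₂
        product (t , (u , v)) = (u ∙ conj g t) ∙ v

        Image? : (z : SL₂ × SL₂) → Dec (Good (proj₁ z) × (Pow 8 (proj₂ z) × disc a (proj₂ z) ≡ disc a (conj g (proj₁ z))))
        Image? (t , w) = Good? t ×? (Pow? 8 w ×? (disc a w ≟ disc a (conj g t)))

        -- Since w determines disc a (conj g t), `same-disc` leaves four values of t.
        images : # Image? ≤ # (Pow? 8) * 4
        images = #-cover Image? (Pow? 8) (λ z w → proj₂ z ≟ w) 4 (λ (t , w) (_ , (q , _)) → w , q , refl)
          λ w _ → #-inhabited (λ z → Image? z ×? (proj₂ z ≟ w)) λ { (t₀ , .w) ((((( _ , c₀) , _) , _) , (_ , d₀)) , refl) →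
            #-list (λ z → Image? z ×? (proj₂ z ≟ w)) ((t₀ , w) ∷ (negate t₀ , w) ∷ (t₀ ⁻¹ , w) ∷ (negate (t₀ ⁻¹) , w) ∷ [])
              λ { (t , .w) ((((( _ , c) , _) , _) , (_ , d)) , refl) →
                member (same-disc a g t₀ t na Δ≢0 c₀ c (trans (sym d) d₀)) } }
          where
          member : ∀ {t t₀ w : SL₂} → t ≡ t₀ ⊎ t ≡ negate t₀ ⊎ t ≡ t₀ ⁻¹ ⊎ t ≡ negate (t₀ ⁻¹) →
            (t , w) ∈ (t₀ , w) ∷ (negate t₀ , w) ∷ (t₀ ⁻¹ , w) ∷ (negate (t₀ ⁻¹) , w) ∷ []
          member {w = w} (inj₁ e) = here (cong (_, w) e)
          member {w = w} (inj₂ (inj₁ e)) = there (here (cong (_, w) e))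
          member {w = w} (inj₂ (inj₂ (inj₁ e))) = there (there (here (cong (_, w) e)))
          member {w = w} (inj₂ (inj₂ (inj₂ e))) = there (there (there (here (cong (_, w) e))))

        Triple? : (z : SL₂ × (SL₂ × SL₂)) → Dec (Good (proj₁ z) × ((Pow 2 (proj₁ (proj₂ z)) × Commute (proj₁ (proj₂ z)) a) × (Pow 2 (proj₂ (proj₂ z)) × Commute (proj₂ (proj₂ z)) a)))
        Triple? (t , (u , v)) = Good? t ×? (C? a u ×? C? a v)

        -- Let X = conj g t. Two preimages (t, u, v) and (t, u₀, v₀) satisfy u₀⁻¹ u X = X v₀ v⁻¹. By
        -- `twist` and the choice of t, u₀⁻¹ u is central, hence ±1, and v follows from u.
        triples : # Triple? ≤ # Image? * 2
        triples = #-cover Triple? Image? (λ z y → proj₁ z ≟ proj₁ y ×? product z ≟ proj₂ y) 2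
          (λ { (t , (u , v)) (gd@(((pt , ct) , _) , _) , ((pu , cu) , (pv , cv))) → (t , product (t , (u , v))) ,
              (gd , Pow-∙ 6 2 {u ∙ conj g t} {v} (Pow-∙ 2 4 {u} {conj g t} pu (Pow-conj 1 2 {g} {t} (Pow-1 g∈D) pt)) pv , disc-sandwich a u (conj g t) v cu cv) , refl , refl })
          λ { (t , w) (gd , _) → #-inhabited _ λ { (.t , (u₀ , v₀)) ((_ , ((_ , cu₀) , (_ , cv₀))) , refl , e₀) →
            #-list _ (candidate t w u₀ ∷ candidate t w (u₀ ∙ negate ε) ∷ []) λ { (.t , (u , v)) ((_ , ((_ , cu) , (_ , cv))) , refl , e) →
              member t w u₀ u v (sym (yx⁻¹ t u v w e))
                (central t gd u₀ v₀ u v cu₀ cv₀ cu cv (trans e (sym e₀))) } } }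
          where
          candidate : SL₂ → SL₂ → SL₂ → SL₂ × (SL₂ × SL₂)
          candidate t w u = t , (u , (u ∙ conj g t) ⁻¹ ∙ w)
          yx⁻¹ : ∀ t u v w → (u ∙ conj g t) ∙ v ≡ w → (u ∙ conj g t) ⁻¹ ∙ w ≡ v
          yx⁻¹ t u v w e = trans (cong ((u ∙ conj g t) ⁻¹ ∙_) (sym e)) (x⁻¹∙xy (u ∙ conj g t) v)
          central : ∀ t → Good t → ∀ u₀ v₀ u v → Commute u₀ a → Commute v₀ a → Commute u a → Commute v a →
            (u ∙ conj g t) ∙ v ≡ (u₀ ∙ conj g t) ∙ v₀ → u ≡ u₀ ⊎ u ≡ u₀ ∙ negate ε
          central t (((_ , ct) , nt) , ne) u₀ v₀ u v cu₀ cv₀ cu cv e = pick (twist a X (u₀ ⁻¹ ∙ u) (v₀ ∙ v ⁻¹) na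
              (disc-nonzero a g t na Δ≢0 ct nt) (Commute-∙ {u₀ ⁻¹} {u} {a} (Commute-⁻¹ {u₀} {a} cu₀) cu)
              (Commute-∙ {v₀} {v ⁻¹} {a} cv₀ (Commute-⁻¹ {v} {a} cv)) tX)
            where
            X = conj g t
            open ≡-Reasoning
            tX : (u₀ ⁻¹ ∙ u) ∙ X ≡ X ∙ (v₀ ∙ v ⁻¹)
            tX = begin
              (u₀ ⁻¹ ∙ u) ∙ X                       ≡⟨ assoc (u₀ ⁻¹) u X ⟩
              u₀ ⁻¹ ∙ (u ∙ X)                       ≡⟨ cong (u₀ ⁻¹ ∙_) (yx∙x⁻¹ v (u ∙ X)) ⟨
              u₀ ⁻¹ ∙ (((u ∙ X) ∙ v) ∙ v ⁻¹)        ≡⟨ cong (λ w → u₀ ⁻¹ ∙ (w ∙ v ⁻¹)) e ⟩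
              u₀ ⁻¹ ∙ (((u₀ ∙ X) ∙ v₀) ∙ v ⁻¹)      ≡⟨ cong (u₀ ⁻¹ ∙_) (trans (assoc (u₀ ∙ X) v₀ (v ⁻¹)) (assoc u₀ X (v₀ ∙ v ⁻¹))) ⟩
              u₀ ⁻¹ ∙ (u₀ ∙ (X ∙ (v₀ ∙ v ⁻¹)))      ≡⟨ x⁻¹∙xy u₀ (X ∙ (v₀ ∙ v ⁻¹)) ⟩
              X ∙ (v₀ ∙ v ⁻¹)                       ∎
            recover : ∀ z → u₀ ⁻¹ ∙ u ≡ z → u ≡ u₀ ∙ z
            recover z q = trans (sym (x∙x⁻¹y u₀ u)) (cong (u₀ ∙_) q)
            sign : u₀ ⁻¹ ∙ u ≡ ε ⊎ u₀ ⁻¹ ∙ u ≡ negate ε → u ≡ u₀ ⊎ u ≡ u₀ ∙ negate ε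
            sign (inj₁ q) = inj₁ (trans (recover ε q) (identityʳ u₀))
            sign (inj₂ q) = inj₂ (recover (negate ε) q)
            pick : Central (u₀ ⁻¹ ∙ u) ⊎ a ∙ X ≡ X ∙ a ⁻¹ → u ≡ u₀ ⊎ u ≡ u₀ ∙ negate ε
            pick (inj₁ z) = sign (Central⇒±ε (u₀ ⁻¹ ∙ u) z)
            pick (inj₂ z) = contradiction z ne
          member : ∀ t w u₀ u v → v ≡ (u ∙ conj g t) ⁻¹ ∙ w → u ≡ u₀ ⊎ u ≡ u₀ ∙ negate ε →
            (t , (u , v)) ∈ candidate t w u₀ ∷ candidate t w (u₀ ∙ negate ε) ∷ []
          member t w u₀ u v f (inj₁ refl) = here (cong (λ x → t , (u , x)) f)
          member t w u₀ u v f (inj₂ refl) = there (here (cong (λ x → t , (u , x)) f))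

      -- A Larsen-Pink inequality: the product of three copies of a one-dimensional centraliser, the
      -- middle one moved into general position by g, maps to the three-dimensional group with
      -- bounded multiplicity. Here 8 = 4 · 2 collects the two multiplicities.
      centralizer³-good : γ * (χ a * χ a) ≤ 8 * (L * N)
      centralizer³-good = begin
        γ * (χ a * χ a)       ≡⟨ trans (cong (γ *_) (sym (#-× (C? a) (C? a)))) (sym (#-× Good? (λ (u , v) → C? a u ×? C? a v))) ⟩
        # Triple?             ≤⟨ triples ⟩
        # Image? * 2          ≤⟨ *-monoˡ-≤ 2 images ⟩
        # (Pow? 8) * 4 * 2    ≤⟨ *-monoˡ-≤ 2 (*-monoˡ-≤ 4 (bounded 8 (n≤1+n 8))) ⟩
        L * N * 4 * 2         ≡⟨ e (L * N) ⟩
        8 * (L * N)           ∎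
        where
        open ≤-Reasoning
        e : ∀ x → x * 4 * 2 ≡ 8 * x
        e = solve-∀

    opaque
      ξ : ℕ
      ξ = proj₁ (integer-root 2 (512 * (L * N)))

      ξ³≤ : ξ ^ 3 ≤ 512 * (L * N)
      ξ³≤ = proj₁ (proj₂ (integer-root 2 (512 * (L * N))))

      ξ³> : 512 * (L * N) < suc ξ ^ 3
      ξ³> = proj₂ (proj₂ (integer-root 2 (512 * (L * N))))

      χ≤ξ : ∀ a → ¬ Central a → χ a ≤ ξ
      χ≤ξ a na = helper (escape E? nc a na)
        where
        helper : (∃ λ g → E g × disc a (conj g a) ≢ 0#) → χ a ≤ ξ
        helper (g , e , d) = ≮⇒≥ λ ξ<χ → <⇒≱ (≤-<-trans (cube-bound (χ a) _ (L * N) (*-mono-≤ L>0 N>0)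
          (χ≤good a na g (E⊆D g e) d) (centralizer³-good a na g (E⊆D g e) d)) ξ³>) (^-monoˡ-≤ 3 ξ<χ)

    Class? : ∀ j τ h → Dec (Pow j h × trace h ≡ τ)
    Class? j τ h = Pow? j h ×? trace h ≟ τ

    -- Orbit and stabiliser for conjugation by D: elements b with the same conjugate of a differ by
    -- an element of D² that commutes with a.
    orbit : ∀ j a → Pow j a → N ≤ # (Class? (1 + j + 1) (trace a)) * χ a
    orbit j a pa = #-cover D? (Class? (1 + j + 1) (trace a)) (λ b h → conj b a ≟ h) (χ a)
      (λ b d → conj b a , (Pow-conj 1 j {b} {a} (Pow-1 d) pa , trace-conj b a) , refl)
      λ h _ → #-inhabited (λ b → D? b ×? conj b a ≟ h) λ b₀ (d₀ , e₀) →
        #-injection (λ b → D? b ×? conj b a ≟ h) (C? a) (b₀ ⁻¹ ∙_)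
          (λ b (d , e) → Pow-∙ 1 1 {b₀ ⁻¹} {b} (Pow-1 (D⁻¹ b₀ d₀)) (Pow-1 d) ,
             conj-fixed⇒Commute (b₀ ⁻¹ ∙ b) a (trans (conj-∙ (b₀ ⁻¹) b a)
               (trans (cong (conj (b₀ ⁻¹)) (trans e (sym e₀))) (conj-inverse b₀ a))))
          (λ b b′ _ _ q → trans (sym (x∙x⁻¹y b₀ b)) (trans (cong (b₀ ∙_) q) (x∙x⁻¹y b₀ b′)))

    -- Seven is the power of D that contains (g a g⁻¹) y for a, g ∈ D and y ∈ D⁴, the products whose
    -- traces `class≤` needs.
    T? : ∀ τ → Dec (∃ λ g → Pow 7 g × trace g ≡ τ)
    T? τ = ∃? (Class? 7 τ)

    θ : ℕ
    θ = # T?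

    -- If τ is the trace of a noncentral element of D⁷, `orbit` gives at least N / ξ elements of
    -- that trace in D⁹. As D⁹ has at most L N elements there are at most ξ L such τ; the central
    -- elements add two.
    θ≤ : θ ≤ 2 + ξ * L
    θ≤ = ≤-trans (#-∪ T? T₀? T₁? cover) (+-mono-≤ central noncentral)
      where
      T₀? : ∀ τ → Dec (∃ λ g → Central g × trace g ≡ τ)
      T₀? τ = ∃? λ g → Central? g ×? trace g ≟ τ
      T₁? : ∀ τ → Dec (∃ λ g → (Pow 7 g × ¬ Central g) × trace g ≡ τ)
      T₁? τ = ∃? λ g → (Pow? 7 g ×? ¬? (Central? g)) ×? trace g ≟ τ
      cover : ∀ τ → (∃ λ g → Pow 7 g × trace g ≡ τ) → (∃ λ g → Central g × trace g ≡ τ) ⊎ (∃ λ g → (Pow 7 g × ¬ Central g) × trace g ≡ τ)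
      cover τ (g , q , e) = split (Central? g)
        where
        split : Dec (Central g) → _ ⊎ _
        split (yes z) = inj₁ (g , z , e)
        split (no z) = inj₂ (g , (q , z) , e)
      central : # T₀? ≤ 2
      central = #-list T₀? (trace ε ∷ trace (negate ε) ∷ []) λ τ (g , z , e) → member τ g e (Central⇒±ε g z)
        where
        member : ∀ τ g → trace g ≡ τ → g ≡ ε ⊎ g ≡ negate ε → τ ∈ trace ε ∷ trace (negate ε) ∷ []
        member τ g e (inj₁ q) = here (trans (sym e) (cong trace q))
        member τ g e (inj₂ q) = there (here (trans (sym e) (cong trace q)))
      noncentral : # T₁? ≤ ξ * L
      noncentral = *-cancelʳ-≤ _ _ N {{>-nonZero N>0}} (begin
        # T₁? * N                                            ≡⟨ ∑-*ʳ N _ ⟨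
        ∑ (λ τ → ⟦ T₁? τ ⟧ * N)                              ≤⟨ ∑-mono (λ τ → ⟦⟧-gate (T₁? τ) λ (g , (q , z) , e) →
            ≤-trans (orbit 7 g q) (*-mono-≤ (≤-reflexive (cong (λ w → # (Class? 9 w)) e)) (χ≤ξ g z))) ⟩
        ∑ (λ τ → # (Class? 9 τ) * ξ)                         ≡⟨ ∑-*ʳ ξ _ ⟩
        ∑ (λ τ → # (Class? 9 τ)) * ξ                         ≡⟨ cong (_* ξ) classes ⟩
        # (Pow? 9) * ξ                                       ≤⟨ *-monoˡ-≤ ξ (bounded 9 ≤-refl) ⟩
        L * N * ξ                                            ≡⟨ e L N ξ ⟩
        ξ * L * N                                            ∎)
        where
        open ≤-Reasoning
        e : ∀ L N ξ → L * N * ξ ≡ ξ * L * N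
        e = solve-∀
        classes : ∑ (λ τ → # (Class? 9 τ)) ≡ # (Pow? 9)
        classes = trans (∑-swap (λ τ h → ⟦ Class? 9 τ h ⟧)) (∑-cong λ h → trans (∑-cong λ τ →
          trans (⟦⟧-× (Pow? 9 h) (trace h ≟ τ)) (trans (*-comm ⟦ Pow? 9 h ⟧ _) (cong (_* ⟦ Pow? 9 h ⟧) (⟦⟧-cong (trace h ≟ τ) (τ ≟ trace h) sym sym))))
          (∑-pick (trace h) (λ _ → ⟦ Pow? 9 h ⟧)))

    -- Take a, g ∈ E with a and g a g⁻¹ in general position. An element y is then known up to two
    -- choices from the traces of y, a y and g a g⁻¹ y; the first is τ, and each of the others takes
    -- at most θ values.
    class≤ : ∀ τ → # (Class? 4 τ) ≤ θ * θ * 2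
    class≤ τ = start (nonCentral-element E? nc)
      where
      pair : ∀ a g → D a → D g → disc a (conj g a) ≢ 0# → # (Class? 4 τ) ≤ θ * θ * 2
      pair a g a∈D g∈D Δ≢0 = ≤-trans
        (#-cover (Class? 4 τ) (λ (σ , σ′) → T? σ ×? T? σ′) (λ y (σ , σ′) → trace (a ∙ y) ≟ σ ×? trace (conj g a ∙ y) ≟ σ′) 2
          (λ y (q , _) → (trace (a ∙ y) , trace (conj g a ∙ y)) ,
            ((a ∙ y , Pow-+ 2 5 {a ∙ y} (Pow-∙ 1 4 {a} {y} (Pow-1 a∈D) q) , refl) ,
             (conj g a ∙ y , Pow-∙ 3 4 {conj g a} {y} (Pow-conj 1 1 {g} {a} (Pow-1 g∈D) (Pow-1 a∈D)) q , refl)) , refl , refl)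
          λ (σ , σ′) _ → #trace-fibre a (conj g a) Δ≢0 (Class? 4 τ) τ σ σ′ (λ y → proj₂))
        (≤-reflexive (cong (_* 2) (#-× T? T?)))
      start : (∃ λ g → E g × ¬ Central g) → # (Class? 4 τ) ≤ θ * θ * 2
      start (a , ea , na) = next (escape E? nc a na)
        where
        next : (∃ λ g → E g × disc a (conj g a) ≢ 0#) → # (Class? 4 τ) ≤ θ * θ * 2
        next (g , eg , d) = pair a g (E⊆D a ea) (E⊆D g eg) d

    -- The converse of `χ≤ξ`: small trace classes mean small orbits, hence large stabilisers.
    rich : ∀ a → Pow 2 a → N ≤ θ * θ * 2 * χ a
    rich a pa = ≤-trans (orbit 2 a pa) (*-monoˡ-≤ (χ a) (class≤ (trace a)))

    module _ (big : 4 * L * (θ * θ) < N) where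

      -- The threshold 2L comes from `pivot`, where a map that is at most two-to-one into a set of
      -- at most L N elements has to be excluded.
      χ>2L : ∀ a → Pow 2 a → 2 * L < χ a
      χ>2L a pa = ≰⇒> λ small → <⇒≱ big (≤-trans (rich a pa) (≤-trans (*-monoʳ-≤ (θ * θ * 2) small) (≤-reflexive (e (θ * θ) L))))
        where
        e : ∀ t L → t * 2 * (2 * L) ≡ 4 * L * t
        e = solve-∀

      -- Otherwise D would lie in the classes of trace 2 and -2, each with at most 2θ² elements.
      regular-element : ∃ λ t → D t × Regular t
      regular-element = extract (∃? λ t → D? t ×? ¬? (trace t *ᶠ trace t ≟ (1# +ᶠ 1#) *ᶠ (1# +ᶠ 1#)))
        where
        extract : Dec (∃ λ t → D t × Regular t) → ∃ λ t → D t × Regular t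
        extract (yes w) = w
        extract (no ¬w) = contradiction (begin
            N                                    ≤⟨ #-∪ D? (Class? 4 (1# +ᶠ 1#)) (Class? 4 (-ᶠ (1# +ᶠ 1#))) (λ t d →
                                                      classify t d (¬Regular⇒trace t (decidable-stable (_ ≟ _) λ r → ¬w (t , d , r)))) ⟩
            # (Class? 4 (1# +ᶠ 1#)) + # (Class? 4 (-ᶠ (1# +ᶠ 1#)))  ≤⟨ +-mono-≤ (class≤ _) (class≤ _) ⟩
            θ * θ * 2 + θ * θ * 2                ≡⟨ e (θ * θ) ⟩
            4 * (θ * θ) * 1                      ≤⟨ *-monoʳ-≤ (4 * (θ * θ)) L>0 ⟩
            4 * (θ * θ) * L                      ≡⟨ e′ (θ * θ) L ⟩
            4 * L * (θ * θ)                      ∎) (<⇒≱ big)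
          where
          open ≤-Reasoning
          e : ∀ t → t * 2 + t * 2 ≡ 4 * t * 1
          e = solve-∀
          e′ : ∀ t L → 4 * t * L ≡ 4 * L * t
          e′ = solve-∀
          classify : ∀ t → D t → trace t ≡ 1# +ᶠ 1# ⊎ trace t ≡ -ᶠ (1# +ᶠ 1#) →
            (Pow 4 t × trace t ≡ 1# +ᶠ 1#) ⊎ (Pow 4 t × trace t ≡ -ᶠ (1# +ᶠ 1#))
          classify t d (inj₁ q) = inj₁ (Pow-+ 3 1 {t} (Pow-1 d) , q)
          classify t d (inj₂ q) = inj₂ (Pow-+ 3 1 {t} (Pow-1 d) , q)

      -- For noncentral x this depends only on the centraliser of x: it must contain a noncentral
      -- element of D². By `rich` it then contains many.
      Involved : SL₂ → Set
      Involved x = ¬ Central x × ∃ λ y → (Pow 2 y × ¬ Central y) × Commute y x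

      Involved? : ∀ x → Dec (Involved x)
      Involved? x = ¬? (Central? x) ×? ∃? λ y → (Pow? 2 y ×? ¬? (Central? y)) ×? Commute? y x

      -- If Pow 2 met C(x′) only in the centre, (t , d) ↦ btb⁻¹d would be two-to-one from C(y) × D into Pow 5.
      pivot : ∀ b → D b → ∀ x → Involved x → Involved (conj b x)
      pivot b d x (nx , y , (py , ny) , c) = decidable-stable (Involved? x′) λ ¬inv →
          <⇒≱ (χ>2L y py) (*-cancelʳ-≤ _ _ N {{>-nonZero N>0}} (begin
            χ y * N                       ≡⟨ #-× (C? y) D? ⟨
            # Pair?                       ≤⟨ #-cover Pair? (Pow? 5) (λ z w → image z ≟ w) 2
                (λ (t , h) ((pt , _) , dh) → image (t , h) , Pow-∙ 4 1 {conj b t} {h} (Pow-conj 1 2 {b} {t} (Pow-1 d) pt) (Pow-1 dh) , refl)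
                (λ w _ → #-inhabited (λ z → Pair? z ×? image z ≟ w) λ (t₀ , h₀) (((pt₀ , ct₀) , dh₀) , e₀) →
                  #-list (λ z → Pair? z ×? image z ≟ w) (candidate w t₀ ∷ candidate w (t₀ ∙ negate ε) ∷ []) λ (t , h) (((pt , ct) , dh) , e) →
                    member w t₀ t h (solve-h t h w e) (sign t₀ t (central ¬inv t₀ h₀ t h ct₀ dh₀ ct dh (trans e (sym e₀))))) ⟩
            # (Pow? 5) * 2                ≤⟨ *-monoˡ-≤ 2 (bounded 5 (m≤m+n 5 4)) ⟩
            L * N * 2                     ≡⟨ e₁ L N ⟩
            2 * L * N                     ∎))
        where
        open ≤-Reasoning
        e₁ : ∀ L N → L * N * 2 ≡ 2 * L * N
        e₁ = solve-∀
        x′ : SL₂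
        x′ = conj b x
        Pair? : (z : SL₂ × SL₂) → Dec ((Pow 2 (proj₁ z) × Commute (proj₁ z) y) × D (proj₂ z))
        Pair? (t , h) = C? y t ×? D? h
        image : SL₂ × SL₂ → SL₂
        image (t , h) = conj b t ∙ h
        candidate : SL₂ → SL₂ → SL₂ × SL₂
        candidate w t = t , conj b t ⁻¹ ∙ w
        solve-h : ∀ t h w → conj b t ∙ h ≡ w → h ≡ conj b t ⁻¹ ∙ w
        solve-h t h w e = trans (sym (x⁻¹∙xy (conj b t) h)) (cong (conj b t ⁻¹ ∙_) e)
        central : ¬ Involved x′ → ∀ t₀ h₀ t h → Commute t₀ y → D h₀ → Commute t y → D h → conj b t ∙ h ≡ conj b t₀ ∙ h₀ → Central (t₀ ⁻¹ ∙ t)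
        central ¬inv t₀ h₀ t h c₀ d₀ c₁ d₁ e = Central-conj b (t₀ ⁻¹ ∙ t) (decidable-stable (Central? s) λ ns →
          ¬inv (nx ∘ Central-conj b x , s , (subst (Pow 2) (sym s≡) (Pow-∙ 1 1 {h₀} {h ⁻¹} (Pow-1 d₀) (Pow-1 (D⁻¹ h d₁))) , ns) ,
            Commute-conj b {t₀ ⁻¹ ∙ t} {x} (Commute-trans {t₀ ⁻¹ ∙ t} {y} {x} ny (Commute-∙ {t₀ ⁻¹} {t} {y} (Commute-⁻¹ {t₀} {y} c₀) c₁) c)))
          where
          s : SL₂
          s = conj b (t₀ ⁻¹ ∙ t)
          s≡ : s ≡ h₀ ∙ h ⁻¹
          s≡ = trans (conj-homo b (t₀ ⁻¹) t) (trans (cong (_∙ conj b t) (conj-⁻¹ b t₀)) (trans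
            (cong (conj b t₀ ⁻¹ ∙_) (trans (sym (yx∙x⁻¹ h (conj b t))) (trans (cong (_∙ h ⁻¹) e) (assoc (conj b t₀) h₀ (h ⁻¹)))))
            (x⁻¹∙xy (conj b t₀) (h₀ ∙ h ⁻¹))))
        sign : ∀ t₀ t → Central (t₀ ⁻¹ ∙ t) → t ≡ t₀ ⊎ t ≡ t₀ ∙ negate ε
        sign t₀ t z = cases (Central⇒±ε (t₀ ⁻¹ ∙ t) z)
          where
          cases : t₀ ⁻¹ ∙ t ≡ ε ⊎ t₀ ⁻¹ ∙ t ≡ negate ε → t ≡ t₀ ⊎ t ≡ t₀ ∙ negate ε
          cases (inj₁ q) = inj₁ (trans (sym (x∙x⁻¹y t₀ t)) (trans (cong (t₀ ∙_) q) (identityʳ t₀)))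
          cases (inj₂ q) = inj₂ (trans (sym (x∙x⁻¹y t₀ t)) (cong (t₀ ∙_) q))
        member : ∀ w t₀ t h → h ≡ conj b t ⁻¹ ∙ w → t ≡ t₀ ⊎ t ≡ t₀ ∙ negate ε → (t , h) ∈ candidate w t₀ ∷ candidate w (t₀ ∙ negate ε) ∷ []
        member w t₀ t h f (inj₁ refl) = here (cong (t ,_) f)
        member w t₀ t h f (inj₂ refl) = there (here (cong (t ,_) f))

      -- Asking for h and h⁻¹ alike makes closure under inverses immediate, so that `Preserves` is a
      -- subgroup.
      Preserves : SL₂ → Set
      Preserves h = (∀ x → Involved x → Involved (conj h x)) × (∀ x → Involved x → Involved (conj (h ⁻¹) x))

      Preserves? : ∀ h → Dec (Preserves h)
      Preserves? h = (∀? λ x → Involved? x →-dec Involved? (conj h x)) ×? (∀? λ x → Involved? x →-dec Involved? (conj (h ⁻¹) x))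

      -- If this subgroup were proper, E would have an element outside it, contrary to `pivot`.
      all-preserve : ∀ h → Preserves h
      all-preserve h = decidable-stable (Preserves? h) λ missing → refute (proper-escape E? nc Preserves? (proper missing))
        where
        proper : ¬ Preserves h → IsProper Preserves
        proper missing = record
          { ε∈ = (λ x → subst Involved (sym (conj-ε x))) , (λ x → subst Involved (sym (trans (cong (λ w → conj w x) ε⁻¹≈ε) (conj-ε x))))
          ; ∙-closed = λ {g} {k} (p , p′) (q , q′) →
              (λ x i → subst Involved (sym (conj-∙ g k x)) (p (conj k x) (q x i))) ,
              (λ x i → subst Involved (trans (sym (conj-∙ (k ⁻¹) (g ⁻¹) x)) (cong (λ w → conj w x) (sym (⁻¹-anti-homo-∙ g k)))) (q′ (conj (g ⁻¹) x) (p′ x i)))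
          ; ⁻¹-closed = λ {g} (p , p′) → p′ , (λ x i → subst (λ w → Involved (conj w x)) (sym (⁻¹-involutive g)) (p x i))
          ; missing = h , missing }
          where open import Algebra.Properties.Group group using (ε⁻¹≈ε)
        refute : ¬ ∃ λ g → E g × ¬ Preserves g
        refute (g , e , n) = n (pivot g (E⊆D g e) , pivot (g ⁻¹) (D⁻¹ g (E⊆D g e)))

      -- Counts the pairs of g in the group and noncentral t ∈ D² commuting with conj g t₀, where t₀
      -- ∈ D is regular. All these conjugates are involved, so each g has at least N / 6θ² partners.
      -- Each t has at most 4p partners by `#conjugators`, and D² has at most L N elements.
      expansion : # (λ (g : SL₂) → yes tt) ≤ 24 * (p * (L * (θ * θ)))
      expansion = finish regular-element
        where
        finish : (∃ λ t → D t × Regular t) → # (λ (g : SL₂) → yes tt) ≤ 24 * (p * (L * (θ * θ)))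
        finish (t₀ , d₀ , r₀) = *-cancelʳ-≤ _ _ N {{>-nonZero N>0}} (begin
            # (λ (g : SL₂) → yes tt) * N                 ≡⟨ ∑-*ʳ N _ ⟨
            ∑ (λ (g : SL₂) → ⟦ yes tt ⟧ * N)             ≤⟨ ∑-mono (λ g → ⟦⟧-gate (yes tt) λ _ → local g) ⟩
            ∑ (λ g → θ * θ * 6 * # (Z? g))               ≡⟨ ∑-*ˡ (θ * θ * 6) _ ⟩
            θ * θ * 6 * ∑ (λ g → # (Z? g))               ≤⟨ *-monoʳ-≤ (θ * θ * 6) total ⟩
            θ * θ * 6 * (L * N * (p * 4))                ≡⟨ e (θ * θ) L N p ⟩
            24 * (p * (L * (θ * θ))) * N                 ∎)
          where
          open ≤-Reasoning
          e : ∀ t L N p → t * 6 * (L * N * (p * 4)) ≡ 24 * (p * (L * t)) * N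
          e = solve-∀
          n₀ : ¬ Central t₀
          n₀ z = Central⇒¬Regular t₀ z r₀
          Z? : ∀ g t → Dec ((Pow 2 t × ¬ Central t) × Commute t (conj g t₀))
          Z? g t = (Pow? 2 t ×? ¬? (Central? t)) ×? Commute? t (conj g t₀)
          involved : ∀ g → Involved (conj g t₀)
          involved g = proj₁ (all-preserve g) t₀ (n₀ , t₀ , (Pow-+ 1 1 {t₀} (Pow-1 d₀) , n₀) , refl)
          -- As χ > 2L ≥ 2, at least three elements are present, and omitting the two central ones
          -- costs at most a factor 3.
          triple : ∀ {x z} → 3 ≤ x → x ≤ 2 + z → x ≤ 3 * z
          triple {x} {z} h k = ≤-trans k (≤-trans (+-monoˡ-≤ z (*-monoʳ-≤ 2 (+-cancelˡ-≤ 2 1 z (≤-trans h k)))) (≤-reflexive (e₃ z)))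
            where
            e₃ : ∀ z → 2 * z + z ≡ 3 * z
            e₃ = solve-∀
          local : ∀ g → N ≤ θ * θ * 6 * # (Z? g)
          local g = from (involved g)
            where
            from : Involved (conj g t₀) → N ≤ θ * θ * 6 * # (Z? g)
            from (_ , y , (py , ny) , c) = begin
              N                                ≤⟨ rich y py ⟩
              θ * θ * 2 * χ y                  ≤⟨ *-monoʳ-≤ (θ * θ * 2) (triple (≤-trans (s≤s (*-monoʳ-≤ 2 L>0)) (χ>2L y py)) χ≤Z+2) ⟩
              θ * θ * 2 * (3 * # (Z? g))       ≡⟨ e₂ (θ * θ) (# (Z? g)) ⟩
              θ * θ * 6 * # (Z? g)             ∎
              where
              e₂ : ∀ t z → t * 2 * (3 * z) ≡ t * 6 * z
              e₂ = solve-∀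
              χ≤Z+2 : χ y ≤ 2 + # (Z? g)
              χ≤Z+2 = ≤-trans (#-∪ (C? y) Central? (Z? g) λ t (pt , ct) → split t pt ct (Central? t)) (+-monoˡ-≤ (# (Z? g)) #Central)
                where
                split : ∀ t → Pow 2 t → Commute t y → Dec (Central t) → Central t ⊎ ((Pow 2 t × ¬ Central t) × Commute t (conj g t₀))
                split t pt ct (yes z) = inj₁ z
                split t pt ct (no z) = inj₂ ((pt , z) , Commute-trans {t} {y} {conj g t₀} ny ct c)
          total : ∑ (λ g → # (Z? g)) ≤ L * N * (p * 4)
          total = begin
            ∑ (λ g → ∑ λ t → ⟦ Z? g t ⟧)                 ≡⟨ ∑-swap (λ g t → ⟦ Z? g t ⟧) ⟩
            ∑ (λ t → ∑ λ g → ⟦ Z? g t ⟧)                 ≤⟨ ∑-mono (λ t → begin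
                ∑ (λ g → ⟦ Z? g t ⟧)                     ≡⟨ ∑-cong (λ g → ⟦⟧-× (Pow? 2 t ×? ¬? (Central? t)) (Commute? t (conj g t₀))) ⟩
                ∑ (λ g → ⟦ Pow? 2 t ×? ¬? (Central? t) ⟧ * ⟦ Commute? t (conj g t₀) ⟧)
                                                         ≡⟨ ∑-*ˡ ⟦ Pow? 2 t ×? ¬? (Central? t) ⟧ _ ⟩
                ⟦ Pow? 2 t ×? ¬? (Central? t) ⟧ * # (λ g → Commute? t (conj g t₀))
                                                         ≤⟨ ⟦⟧-gate-mono (Pow? 2 t ×? ¬? (Central? t)) (λ (_ , nt) → #conjugators t₀ t r₀ n₀ nt) ⟩
                ⟦ Pow? 2 t ×? ¬? (Central? t) ⟧ * (p * 4) ≤⟨ *-monoˡ-≤ (p * 4) (⟦⟧-mono (Pow? 2 t ×? ¬? (Central? t)) (Pow? 2 t) proj₁) ⟩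
                ⟦ Pow? 2 t ⟧ * (p * 4)                   ∎) ⟩
            ∑ (λ t → ⟦ Pow? 2 t ⟧ * (p * 4))             ≡⟨ ∑-*ʳ (p * 4) _ ⟩
            # (Pow? 2) * (p * 4)                         ≤⟨ *-monoˡ-≤ (p * 4) (bounded 2 (m≤m+n 2 7)) ⟩
            L * N * (p * 4)                              ∎

    opaque
      -- θ and ξ leave this module as unspecified numbers, so that the later arithmetic does not
      -- unfold the counts behind them.
      growth-dichotomy : ∃₂ λ t x → (512 * (L * # D?) < suc x ^ 3 × x ^ 3 ≤ 512 * (L * # D?) × t ≤ 2 + x * L) ×
        (4 * L * (t * t) < # D? → # (λ (g : SL₂) → yes tt) ≤ 24 * (p * (L * (t * t))))
      growth-dichotomy = θ , ξ , (ξ³> , ξ³≤ , θ≤) , expansion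

-- Constants, all polynomial in K.

module Constants where

  open import Data.Nat
  open import Data.Nat.Properties

  -- Opaque, so that no conversion check unfolds multiples of large literals.
  opaque
    -- 24³ comes from cubing `expansion` and 27 · 512 from cubing 3ξL; the two numbers agree. The
    -- case of a small D needs only 6 · 4³.
    c₀ : ℕ
    c₀ = 13824

    24³≡c₀ : 24 ^ 3 ≡ c₀
    24³≡c₀ = refl

    27*512≡c₀ : 27 * 512 ≡ c₀
    27*512≡c₀ = refl

    6*64≤c₀ : 6 * 64 ≤ c₀
    6*64≤c₀ = ≤ᵇ⇒≤ _ _ tt

    -- This is `K₁` of the Balog-Szemerédi-Gowers argument with β written out.
    doublingConstant : ℕ → ℕ
    doublingConstant K = 2 * (64 * (K * K) * (64 * (K * K))) * (2 * K * (2 * K) * (2 * K * (2 * K))) * (8 * (K * K)) * 2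

    doublingConstant-def : ∀ K β → β ≡ 64 * (K * K) → 2 * (β * β) * (2 * K * (2 * K) * (2 * K * (2 * K))) * (8 * (K * K)) * 2 ≡ doublingConstant K
    doublingConstant-def K β refl = refl

    -- With k twice the doubling constant, j-fold products cost at most k^(2j), and j is at most 9.
    growthConstant : ℕ → ℕ
    growthConstant K = (2 * doublingConstant K) ^ 18

    growthConstant-bound : ∀ K → (2 * doublingConstant K) ^ 18 ≤ growthConstant K
    growthConstant-bound K = ≤-refl

    -- 96 = 8 · 6 · 2: the 8 of `Nonconcentrated` times the loss 6K · 2d in passing from S to E,
    -- where d is the doubling constant.
    concentrationConstant : ℕ → ℕ
    concentrationConstant K = 96 * (K * doublingConstant K)

    concentrationConstant-def : ∀ K → 96 * (K * doublingConstant K) ≡ concentrationConstant K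
    concentrationConstant-def K = refl

    -- The power L¹¹ = L³ · (L⁴)² arises from (L θ²)³ and θ³ ≪ L⁴ N. The factor K k², with k twice
    -- the doubling constant, covers the comparison of |S| with |D| in both alternatives.
    flatteningConstant : ℕ → ℕ
    flatteningConstant K = c₀ * (c₀ * c₀) * (K * (2 * doublingConstant K) ^ 2) * growthConstant K ^ 11

    flatteningConstant-def : ∀ K → c₀ * (c₀ * c₀) * (K * (2 * doublingConstant K) ^ 2) * growthConstant K ^ 11 ≡ flatteningConstant K
    flatteningConstant-def K = refl

  -- For K ≥ 2 numerical constants are absorbed into the power of K, a constant c by way of c ≤ 2^c.
  PolynomiallyBounded : (ℕ → ℕ) → Set
  PolynomiallyBounded f = ∃ λ A → ∀ K → 2 ≤ K → f K ≤ K ^ A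

  private
    const-bounded : ∀ c → PolynomiallyBounded (λ _ → c)
    const-bounded c = c , λ K K≥2 → ≤-trans (grows c) (^-monoˡ-≤ c K≥2)
      where
      grows : ∀ c → c ≤ 2 ^ c
      grows zero = z≤n
      grows (suc c) = ≤-trans (+-mono-≤ (m^n>0 2 c) (grows c)) (≤-reflexive (cong (2 ^ c +_) (sym (+-identityʳ (2 ^ c)))))

    id-bounded : PolynomiallyBounded (λ K → K)
    id-bounded = 1 , λ K _ → ≤-reflexive (sym (*-identityʳ K))

    *-bounded : ∀ {f g} → PolynomiallyBounded f → PolynomiallyBounded g → PolynomiallyBounded (λ K → f K * g K)
    *-bounded (A , f) (B , g) = A + B , λ K K≥2 → ≤-trans (*-mono-≤ (f K K≥2) (g K K≥2)) (≤-reflexive (sym (^-distribˡ-+-* K A B)))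

    ^-bounded : ∀ {f} n → PolynomiallyBounded f → PolynomiallyBounded (λ K → f K ^ n)
    ^-bounded n (A , f) = A * n , λ K K≥2 → ≤-trans (^-monoˡ-≤ n (f K K≥2)) (≤-reflexive (^-*-assoc K A n))

    +-bounded : ∀ {f g} → PolynomiallyBounded f → PolynomiallyBounded g → PolynomiallyBounded (λ K → f K + g K)
    +-bounded {f} {g} (A , f≤) (B , g≤) = suc (A + B) , λ K K≥2 → let instance K≢0 = >-nonZero (≤-trans (s≤s z≤n) K≥2) in
      ≤-trans (+-mono-≤ (≤-trans (f≤ K K≥2) (^-monoʳ-≤ K (m≤m+n A B))) (≤-trans (g≤ K K≥2) (^-monoʳ-≤ K (m≤n+m B A))))
        (≤-trans (≤-reflexive (cong (K ^ (A + B) +_) (sym (+-identityʳ (K ^ (A + B)))))) (*-monoˡ-≤ (K ^ (A + B)) K≥2))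

  opaque
    unfolding flatteningConstant

    private
      doubling-bounded : PolynomiallyBounded doublingConstant
      doubling-bounded = *-bounded (*-bounded (*-bounded (*-bounded (const-bounded 2) (*-bounded β β)) (*-bounded (*-bounded 2K 2K) (*-bounded 2K 2K)))
        (*-bounded (const-bounded 8) (*-bounded id-bounded id-bounded))) (const-bounded 2)
        where
        β : PolynomiallyBounded (λ K → 64 * (K * K))
        β = *-bounded (const-bounded 64) (*-bounded id-bounded id-bounded)
        2K : PolynomiallyBounded (λ K → 2 * K)
        2K = *-bounded (const-bounded 2) id-bounded

      k-bounded : PolynomiallyBounded (λ K → 2 * doublingConstant K)
      k-bounded = *-bounded (const-bounded 2) doubling-bounded

    constants-bounded : PolynomiallyBounded (λ K → concentrationConstant K + 8 * flatteningConstant K)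
    constants-bounded = +-bounded (*-bounded (const-bounded 96) (*-bounded id-bounded doubling-bounded))
      (*-bounded (const-bounded 8) (*-bounded (*-bounded (*-bounded (const-bounded c₀) (*-bounded (const-bounded c₀) (const-bounded c₀)))
        (*-bounded id-bounded (^-bounded 2 k-bounded))) (^-bounded 11 (^-bounded 18 k-bounded))))

open Constants

-- Flattening: large energy forces S to be tiny or almost everything.

module Flattening (𝔽 : FiniteField) where

  open import Data.Nat hiding (_≟_)
  open import Data.Nat.Properties hiding (_≟_)
  open FiniteField 𝔽 using (F-finite)
  open Matrices 𝔽
  open Centralizers 𝔽
  open Escape 𝔽 using (IsProper)
  open Nonconcentration 𝔽
  open CentralizerCount 𝔽 using (p)
  open BSG SL₂ SL₂-finite _∙_ ε _⁻¹ isGroup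
  open SmallQuotients SL₂ SL₂-finite _∙_ ε _⁻¹ isGroup

  private
    scaled : ∀ a b c x y → a * b ≡ c → x ≤ b * y → a * x ≤ c * y
    scaled a b c x y e h = ≤-trans (*-monoʳ-≤ a h) (≤-reflexive (trans (sym (*-assoc a b y)) (cong (_* y) e)))

    module Arithmetic (c L N θ ξ : ℕ) (ξ>0 : 0 < ξ) (L>0 : 0 < L) (θ≤ : θ ≤ 2 + ξ * L) (27ξ³≤ : 27 * ξ ^ 3 ≤ c * (L * N)) where

      open ≤-Reasoning

      θ≤3ξL : θ ≤ 3 * (ξ * L)
      θ≤3ξL = ≤-trans θ≤ (≤-trans (+-monoˡ-≤ (ξ * L) (*-monoʳ-≤ 2 (*-mono-≤ ξ>0 L>0))) (≤-reflexive (e (ξ * L))))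
        where
        e : ∀ x → 2 * x + x ≡ 3 * x
        e = solve-∀

      θ³≤ : θ ^ 3 ≤ c * (L * L * L * L * N)
      θ³≤ = begin
        θ ^ 3                         ≤⟨ ^-monoˡ-≤ 3 θ≤3ξL ⟩
        (3 * (ξ * L)) ^ 3             ≡⟨ e₁ ξ L ⟩
        27 * ξ ^ 3 * (L * L * L)      ≤⟨ *-monoˡ-≤ (L * L * L) 27ξ³≤ ⟩
        c * (L * N) * (L * L * L)     ≡⟨ e₂ c L N ⟩
        c * (L * L * L * L * N)       ∎
        where
        e₁ : ∀ ξ L → 3 * (ξ * L) * (3 * (ξ * L) * (3 * (ξ * L) * 1)) ≡ 27 * (ξ * (ξ * (ξ * 1))) * (L * L * L)
        e₁ = solve-∀
        e₂ : ∀ c L N → c * (L * N) * (L * L * L) ≡ c * (L * L * L * L * N)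
        e₂ = solve-∀

      cube-bound : ∀ a x → (a * (L * (θ * θ))) ^ 3 * x ≤ a ^ 3 * (c * c) * L ^ 11 * (N * N) * x
      cube-bound a x = begin
        (a * (L * (θ * θ))) ^ 3 * x                            ≡⟨ e₁ a L θ x ⟩
        a ^ 3 * (L * L * L) * (θ ^ 3 * θ ^ 3) * x              ≤⟨ *-monoˡ-≤ x (*-monoʳ-≤ (a ^ 3 * (L * L * L)) (*-mono-≤ θ³≤ θ³≤)) ⟩
        a ^ 3 * (L * L * L) * (c * (L * L * L * L * N) * (c * (L * L * L * L * N))) * x ≡⟨ e₂ (a ^ 3) c L N x ⟩
        a ^ 3 * (c * c) * L ^ 11 * (N * N) * x                 ∎
        where
        e₁ : ∀ a L t x → a * (L * (t * t)) * (a * (L * (t * t)) * (a * (L * (t * t)) * 1)) * x ≡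
          a * (a * (a * 1)) * (L * L * L) * (t * (t * (t * 1)) * (t * (t * (t * 1)))) * x
        e₁ = solve-∀
        e₂ : ∀ a c L N x → a * (L * L * L) * (c * (L * L * L * L * N) * (c * (L * L * L * L * N))) * x ≡
          a * (c * c) * (L * (L * (L * (L * (L * (L * (L * (L * (L * (L * (L * 1))))))))))) * (N * N) * x
        e₂ = solve-∀

      -- From N ≤ a L θ² and θ⁶ ≪ L⁸ N² follows N³ ≪ L¹¹ N², which bounds N, and with it n, by the
      -- constants alone.
      size-bound : ∀ a s K k n → 0 < N → 0 < k → s * a ^ 3 ≤ c → n ≤ s * K * k * N → N ≤ a * (L * (θ * θ)) →
        n ≤ c * (c * c) * (K * k ^ 2) * L ^ 11
      size-bound a s K k n N>0 k>0 sa³≤c n≤ h = begin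
        n                                             ≤⟨ n≤ ⟩
        s * K * k * N                                 ≤⟨ *-monoʳ-≤ (s * K * k) N≤ ⟩
        s * K * k * (a ^ 3 * (c * c) * L ^ 11)        ≡⟨ e₁ s (a ^ 3) c K k (L ^ 11) ⟩
        s * a ^ 3 * (c * c) * (K * (k * 1)) * L ^ 11  ≤⟨ *-monoˡ-≤ (L ^ 11) (*-mono-≤ (*-monoˡ-≤ (c * c) sa³≤c)
                                                           (*-monoʳ-≤ K (*-monoʳ-≤ k (*-mono-≤ k>0 (≤-refl {1}))))) ⟩
        c * (c * c) * (K * k ^ 2) * L ^ 11            ∎
        where
        e₁ : ∀ s b c K k l → s * K * k * (b * (c * c) * l) ≡ s * b * (c * c) * (K * (k * 1)) * l
        e₁ = solve-∀
        e₂ : ∀ N → N * (N * N) ≡ N * (N * (N * 1)) * 1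
        e₂ = solve-∀
        N≤ : N ≤ a ^ 3 * (c * c) * L ^ 11
        N≤ = *-cancelʳ-≤ _ _ (N * N) {{>-nonZero (*-mono-≤ N>0 N>0)}} (begin
          N * (N * N)                                 ≡⟨ e₂ N ⟩
          N ^ 3 * 1                                   ≤⟨ *-monoˡ-≤ 1 (^-monoˡ-≤ 3 h) ⟩
          (a * (L * (θ * θ))) ^ 3 * 1                 ≤⟨ cube-bound a 1 ⟩
          a ^ 3 * (c * c) * L ^ 11 * (N * N) * 1      ≡⟨ *-identityʳ _ ⟩
          a ^ 3 * (c * c) * L ^ 11 * (N * N)          ∎)

      -- The same computation with an additional factor p: G³ ≪ p³ L¹¹ N². For G of order p³ it says
      -- that N, and hence n, has order at least p³ up to the constants.
      growth-bound : ∀ a K k n p G → 0 < K → a ^ 3 ≤ c → N ≤ k * n → G ≤ a * (p * (L * (θ * θ))) →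
        G ^ 3 ≤ c * (c * c) * (K * k ^ 2) * L ^ 11 * (p ^ 3 * n ^ 2)
      growth-bound a K k n p G K>0 a³≤c N≤kn h = begin
        G ^ 3                                            ≤⟨ ^-monoˡ-≤ 3 h ⟩
        (a * (p * (L * (θ * θ)))) ^ 3                    ≡⟨ e₁ a p (L * (θ * θ)) ⟩
        (a * (L * (θ * θ))) ^ 3 * p ^ 3                  ≤⟨ cube-bound a (p ^ 3) ⟩
        a ^ 3 * (c * c) * L ^ 11 * (N * N) * p ^ 3       ≤⟨ *-monoˡ-≤ (p ^ 3) (*-monoʳ-≤ (a ^ 3 * (c * c) * L ^ 11) (*-mono-≤ N≤kn N≤kn)) ⟩
        a ^ 3 * (c * c) * L ^ 11 * (k * n * (k * n)) * p ^ 3  ≡⟨ e₂ (a ^ 3 * (c * c)) (L ^ 11) k n (p ^ 3) ⟩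
        a ^ 3 * (c * c) * (1 * k ^ 2) * L ^ 11 * (p ^ 3 * n ^ 2)
          ≤⟨ *-monoˡ-≤ (p ^ 3 * n ^ 2) (*-monoˡ-≤ (L ^ 11) (*-mono-≤ (*-monoˡ-≤ (c * c) a³≤c) (*-monoˡ-≤ (k ^ 2) K>0))) ⟩
        c * (c * c) * (K * k ^ 2) * L ^ 11 * (p ^ 3 * n ^ 2)  ∎
        where
        e₁ : ∀ a p t → a * (p * t) * (a * (p * t) * (a * (p * t) * 1)) ≡ a * t * (a * t * (a * t * 1)) * (p * (p * (p * 1)))
        e₁ = solve-∀
        e₂ : ∀ c l k n q → c * l * (k * n * (k * n)) * q ≡ c * (1 * (k * (k * 1))) * l * (q * (n * (n * 1)))
        e₂ = solve-∀

    opaque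
      -- The case distinction is the size condition of `expansion`. It is stated for bare numbers,
      -- so that the arithmetic never meets the counts they stand for.
      conclude : ∀ L N t x K k n p G → 0 < K → 0 < k → 0 < L → 0 < N → n ≤ 6 * K * k * N → N ≤ k * n →
        512 * (L * N) < suc x ^ 3 → x ^ 3 ≤ 512 * (L * N) → t ≤ 2 + x * L →
        (4 * L * (t * t) < N → G ≤ 24 * (p * (L * (t * t)))) →
        n ≤ c₀ * (c₀ * c₀) * (K * k ^ 2) * L ^ 11 ⊎ G ^ 3 ≤ c₀ * (c₀ * c₀) * (K * k ^ 2) * L ^ 11 * (p ^ 3 * n ^ 2)
      conclude L N t x K k n p G K>0 k>0 L>0 N>0 n≤ N≤kn x> x≤ t≤ expand = cases (N ≤? 4 * (L * (t * t)))
        where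
        x>0 : 0 < x
        x>0 = n≢0⇒n>0 λ z → <⇒≱ x> (≤-trans (≤-reflexive (cong (λ w → suc w ^ 3) z)) (*-mono-≤ (s≤s (z≤n {511})) (*-mono-≤ L>0 N>0)))
        open Arithmetic c₀ L N t x x>0 L>0 t≤ (scaled 27 512 c₀ (x ^ 3) (L * N) 27*512≡c₀ x≤)
        cases : Dec (N ≤ 4 * (L * (t * t))) → n ≤ c₀ * (c₀ * c₀) * (K * k ^ 2) * L ^ 11 ⊎ G ^ 3 ≤ c₀ * (c₀ * c₀) * (K * k ^ 2) * L ^ 11 * (p ^ 3 * n ^ 2)
        cases (yes h) = inj₁ (size-bound 4 6 K k n N>0 k>0 6*64≤c₀ n≤ h)
        cases (no h) = inj₂ (growth-bound 24 K k n p G K>0 (≤-reflexive 24³≡c₀) N≤kn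
          (expand (subst (_< N) (sym (*-assoc 4 L (t * t))) (≰⇒> h))))

    module FromCore (K d L : ℕ) (K>0 : 0 < K) (k¹⁸≤L : (2 * d) ^ 18 ≤ L) {S Core : SL₂ → Set} (S? : ∀ g → Dec (S g)) (Core? : ∀ g → Dec (Core g))
      (Core⊆S : ∀ g → Core g → S g) (Core>0 : 0 < # Core?) (n≤6Km : # S? ≤ 6 * K * # Core?)
      (small-quotients : # (λ g → ∃? λ x → Core? x ×? Core? (g ∙ x)) ≤ d * # Core?)
      (nonconcentrated : ∀ {H : SL₂ → Set} (H? : ∀ g → Dec (H g)) → IsProper H → ∀ x →
        96 * (K * d) * # (λ g → S? g ×? H? (x ⁻¹ ∙ g)) < # S?) where

      n m k : ℕ
      n = # S?
      m = # Core?
      k = 2 * d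

      module A = ApproximateGroup d Core? Core>0 small-quotients

      x₀ : SL₂
      x₀ = proj₁ A.rich-translate

      E? : ∀ g → Dec (A.D g × Core (x₀ ∙ g))
      E? g = A.D? g ×? Core? (x₀ ∙ g)

      m≤k#E : m ≤ k * # E?
      m≤k#E = proj₂ (proj₂ A.rich-translate)

      N : ℕ
      N = # A.D?

      n≤ : ∀ e → m ≤ k * e → n ≤ 6 * K * k * e
      n≤ e h = ≤-trans n≤6Km (≤-trans (*-monoʳ-≤ (6 * K) h) (≤-reflexive (sym (*-assoc (6 * K) k e))))

      -- Translation by x₀ embeds E into S, and #E is at least n / (6Kk). A coset containing an
      -- eighth of E would therefore contain too much of S.
      nc : Nonconcentrated E?
      nc {H} H? proper x = *-cancelˡ-< (6 * K * k) _ _ (begin-strict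
        6 * K * k * (8 * # (λ g → E? g ×? H? (x ⁻¹ ∙ g)))                ≡⟨ e K d _ ⟩
        (96 * (K * d)) * # (λ g → E? g ×? H? (x ⁻¹ ∙ g))        ≤⟨ *-monoʳ-≤ ((96 * (K * d))) (#-injection
            (λ g → E? g ×? H? (x ⁻¹ ∙ g)) (λ s → S? s ×? H? ((x₀ ∙ x) ⁻¹ ∙ s)) (x₀ ∙_)
            (λ g ((_ , c) , h) → Core⊆S (x₀ ∙ g) c , subst H (sym (shift g)) h)
            (λ g h _ _ q → trans (sym (x⁻¹∙xy x₀ g)) (trans (cong (x₀ ⁻¹ ∙_) q) (x⁻¹∙xy x₀ h)))) ⟩
        (96 * (K * d)) * # (λ s → S? s ×? H? ((x₀ ∙ x) ⁻¹ ∙ s)) <⟨ nonconcentrated H? proper (x₀ ∙ x) ⟩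
        n                                                                ≤⟨ n≤ (# E?) m≤k#E ⟩
        6 * K * k * # E?                                                 ∎)
        where
        open ≤-Reasoning
        e : ∀ K d y → 6 * K * (2 * d) * (8 * y) ≡ 96 * (K * d) * y
        e = solve-∀
        shift : ∀ g → (x₀ ∙ x) ⁻¹ ∙ (x₀ ∙ g) ≡ x ⁻¹ ∙ g
        shift g = trans (cong (_∙ (x₀ ∙ g)) (⁻¹-anti-homo-∙ x₀ x)) (trans (assoc (x ⁻¹) (x₀ ⁻¹) (x₀ ∙ g)) (cong (x ⁻¹ ∙_) (x⁻¹∙xy x₀ g)))

      N>0 : 0 < N
      N>0 = #-positive A.D? ε A.ε∈D

      k>0 : 0 < k
      k>0 = n≢0⇒n>0 λ z → <⇒≱ Core>0 (≤-trans m≤k#E (≤-reflexive (cong (_* # E?) z)))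

      L>0 : 0 < L
      L>0 = ≤-trans (m^n>0 k {{>-nonZero k>0}} 18) k¹⁸≤L

      bounded : ∀ j → j ≤ 9 → # (A.Pow? j) ≤ L * N
      bounded zero _ = ≤-trans (#-unique (A.Pow? 0) λ g h e f → trans e (sym f)) (*-mono-≤ L>0 N>0)
      bounded (suc j) j<9 = begin
        # (A.Pow? (suc j))                       ≤⟨ A.#Pow j ⟩
        k ^ suc j * d ^ j * m   ≤⟨ *-mono-≤ (*-monoʳ-≤ (k ^ suc j) (^-monoˡ-≤ j (m≤n*m (d) 2))) A.m≤2K#D ⟩
        k ^ suc j * k ^ j * (k * N)              ≡⟨ trans (sym (*-assoc (k ^ suc j * k ^ j) k N)) (cong (_* N) (e (k ^ suc j) (k ^ j) k)) ⟩
        k ^ suc j * k ^ suc j * N                ≡⟨ cong (_* N) (^-distribˡ-+-* k (suc j) (suc j)) ⟨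
        k ^ (suc j + suc j) * N                  ≤⟨ *-monoˡ-≤ N (≤-trans (^-monoʳ-≤ k {{>-nonZero k>0}} (+-mono-≤ j<9 j<9)) k¹⁸≤L) ⟩
        L * N                                    ∎
        where
        open ≤-Reasoning
        e : ∀ a b k → a * b * k ≡ a * (k * b)
        e = solve-∀

      N≤kn : N ≤ k * n
      N≤kn = ≤-trans A.#D≤ (*-monoʳ-≤ k (#-mono Core? S? Core⊆S))

      result : # S? ≤ c₀ * (c₀ * c₀) * (K * (2 * d) ^ 2) * L ^ 11 ⊎
        (# (λ (g : SL₂) → yes tt)) ^ 3 ≤ c₀ * (c₀ * c₀) * (K * (2 * d) ^ 2) * L ^ 11 * (p ^ 3 * # S? ^ 2)
      result =
        let t , x , (x> , x≤ , t≤) , expand = Expansion.Growth.growth-dichotomy 𝔽 A.D? E? A.ε∈D A.D⁻¹ (λ g → proj₁) nc L bounded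
        in conclude L (# A.D?) t x K (2 * d) (# S?) p (# (λ (g : SL₂) → yes tt)) K>0 k>0 L>0 N>0 (n≤ N A.m≤2K#D) N≤kn x> x≤ t≤ expand

  private
    module FromEnergy (K d : ℕ) {S : SL₂ → Set} (S? : ∀ g → Dec (S g)) (S>0 : 0 < # S?) (large : # S? * # S? * # S? ≤ K * energy S?) where

      module B = Dense K S? S>0 large

      -- The 32 of `core-large` is raised to 36 = 6² in order to take the square root.
      n≤6Km : # S? ≤ 6 * K * # B.Core?
      n≤6Km = sq-cancel-≤ (≤-trans B.core-large (≤-trans (*-monoˡ-≤ (# B.Core? * # B.Core?) (*-monoˡ-≤ (K * K) (m≤m+n 32 4))) (≤-reflexive (e K (# B.Core?)))))
        where
        e : ∀ K m → 36 * (K * K) * (m * m) ≡ 6 * K * m * (6 * K * m)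
        e = solve-∀

      m>0 : 0 < # B.Core?
      m>0 = n≢0⇒n>0 λ z → <⇒≱ S>0 (≤-trans n≤6Km (≤-reflexive (trans (cong (6 * K *_) z) (*-zeroʳ (6 * K)))))

      small-quotients : B.K₁ ≡ d → # B.Quotient? ≤ d * # B.Core?
      small-quotients e = subst (λ w → # B.Quotient? ≤ w * # B.Core?) e B.small-quotients

      result : ∀ L → (2 * d) ^ 18 ≤ L → B.K₁ ≡ d → (∀ {H : SL₂ → Set} (H? : ∀ g → Dec (H g)) → IsProper H → ∀ x →
        96 * (K * d) * # (λ g → S? g ×? H? (x ⁻¹ ∙ g)) < # S?) →
        # S? ≤ c₀ * (c₀ * c₀) * (K * (2 * d) ^ 2) * L ^ 11 ⊎
        (# (λ (g : SL₂) → yes tt)) ^ 3 ≤ c₀ * (c₀ * c₀) * (K * (2 * d) ^ 2) * L ^ 11 * (p ^ 3 * # S? ^ 2)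
      result L h e nc = C.result
        where
        module C = FromCore K d L B.K>0 h {S} {B.Core} S? B.Core? (λ g c → proj₁ (proj₁ c)) m>0 n≤6Km (small-quotients e) nc

  opaque
    flattening : ∀ K {S : SL₂ → Set} (S? : ∀ g → Dec (S g)) → 0 < # S? → # S? * # S? * # S? ≤ K * energy S? →
      (∀ {H : SL₂ → Set} (H? : ∀ g → Dec (H g)) → IsProper H → ∀ x →
        concentrationConstant K * # (λ g → S? g ×? H? (x ⁻¹ ∙ g)) < # S?) →
      # S? ≤ flatteningConstant K ⊎ (# (λ (g : SL₂) → yes tt)) ^ 3 ≤ flatteningConstant K * (p ^ 3 * # S? ^ 2)
    flattening K {S} S? S>0 large nonconcentrated = subst (λ c → # S? ≤ c ⊎ (# (λ (g : SL₂) → yes tt)) ^ 3 ≤ c * (p ^ 3 * # S? ^ 2))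
      (flatteningConstant-def K)
      (E.result (growthConstant K) (growthConstant-bound K) (doublingConstant-def K E.B.β E.B.β-def)
        λ {H} H? proper x → subst (λ w → w * # (λ g → S? g ×? H? (x ⁻¹ ∙ g)) < # S?) (sym (concentrationConstant-def K)) (nonconcentrated H? proper x))
      where
      module E = FromEnergy K (doublingConstant K) S? S>0 large

-- The action of SL₂ on the points of the plane.

module Points (𝔽 : FiniteField) where

  open import Data.Nat hiding (_≟_)
  open import Data.Nat.Properties hiding (_≟_)
  open FiniteField 𝔽 using (F; 0#; 1#; F-finite; by; _⊡_; _⊞_; solve; _:=_; _:+_; _:*_; :-_; :0; 1≢0; inverse; *-cancelˡ)
    renaming (_+_ to _+ᶠ_; _*_ to _*ᶠ_; -_ to -ᶠ_; *-identityˡ to *ᶠ-identityˡ; *-comm to *ᶠ-comm; *-assoc to *ᶠ-assoc; *-identityʳ to *ᶠ-identityʳ; zeroˡ to zeroˡᶠ; zeroʳ to zeroʳᶠ; +-identityʳ to +ᶠ-identityʳ)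
  open Matrices 𝔽
  open Matrix
  open Centralizers 𝔽
  open Escape 𝔽
  open CentralizerCount 𝔽 using (p) public

  e₁ : Pt
  e₁ = 1# , 0#

  e₁≢0 : e₁ ≢ 0ₚ
  e₁≢0 = 1≢0 ∘ cong proj₁

  transitive : ∀ z → z ≢ 0ₚ → ∃ λ g → g ▷ e₁ ≡ z
  transitive (x , y) n = split (x ≟ 0#)
    where
    split : Dec (x ≡ 0#) → ∃ λ g → g ▷ e₁ ≡ (x , y)
    split (no x≢0) = build (inverse x x≢0)
      where
      build : (∃ λ w → x *ᶠ w ≡ 1#) → ∃ λ g → g ▷ e₁ ≡ (x , y)
      build (w , e) = ⟨ mat x 0# y w ⟩ {trans (solve 3 (λ x y w → x :* w :+ :- (:0 :* y) := x :* w) refl x y w) e} ,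
        cong₂ _,_ (trans (solve 2 (λ x o → x :* o :+ :0 :* :0 := x :* o) refl x 1#) (*ᶠ-identityʳ x))
          (trans (solve 3 (λ y w o → y :* o :+ w :* :0 := y :* o) refl y w 1#) (*ᶠ-identityʳ y))
    split (yes x≡0) = build (inverse y λ y≡0 → n (cong₂ _,_ x≡0 y≡0))
      where
      build : (∃ λ w → y *ᶠ w ≡ 1#) → ∃ λ g → g ▷ e₁ ≡ (x , y)
      build (w , e) = ⟨ mat 0# (-ᶠ w) y 0# ⟩ {trans (solve 2 (λ y w → :0 :* :0 :+ :- (:- w :* y) := y :* w) refl y w) e} ,
        cong₂ _,_ (trans (solve 2 (λ w o → :0 :* o :+ :- w :* :0 := :0) refl w 1#) (sym x≡0))
          (trans (solve 2 (λ y o → y :* o :+ :0 :* :0 := y :* o) refl y 1#) (*ᶠ-identityʳ y))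

  #fixing-e₁ : # (λ g → g ▷ e₁ ≟ e₁) ≡ p
  #fixing-e₁ = ≤-antisym
    (#-injection (λ g → g ▷ e₁ ≟ e₁) (λ (x : F) → yes tt) (m₁₂ ∘ matrix) (λ _ _ → tt) λ g h e f q → SL₂-≡ (entries g h e f q))
    (#-injection (λ (x : F) → yes tt) (λ g → g ▷ e₁ ≟ e₁) unipotent (λ x _ → fixes x) λ x y _ _ q → cong (m₁₂ ∘ matrix) q)
    where
    unipotent : F → SL₂
    unipotent x = ⟨ mat 1# x 0# 1# ⟩ {trans (solve 2 (λ x o → o :* o :+ :- (x :* :0) := o :* o) refl x 1#) (*ᶠ-identityˡ 1#)}
    fixes : ∀ x → unipotent x ▷ e₁ ≡ e₁
    fixes x = cong₂ _,_ (trans (solve 2 (λ x o → o :* o :+ x :* :0 := o :* o) refl x 1#) (*ᶠ-identityˡ 1#)) (solve 1 (λ o → :0 :* o :+ o :* :0 := :0) refl 1#)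
    first : ∀ a b → a *ᶠ 1# +ᶠ b *ᶠ 0# ≡ a
    first a b = trans (solve 3 (λ a b o → a :* o :+ b :* :0 := a :* o) refl a b 1#) (*ᶠ-identityʳ a)
    shape : ∀ g → g ▷ e₁ ≡ e₁ → m₁₁ (matrix g) ≡ 1# × m₂₁ (matrix g) ≡ 0# × m₂₂ (matrix g) ≡ 1#
    shape g@(⟨ mat a b c d ⟩) e = a≡1 , c≡0 , trans (sym (*ᶠ-identityˡ d)) (by (det≡1 g ⊞ d ⊡ sym a≡1 ⊞ b ⊡ c≡0)
        (solve 5 (λ a b c d o → o :* d :+ (o :+ d :* a :+ b :* :0) := o :+ (a :* d :+ :- (b :* c) :+ d :* o :+ b :* c)) refl a b c d 1#))
      where
      a≡1 : a ≡ 1#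
      a≡1 = trans (sym (first a b)) (cong proj₁ e)
      c≡0 : c ≡ 0#
      c≡0 = trans (sym (first c d)) (cong proj₂ e)
    entries : ∀ g h → g ▷ e₁ ≡ e₁ → h ▷ e₁ ≡ e₁ → m₁₂ (matrix g) ≡ m₁₂ (matrix h) → matrix g ≡ matrix h
    entries g@(⟨ mat _ _ _ _ ⟩) h@(⟨ mat _ _ _ _ ⟩) e f q =
      let a , c , d = shape g e ; a′ , c′ , d′ = shape h f in mat-≡ (trans a (sym a′)) q (trans c (sym c′)) (trans d (sym d′))

  -- By transitivity these elements correspond to the stabiliser of e₁, the group of p upper
  -- unipotent matrices.
  #moving : ∀ y z → y ≢ 0ₚ → z ≢ 0ₚ → # (λ g → g ▷ y ≟ z) ≡ p
  #moving y z y≢0 z≢0 = from (transitive y y≢0) (transitive z z≢0)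
    where
    from : (∃ λ g → g ▷ e₁ ≡ y) → (∃ λ g → g ▷ e₁ ≡ z) → # (λ g → g ▷ y ≟ z) ≡ p
    from (Y , Ye) (Z , Ze) = begin
      # (λ g → g ▷ y ≟ z)                           ≡⟨ ∑-leftMul Z (λ g → ⟦ g ▷ y ≟ z ⟧) ⟨
      # (λ g → (Z ∙ g) ▷ y ≟ z)                     ≡⟨ ∑-rightMul (Y ⁻¹) (λ g → ⟦ (Z ∙ g) ▷ y ≟ z ⟧) ⟨
      # (λ g → (Z ∙ (g ∙ Y ⁻¹)) ▷ y ≟ z)            ≡⟨ #-cong (λ g → (Z ∙ (g ∙ Y ⁻¹)) ▷ y ≟ z) (λ g → g ▷ e₁ ≟ e₁)
          (λ g e → trans (sym (⁻¹-▷ Z (g ▷ e₁))) (trans (cong (Z ⁻¹ ▷_) (trans (sym (moved g)) (trans e (sym Ze)))) (⁻¹-▷ Z e₁)))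
          (λ g e → trans (moved g) (trans (cong (Z ▷_) e) Ze)) ⟩
      # (λ g → g ▷ e₁ ≟ e₁)                         ≡⟨ #fixing-e₁ ⟩
      p                                             ∎
      where
      open ≡-Reasoning
      moved : ∀ g → (Z ∙ (g ∙ Y ⁻¹)) ▷ y ≡ Z ▷ g ▷ e₁
      moved g = trans (∙-▷ Z (g ∙ Y ⁻¹) y) (cong (Z ▷_) (trans (∙-▷ g (Y ⁻¹) y)
        (cong (g ▷_) (trans (cong (Y ⁻¹ ▷_) (sym Ye)) (⁻¹-▷ Y e₁)))))

  |F|≡p : ∑ {X = F} (λ _ → 1) ≡ p
  |F|≡p = sym (#-true {X = F})

  |G| : ℕ
  |G| = # λ (g : SL₂) → yes tt

  |Pt|≡p² : ∑ {X = Pt} (λ _ → 1) ≡ p * p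
  |Pt|≡p² = trans (∑-× (λ _ → 1)) (trans (∑-const (∑ {X = F} (λ _ → 1))) (cong₂ _*_ |F|≡p |F|≡p))

  -- Sorted by the image of e₁, the group has p elements over each of the p² - 1 nonzero points; the
  -- p on the left supplies the missing ones over the origin.
  |G|+p : |G| + p ≡ p * (p * p)
  |G|+p = begin
    |G| + p
      ≡⟨ cong₂ _+_ (trans (#-true {X = SL₂}) (∑-cong λ g → trans (sym (∑-once (g ▷ e₁))) (∑-cong λ z → ⟦⟧-cong (z ≟ g ▷ e₁) (g ▷ e₁ ≟ z) sym sym)))
           (trans (sym (*-identityˡ p)) (trans (cong (_* p) (sym (#-≟ 0ₚ))) (sym (∑-*ʳ p _)))) ⟩
    ∑ (λ g → ∑ λ z → ⟦ g ▷ e₁ ≟ z ⟧) + ∑ (λ z → ⟦ z ≟ 0ₚ ⟧ * p)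
      ≡⟨ cong (_+ ∑ (λ z → ⟦ z ≟ 0ₚ ⟧ * p)) (∑-swap (λ g z → ⟦ g ▷ e₁ ≟ z ⟧)) ⟩
    ∑ (λ z → # (λ g → g ▷ e₁ ≟ z)) + ∑ (λ z → ⟦ z ≟ 0ₚ ⟧ * p)
      ≡⟨ ∑-+ _ _ ⟨
    ∑ (λ z → # (λ g → g ▷ e₁ ≟ z) + ⟦ z ≟ 0ₚ ⟧ * p)
      ≡⟨ ∑-cong (λ z → pointwise z (z ≟ 0ₚ)) ⟩
    ∑ {X = Pt} (λ _ → p)
      ≡⟨ trans (∑-const p) (cong (_* p) |Pt|≡p²) ⟩
    p * p * p
      ≡⟨ *-assoc p p p ⟩
    p * (p * p) ∎
    where
    open ≡-Reasoning
    pointwise : ∀ z (d : Dec (z ≡ 0ₚ)) → # (λ g → g ▷ e₁ ≟ z) + ⟦ d ⟧ * p ≡ p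
    pointwise z d@(yes e) = cong₂ _+_ (trans (∑-cong λ g → ⟦⟧-no (g ▷ e₁ ≟ z) λ q → ▷-nonzero g e₁≢0 (trans q e)) ∑0)
      (trans (cong (_* p) (⟦⟧-yes d e)) (*-identityˡ p))
    pointwise z d@(no n) = trans (cong₂ _+_ (#moving e₁ z e₁≢0 n) (cong (_* p) (⟦⟧-no d n))) (+-identityʳ p)

  ∑-▷ : ∀ g (f : Pt → ℕ) → ∑ (λ x → f (g ▷ x)) ≡ ∑ f
  ∑-▷ g = ∑-reindex (g ▷_) (g ⁻¹ ▷_) (⁻¹-▷ g) (▷-⁻¹ g)

  infixr 8 _⋆ₚ_
  _⋆ₚ_ : F → Pt → Pt
  t ⋆ₚ (x , y) = t *ᶠ x , t *ᶠ y

  ⋆ₚ-assoc : ∀ s t v → s ⋆ₚ t ⋆ₚ v ≡ (s *ᶠ t) ⋆ₚ v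
  ⋆ₚ-assoc s t (x , y) = cong₂ _,_ (sym (*ᶠ-assoc s t x)) (sym (*ᶠ-assoc s t y))

  ⋆ₚ-identity : ∀ v → 1# ⋆ₚ v ≡ v
  ⋆ₚ-identity (x , y) = cong₂ _,_ (*ᶠ-identityˡ x) (*ᶠ-identityˡ y)

  ⋆ₚ-cancel : ∀ s t v → s *ᶠ t ≡ 1# → s ⋆ₚ t ⋆ₚ v ≡ v
  ⋆ₚ-cancel s t v e = trans (⋆ₚ-assoc s t v) (trans (cong (_⋆ₚ v) e) (⋆ₚ-identity v))

  ∑-⋆ₚ : ∀ c → c ≢ 0# → (f : Pt → ℕ) → ∑ (λ z → f (c ⋆ₚ z)) ≡ ∑ f
  ∑-⋆ₚ c c≢0 f = from (inverse c c≢0)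
    where
    from : (∃ λ w → c *ᶠ w ≡ 1#) → ∑ (λ z → f (c ⋆ₚ z)) ≡ ∑ f
    from (w , e) = ∑-reindex (c ⋆ₚ_) (w ⋆ₚ_) (λ z → ⋆ₚ-cancel w c z (trans (*ᶠ-comm w c) e)) (λ z → ⋆ₚ-cancel c w z e) f

  ∥⇒multiple : ∀ v w → v ≢ 0ₚ → v ∥ w → ∃ λ t → t ⋆ₚ v ≡ w
  ∥⇒multiple (x , y) (z , w) n e = split (x ≟ 0#)
    where
    solve₁ : ∀ x z i → x *ᶠ i ≡ 1# → z *ᶠ i *ᶠ x ≡ z
    solve₁ x z i q = trans (*ᶠ-assoc z i x) (trans (cong (z *ᶠ_) (trans (*ᶠ-comm i x) q)) (*ᶠ-identityʳ z))
    split : Dec (x ≡ 0#) → ∃ λ t → t ⋆ₚ (x , y) ≡ (z , w)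
    split (no x≢0) = build (inverse x x≢0)
      where
      build : (∃ λ i → x *ᶠ i ≡ 1#) → ∃ λ t → t ⋆ₚ (x , y) ≡ (z , w)
      build (i , q) = z *ᶠ i , cong₂ _,_ (solve₁ x z i q) (trans
        (by (i ⊡ sym e) (solve 5 (λ x y z w i → z :* i :* y :+ i :* (x :* w :+ :- (y :* z)) := w :* i :* x :+ i :* :0) refl x y z w i)) (solve₁ x w i q))
    split (yes x≡0) = build (inverse y λ y≡0 → n (cong₂ _,_ x≡0 y≡0))
      where
      build : (∃ λ i → y *ᶠ i ≡ 1#) → ∃ λ t → t ⋆ₚ (x , y) ≡ (z , w)
      build (i , q) = w *ᶠ i , cong₂ _,_ (trans
        (by (i ⊡ e) (solve 5 (λ x y z w i → w :* i :* x :+ i :* :0 := z :* i :* y :+ i :* (x :* w :+ :- (y :* z))) refl x y z w i)) (solve₁ y z i q)) (solve₁ y w i q)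

  ⋆ₚ-injectiveˡ : ∀ s t v → v ≢ 0ₚ → s ⋆ₚ v ≡ t ⋆ₚ v → s ≡ t
  ⋆ₚ-injectiveˡ s t (x , y) n e = split (x ≟ 0#)
    where
    split : Dec (x ≡ 0#) → s ≡ t
    split (no x≢0) = *-cancelˡ x x≢0 (trans (*ᶠ-comm x s) (trans (cong proj₁ e) (*ᶠ-comm t x)))
    split (yes x≡0) = *-cancelˡ y (λ y≡0 → n (cong₂ _,_ x≡0 y≡0)) (trans (*ᶠ-comm y s) (trans (cong proj₂ e) (*ᶠ-comm t y)))

  ▷-determined : ∀ g h y z → ¬ (y ∥ z) → g ▷ y ≡ h ▷ y → g ▷ z ≡ h ▷ z → g ≡ h
  ▷-determined g@(⟨ mat a b c d ⟩) h@(⟨ mat a′ b′ c′ d′ ⟩) (x , y) (z , w) n p q = SL₂-≡ (mat-≡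
    (left a b a′ b′ (cong proj₁ p) (cong proj₁ q)) (right a b a′ b′ (cong proj₁ p) (cong proj₁ q))
    (left c d c′ d′ (cong proj₂ p) (cong proj₂ q)) (right c d c′ d′ (cong proj₂ p) (cong proj₂ q)))
    where
    Δ = x *ᶠ w +ᶠ -ᶠ (y *ᶠ z)
    left : ∀ a b a′ b′ → a *ᶠ x +ᶠ b *ᶠ y ≡ a′ *ᶠ x +ᶠ b′ *ᶠ y → a *ᶠ z +ᶠ b *ᶠ w ≡ a′ *ᶠ z +ᶠ b′ *ᶠ w → a ≡ a′
    left a b a′ b′ u v = *-cancelˡ Δ n (by (w ⊡ u ⊞ (-ᶠ y) ⊡ v) (solve 8 (λ x y z w a b c d →
      (x :* w :+ :- (y :* z)) :* a :+ (w :* (c :* x :+ d :* y) :+ :- y :* (c :* z :+ d :* w)) := (x :* w :+ :- (y :* z)) :* c :+ (w :* (a :* x :+ b :* y) :+ :- y :* (a :* z :+ b :* w))) refl x y z w a b a′ b′))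
    right : ∀ a b a′ b′ → a *ᶠ x +ᶠ b *ᶠ y ≡ a′ *ᶠ x +ᶠ b′ *ᶠ y → a *ᶠ z +ᶠ b *ᶠ w ≡ a′ *ᶠ z +ᶠ b′ *ᶠ w → b ≡ b′
    right a b a′ b′ u v = *-cancelˡ Δ n (by (x ⊡ v ⊞ (-ᶠ z) ⊡ u) (solve 8 (λ x y z w a b c d →
      (x :* w :+ :- (y :* z)) :* b :+ (x :* (c :* z :+ d :* w) :+ :- z :* (c :* x :+ d :* y)) := (x :* w :+ :- (y :* z)) :* d :+ (x :* (a :* z :+ b :* w) :+ :- z :* (a :* x :+ b :* y))) refl x y z w a b a′ b′))

-- Second moments for the incidence problem.

module Incidence (𝔽 : FiniteField) where

  open import Data.Nat hiding (_≟_)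
  open import Data.Nat.Properties hiding (_≟_)
  open FiniteField 𝔽 using (F; 0#; 1#; F-finite; by; solve; _:=_; _:+_; _:*_; :-_; :0; 1≢0; inverse; *-cancelˡ; difference≡0)
    renaming (_+_ to _+ᶠ_; _*_ to _*ᶠ_; -_ to -ᶠ_; *-comm to *ᶠ-comm; *-assoc to *ᶠ-assoc; *-identityˡ to *ᶠ-identityˡ; zeroˡ to zeroˡᶠ)
  open Matrices 𝔽 hiding (det)
  open Centralizers 𝔽
  open Escape 𝔽
  open Points 𝔽 hiding (e₁)
  open BSG SL₂ SL₂-finite _∙_ ε _⁻¹ isGroup using (quotients; energy; ∑-quotients)

  OnLine : Pt → Pt → Set
  OnLine v y = ∃ λ t → t ⋆ₚ v ≡ y

  OnLine? : ∀ v y → Dec (OnLine v y)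
  OnLine? v y = ∃? λ t → t ⋆ₚ v ≟ y

  instance
    finite-Pt² : Finite (Pt × Pt)
    finite-Pt² = ×-finite finite-Pt finite-Pt

  nonzero : ℕ
  nonzero = # λ (c : F) → ¬? (c ≟ 0#)

  p≡ : p ≡ 1 + nonzero
  p≡ = trans (sym |F|≡p) (trans (sym (#-complement (λ (c : F) → c ≟ 0#))) (cong (_+ nonzero) (#-≟ 0#)))

  nonzero>0 : 0 < nonzero
  nonzero>0 = #-positive (λ (c : F) → ¬? (c ≟ 0#)) 1# 1≢0

  p>0 : 0 < p
  p>0 = subst (0 <_) (sym p≡) (s≤s z≤n)

  #nonzeroPts : # (λ (z : Pt) → ¬? (z ≟ 0ₚ)) ≡ nonzero * p + nonzero
  #nonzeroPts = +-cancelˡ-≡ 1 _ _ (begin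
    1 + # (λ (z : Pt) → ¬? (z ≟ 0ₚ))                        ≡⟨ cong (_+ # (λ (z : Pt) → ¬? (z ≟ 0ₚ))) (#-≟ 0ₚ) ⟨
    # (λ z → z ≟ 0ₚ) + # (λ (z : Pt) → ¬? (z ≟ 0ₚ))         ≡⟨ #-complement (λ z → z ≟ 0ₚ) ⟩
    ∑ {X = Pt} (λ _ → 1)                                    ≡⟨ |Pt|≡p² ⟩
    p * p                                                   ≡⟨ cong (λ w → w * p) p≡ ⟩
    (1 + nonzero) * p                                       ≡⟨ e nonzero p ⟩
    p + nonzero * p                                         ≡⟨ cong (_+ nonzero * p) p≡ ⟩
    1 + nonzero + nonzero * p                               ≡⟨ e′ nonzero (nonzero * p) ⟩
    1 + (nonzero * p + nonzero)                             ∎)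
    where
    open ≡-Reasoning
    e : ∀ q p → (1 + q) * p ≡ p + q * p
    e = solve-∀
    e′ : ∀ q x → 1 + q + x ≡ 1 + (x + q)
    e′ = solve-∀

  cross-⋆ₚ : ∀ c y u → cross (c ⋆ₚ y) u ≡ c *ᶠ cross y u
  cross-⋆ₚ c (x , y) (u , v) = solve 5 (λ c x y u v → c :* x :* v :+ :- (c :* y :* u) := c :* (x :* v :+ :- (y :* u))) refl c x y u v

  -- The elements of S carrying x into B. By the symmetry of S, summing over x ∈ A gives the
  -- incidences.
  transfers : {B : Pt → Set} {S : SL₂ → Set} → (∀ y → Dec (B y)) → (∀ g → Dec (S g)) → Pt → ℕ
  transfers B? S? x = # λ g → S? g ×? B? (g ▷ x)

  module PointSet {B : Pt → Set} (B? : ∀ y → Dec (B y)) (0∉B : ¬ B 0ₚ) (k : ℕ)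
    (lines : ∀ v → v ≢ 0ₚ → # (λ y → B? y ×? OnLine? v y) ≤ k) where

    private
      m : ℕ
      m = # B?

      b : Pt → ℕ
      b y = ⟦ B? y ⟧

      B≢0 : ∀ {y} → B y → y ≢ 0ₚ
      B≢0 h refl = 0∉B h

    -- For y ≠ 0 the points u with `cross y u` = δ form one of the p affine lines parallel to y.
    N : Pt → F → ℕ
    N y δ = # λ u → B? u ×? cross y u ≟ δ

    ∑N : ∀ y → ∑ (N y) ≡ m
    ∑N y = trans (∑-cong λ δ → sym (*-identityˡ (N y δ))) (trans (∑-fibres B? (cross y) (λ _ → 1)) (∑-cong λ u → *-identityʳ (b u)))

    -- `J y` counts pairs of points of B on a common line parallel to y. `W y` measures, scaled by
    -- p², the deviation of B from equidistribution over these lines.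
    J W : Pt → ℕ
    J y = ∑ λ δ → N y δ * N y δ
    W y = ∑ λ δ → ∣ p * N y δ - m ∣ * ∣ p * N y δ - m ∣

    W+ : ∀ y → W y + p * (m * m) ≡ p * p * J y
    W+ y = +-cancelʳ-≡ (p * (m * m)) _ _ (begin
      W y + p * (m * m) + p * (m * m)               ≡⟨ e (W y) p m ⟩
      W y + 2 * (p * m) * m                         ≡⟨ cong (λ w → W y + 2 * (p * m) * w) (∑N y) ⟨
      W y + 2 * (p * m) * ∑ (N y)                   ≡⟨ variance (N y) p m ⟩
      p * p * J y + ∑ {X = F} (λ _ → 1) * (m * m)   ≡⟨ cong (λ w → p * p * J y + w * (m * m)) |F|≡p ⟩
      p * p * J y + p * (m * m)                     ∎)
      where
      open ≡-Reasoning
      e : ∀ w p m → w + p * (m * m) + p * (m * m) ≡ w + 2 * (p * m) * m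
      e = solve-∀

    -- Scaling y by c permutes the lines parallel to y.
    W-scale : ∀ c → c ≢ 0# → ∀ y → W (c ⋆ₚ y) ≡ W y
    W-scale c c≢0 y = from (inverse c c≢0)
      where
      same : ∀ δ → N (c ⋆ₚ y) (c *ᶠ δ) ≡ N y δ
      same δ = #-cong (λ u → B? u ×? cross (c ⋆ₚ y) u ≟ c *ᶠ δ) (λ u → B? u ×? cross y u ≟ δ)
        (λ u (h , e) → h , *-cancelˡ c c≢0 (trans (sym (cross-⋆ₚ c y u)) e)) (λ u (h , e) → h , trans (cross-⋆ₚ c y u) (cong (c *ᶠ_) e))
      cancel : ∀ s t x → s *ᶠ t ≡ 1# → s *ᶠ (t *ᶠ x) ≡ x
      cancel s t x e = trans (sym (*ᶠ-assoc s t x)) (trans (cong (_*ᶠ x) e) (*ᶠ-identityˡ x))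
      from : (∃ λ w → c *ᶠ w ≡ 1#) → W (c ⋆ₚ y) ≡ W y
      from (w , e) = trans (sym (∑-reindex (c *ᶠ_) (w *ᶠ_) (λ x → cancel w c x (trans (*ᶠ-comm w c) e)) (λ x → cancel c w x e)
          (λ δ → ∣ p * N (c ⋆ₚ y) δ - m ∣ * ∣ p * N (c ⋆ₚ y) δ - m ∣)))
        (∑-cong λ δ → cong (λ v → ∣ p * v - m ∣ * ∣ p * v - m ∣) (same δ))

    J≡ : ∀ y → J y ≡ ∑ λ u → b u * N y (cross y u)
    J≡ y = ∑-fibres B? (cross y) (N y)

    private
      NZ : Pt → ℕ
      NZ z = ⟦ ¬? (z ≟ 0ₚ) ⟧

      parallel-count : ∀ w → w ≢ 0ₚ → # (λ z → ¬? (z ≟ 0ₚ) ×? cross z w ≟ 0#) ≤ nonzero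
      parallel-count w w≢0 = ≤-trans (#-cover (λ z → ¬? (z ≟ 0ₚ) ×? cross z w ≟ 0#) (λ (c : F) → ¬? (c ≟ 0#)) (λ z c → c ⋆ₚ w ≟ z) 1
          (λ z (z≢0 , e) → let t , q = ∥⇒multiple w z w≢0 (∥-sym z w e) in
            t , (λ t≡0 → z≢0 (trans (sym q) (trans (cong (_⋆ₚ w) t≡0) (zero-scale w)))) , q)
          (λ c _ → #-unique _ λ x y (_ , q) (_ , r) → trans (sym q) r))
        (≤-reflexive (*-identityʳ nonzero))
        where
        zero-scale : ∀ w → 0# ⋆ₚ w ≡ 0ₚ
        zero-scale (x , y) = cong₂ _,_ (zeroˡᶠ x) (zeroˡᶠ y)

      equal-count : ∀ u v → # (λ z → ¬? (z ≟ 0ₚ) ×? cross z v ≟ cross z u) ≤ ⟦ v ≟ u ⟧ * (nonzero * p) + nonzero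
      equal-count u v = split (v ≟ u)
        where
        split : (d : Dec (v ≡ u)) → # (λ z → ¬? (z ≟ 0ₚ) ×? cross z v ≟ cross z u) ≤ ⟦ d ⟧ * (nonzero * p) + nonzero
        split d@(yes e) = ≤-trans (#-mono (λ z → ¬? (z ≟ 0ₚ) ×? cross z v ≟ cross z u) (λ z → ¬? (z ≟ 0ₚ)) λ z → proj₁)
          (≤-reflexive (trans #nonzeroPts (cong (_+ nonzero) (sym (trans (cong (_* (nonzero * p)) (⟦⟧-yes d e)) (*-identityˡ _))))))
        split d@(no n) = ≤-trans (≤-trans (#-mono (λ z → ¬? (z ≟ 0ₚ) ×? cross z v ≟ cross z u) (λ z → ¬? (z ≟ 0ₚ) ×? cross z (sub v u) ≟ 0#)
            λ z (z≢0 , e) → z≢0 , difference z v u e) (parallel-count (sub v u) (n ∘ sub≡0 v u))) (m≤n+m _ _)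
          where
          sub : Pt → Pt → Pt
          sub (x , y) (x′ , y′) = x +ᶠ -ᶠ x′ , y +ᶠ -ᶠ y′
          sub≡0 : ∀ v u → sub v u ≡ 0ₚ → v ≡ u
          sub≡0 (x , y) (x′ , y′) e = cong₂ _,_ (difference≡0 (cong proj₁ e)) (difference≡0 (cong proj₂ e))
          difference : ∀ z v u → cross z v ≡ cross z u → cross z (sub v u) ≡ 0#
          difference (a , c) (x , y) (x′ , y′) e = by e (solve 6 (λ a c x y x′ y′ →
            a :* (y :+ :- y′) :+ :- (c :* (x :+ :- x′)) :+ (a :* y′ :+ :- (c :* x′)) := :0 :+ (a :* y :+ :- (c :* x))) refl a c x y x′ y′)

    -- For u ≠ v the points u and v lie on a common line parallel to z exactly when z is parallel to
    -- v - u, so there are at most p - 1 nonzero z. The diagonal u = v allows every nonzero z.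
    ∑J : ∑ (λ z → NZ z * J z) ≤ nonzero * (m * p + m * m)
    ∑J = begin
      ∑ (λ z → NZ z * J z)
        ≡⟨ ∑-cong (λ z → trans (cong (NZ z *_) (J≡ z)) (sym (∑-*ˡ (NZ z) _))) ⟩
      ∑ (λ z → ∑ λ u → NZ z * (b u * N z (cross z u)))
        ≡⟨ ∑-swap (λ z u → NZ z * (b u * N z (cross z u))) ⟩
      ∑ (λ u → ∑ λ z → NZ z * (b u * N z (cross z u)))
        ≤⟨ ∑-mono bound ⟩
      ∑ (λ u → b u * (nonzero * p + m * nonzero))
        ≡⟨ ∑-*ʳ (nonzero * p + m * nonzero) b ⟩
      m * (nonzero * p + m * nonzero)
        ≡⟨ e nonzero m p ⟩
      nonzero * (m * p + m * m) ∎
      where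
      open ≤-Reasoning
      e : ∀ q m p → m * (q * p + m * q) ≡ q * (m * p + m * m)
      e = solve-∀
      e₁ : ∀ z u n → z * (u * n) ≡ u * (z * n)
      e₁ = solve-∀
      e₂ : ∀ v d q n → v * (d * q + n) ≡ d * v * q + v * n
      e₂ = solve-∀
      e₃ : ∀ z v q → z * (v * q) ≡ v * (z * q)
      e₃ = solve-∀
      bound : ∀ u → ∑ (λ z → NZ z * (b u * N z (cross z u))) ≤ b u * (nonzero * p + m * nonzero)
      bound u = begin
        ∑ (λ z → NZ z * (b u * N z (cross z u)))
          ≡⟨ trans (∑-cong λ z → e₁ (NZ z) (b u) (N z (cross z u))) (∑-*ˡ (b u) _) ⟩
        b u * ∑ (λ z → NZ z * N z (cross z u))
          ≡⟨ cong (b u *_) (trans (∑-cong λ z → trans (sym (∑-*ˡ (NZ z) _)) (∑-cong λ v → trans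
               (cong (NZ z *_) (⟦⟧-× (B? v) (cross z v ≟ cross z u))) (trans (e₃ (NZ z) (b v) _) (cong (b v *_) (sym (⟦⟧-× (¬? (z ≟ 0ₚ)) (cross z v ≟ cross z u)))))))
               (trans (∑-swap (λ z v → b v * ⟦ ¬? (z ≟ 0ₚ) ×? cross z v ≟ cross z u ⟧)) (∑-cong λ v → ∑-*ˡ (b v) _))) ⟩
        b u * ∑ (λ v → b v * # (λ z → ¬? (z ≟ 0ₚ) ×? cross z v ≟ cross z u))
          ≤⟨ *-monoʳ-≤ (b u) (∑-mono λ v → *-monoʳ-≤ (b v) (equal-count u v)) ⟩
        b u * ∑ (λ v → b v * (⟦ v ≟ u ⟧ * (nonzero * p) + nonzero))
          ≡⟨ cong (b u *_) (trans (∑-cong λ v → e₂ (b v) ⟦ v ≟ u ⟧ (nonzero * p) nonzero) (∑-+ _ _)) ⟩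
        b u * (∑ (λ v → ⟦ v ≟ u ⟧ * b v * (nonzero * p)) + ∑ (λ v → b v * nonzero))
          ≡⟨ cong (b u *_) (cong₂ _+_ (trans (∑-*ʳ (nonzero * p) _) (cong (_* (nonzero * p)) (∑-pick u b))) (∑-*ʳ nonzero b)) ⟩
        b u * (b u * (nonzero * p) + m * nonzero)
          ≤⟨ *-monoʳ-≤ (b u) (+-monoˡ-≤ (m * nonzero) (⟦⟧-gate (B? u) λ _ → ≤-refl)) ⟩
        b u * (nonzero * p + m * nonzero) ∎

    -- The squared means on the left of `W+` cancel the contribution of the pairs u ≠ v to `∑J`; the
    -- diagonal remains.
    ∑W : ∑ (λ z → NZ z * W z) ≤ nonzero * (p * p * p * m)
    ∑W = +-cancelʳ-≤ (nonzero * p * (p * (m * m))) _ _ (begin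
      ∑ (λ z → NZ z * W z) + nonzero * p * (p * (m * m))
        ≤⟨ +-monoʳ-≤ _ (*-monoˡ-≤ (p * (m * m)) (m≤m+n (nonzero * p) nonzero)) ⟩
      ∑ (λ z → NZ z * W z) + (nonzero * p + nonzero) * (p * (m * m))
        ≡⟨ cong (λ w → ∑ (λ z → NZ z * W z) + w * (p * (m * m))) #nonzeroPts ⟨
      ∑ (λ z → NZ z * W z) + # (λ (z : Pt) → ¬? (z ≟ 0ₚ)) * (p * (m * m))
        ≡⟨ cong (∑ (λ z → NZ z * W z) +_) (∑-*ʳ (p * (m * m)) NZ) ⟨
      ∑ (λ z → NZ z * W z) + ∑ (λ z → NZ z * (p * (m * m)))
        ≡⟨ ∑-+ _ _ ⟨
      ∑ (λ z → NZ z * W z + NZ z * (p * (m * m)))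
        ≡⟨ ∑-cong (λ z → trans (sym (*-distribˡ-+ (NZ z) _ _)) (trans (cong (NZ z *_) (W+ z)) (e₁ (NZ z) (p * p) (J z)))) ⟩
      ∑ (λ z → p * p * (NZ z * J z))
        ≡⟨ ∑-*ˡ (p * p) _ ⟩
      p * p * ∑ (λ z → NZ z * J z)
        ≤⟨ *-monoʳ-≤ (p * p) ∑J ⟩
      p * p * (nonzero * (m * p + m * m))
        ≡⟨ e₂ p nonzero m ⟩
      nonzero * (p * p * p * m) + nonzero * p * (p * (m * m)) ∎)
      where
      open ≤-Reasoning
      e₁ : ∀ a c j → a * (c * j) ≡ c * (a * j)
      e₁ = solve-∀
      e₂ : ∀ p q m → p * p * (q * (m * p + m * m)) ≡ q * (p * p * p * m) + q * p * (p * (m * m))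
      e₂ = solve-∀

    -- W is constant on punctured lines through the origin, each of which meets B in at most k points.
    ∑-B-W : ∑ (λ y → b y * W y) ≤ k * (p * p * p * m)
    ∑-B-W = *-cancelˡ-≤ nonzero {{>-nonZero nonzero>0}} (begin
      nonzero * ∑ (λ y → b y * W y)
        ≡⟨ ∑-*ʳ (∑ (λ y → b y * W y)) _ ⟨
      ∑ (λ (c : F) → ⟦ ¬? (c ≟ 0#) ⟧ * ∑ (λ y → b y * W y))
        ≡⟨ ∑-cong (λ c → ⟦⟧-gate-cong (¬? (c ≟ 0#)) λ c≢0 → trans (sym (∑-⋆ₚ c c≢0 (λ y → b y * W y)))
             (∑-cong λ y → cong (b (c ⋆ₚ y) *_) (W-scale c c≢0 y))) ⟩
      ∑ (λ (c : F) → ⟦ ¬? (c ≟ 0#) ⟧ * ∑ (λ y → b (c ⋆ₚ y) * W y))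
        ≡⟨ trans (∑-cong λ c → sym (∑-*ˡ ⟦ ¬? (c ≟ 0#) ⟧ _)) (∑-swap (λ (c : F) y → ⟦ ¬? (c ≟ 0#) ⟧ * (b (c ⋆ₚ y) * W y))) ⟩
      ∑ (λ y → ∑ λ (c : F) → ⟦ ¬? (c ≟ 0#) ⟧ * (b (c ⋆ₚ y) * W y))
        ≡⟨ ∑-cong (λ y → trans (∑-cong λ c → trans (sym (*-assoc ⟦ ¬? (c ≟ 0#) ⟧ _ _)) (cong (_* W y) (sym (⟦⟧-× (¬? (c ≟ 0#)) (B? (c ⋆ₚ y)))))) (∑-*ʳ (W y) _)) ⟩
      ∑ (λ y → # (λ (c : F) → ¬? (c ≟ 0#) ×? B? (c ⋆ₚ y)) * W y)
        ≤⟨ ∑-mono (λ y → bound y (y ≟ 0ₚ)) ⟩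
      ∑ (λ y → k * (NZ y * W y))
        ≡⟨ ∑-*ˡ k _ ⟩
      k * ∑ (λ y → NZ y * W y)
        ≤⟨ *-monoʳ-≤ k ∑W ⟩
      k * (nonzero * (p * p * p * m))
        ≡⟨ e k nonzero _ ⟩
      nonzero * (k * (p * p * p * m)) ∎)
      where
      open ≤-Reasoning
      e : ∀ k q x → k * (q * x) ≡ q * (k * x)
      e = solve-∀
      zero-point : ∀ c → c ⋆ₚ 0ₚ ≡ 0ₚ
      zero-point c = cong₂ _,_ (z c) (z c)
        where
        z : ∀ c → c *ᶠ 0# ≡ 0#
        z c = trans (*ᶠ-comm c 0#) (zeroˡᶠ c)
      bound : ∀ y (d : Dec (y ≡ 0ₚ)) → # (λ (c : F) → ¬? (c ≟ 0#) ×? B? (c ⋆ₚ y)) * W y ≤ k * (⟦ ¬? d ⟧ * W y)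
      bound y (yes refl) = ≤-trans (≤-reflexive (cong (_* W y) (trans (∑-cong λ c → ⟦⟧-no (¬? (c ≟ 0#) ×? B? (c ⋆ₚ y)) λ (_ , h) → 0∉B (subst B (zero-point c) h)) ∑0))) z≤n
      bound y d@(no n) = *-monoˡ-≤ (W y) (≤-trans (#-injection (λ (c : F) → ¬? (c ≟ 0#) ×? B? (c ⋆ₚ y)) (λ u → B? u ×? OnLine? y u) (_⋆ₚ y)
          (λ c (_ , h) → h , c , refl) (λ s t _ _ → ⋆ₚ-injectiveˡ s t y n)) (lines y n))
        ⟨≤⟩ ≤-reflexive (cong (k *_) (sym (trans (cong (_* W y) (⟦⟧-yes (¬? d) n)) (*-identityˡ (W y)))))
        where
        infixl 1 _⟨≤⟩_
        _⟨≤⟩_ : ∀ {x y z : ℕ} → x ≤ y → y ≤ z → x ≤ z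
        _⟨≤⟩_ = ≤-trans

    areas : F → ℕ
    areas δ = ∑ λ y → b y * N y δ

    ∑-areas : ∑ areas ≡ m * m
    ∑-areas = trans (∑-swap (λ δ y → b y * N y δ)) (trans (∑-cong λ y → trans (∑-*ˡ (b y) (N y)) (cong (b y *_) (∑N y))) (∑-*ʳ m b))

    -- The deviation of `areas` from its mean is a sum over y ∈ B of the deviations of `N y`.
    -- Cauchy-Schwarz over B reduces its square to the sum of `W` over B.
    ∑-areas² : p * ∑ (λ δ → areas δ * areas δ) ≤ k * (p * p) * (m * m) + m * m * (m * m)
    ∑-areas² = *-cancelˡ-≤ p {{>-nonZero p>0}} (begin
      p * (p * S)                              ≡⟨ *-assoc p p S ⟨
      p * p * S                                ≡⟨ +-cancelʳ-≡ (p * (m * m * (m * m))) _ _ exact ⟨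
      V + p * (m * m * (m * m))                ≤⟨ +-monoˡ-≤ _ V≤ ⟩
      m * (k * (p * p * p * m)) + p * (m * m * (m * m))  ≡⟨ e₁ m k p ⟩
      p * (k * (p * p) * (m * m) + m * m * (m * m)) ∎)
      where
      open ≤-Reasoning
      S = ∑ (λ δ → areas δ * areas δ)
      V = ∑ (λ δ → ∣ p * areas δ - m * m ∣ * ∣ p * areas δ - m * m ∣)
      e₁ : ∀ m k p → m * (k * (p * p * p * m)) + p * (m * m * (m * m)) ≡ p * (k * (p * p) * (m * m) + m * m * (m * m))
      e₁ = solve-∀
      e₂ : ∀ v p m → v + p * (m * (m)) + p * (m * m) ≡ v + 2 * (p * m) * m
      e₂ = solve-∀
      e₃ : ∀ p b n → p * (b * n) ≡ b * (p * n)
      e₃ = solve-∀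
      exact : V + p * (m * m * (m * m)) + p * (m * m * (m * m)) ≡ p * p * S + p * (m * m * (m * m))
      exact = trans (e₂ V p (m * m)) (trans (cong (λ w → V + 2 * (p * (m * m)) * w) (sym ∑-areas))
        (trans (variance areas p (m * m)) (cong (λ w → p * p * S + w * (m * m * (m * m))) |F|≡p)))
      deviation : ∀ δ → ∣ p * areas δ - m * m ∣ ≤ ∑ (λ y → b y * ∣ p * N y δ - m ∣)
      deviation δ = begin
        ∣ p * areas δ - m * m ∣
          ≡⟨ cong₂ ∣_-_∣ (trans (sym (∑-*ˡ p _)) (∑-cong λ y → e₃ p (b y) (N y δ))) (sym (∑-*ʳ m b)) ⟩
        ∣ ∑ (λ y → b y * (p * N y δ)) - ∑ (λ y → b y * m) ∣
          ≤⟨ ∑-∣-∣ _ _ ⟩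
        ∑ (λ y → ∣ b y * (p * N y δ) - b y * m ∣)
          ≡⟨ ∑-cong (λ y → sym (*-distribˡ-∣-∣ (b y) (p * N y δ) m)) ⟩
        ∑ (λ y → b y * ∣ p * N y δ - m ∣) ∎
      V≤ : V ≤ m * (k * (p * p * p * m))
      V≤ = begin
        V
          ≤⟨ ∑-mono (λ δ → ≤-trans (*-mono-≤ (deviation δ) (deviation δ)) (cauchy-schwarz-on B? (λ y → ∣ p * N y δ - m ∣))) ⟩
        ∑ (λ δ → m * ∑ (λ y → b y * (∣ p * N y δ - m ∣ * ∣ p * N y δ - m ∣)))
          ≡⟨ ∑-*ˡ m _ ⟩
        m * ∑ (λ δ → ∑ (λ y → b y * (∣ p * N y δ - m ∣ * ∣ p * N y δ - m ∣)))
          ≡⟨ cong (m *_) (trans (∑-swap (λ δ y → b y * (∣ p * N y δ - m ∣ * ∣ p * N y δ - m ∣))) (∑-cong λ y → ∑-*ˡ (b y) _)) ⟩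
        m * ∑ (λ y → b y * W y)
          ≤⟨ *-monoʳ-≤ m ∑-B-W ⟩
        m * (k * (p * p * p * m)) ∎

    T : SL₂ → ℕ
    T g = # λ y → B? y ×? B? (g ▷ y)

    private
      orbit-mass : ∀ y → y ≢ 0ₚ → ∑ (λ g → b (g ▷ y)) ≡ m * p
      orbit-mass y y≢0 = begin
        ∑ (λ g → b (g ▷ y))
          ≡⟨ ∑-cong (λ g → trans (sym (*-identityˡ _)) (cong (_* b (g ▷ y)) (sym (⟦⟧-yes (yes tt) tt)))) ⟩
        ∑ (λ (g : SL₂) → ⟦ yes tt ⟧ * b (g ▷ y))
          ≡⟨ ∑-fibres (λ (g : SL₂) → yes tt) (_▷ y) b ⟨
        ∑ (λ z → b z * # (λ (g : SL₂) → yes tt ×? g ▷ y ≟ z))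
          ≡⟨ ∑-cong (λ z → ⟦⟧-gate-cong (B? z) λ h → trans
               (#-cong (λ (g : SL₂) → yes tt ×? g ▷ y ≟ z) (λ g → g ▷ y ≟ z) (λ g → proj₂) (λ g e → tt , e)) (#moving y z y≢0 (B≢0 h))) ⟩
        ∑ (λ z → b z * p)
          ≡⟨ ∑-*ʳ p b ⟩
        m * p ∎
        where open ≡-Reasoning

    ∑T : ∑ T ≡ m * m * p
    ∑T = begin
      ∑ (λ g → ∑ λ y → ⟦ B? y ×? B? (g ▷ y) ⟧)   ≡⟨ ∑-swap (λ g y → ⟦ B? y ×? B? (g ▷ y) ⟧) ⟩
      ∑ (λ y → ∑ λ g → ⟦ B? y ×? B? (g ▷ y) ⟧)   ≡⟨ ∑-cong (λ y → trans (∑-cong λ g → ⟦⟧-× (B? y) (B? (g ▷ y))) (∑-*ˡ (b y) _)) ⟩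
      ∑ (λ y → b y * ∑ (λ g → b (g ▷ y)))        ≡⟨ ∑-cong (λ y → ⟦⟧-gate-cong (B? y) λ h → orbit-mass y (B≢0 h)) ⟩
      ∑ (λ y → b y * (m * p))                    ≡⟨ trans (∑-*ʳ (m * p) b) (sym (*-assoc m m p)) ⟩
      m * m * p                                  ∎
      where open ≡-Reasoning

    private
      pairs≡areas : ∀ δ → # (λ (z : Pt × Pt) → B? (proj₁ z) ×? (B? (proj₂ z) ×? cross (proj₁ z) (proj₂ z) ≟ δ)) ≡ areas δ
      pairs≡areas δ = trans (∑-× (λ (z , z′) → ⟦ B? z ×? (B? z′ ×? cross z z′ ≟ δ) ⟧))
        (∑-cong λ y → trans (∑-cong λ u → ⟦⟧-× (B? y) (B? u ×? cross y u ≟ δ)) (∑-*ˡ (b y) _))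

      both : Pt → Pt → ℕ
      both y y′ = # λ g → B? (g ▷ y) ×? B? (g ▷ y′)

      -- If y and y′ are independent, g is determined by the images g y and g y′, a pair in B with
      -- the same determinant. If they are parallel, only the condition on g y is kept.
      both≤ : ∀ y y′ → y ≢ 0ₚ → both y y′ ≤ ⟦ cross y y′ ≟ 0# ⟧ * (m * p) + areas (cross y y′)
      both≤ y y′ y≢0 = split (cross y y′ ≟ 0#)
        where
        split : (d : Dec (y ∥ y′)) → both y y′ ≤ ⟦ d ⟧ * (m * p) + areas (cross y y′)
        split d@(yes e) = ≤-trans (≤-trans (#-mono (λ g → B? (g ▷ y) ×? B? (g ▷ y′)) (λ g → B? (g ▷ y)) λ g → proj₁) (≤-reflexive (orbit-mass y y≢0)))
          (≤-trans (≤-reflexive (sym (trans (cong (_* (m * p)) (⟦⟧-yes d e)) (*-identityˡ (m * p))))) (m≤m+n _ _))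
        split (no n) = ≤-trans (≤-trans (#-injection (λ g → B? (g ▷ y) ×? B? (g ▷ y′))
            (λ (z : Pt × Pt) → B? (proj₁ z) ×? (B? (proj₂ z) ×? cross (proj₁ z) (proj₂ z) ≟ cross y y′)) (λ g → g ▷ y , g ▷ y′)
            (λ g (h , h′) → h , h′ , cross-▷ g y y′) (λ g h _ _ q → ▷-determined g h y y′ n (cong proj₁ q) (cong proj₂ q)))
          (≤-reflexive (pairs≡areas (cross y y′)))) (m≤n+m _ _)

    ∑T² : ∑ (λ g → T g * T g) ≤ k * (p * (m * m)) + ∑ (λ δ → areas δ * areas δ)
    ∑T² = begin
      ∑ (λ g → T g * T g)
        ≡⟨ ∑-cong (λ g → trans (∑*∑ (λ y → ⟦ B? y ×? B? (g ▷ y) ⟧) (λ y → ⟦ B? y ×? B? (g ▷ y) ⟧)) (∑-cong λ y → ∑-cong λ y′ → expand g y y′)) ⟩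
      ∑ (λ g → ∑ λ y → ∑ λ y′ → b y * (b y′ * ⟦ B? (g ▷ y) ×? B? (g ▷ y′) ⟧))
        ≡⟨ trans (∑-swap (λ g y → ∑ λ y′ → b y * (b y′ * ⟦ B? (g ▷ y) ×? B? (g ▷ y′) ⟧))) (∑-cong λ y → trans
             (∑-swap (λ g y′ → b y * (b y′ * ⟦ B? (g ▷ y) ×? B? (g ▷ y′) ⟧))) (trans (∑-cong λ y′ → trans (∑-*ˡ (b y) _) (cong (b y *_) (∑-*ˡ (b y′) _))) (∑-*ˡ (b y) _))) ⟩
      ∑ (λ y → b y * ∑ (λ y′ → b y′ * both y y′))
        ≤⟨ ∑-mono (λ y → ⟦⟧-gate-mono (B? y) λ h → inner y (B≢0 h)) ⟩
      ∑ (λ y → b y * (k * (m * p) + ∑ (λ y′ → b y′ * areas (cross y y′))))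
        ≡⟨ trans (∑-cong λ y → *-distribˡ-+ (b y) _ _) (∑-+ _ _) ⟩
      ∑ (λ y → b y * (k * (m * p))) + ∑ (λ y → b y * ∑ (λ y′ → b y′ * areas (cross y y′)))
        ≡⟨ cong₂ _+_ (trans (∑-*ʳ (k * (m * p)) b) (e₁ m k p)) (sym areas²) ⟩
      k * (p * (m * m)) + ∑ (λ δ → areas δ * areas δ) ∎
      where
      open ≤-Reasoning
      e₁ : ∀ m k p → m * (k * (m * p)) ≡ k * (p * (m * m))
      e₁ = solve-∀
      e₂ : ∀ a c d e → a * c * (d * e) ≡ a * (d * (c * e))
      e₂ = solve-∀
      e₄ : ∀ b c x a → b * (c * x + a) ≡ b * c * x + b * a
      e₄ = solve-∀
      expand : ∀ g y y′ → ⟦ B? y ×? B? (g ▷ y) ⟧ * ⟦ B? y′ ×? B? (g ▷ y′) ⟧ ≡ b y * (b y′ * ⟦ B? (g ▷ y) ×? B? (g ▷ y′) ⟧)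
      expand g y y′ = trans (cong₂ _*_ (⟦⟧-× (B? y) (B? (g ▷ y))) (⟦⟧-× (B? y′) (B? (g ▷ y′))))
        (trans (e₂ (b y) (b (g ▷ y)) (b y′) (b (g ▷ y′))) (cong (λ w → b y * (b y′ * w)) (sym (⟦⟧-× (B? (g ▷ y)) (B? (g ▷ y′))))))
      inner : ∀ y → y ≢ 0ₚ → ∑ (λ y′ → b y′ * both y y′) ≤ k * (m * p) + ∑ (λ y′ → b y′ * areas (cross y y′))
      inner y y≢0 = begin
        ∑ (λ y′ → b y′ * both y y′)
          ≤⟨ ∑-mono (λ y′ → *-monoʳ-≤ (b y′) (both≤ y y′ y≢0)) ⟩
        ∑ (λ y′ → b y′ * (⟦ cross y y′ ≟ 0# ⟧ * (m * p) + areas (cross y y′)))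
          ≡⟨ trans (∑-cong λ y′ → trans (e₄ (b y′) ⟦ cross y y′ ≟ 0# ⟧ (m * p) (areas (cross y y′))) (cong (λ w → w * (m * p) + b y′ * areas (cross y y′)) (sym (⟦⟧-× (B? y′) (cross y y′ ≟ 0#))))) (∑-+ _ _) ⟩
        ∑ (λ y′ → ⟦ B? y′ ×? cross y y′ ≟ 0# ⟧ * (m * p)) + ∑ (λ y′ → b y′ * areas (cross y y′))
          ≤⟨ +-monoˡ-≤ _ (≤-trans (≤-reflexive (∑-*ʳ (m * p) _)) (*-monoˡ-≤ (m * p) (≤-trans
               (#-mono (λ y′ → B? y′ ×? cross y y′ ≟ 0#) (λ y′ → B? y′ ×? OnLine? y y′) λ y′ (h , e) → h , ∥⇒multiple y y′ y≢0 e) (lines y y≢0)))) ⟩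
        k * (m * p) + ∑ (λ y′ → b y′ * areas (cross y y′)) ∎
      areas² : ∑ (λ δ → areas δ * areas δ) ≡ ∑ (λ y → b y * ∑ (λ y′ → b y′ * areas (cross y y′)))
      areas² = trans (∑-cong λ δ → sym (∑-*ˡ (areas δ) _)) (trans (∑-swap (λ δ y → areas δ * (b y * N y δ))) (∑-cong λ y → trans
        (∑-cong λ δ → e₃ (areas δ) (b y) (N y δ)) (trans (∑-*ˡ (b y) _) (cong (b y *_) (∑-fibres B? (cross y) areas)))))
        where
        e₃ : ∀ a c n → a * (c * n) ≡ c * (a * n)
        e₃ = solve-∀

    V : ℕ
    V = ∑ λ g → ∣ p * p * T g - m * m ∣ * ∣ p * p * T g - m * m ∣

    -- T has mean close to m² / p². The terms of order p³ m⁴ cancel exactly, once the order of the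
    -- group is bounded by p³. What remains are two terms k p⁵ m², one from parallel pairs and one
    -- from the unequal distribution of determinants.
    V≤ : V ≤ 2 * (k * (p * p * p * p * p) * (m * m))
    V≤ = +-cancelʳ-≤ (2 * (p * p * (m * m)) * (m * m * p)) _ _ (begin
      V + 2 * (p * p * (m * m)) * (m * m * p)
        ≡⟨ cong (λ w → V + 2 * (p * p * (m * m)) * w) ∑T ⟨
      V + 2 * (p * p * (m * m)) * ∑ T
        ≡⟨ variance T (p * p) (m * m) ⟩
      p * p * (p * p) * ∑ (λ g → T g * T g) + ∑ {X = SL₂} (λ _ → 1) * (m * m * (m * m))
        ≤⟨ +-mono-≤ (*-monoʳ-≤ (p * p * (p * p)) ∑T²) (*-monoˡ-≤ (m * m * (m * m)) G≤) ⟩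
      p * p * (p * p) * (k * (p * (m * m)) + D) + p * (p * p) * (m * m * (m * m))
        ≡⟨ e₁ p (m * m) k D ⟩
      k * (p * p * p * p * p) * (m * m) + p * p * p * (p * D) + p * (p * p) * (m * m * (m * m))
        ≤⟨ +-monoˡ-≤ _ (+-monoʳ-≤ (k * (p * p * p * p * p) * (m * m)) (*-monoʳ-≤ (p * p * p) ∑-areas²)) ⟩
      k * (p * p * p * p * p) * (m * m) + p * p * p * (k * (p * p) * (m * m) + m * m * (m * m)) + p * (p * p) * (m * m * (m * m))
        ≡⟨ e₂ p (m * m) k ⟩
      2 * (k * (p * p * p * p * p) * (m * m)) + 2 * (p * p * (m * m)) * (m * m * p) ∎)
      where
      open ≤-Reasoning
      D = ∑ (λ δ → areas δ * areas δ)
      G≤ : ∑ {X = SL₂} (λ _ → 1) ≤ p * (p * p)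
      G≤ = ≤-trans (≤-reflexive (sym (#-true {X = SL₂}))) (≤-trans (m≤m+n _ p) (≤-reflexive |G|+p))
      e₁ : ∀ p s k D → p * p * (p * p) * (k * (p * s) + D) + p * (p * p) * (s * s) ≡ k * (p * p * p * p * p) * s + p * p * p * (p * D) + p * (p * p) * (s * s)
      e₁ = solve-∀
      e₂ : ∀ p s k → k * (p * p * p * p * p) * s + p * p * p * (k * (p * p) * s + s * s) + p * (p * p) * (s * s) ≡ 2 * (k * (p * p * p * p * p) * s) + 2 * (p * p * s) * (s * p)
      e₂ = solve-∀

    module _ {S : SL₂ → Set} (S? : ∀ g → Dec (S g)) where

      private
        n : ℕ
        n = # S?

        r : SL₂ → ℕ
        r = quotients S?

      Q : ℕ
      Q = ∑ λ g → r g * T g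

      -- For two elements g and u g of S that carry x into B, put y = g x: the conditions separate
      -- into g, u g ∈ S and y, u y ∈ B.
      transfers²≡Q : ∑ (λ x → transfers B? S? x * transfers B? S? x) ≡ Q
      transfers²≡Q = begin
        ∑ (λ x → transfers B? S? x * transfers B? S? x)
          ≡⟨ ∑-cong (λ x → trans (∑*∑ (λ g → ⟦ S? g ×? B? (g ▷ x) ⟧) (λ g → ⟦ S? g ×? B? (g ▷ x) ⟧)) (∑-cong λ g → trans
               (sym (∑-rightMul g (λ h → ⟦ S? g ×? B? (g ▷ x) ⟧ * ⟦ S? h ×? B? (h ▷ x) ⟧))) (∑-cong λ u → expand x g u))) ⟩
        ∑ (λ x → ∑ λ g → ∑ λ u → ⟦ S? g ×? S? (u ∙ g) ⟧ * ⟦ B? (g ▷ x) ×? B? (u ▷ g ▷ x) ⟧)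
          ≡⟨ trans (∑-swap (λ x g → ∑ λ u → ⟦ S? g ×? S? (u ∙ g) ⟧ * ⟦ B? (g ▷ x) ×? B? (u ▷ g ▷ x) ⟧))
               (∑-cong λ g → ∑-▷ g (λ y → ∑ λ u → ⟦ S? g ×? S? (u ∙ g) ⟧ * ⟦ B? y ×? B? (u ▷ y) ⟧)) ⟩
        ∑ (λ g → ∑ λ y → ∑ λ u → ⟦ S? g ×? S? (u ∙ g) ⟧ * ⟦ B? y ×? B? (u ▷ y) ⟧)
          ≡⟨ trans (∑-cong λ g → ∑-swap (λ y u → ⟦ S? g ×? S? (u ∙ g) ⟧ * ⟦ B? y ×? B? (u ▷ y) ⟧))
               (∑-swap (λ g u → ∑ λ y → ⟦ S? g ×? S? (u ∙ g) ⟧ * ⟦ B? y ×? B? (u ▷ y) ⟧)) ⟩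
        ∑ (λ u → ∑ λ g → ∑ λ y → ⟦ S? g ×? S? (u ∙ g) ⟧ * ⟦ B? y ×? B? (u ▷ y) ⟧)
          ≡⟨ ∑-cong (λ u → sym (∑*∑ (λ g → ⟦ S? g ×? S? (u ∙ g) ⟧) (λ y → ⟦ B? y ×? B? (u ▷ y) ⟧))) ⟩
        Q ∎
        where
        open ≡-Reasoning
        e : ∀ a c d f → a * c * (d * f) ≡ a * d * (c * f)
        e = solve-∀
        expand : ∀ x g u → ⟦ S? g ×? B? (g ▷ x) ⟧ * ⟦ S? (u ∙ g) ×? B? ((u ∙ g) ▷ x) ⟧ ≡ ⟦ S? g ×? S? (u ∙ g) ⟧ * ⟦ B? (g ▷ x) ×? B? (u ▷ g ▷ x) ⟧
        expand x g u = trans (cong₂ _*_ (⟦⟧-× (S? g) (B? (g ▷ x))) (trans (⟦⟧-× (S? (u ∙ g)) (B? ((u ∙ g) ▷ x))) (cong (λ w → ⟦ S? (u ∙ g) ⟧ * b w) (∙-▷ u g x))))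
          (trans (e ⟦ S? g ⟧ (b (g ▷ x)) ⟦ S? (u ∙ g) ⟧ (b (u ▷ g ▷ x))) (sym (cong₂ _*_ (⟦⟧-× (S? g) (S? (u ∙ g))) (⟦⟧-× (B? (g ▷ x)) (B? (u ▷ g ▷ x))))))

      -- Q is at most its main term plus the deviation s. If the main term accounts for less than
      -- half of Q, then Q is controlled by s, and Cauchy-Schwarz bounds s² by E(S) V.
      Q-bound : p * p * Q ≤ 2 * (n * n * (m * m)) ⊎ Q * Q ≤ 8 * (energy S? * (k * p * (m * m)))
      Q-bound = split (p * p * Q ≤? 2 * (n * n * (m * m)))
        where
        open ≤-Reasoning
        s : ℕ
        s = ∑ λ g → r g * ∣ p * p * T g - m * m ∣
        e₁ : ∀ a r t → a * (r * t) ≡ r * (a * t)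
        e₁ = solve-∀
        first-moment : p * p * Q ≤ n * n * (m * m) + s
        first-moment = begin
          p * p * Q                                               ≡⟨ ∑-*ˡ (p * p) _ ⟨
          ∑ (λ g → p * p * (r g * T g))                           ≤⟨ ∑-mono (λ g → ≤-trans (≤-reflexive (e₁ (p * p) (r g) (T g)))
              (≤-trans (*-monoʳ-≤ (r g) (m≤n+∣m-n∣ (p * p * T g) (m * m))) (≤-reflexive (*-distribˡ-+ (r g) _ _)))) ⟩
          ∑ (λ g → r g * (m * m) + r g * ∣ p * p * T g - m * m ∣) ≡⟨ trans (∑-+ _ _) (cong (_+ s) (trans (∑-*ʳ (m * m) r) (cong (_* (m * m)) (∑-quotients S?)))) ⟩
          n * n * (m * m) + s                                     ∎
        second-moment : s * s ≤ energy S? * V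
        second-moment = cauchy-schwarz r _
        double : ∀ {x y z} → x ≤ y + z → 2 * y ≤ x → x ≤ 2 * z
        double {x} {y} {z} h l = +-cancelʳ-≤ x x (2 * z) (begin
          x + x               ≡⟨ e x ⟩
          2 * x               ≤⟨ *-monoʳ-≤ 2 h ⟩
          2 * (y + z)         ≡⟨ *-distribˡ-+ 2 y z ⟩
          2 * y + 2 * z       ≤⟨ +-monoˡ-≤ (2 * z) l ⟩
          x + 2 * z           ≡⟨ +-comm x (2 * z) ⟩
          2 * z + x           ∎)
          where
          e : ∀ x → x + x ≡ 2 * x
          e = solve-∀
        split : Dec (p * p * Q ≤ 2 * (n * n * (m * m))) → p * p * Q ≤ 2 * (n * n * (m * m)) ⊎ Q * Q ≤ 8 * (energy S? * (k * p * (m * m)))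
        split (yes h) = inj₁ h
        split (no h) = inj₂ (*-cancelˡ-≤ (p * p * (p * p)) {{>-nonZero (*-mono-≤ (*-mono-≤ p>0 p>0) (*-mono-≤ p>0 p>0))}} (begin
          p * p * (p * p) * (Q * Q)                    ≡⟨ e₂ (p * p) Q ⟩
          p * p * Q * (p * p * Q)                      ≤⟨ *-mono-≤ Q≤2s Q≤2s ⟩
          2 * s * (2 * s)                              ≡⟨ e₃ s ⟩
          4 * (s * s)                                  ≤⟨ *-monoʳ-≤ 4 (≤-trans second-moment (*-monoʳ-≤ (energy S?) V≤)) ⟩
          4 * (energy S? * (2 * (k * (p * p * p * p * p) * (m * m)))) ≡⟨ e₄ (energy S?) k p (m * m) ⟩
          p * p * (p * p) * (8 * (energy S? * (k * p * (m * m)))) ∎))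
          where
          Q≤2s : p * p * Q ≤ 2 * s
          Q≤2s = double {p * p * Q} {n * n * (m * m)} {s} first-moment (<⇒≤ (≰⇒> h))
          e₂ : ∀ a Q → a * a * (Q * Q) ≡ a * Q * (a * Q)
          e₂ = solve-∀
          e₃ : ∀ s → 2 * s * (2 * s) ≡ 4 * (s * s)
          e₃ = solve-∀
          e₄ : ∀ E k p s → 4 * (E * (2 * (k * (p * p * p * p * p) * s))) ≡ p * p * (p * p) * (8 * (E * (k * p * s)))
          e₄ = solve-∀

      weighted-transfers : ∀ {A : Pt → Set} (A? : ∀ x → Dec (A x)) →
        ∑ (λ x → ⟦ A? x ⟧ * transfers B? S? x) * ∑ (λ x → ⟦ A? x ⟧ * transfers B? S? x) ≤ # A? * Q
      weighted-transfers A? = ≤-trans (cauchy-schwarz-on A? (transfers B? S?)) (*-monoʳ-≤ (# A?) (≤-trans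
        (∑-mono λ x → ⟦⟧-gate (A? x) {transfers B? S? x * transfers B? S? x} λ _ → ≤-refl) (≤-reflexive transfers²≡Q)))

-- The integers modulo an odd prime as a finite field.

module PrimeField where

  open import Data.Fin.Properties using (toℕ-injective; toℕ-fromℕ<; toℕ<n)
  open import Data.Nat
  open import Data.Nat.Properties
  open import Data.Nat.DivMod
  open import Data.Nat.Coprimality using (prime⇒coprime; coprime-Bézout)
  open import Data.Nat.GCD using (module Bézout)
  open import Defs using (_+F_; _*F_; -F_; 0F; 1F)

  module _ (p : ℕ) .{{_ : NonZero p}} where

    private
      [_] : ℕ → Fin p
      [ m ] = m mod p

      toℕ-[] : ∀ m → toℕ [ m ] ≡ m % p
      toℕ-[] m = toℕ-fromℕ< (m%n<n m p)

      []-toℕ : ∀ x → [ toℕ x ] ≡ x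
      []-toℕ x = toℕ-injective (trans (toℕ-[] (toℕ x)) (m<n⇒m%n≡m (toℕ<n x)))

      []-≡ : ∀ {m n} → m % p ≡ n % p → [ m ] ≡ [ n ]
      []-≡ {m} {n} e = toℕ-injective (trans (toℕ-[] m) (trans e (sym (toℕ-[] n))))

      []-+ : ∀ m n → [ m ] +F [ n ] ≡ [ m + n ]
      []-+ m n = []-≡ (trans (cong₂ (λ a b → (a + b) % p) (toℕ-[] m) (toℕ-[] n)) (sym (%-distribˡ-+ m n p)))

      []-* : ∀ m n → [ m ] *F [ n ] ≡ [ m * n ]
      []-* m n = []-≡ (trans (cong₂ (λ a b → (a * b) % p) (toℕ-[] m) (toℕ-[] n)) (sym (%-distribˡ-* m n p)))

      +[] : ∀ x n → x +F [ n ] ≡ [ toℕ x + n ]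
      +[] x n = trans (cong (_+F [ n ]) (sym ([]-toℕ x))) ([]-+ (toℕ x) n)

      []+ : ∀ m y → [ m ] +F y ≡ [ m + toℕ y ]
      []+ m y = trans (cong ([ m ] +F_) (sym ([]-toℕ y))) ([]-+ m (toℕ y))

      *[] : ∀ x n → x *F [ n ] ≡ [ toℕ x * n ]
      *[] x n = trans (cong (_*F [ n ]) (sym ([]-toℕ x))) ([]-* (toℕ x) n)

      []* : ∀ m y → [ m ] *F y ≡ [ m * toℕ y ]
      []* m y = trans (cong ([ m ] *F_) (sym ([]-toℕ y))) ([]-* m (toℕ y))

      +F-comm : ∀ x y → x +F y ≡ y +F x
      +F-comm x y = cong [_] (+-comm (toℕ x) (toℕ y))

      *F-comm : ∀ x y → x *F y ≡ y *F x
      *F-comm x y = cong [_] (*-comm (toℕ x) (toℕ y))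

      +F-assoc : ∀ x y z → (x +F y) +F z ≡ x +F (y +F z)
      +F-assoc x y z = trans ([]+ (toℕ x + toℕ y) z) (trans (cong [_] (+-assoc (toℕ x) (toℕ y) (toℕ z))) (sym (+[] x (toℕ y + toℕ z))))

      *F-assoc : ∀ x y z → (x *F y) *F z ≡ x *F (y *F z)
      *F-assoc x y z = trans ([]* (toℕ x * toℕ y) z) (trans (cong [_] (*-assoc (toℕ x) (toℕ y) (toℕ z))) (sym (*[] x (toℕ y * toℕ z))))

      +F-identityˡ : ∀ x → 0F +F x ≡ x
      +F-identityˡ x = trans ([]+ 0 x) ([]-toℕ x)

      *F-identityˡ : ∀ x → 1F *F x ≡ x
      *F-identityˡ x = trans ([]* 1 x) (trans (cong [_] (*-identityˡ (toℕ x))) ([]-toℕ x))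

      -F-inverseʳ : ∀ x → x +F (-F x) ≡ 0F
      -F-inverseʳ x = trans (+[] x (p ∸ toℕ x)) ([]-≡ (trans (cong (_% p) (m+[n∸m]≡n (<⇒≤ (toℕ<n x)))) (trans (n%n≡0 p) (sym (m*n%n≡0 0 p)))))

      *F-distribˡ : ∀ x y z → x *F (y +F z) ≡ (x *F y) +F (x *F z)
      *F-distribˡ x y z = trans (*[] x (toℕ y + toℕ z)) (trans (cong [_] (*-distribˡ-+ (toℕ x) (toℕ y) (toℕ z)))
        (sym ([]-+ (toℕ x * toℕ y) (toℕ x * toℕ z))))

    isCommutativeRing : IsCommutativeRing {A = Fin p} _≡_ _+F_ _*F_ (-F_) 0F 1F
    isCommutativeRing = record
      { isRing = record
        { +-isAbelianGroup = record
          { isGroup = record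
            { isMonoid = record
              { isSemigroup = record
                { isMagma = record { isEquivalence = isEquivalence ; ∙-cong = cong₂ _+F_ }
                ; assoc = +F-assoc }
              ; identity = +F-identityˡ , λ x → trans (+F-comm x 0F) (+F-identityˡ x) }
            ; inverse = (λ x → trans (+F-comm (-F x) x) (-F-inverseʳ x)) , -F-inverseʳ
            ; ⁻¹-cong = cong (-F_) }
          ; comm = +F-comm }
        ; *-cong = cong₂ _*F_
        ; *-assoc = *F-assoc
        ; *-identity = *F-identityˡ , λ x → trans (*F-comm x 1F) (*F-identityˡ x)
        ; distrib = *F-distribˡ , λ x y z → trans (*F-comm (y +F z) x) (trans (*F-distribˡ x y z) (cong₂ _+F_ (*F-comm x y) (*F-comm x z))) }
      ; *-comm = *F-comm }

    module _ (prime : Prime p) (p>2 : 2 < p) where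

      private
        ring : CommutativeRing 0ℓ 0ℓ
        ring = record { isCommutativeRing = isCommutativeRing }

        open import Algebra.Properties.Ring (CommutativeRing.ring ring) using (-‿distribʳ-*)
        open import Algebra.Properties.Group (CommutativeRing.+-group ring) using (inverseˡ-unique)

        -- Bézout's identity comes with one of two signs. In the second case it reads 1 + v a = u p,
        -- and the inverse is -v.
        inverse : ∀ x → x ≢ 0F → ∃ λ y → x *F y ≡ 1F
        inverse x x≢0 = from (coprime-Bézout (prime⇒coprime prime {{≢-nonZero λ e → x≢0 (trans (sym ([]-toℕ x)) (cong [_] e))}} (toℕ<n x)))
          where
          a = toℕ x
          kp≡0 : ∀ k → [ k * p ] ≡ 0F
          kp≡0 k = []-≡ (trans (m*n%n≡0 k p) (sym (m*n%n≡0 0 p)))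
          from : Bézout.Identity 1 p a → ∃ λ y → x *F y ≡ 1F
          from (Bézout.-+ u v e) = [ v ] , trans (*F-comm x [ v ]) (trans ([]* v x) (trans (cong [_] (sym e))
            (trans (sym ([]-+ 1 (u * p))) (trans (cong (1F +F_) (kp≡0 u)) (trans (+F-comm 1F 0F) (+F-identityˡ 1F))))))
          from (Bézout.+- u v e) = (-F [ v ]) , trans (sym (-‿distribʳ-* x [ v ])) (sym (inverseˡ-unique 1F (x *F [ v ])
            (trans (cong (1F +F_) (trans (*F-comm x [ v ]) ([]* v x))) (trans ([]-+ 1 (v * a)) (trans (cong [_] e) (kp≡0 u))))))

      primeField : FiniteField
      primeField = record
        { F = Fin p ; finite-F = fin-finite p ; _+_ = _+F_ ; _*_ = _*F_ ; -_ = -F_ ; 0# = 0F ; 1# = 1F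
        ; isCommutativeRing = isCommutativeRing
        ; inverse = inverse
        ; 2≢0 = λ e → contradiction (trans (sym (trans (cong toℕ ([]-+ 1 1)) (trans (toℕ-[] 2) (m<n⇒m%n≡m p>2)))) (trans (cong toℕ e) (trans (toℕ-[] 0) (m*n%n≡0 0 p)))) λ () }

open import Data.Nat using (ℕ; zero; suc; _+_; _*_; _^_; _≤_; _<_; z≤n; s≤s; NonZero; >-nonZero)

-- From Boolean sets and lists to decidable predicates on SL₂ and on points.

module Bridge (p : ℕ) .{{_ : NonZero p}} (prime : Prime p) (p>2 : 2 < p) where

  open import Data.Bool using (Bool; true; false; _∧_; _∨_)
  import Data.Bool.Properties as Boolₚ
  open import Data.Bool.ListAction using (any)
  import Data.Fin.Properties as Finₚ
  open import Data.List using ([]; _∷_; allFin; cartesianProduct)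
  open import Data.List.Membership.Propositional using (_∈_; lose)
  open import Data.List.Membership.Propositional.Properties using (∈-allFin; ∈-map⁺; ∈-concatMap⁺)
  open import Data.List.Relation.Unary.Any using (here; there)
  open import Data.Nat hiding (_≟_)
  open import Data.Nat.Properties hiding (_≟_)
  import Defs as D
  open D using (Mat; Pt; LinesBounded; IsProperSubgroup; cardCosetMeet; incidences; cardPt; cardMat; isSL; inv; allMat; allPt; eqF; eqPt; eqMat; onLine; inCoset; origin)

  𝔽 : FiniteField
  𝔽 = PrimeField.primeField p prime p>2

  open FiniteField 𝔽 using (1#; F-finite)
  open Matrices 𝔽 hiding (Pt; I)
  open Centralizers 𝔽
  open Escape 𝔽
  open Incidence 𝔽 using (OnLine?; transfers)

  True? : (b : Bool) → Dec (b ≡ true)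
  True? b = b Boolₚ.≟ true

  ∧-true : ∀ {x y} → x ∧ y ≡ true → x ≡ true × y ≡ true
  ∧-true {true} {true} e = refl , refl

  true-∧ : ∀ {x y} → x ≡ true → y ≡ true → x ∧ y ≡ true
  true-∧ refl refl = refl

  ⌊⌋-true : ∀ {P : Set} (d : Dec P) → P → ⌊ d ⌋ ≡ true
  ⌊⌋-true (yes _) x = refl
  ⌊⌋-true (no n) x = contradiction x n

  true-⌊⌋ : ∀ {P : Set} (d : Dec P) → ⌊ d ⌋ ≡ true → P
  true-⌊⌋ (yes x) e = x

  count≡sumL : ∀ {X : Set} (f : X → Bool) xs → D.count f xs ≡ sumL xs (λ x → ⟦ True? (f x) ⟧)
  count≡sumL f [] = refl
  count≡sumL f (x ∷ xs) with f x
  ... | true = cong₂ _+_ (sym (⟦⟧-yes (True? true) refl)) (count≡sumL f xs)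
  ... | false = trans (count≡sumL f xs) (cong (_+ sumL xs (λ x → ⟦ True? (f x) ⟧)) (sym (⟦⟧-no (True? false) λ ())))

  any-true : ∀ {X : Set} (f : X → Bool) {x xs} → x ∈ xs → f x ≡ true → any f xs ≡ true
  any-true f {xs = x ∷ xs} (here refl) e = cong (_∨ any f xs) e
  any-true f {xs = y ∷ xs} (there m) e = trans (cong (f y ∨_) (any-true f m e)) (Boolₚ.∨-zeroʳ (f y))

  toMat : Matrix (Fin p) → Mat p
  toMat (mat a b c d) = D.mat a b c d

  fromMat : Mat p → Matrix (Fin p)
  fromMat (D.mat a b c d) = mat a b c d

  ∈-allMat : ∀ X → toMat X ∈ allMat p
  ∈-allMat (mat a b c d) = ∈-concatMap⁺ _ (lose (∈-allFin a) (∈-concatMap⁺ _ (lose (∈-allFin b) (∈-concatMap⁺ _ (lose (∈-allFin c) (∈-map⁺ _ (∈-allFin d)))))))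

  sumL-allMat : ∀ (f : Mat p → ℕ) → sumL (allMat p) f ≡ sumL (elems {{matrix-finite}}) (f ∘ toMat)
  sumL-allMat f = trans
    (trans (sumL-concatMap _ (allFin p) f) (sumL-cong (allFin p) λ a → trans (sumL-concatMap _ (allFin p) f) (sumL-cong (allFin p) λ b →
      trans (sumL-concatMap _ (allFin p) f) (sumL-cong (allFin p) λ c → sumL-map _ (allFin p) f))))
    (sym (trans (sumL-map _ (cartesianProduct F² F²) (f ∘ toMat)) (trans (sumL-cartesianProduct F² F² _)
      (trans (sumL-cartesianProduct (allFin p) (allFin p) _) (sumL-cong (allFin p) λ a → sumL-cong (allFin p) λ b → sumL-cartesianProduct (allFin p) (allFin p) _)))))
    where
    F² = cartesianProduct (allFin p) (allFin p)

  isSL⇒det : ∀ X → isSL (toMat X) ≡ true → det X ≡ 1#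
  isSL⇒det X e = true-⌊⌋ (det X Finₚ.≟ 1#) e

  det⇒isSL : ∀ X → det X ≡ 1# → isSL (toMat X) ≡ true
  det⇒isSL X e = ⌊⌋-true (det X Finₚ.≟ 1#) e

  count-SL : ∀ (f : Mat p → Bool) → (∀ θ → f θ ≡ true → isSL θ ≡ true) → D.count f (allMat p) ≡ # (λ g → True? (f (toMat (matrix g))))
  count-SL f h = begin
    D.count f (allMat p)
      ≡⟨ trans (count≡sumL f (allMat p)) (sumL-allMat _) ⟩
    sumL (elems {{matrix-finite}}) (λ X → ⟦ True? (f (toMat X)) ⟧)
      ≡⟨ sumL-cong (elems {{matrix-finite}}) (λ X → trans (⟦⟧-cong (True? (f (toMat X))) (det X ≟ 1# ×? True? (f (toMat X)))
           (λ e → isSL⇒det X (h (toMat X) e) , e) proj₂) (⟦⟧-× (det X ≟ 1#) (True? (f (toMat X))))) ⟩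
    sumL (elems {{matrix-finite}}) (λ X → ⟦ det X ≟ 1# ⟧ * ⟦ True? (f (toMat X)) ⟧)
      ≡⟨ sumL-SL₂ (λ X → ⟦ True? (f (toMat X)) ⟧) ⟨
    sumL SL₂-elems (λ g → ⟦ True? (f (toMat (matrix g))) ⟧)
      ≡⟨ ∑-sumL (λ g → ⟦ True? (f (toMat (matrix g))) ⟧) ⟨
    # (λ g → True? (f (toMat (matrix g)))) ∎
    where open ≡-Reasoning

  cardPt≡ : ∀ (A : Pt p → Bool) → cardPt A ≡ # (λ x → True? (A x))
  cardPt≡ A = trans (count≡sumL A (allPt p)) (sym (∑-sumL (λ x → ⟦ True? (A x) ⟧)))

  module _ (B : Pt p → Bool) where

    -- Removing the origin from B loses no incidence. Every matrix fixes it, so an incidence with y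
    -- = 0 has x = 0, and (0, 0) is excluded from A × B.
    B* : Pt p → Set
    B* y = B y ≡ true × y ≢ 0ₚ

    B*? : ∀ y → Dec (B* y)
    B*? y = True? (B y) ×? ¬? (y ≟ 0ₚ)

    #B*≤ : # B*? ≤ cardPt B
    #B*≤ = ≤-trans (#-mono B*? (λ y → True? (B y)) λ y → proj₁) (≤-reflexive (sym (cardPt≡ B)))

    eqPt-true : ∀ (x y : Pt p) → x ≡ y → eqPt x y ≡ true
    eqPt-true (a , b) (c , d) refl = true-∧ (⌊⌋-true (a Finₚ.≟ a) refl) (⌊⌋-true (b Finₚ.≟ b) refl)

    true-eqPt : ∀ (x y : Pt p) → eqPt x y ≡ true → x ≡ y
    true-eqPt (a , b) (c , d) e = cong₂ _,_ (true-⌊⌋ (a Finₚ.≟ c) (proj₁ (∧-true e))) (true-⌊⌋ (b Finₚ.≟ d) (proj₂ (∧-true {eqF a c} e)))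

    line-count : ∀ k → LinesBounded B k → ∀ v → v ≢ 0ₚ → # (λ y → B*? y ×? OnLine? v y) ≤ k
    line-count k h v v≢0 = ≤-trans
      (#-mono (λ y → B*? y ×? OnLine? v y) (λ y → True? (B y ∧ onLine v y)) λ y ((b , _) , t , e) →
        true-∧ b (any-true (λ t → eqPt (D.scale t v) y) (∈-allFin t) (eqPt-true _ _ e)))
      (≤-trans (≤-reflexive (sym (trans (count≡sumL (λ y → B y ∧ onLine v y) (allPt p)) (sym (∑-sumL (λ y → ⟦ True? (B y ∧ onLine v y) ⟧))))))
        (h v (not-origin (eqPt v origin) refl)))
      where
      not-origin : ∀ b → eqPt v origin ≡ b → eqPt v origin ≡ false
      not-origin true e = contradiction (true-eqPt v origin e) v≢0
      not-origin false e = e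

    module _ (S : Mat p → Bool) (S⊆SL : ∀ θ → S θ ≡ true → isSL θ ≡ true) (S-symmetric : ∀ θ → S θ ≡ S (inv θ)) where

      S? : ∀ g → Dec (S (toMat (matrix g)) ≡ true)
      S? g = True? (S (toMat (matrix g)))

      cardMat≡ : cardMat S ≡ # S?
      cardMat≡ = count-SL S S⊆SL

      S-inverse : ∀ g → S (toMat (matrix (g ⁻¹))) ≡ S (toMat (matrix g))
      S-inverse g = sym (S-symmetric (toMat (matrix g)))

      -- Reindexing the group by inversion and using the symmetry of S turns θ y = x into y = g x
      -- with g ∈ S. For given x and g there is at most one y.
      incidences≤ : ∀ (A : Pt p → Bool) → ¬ (A origin ≡ true × B origin ≡ true) →
        incidences A B S ≤ ∑ (λ x → ⟦ True? (A x) ⟧ * transfers B*? S? x)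
      incidences≤ A 0∉A×B = begin
        incidences A B S
          ≡⟨ trans (count≡sumL _ (cartesianProduct (cartesianProduct (allPt p) (allPt p)) (allMat p)))
               (trans (sumL-cartesianProduct (cartesianProduct (allPt p) (allPt p)) (allMat p) _) (sumL-cartesianProduct (allPt p) (allPt p) _)) ⟩
        sumL (allPt p) (λ x → sumL (allPt p) λ y → sumL (allMat p) λ θ → ⟦ True? (I x y θ) ⟧)
          ≡⟨ sumL-cong (allPt p) (λ x → sumL-cong (allPt p) λ y → trans (sym (count≡sumL (I x y) (allMat p)))
               (count-SL (I x y) λ θ e → S⊆SL θ (proj₁ (∧-true (proj₂ (∧-true {B y} (proj₂ (∧-true {A x} e)))))))) ⟩
        sumL (allPt p) (λ x → sumL (allPt p) λ y → # λ g → True? (I x y (toMat (matrix g))))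
          ≡⟨ trans (sumL-cong (allPt p) λ x → sym (∑-sumL _)) (sym (∑-sumL _)) ⟩
        ∑ (λ x → ∑ λ y → # λ g → True? (I x y (toMat (matrix g))))
          ≤⟨ ∑-mono bound ⟩
        ∑ (λ x → ⟦ True? (A x) ⟧ * transfers B*? S? x) ∎
        where
        open ≤-Reasoning
        I : Pt p → Pt p → Mat p → Bool
        I x y θ = A x ∧ B y ∧ S θ ∧ eqPt (D.act θ y) x
        split : ∀ x y θ → I x y θ ≡ true → A x ≡ true × B y ≡ true × S θ ≡ true × D.act θ y ≡ x
        split x y θ e =
          let a , e₁ = ∧-true {A x} e ; b , e₂ = ∧-true {B y} e₁ ; s , e₃ = ∧-true {S θ} e₂ in a , b , s , true-eqPt _ x e₃
        single : ∀ x g → # (λ y → True? (I x y (toMat (matrix (g ⁻¹))))) ≤ ⟦ True? (A x) ×? (S? g ×? B*? (g ▷ x)) ⟧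
        single x g = #-inhabited (λ y → True? (I x y (toMat (matrix (g ⁻¹))))) λ y e →
          let a , b , s , q = split x y (toMat (matrix (g ⁻¹))) e
              y≡ = trans (sym (▷-⁻¹ g y)) (cong (g ▷_) q)
              y≢0 = λ y≡0 → 0∉A×B (subst (λ w → A w ≡ true) (trans (sym q) (trans (cong (g ⁻¹ ▷_) y≡0) (▷-0 (g ⁻¹)))) a , subst (λ w → B w ≡ true) y≡0 b)
          in ≤-trans (#-unique (λ y → True? (I x y (toMat (matrix (g ⁻¹))))) λ u v e f → unique u v e f)
               (≤-reflexive (sym (⟦⟧-yes (True? (A x) ×? (S? g ×? B*? (g ▷ x)))
                 (a , trans (sym (S-inverse g)) s , subst (λ w → B w ≡ true) y≡ b , λ z → y≢0 (trans y≡ z)))))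
          where
          unique : ∀ u v → I x u (toMat (matrix (g ⁻¹))) ≡ true → I x v (toMat (matrix (g ⁻¹))) ≡ true → u ≡ v
          unique u v e f =
            let _ , _ , _ , q = split x u (toMat (matrix (g ⁻¹))) e ; _ , _ , _ , r = split x v (toMat (matrix (g ⁻¹))) f
            in trans (sym (▷-⁻¹ g u)) (trans (cong (g ▷_) (trans q (sym r))) (▷-⁻¹ g v))
        bound : ∀ x → ∑ (λ y → # λ g → True? (I x y (toMat (matrix g)))) ≤ ⟦ True? (A x) ⟧ * transfers B*? S? x
        bound x = begin
          ∑ (λ y → # λ g → True? (I x y (toMat (matrix g))))
            ≡⟨ ∑-swap (λ y g → ⟦ True? (I x y (toMat (matrix g))) ⟧) ⟩
          ∑ (λ g → # λ y → True? (I x y (toMat (matrix g))))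
            ≡⟨ ∑-inverse (λ g → # λ y → True? (I x y (toMat (matrix g)))) ⟨
          ∑ (λ g → # λ y → True? (I x y (toMat (matrix (g ⁻¹)))))
            ≤⟨ ∑-mono (single x) ⟩
          ∑ (λ g → ⟦ True? (A x) ×? (S? g ×? B*? (g ▷ x)) ⟧)
            ≡⟨ trans (∑-cong λ g → ⟦⟧-× (True? (A x)) (S? g ×? B*? (g ▷ x))) (∑-*ˡ ⟦ True? (A x) ⟧ _) ⟩
          ⟦ True? (A x) ⟧ * transfers B*? S? x ∎

      module _ {H : SL₂ → Set} (H? : ∀ g → Dec (H g)) (proper : IsProper H) where

        open IsProper proper

        -- The hypothesis on S ranges over Boolean subgroups of matrices; this is the form in which
        -- a decidable subgroup of SL₂ is submitted to it.
        Hᵇ : Mat p → Bool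
        Hᵇ θ = case (det (fromMat θ) ≟ 1#)
          where
          case : Dec (det (fromMat θ) ≡ 1#) → Bool
          case (yes e) = ⌊ H? (⟨ fromMat θ ⟩ {e}) ⌋
          case (no _) = false

        Hᵇ-sound : ∀ θ → Hᵇ θ ≡ true → Σ SL₂ λ g → toMat (matrix g) ≡ θ × H g
        Hᵇ-sound θ e with det (fromMat θ) ≟ 1#
        ... | yes q = ⟨ fromMat θ ⟩ {q} , refl , true-⌊⌋ (H? (⟨ fromMat θ ⟩ {q})) e

        Hᵇ-complete : ∀ g → H g → Hᵇ (toMat (matrix g)) ≡ true
        Hᵇ-complete g h with det (matrix g) ≟ 1#
        ... | yes q = ⌊⌋-true (H? (⟨ matrix g ⟩ {q})) h
        ... | no n = contradiction (det≡1 g) n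

        Hᵇ-proper : IsProperSubgroup Hᵇ
        Hᵇ-proper =
          (λ θ e → let g , q , _ = Hᵇ-sound θ e in subst (λ w → isSL w ≡ true) q (det⇒isSL (matrix g) (det≡1 g))) ,
          Hᵇ-complete ε ε∈ ,
          (λ θ η e f → let g , q , u = Hᵇ-sound θ e ; h , r , v = Hᵇ-sound η f in
            subst₂ (λ a b → Hᵇ (D.mul a b) ≡ true) q r (Hᵇ-complete (g ∙ h) (∙-closed u v))) ,
          (λ θ e → let g , q , u = Hᵇ-sound θ e in subst (λ a → Hᵇ (inv a) ≡ true) q (Hᵇ-complete (g ⁻¹) (⁻¹-closed u))) ,
          (let g , n = missing in toMat (matrix g) , det⇒isSL (matrix g) (det≡1 g) , outside g n (Hᵇ (toMat (matrix g))) refl)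
          where
          outside : ∀ g → ¬ H g → ∀ b → Hᵇ (toMat (matrix g)) ≡ b → Hᵇ (toMat (matrix g)) ≡ false
          outside g n false e = e
          outside g n true e = contradiction (let h , q , u = Hᵇ-sound (toMat (matrix g)) e in subst H (SL₂-≡ (cong fromMat q)) u) n

        coset-count : ∀ x → # (λ g → S? g ×? H? (x ⁻¹ ∙ g)) ≤ cardCosetMeet S (toMat (matrix x)) Hᵇ
        coset-count x = ≤-trans (#-mono (λ g → S? g ×? H? (x ⁻¹ ∙ g)) (λ g → True? (S (toMat (matrix g)) ∧ inCoset X Hᵇ (toMat (matrix g)))) λ g (s , h) →
            true-∧ s (any-true (λ η → Hᵇ η ∧ eqMat (D.mul X η) (toMat (matrix g))) (∈-allMat (matrix (x ⁻¹ ∙ g)))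
              (true-∧ (Hᵇ-complete (x ⁻¹ ∙ g) h) (eqMat-true _ _ (cong toMat (cong matrix (x∙x⁻¹y x g)))))))
          (≤-reflexive (sym (count-SL (λ θ → S θ ∧ inCoset X Hᵇ θ) λ θ e → S⊆SL θ (proj₁ (∧-true e)))))
          where
          X = toMat (matrix x)
          eqMat-true : ∀ (θ η : Mat p) → θ ≡ η → eqMat θ η ≡ true
          eqMat-true (D.mat a b c d) .(D.mat a b c d) refl = true-∧ (⌊⌋-true (a Finₚ.≟ a) refl) (true-∧ (⌊⌋-true (b Finₚ.≟ b) refl)
            (true-∧ (⌊⌋-true (c Finₚ.≟ c) refl) (⌊⌋-true (d Finₚ.≟ d) refl)))

open import Defs
open import Data.Bool using (Bool; true)
open import Data.Nat.Properties hiding (_≟_)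

-- Arithmetic with γ = a/b and ε = 1/d.

square-power : ∀ x b → x ^ (2 * b) ≡ x ^ b * x ^ b
square-power x b = trans (cong (x ^_) (cong (b +_) (+-identityʳ b))) (^-distribˡ-+-* x b b)

module SizeConstraints (a b p n c Λ : ℕ) (a>0 : 0 < a) (b>0 : 0 < b) (p>1 : 1 < p)
  (constants : (c + 8 * Λ) ^ (2 * b) ≤ p ^ a) (n-large : p ^ a < n ^ b) (n-small : n ^ b * p ^ (2 * a) < p ^ (3 * b)) where

  open ≤-Reasoning

  private
    p>0 : 0 < p
    p>0 = <-trans (s≤s z≤n) p>1

  n>0 : 0 < n
  n>0 = n≢0⇒n>0 λ { refl → contradiction (<-≤-trans n-large (≤-reflexive (zero-power b b>0))) λ () }
    where
    zero-power : ∀ b → 0 < b → 0 ^ b ≡ 0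
    zero-power (suc b) _ = refl

  -- The factor p^(γ/2) of the hypothesis, raised to the power 2b, is p^a, and this dominates the
  -- same power of the constant.
  nonconcentrated : ∀ m → m ^ (2 * b) * p ^ a < n ^ (2 * b) → c * m < n
  nonconcentrated m h = ≰⇒> λ n≤cm → <⇒≱ h (begin
    n ^ (2 * b)                          ≤⟨ ^-monoˡ-≤ (2 * b) n≤cm ⟩
    (c * m) ^ (2 * b)                    ≡⟨ ^-distribʳ-* (2 * b) c m ⟩
    c ^ (2 * b) * m ^ (2 * b)            ≤⟨ *-monoˡ-≤ (m ^ (2 * b)) (≤-trans (^-monoˡ-≤ (2 * b) (m≤m+n c (8 * Λ))) constants) ⟩
    p ^ a * m ^ (2 * b)                  ≡⟨ *-comm (p ^ a) _ ⟩
    m ^ (2 * b) * p ^ a                  ∎)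

  -- The assumed bound has exponent 2b, more than the exponent b needed here; the value 0 is treated
  -- apart because lowering an exponent requires a positive base.
  8Λ^b≤ : (8 * Λ) ^ b ≤ p ^ a
  8Λ^b≤ = split (8 * Λ) refl
    where
    split : ∀ x → 8 * Λ ≡ x → x ^ b ≤ p ^ a
    split zero _ = ≤-trans (^-monoˡ-≤ b (z≤n {1})) (≤-trans (≤-reflexive (^-zeroˡ b)) (m^n>0 p {{>-nonZero p>0}} a))
    split (suc x) e = begin
      suc x ^ b                          ≤⟨ m≤m*n (suc x ^ b) (suc x ^ b) {{m^n≢0 (suc x) b}} ⟩
      suc x ^ b * suc x ^ b              ≡⟨ square-power (suc x) b ⟨
      suc x ^ (2 * b)                    ≤⟨ ^-monoˡ-≤ (2 * b) (subst (_≤ c + 8 * Λ) e (m≤n+m (8 * Λ) c)) ⟩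
      (c + 8 * Λ) ^ (2 * b)              ≤⟨ constants ⟩
      p ^ a                              ∎

  not-small : ¬ n ≤ Λ
  not-small h = <⇒≱ n-large (≤-trans (^-monoˡ-≤ b (≤-trans h (m≤n*m Λ 8))) 8Λ^b≤)

  -- The order G is at least p³ / 2, so the alternative would give p⁶ ≤ 8Λ n². Together with n^b <
  -- p^(3b - 2a) this yields p^(4a) < (8Λ)^b ≤ p^a.
  not-grown : ∀ G → G + p ≡ p * (p * p) → ¬ G ^ 3 ≤ Λ * (p ^ 3 * n ^ 2)
  not-grown G G+p h = <⇒≱ beyond (≤-trans 8Λ^b≤ (^-monoʳ-≤ p {{>-nonZero p>0}} (m≤n*m a 4)))
    where
    q = p * (p * p)
    2p≤q : p + p ≤ q
    2p≤q = begin
      p + p             ≡⟨ e p ⟩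
      p * 2             ≤⟨ *-monoʳ-≤ p (≤-trans p>1 (m≤m*n p p {{>-nonZero p>0}})) ⟩
      p * (p * p)       ∎
      where
      e : ∀ p → p + p ≡ p * 2
      e = solve-∀
    q≤2G : q ≤ 2 * G
    q≤2G = +-cancelʳ-≤ q q (2 * G) (begin
      q + q                   ≡⟨ cong₂ _+_ (sym G+p) (sym G+p) ⟩
      G + p + (G + p)         ≡⟨ e G p ⟩
      2 * G + (p + p)         ≤⟨ +-monoʳ-≤ (2 * G) 2p≤q ⟩
      2 * G + q               ∎)
      where
      e : ∀ G p → G + p + (G + p) ≡ 2 * G + (p + p)
      e = solve-∀
    p⁶≤ : p ^ 6 ≤ 8 * Λ * n ^ 2
    p⁶≤ = *-cancelˡ-≤ (p ^ 3) {{m^n≢0 p 3 {{>-nonZero p>0}}}} (begin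
      p ^ 3 * p ^ 6                     ≡⟨ e₁ p ⟩
      q ^ 3                             ≤⟨ ^-monoˡ-≤ 3 q≤2G ⟩
      (2 * G) ^ 3                       ≡⟨ e₂ G ⟩
      8 * G ^ 3                         ≤⟨ *-monoʳ-≤ 8 h ⟩
      8 * (Λ * (p ^ 3 * n ^ 2))         ≡⟨ e₃ Λ (p ^ 3) (n ^ 2) ⟩
      p ^ 3 * (8 * Λ * n ^ 2)           ∎)
      where
      e₁ : ∀ p → p * (p * (p * 1)) * (p * (p * (p * (p * (p * (p * 1)))))) ≡ p * (p * p) * (p * (p * p) * (p * (p * p) * 1))
      e₁ = solve-∀
      e₂ : ∀ G → 2 * G * (2 * G * (2 * G * 1)) ≡ 8 * (G * (G * (G * 1)))
      e₂ = solve-∀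
      e₃ : ∀ l p n → 8 * (l * (p * n)) ≡ p * (8 * l * n)
      e₃ = solve-∀
    beyond : p ^ (4 * a) < (8 * Λ) ^ b
    beyond = *-cancelˡ-< (n ^ (2 * b)) _ _ (begin-strict
      n ^ (2 * b) * p ^ (4 * a)                     ≡⟨ cong₂ _*_ (square-power n b) (trans (cong (p ^_) (e₁ a)) (square-power p (2 * a))) ⟩
      n ^ b * n ^ b * (p ^ (2 * a) * p ^ (2 * a))   ≡⟨ e₂ (n ^ b) (p ^ (2 * a)) ⟩
      n ^ b * p ^ (2 * a) * (n ^ b * p ^ (2 * a))   <⟨ *-mono-< n-small n-small ⟩
      p ^ (3 * b) * p ^ (3 * b)                     ≡⟨ ^-distribˡ-+-* p (3 * b) (3 * b) ⟨
      p ^ (3 * b + 3 * b)                           ≡⟨ cong (p ^_) (e₃ b) ⟩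
      p ^ (6 * b)                                   ≡⟨ ^-*-assoc p 6 b ⟨
      (p ^ 6) ^ b                                   ≤⟨ ^-monoˡ-≤ b p⁶≤ ⟩
      (8 * Λ * n ^ 2) ^ b                           ≡⟨ trans (^-distribʳ-* b (8 * Λ) (n ^ 2)) (cong ((8 * Λ) ^ b *_) (^-*-assoc n 2 b)) ⟩
      (8 * Λ) ^ b * n ^ (2 * b)                     ≡⟨ *-comm ((8 * Λ) ^ b) _ ⟩
      n ^ (2 * b) * (8 * Λ) ^ b                     ∎)
      where
      e₁ : ∀ a → 4 * a ≡ 2 * (2 * a)
      e₁ = solve-∀
      e₂ : ∀ x y → x * x * (y * y) ≡ x * y * (x * y)
      e₂ = solve-∀
      e₃ : ∀ b → 3 * b + 3 * b ≡ 6 * b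
      e₃ = solve-∀

-- With p ≤ (2K)ᵈ, a saving of K in the energy becomes a saving of p in the d-th power of the bound.
module Optimization (d p K X α β m n k Q E : ℕ) (p≤ : p ≤ (2 * K) ^ d) (d>0 : 0 < d) (p>0 : 0 < p)
  (X²≤ : X * X ≤ α * Q) (m≤β : m ≤ β) (energy≤ : K * E ≤ n * n * n)
  (bound : p * p * Q ≤ 2 * (n * n * (m * m)) ⊎ Q * Q ≤ 8 * (E * (k * p * (m * m)))) where

  open ≤-Reasoning

  Goal : Set
  Goal = Σ ℕ λ u → Σ ℕ λ v →
      X ≤ u + v ×
      u ^ 2 * p ^ 2 ≤ 2 ^ 2 * α * β ^ 2 * n ^ 2 ×
      v ^ (4 * d) * p ^ 1 ≤ 2 ^ (4 * d) * k ^ d * p ^ d * α ^ (2 * d) * β ^ (2 * d) * n ^ (3 * d)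

  conclusion : Goal
  conclusion = cases bound
    where
    main : p * p * Q ≤ 2 * (n * n * (m * m)) → X ^ 2 * p ^ 2 ≤ 2 ^ 2 * α * β ^ 2 * n ^ 2
    main h = begin
      X ^ 2 * p ^ 2                        ≡⟨ e₁ X p ⟩
      X * X * (p * p)                      ≤⟨ *-monoˡ-≤ (p * p) X²≤ ⟩
      α * Q * (p * p)                      ≡⟨ e₂ α Q p ⟩
      α * (p * p * Q)                      ≤⟨ *-monoʳ-≤ α (≤-trans h (*-mono-≤ {2} {4} (s≤s (s≤s z≤n)) (*-monoʳ-≤ (n * n) (*-mono-≤ m≤β m≤β)))) ⟩
      α * (4 * (n * n * (β * β)))          ≡⟨ e₃ α n β ⟩
      2 ^ 2 * α * β ^ 2 * n ^ 2            ∎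
      where
      e₁ : ∀ X p → X * (X * 1) * (p * (p * 1)) ≡ X * X * (p * p)
      e₁ = solve-∀
      e₂ : ∀ a q p → a * q * (p * p) ≡ a * (p * p * q)
      e₂ = solve-∀
      e₃ : ∀ a n b → a * (4 * (n * n * (b * b))) ≡ 4 * a * (b * (b * 1)) * (n * (n * 1))
      e₃ = solve-∀
    -- Squaring X² ≤ α Q brings in Q² and with it the energy; the factor K is then spent on K E ≤
    -- n³.
    X⁴K : Q * Q ≤ 8 * (E * (k * p * (m * m))) → X ^ 4 * K ≤ 8 * (k * p * α ^ 2 * β ^ 2 * n ^ 3)
    X⁴K h = begin
      X ^ 4 * K                                     ≡⟨ e₁ X K ⟩
      X * X * (X * X) * K                           ≤⟨ *-monoˡ-≤ K (*-mono-≤ X²≤ X²≤) ⟩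
      α * Q * (α * Q) * K                           ≡⟨ e₂ α Q K ⟩
      α * α * K * (Q * Q)                           ≤⟨ *-monoʳ-≤ (α * α * K) (≤-trans h (*-monoʳ-≤ 8 (*-monoʳ-≤ E (*-monoʳ-≤ (k * p) (*-mono-≤ m≤β m≤β))))) ⟩
      α * α * K * (8 * (E * (k * p * (β * β))))     ≡⟨ e₃ α K E k p β ⟩
      8 * (k * p * α ^ 2 * β ^ 2) * (K * E)         ≤⟨ *-monoʳ-≤ (8 * (k * p * α ^ 2 * β ^ 2)) energy≤ ⟩
      8 * (k * p * α ^ 2 * β ^ 2) * (n * n * n)     ≡⟨ e₄ (k * p * α ^ 2 * β ^ 2) n ⟩
      8 * (k * p * α ^ 2 * β ^ 2 * n ^ 3)           ∎
      where
      e₁ : ∀ X K → X * (X * (X * (X * 1))) * K ≡ X * X * (X * X) * K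
      e₁ = solve-∀
      e₂ : ∀ a q K → a * q * (a * q) * K ≡ a * a * K * (q * q)
      e₂ = solve-∀
      e₃ : ∀ a K E k p b → a * a * K * (8 * (E * (k * p * (b * b)))) ≡ 8 * (k * p * (a * (a * 1)) * (b * (b * 1))) * (K * E)
      e₃ = solve-∀
      e₄ : ∀ x n → 8 * x * (n * n * n) ≡ 8 * (x * (n * (n * (n * 1))))
      e₄ = solve-∀
    error : Q * Q ≤ 8 * (E * (k * p * (m * m))) → X ^ (4 * d) * p ^ 1 ≤ 2 ^ (4 * d) * k ^ d * p ^ d * α ^ (2 * d) * β ^ (2 * d) * n ^ (3 * d)
    error h = begin
      X ^ (4 * d) * p ^ 1                              ≤⟨ *-mono-≤ (≤-reflexive (sym (^-*-assoc X 4 d))) (≤-trans (≤-reflexive (*-identityʳ p)) p≤) ⟩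
      (X ^ 4) ^ d * (2 * K) ^ d                        ≡⟨ ^-distribʳ-* d (X ^ 4) (2 * K) ⟨
      (X ^ 4 * (2 * K)) ^ d                            ≤⟨ ^-monoˡ-≤ d (begin
          X ^ 4 * (2 * K)                              ≡⟨ e₁ (X ^ 4) K ⟩
          2 * (X ^ 4 * K)                              ≤⟨ *-monoʳ-≤ 2 (X⁴K h) ⟩
          2 * (8 * (k * p * α ^ 2 * β ^ 2 * n ^ 3))    ≡⟨ e₂ (k * p * α ^ 2 * β ^ 2) (n ^ 3) k p (α ^ 2) (β ^ 2) refl ⟩
          2 ^ 4 * k * p * α ^ 2 * β ^ 2 * n ^ 3        ∎) ⟩
      (2 ^ 4 * k * p * α ^ 2 * β ^ 2 * n ^ 3) ^ d      ≡⟨ distribute ⟩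
      2 ^ (4 * d) * k ^ d * p ^ d * α ^ (2 * d) * β ^ (2 * d) * n ^ (3 * d) ∎
      where
      e₁ : ∀ x K → x * (2 * K) ≡ 2 * (x * K)
      e₁ = solve-∀
      e₂′ : ∀ k p a b n → 2 * (8 * (k * p * a * b * n)) ≡ 16 * k * p * a * b * n
      e₂′ = solve-∀
      e₂ : ∀ y n k p a b → y ≡ k * p * a * b → 2 * (8 * (y * n)) ≡ 16 * k * p * a * b * n
      e₂ y n k p a b refl = e₂′ k p a b n
      distribute : (2 ^ 4 * k * p * α ^ 2 * β ^ 2 * n ^ 3) ^ d ≡ 2 ^ (4 * d) * k ^ d * p ^ d * α ^ (2 * d) * β ^ (2 * d) * n ^ (3 * d)
      distribute =
        trans (^-distribʳ-* d (2 ^ 4 * k * p * α ^ 2 * β ^ 2) (n ^ 3)) (cong₂ _*_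
        (trans (^-distribʳ-* d (2 ^ 4 * k * p * α ^ 2) (β ^ 2)) (cong₂ _*_
        (trans (^-distribʳ-* d (2 ^ 4 * k * p) (α ^ 2)) (cong₂ _*_
        (trans (^-distribʳ-* d (2 ^ 4 * k) p) (cong (_* p ^ d)
        (trans (^-distribʳ-* d (2 ^ 4) k) (cong (_* k ^ d) (^-*-assoc 2 4 d)))))
        (^-*-assoc α 2 d))) (^-*-assoc β 2 d))) (^-*-assoc n 3 d))
    zero-power : ∀ e → 0 < e → 0 ^ e ≡ 0
    zero-power (suc e) _ = refl
    cases : p * p * Q ≤ 2 * (n * n * (m * m)) ⊎ Q * Q ≤ 8 * (E * (k * p * (m * m))) → Goal
    -- The alternative that holds carries the whole of X, and the other term is 0.
    cases (inj₁ h) = X , 0 , ≤-reflexive (sym (+-identityʳ X)) , main h ,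
      ≤-trans (≤-reflexive (cong (_* p ^ 1) (zero-power (4 * d) (*-mono-≤ {1} {4} (s≤s z≤n) d>0)))) z≤n
    cases (inj₂ h) = 0 , X , ≤-refl , z≤n , error h

-- Assembly for a fixed prime and the theorem.

module FixedPrime (p : ℕ) .{{_ : NonZero p}} (prime : Prime p) (p>2 : 2 < p) where

  open Bridge p prime p>2
  open Matrices 𝔽 using (SL₂; SL₂-finite; matrix; _∙_; ε; _⁻¹; isGroup)
  open Escape 𝔽 using (IsProper; 0ₚ; finite-Pt)
  open Points 𝔽 using (_⋆ₚ_)
  open BSG SL₂ SL₂-finite _∙_ ε _⁻¹ isGroup using (energy)
  open Incidence 𝔽 using (OnLine?; module PointSet)
  open FiniteSums using (Finite)
  open Fields.FiniteField 𝔽 using (F-finite)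

  private instance
    finite-G : Finite SL₂
    finite-G = SL₂-finite

  |F| : Points.p 𝔽 ≡ p
  |F| = trans (FiniteSums.#-true {{FiniteSums.fin-finite p}}) (FiniteSums.∑-Fin p)

  module _ (a b d K : ℕ) (a>0 : 0 < a) (b>0 : 0 < b) (d>0 : 0 < d)
    (constants : (concentrationConstant K + 8 * flatteningConstant K) ^ (2 * b) ≤ p ^ a) (p≤ : p ≤ (2 * K) ^ d)
    (A B : Pt p → Bool) (S : Mat p → Bool)
    (0∉A×B : ¬ (A origin ≡ true × B origin ≡ true))
    (S⊆SL : ∀ θ → S θ ≡ true → isSL θ ≡ true)
    (S-symmetric : ∀ θ → S θ ≡ S (inv θ))
    (S-large : p ^ a < cardMat S ^ b)
    (S-small : cardMat S ^ b * p ^ (2 * a) < p ^ (3 * b))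
    (S-spread : ∀ H → IsProperSubgroup H → ∀ g → isSL g ≡ true → cardCosetMeet S g H ^ (2 * b) * p ^ a < cardMat S ^ (2 * b)) where

    open SizeConstraints a b p (cardMat S) (concentrationConstant K) (flatteningConstant K) a>0 b>0 (<-trans (s≤s (s≤s z≤n)) p>2) constants S-large S-small

    private
      s? : ∀ g → Dec (S (toMat (matrix g)) ≡ true)
      s? = S? B S S⊆SL S-symmetric

      n≡ : cardMat S ≡ # s?
      n≡ = cardMat≡ B S S⊆SL S-symmetric

    spread : ∀ {H : SL₂ → Set} (H? : ∀ g → Dec (H g)) → IsProper H → ∀ x → concentrationConstant K * # (λ g → s? g ×? H? (x ⁻¹ ∙ g)) < # s?
    spread H? proper x = subst (concentrationConstant K * # (λ g → s? g ×? H? (x ⁻¹ ∙ g)) <_) n≡ (≤-<-trans (*-monoʳ-≤ (concentrationConstant K) (coset-count B S S⊆SL S-symmetric H? proper x))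
      (nonconcentrated (cardCosetMeet S (toMat (matrix x)) (Hᵇ B S S⊆SL S-symmetric H? proper))
        (S-spread _ (Hᵇ-proper B S S⊆SL S-symmetric H? proper) (toMat (matrix x)) (det⇒isSL (matrix x) (Matrices.det≡1 𝔽 x)))))

    -- If it failed, `flattening` would leave two ranges for |S|, which the lower and the upper
    -- bound on |S| exclude.
    energy-saving : K * energy s? ≤ cardMat S * cardMat S * cardMat S
    energy-saving = ≮⇒≥ λ h → refute (Flattening.flattening 𝔽 K s? (subst (0 <_) n≡ n>0)
      (subst (λ m → m * m * m ≤ K * energy s?) n≡ (<⇒≤ h)) spread)
      where
      refute : ¬ (# s? ≤ flatteningConstant K ⊎ Points.|G| 𝔽 ^ 3 ≤ flatteningConstant K * (Points.p 𝔽 ^ 3 * # s? ^ 2))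
      refute (inj₁ h) = not-small (subst (_≤ flatteningConstant K) (sym n≡) h)
      refute (inj₂ h) = not-grown (Points.|G| 𝔽) (subst (λ q → Points.|G| 𝔽 + q ≡ q * (q * q)) |F| (Points.|G|+p 𝔽))
        (subst₂ (λ q m → Points.|G| 𝔽 ^ 3 ≤ flatteningConstant K * (q ^ 3 * m ^ 2)) |F| (sym n≡) h)

    module _ (k : ℕ) (lines : ∀ v → v ≢ 0ₚ → # (λ y → B*? B y ×? OnLine? v y) ≤ k) where

      module B* = PointSet (B*? B) (λ z → proj₂ z refl) k lines

      X²≤ : incidences A B S * incidences A B S ≤ cardPt A * B*.Q s?
      X²≤ = ≤-trans (*-mono-≤ (incidences≤ B S S⊆SL S-symmetric A 0∉A×B) (incidences≤ B S S⊆SL S-symmetric A 0∉A×B))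
        (≤-trans (B*.weighted-transfers s? (λ x → True? (A x))) (*-monoˡ-≤ (B*.Q s?) (≤-reflexive (sym (cardPt≡ A)))))

      bounded : p * p * B*.Q s? ≤ 2 * (cardMat S * cardMat S * (# (B*? B) * # (B*? B))) ⊎
        B*.Q s? * B*.Q s? ≤ 8 * (energy s? * (k * p * (# (B*? B) * # (B*? B))))
      bounded = subst₂ (λ q n → q * q * B*.Q s? ≤ 2 * (n * n * (# (B*? B) * # (B*? B))) ⊎
        B*.Q s? * B*.Q s? ≤ 8 * (energy s? * (k * q * (# (B*? B) * # (B*? B))))) |F| (sym n≡) (B*.Q-bound s?)

      open Optimization d p K (incidences A B S) (cardPt A) (cardPt B) (# (B*? B)) (cardMat S) k (B*.Q s?) (energy s?)
        p≤ d>0 (<-trans (s≤s z≤n) (<-trans (s≤s (s≤s z≤n)) p>2)) X²≤ (#B*≤ B) energy-saving bounded public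

    -- The case k = p, which turns the bound for B with few points on each line into the general
    -- bound.
    lines-trivial : ∀ v → v ≢ 0ₚ → # (λ y → B*? B y ×? OnLine? v y) ≤ p
    lines-trivial v _ = ≤-trans (#-cover (λ y → B*? B y ×? OnLine? v y) (λ (t : Fin p) → yes tt) (λ y t → t ⋆ₚ v ≟ y) 1
        (λ y (_ , t , e) → t , tt , e) (λ t _ → #-unique _ λ x y (_ , e) (_ , f) → trans (sym e) f))
      (≤-reflexive (trans (*-identityʳ _) |F|))

-- Here γ = a/b and ε = e/d, with all fractional exponents cleared by taking powers. The hypotheses
-- on S become weaker as γ decreases, so rational γ suffice. The numbers u and v are the two terms
-- of the bound.
theorem2p2 : (a b : ℕ) → 0 < a → a < b →
    Σ ℕ λ e → Σ ℕ λ d → 0 < e × 0 < d × Σ ℕ λ C → Σ ℕ λ p0 →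
    ∀ (p : ℕ) .{{_ : NonZero p}} → Prime p → p0 ≤ p →
    ∀ (A B : Pt p → Bool) (S : Mat p → Bool) →
    ¬ (A origin ≡ true × B origin ≡ true) →
    (∀ θ → S θ ≡ true → isSL θ ≡ true) →
    (∀ θ → S θ ≡ S (inv θ)) →
    p ^ a < cardMat S ^ b →
    cardMat S ^ b * p ^ (2 * a) < p ^ (3 * b) →
    (∀ H → IsProperSubgroup H → ∀ g → isSL g ≡ true →
    cardCosetMeet S g H ^ (2 * b) * p ^ a < cardMat S ^ (2 * b)) →
    (Σ ℕ λ u → Σ ℕ λ v →
    incidences A B S ≤ u + v ×
    u ^ 2 * p ^ 2 ≤ C ^ 2 * cardPt A * cardPt B ^ 2 * cardMat S ^ 2 ×
    v ^ (4 * d) * p ^ e ≤ C ^ (4 * d) * p ^ (2 * d) * cardPt A ^ (2 * d) * cardPt B ^ (2 * d) * cardMat S ^ (3 * d))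
    ×
    (∀ k → LinesBounded B k →
    Σ ℕ λ u → Σ ℕ λ v →
    incidences A B S ≤ u + v ×
    u ^ 2 * p ^ 2 ≤ C ^ 2 * cardPt A * cardPt B ^ 2 * cardMat S ^ 2 ×
    v ^ (4 * d) * p ^ e ≤ C ^ (4 * d) * k ^ d * p ^ d * cardPt A ^ (2 * d) * cardPt B ^ (2 * d) * cardMat S ^ (3 * d))
-- The witnesses are ε = 1/d and C = 2. In the threshold, 3 makes p odd and 2^d makes the d-th root
-- `K` at least 2, as the polynomial bounds on the constants require.
theorem2p2 a b a>0 a<b = 1 , d , s≤s z≤n , s≤s z≤n , 2 , 3 + 2 ^ d , λ p prime p0≤p A B S 0∉A×B S⊆SL S-symmetric S-large S-small S-spread →
    let root = integer-root degree p
        K = proj₁ root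
        K^d≤p = proj₁ (proj₂ root)
        p<[1+K]^d = proj₂ (proj₂ root)
        p>2 = ≤-trans (m≤m+n 3 (2 ^ d)) p0≤p
        K≥2 = K≥2 p K p0≤p p<[1+K]^d
        p≤ = ≤-trans (<⇒≤ p<[1+K]^d) (^-monoˡ-≤ d (1+K≤2K K K≥2))
        constants = constants p K K≥2 K^d≤p (≤-trans (s≤s z≤n) p>2)
    in (let u , v , h , main , error = FixedPrime.conclusion p prime p>2 a b d K a>0 b>0 (s≤s z≤n) constants p≤ A B S 0∉A×B S⊆SL S-symmetric S-large S-small S-spread p
                                        (FixedPrime.lines-trivial p prime p>2 a b d K a>0 b>0 (s≤s z≤n) constants p≤ A B S 0∉A×B S⊆SL S-symmetric S-large S-small S-spread)
        in u , v , h , main , ≤-trans error (≤-reflexive (cong (λ w → w * cardPt A ^ (2 * d) * cardPt B ^ (2 * d) * cardMat S ^ (3 * d)) (p-power p))))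
     , λ k lines → FixedPrime.conclusion p prime p>2 a b d K a>0 b>0 (s≤s z≤n) constants p≤ A B S 0∉A×B S⊆SL S-symmetric S-large S-small S-spread k
                     (Bridge.line-count p prime p>2 B k lines)
  where
  opaque
    -- Opaque because it is a large numeral, computed from all the constants.
    exponent : ℕ
    exponent = proj₁ constants-bounded

    exponent-bound : ∀ K → 2 ≤ K → concentrationConstant K + 8 * flatteningConstant K ≤ K ^ exponent
    exponent-bound = proj₂ constants-bounded

  -- With this exponent the 2b-th power of the constants is at most `K ^ degree`. The root taken is
  -- of order `suc degree`, because `integer-root` expects the predecessor of the order.
  degree d : ℕ
  degree = exponent * (2 * b)
  d = suc degree

  b>0 : 0 < b
  b>0 = <-trans a>0 a<b

  K≥2 : ∀ p K → 3 + 2 ^ d ≤ p → p < suc K ^ d → 2 ≤ K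
  K≥2 p K h l = ≮⇒≥ λ K<2 → <⇒≱ l (≤-trans (^-monoˡ-≤ d K<2) (≤-trans (m≤n+m (2 ^ d) 3) h))

  1+K≤2K : ∀ K → 2 ≤ K → suc K ≤ 2 * K
  1+K≤2K K h = ≤-trans (+-monoˡ-≤ K (≤-trans (s≤s z≤n) h)) (≤-reflexive (cong (K +_) (sym (+-identityʳ K))))

  constants : ∀ p K → 2 ≤ K → K ^ d ≤ p → 0 < p → (concentrationConstant K + 8 * flatteningConstant K) ^ (2 * b) ≤ p ^ a
  constants p K h l p>0 = begin
    (concentrationConstant K + 8 * flatteningConstant K) ^ (2 * b)  ≤⟨ ^-monoˡ-≤ (2 * b) (exponent-bound K h) ⟩
    (K ^ exponent) ^ (2 * b)                                        ≡⟨ ^-*-assoc K exponent (2 * b) ⟩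
    K ^ degree                                                      ≤⟨ ^-monoʳ-≤ K {{>-nonZero (≤-trans (s≤s z≤n) h)}} (n≤1+n degree) ⟩
    K ^ d                                                           ≤⟨ l ⟩
    p                                                               ≡⟨ *-identityʳ p ⟨
    p ^ 1                                                           ≤⟨ ^-monoʳ-≤ p {{>-nonZero p>0}} a>0 ⟩
    p ^ a                                                           ∎
    where open ≤-Reasoning

  p-power : ∀ p → 2 ^ (4 * d) * p ^ d * p ^ d ≡ 2 ^ (4 * d) * p ^ (2 * d)
  p-power p = trans (*-assoc (2 ^ (4 * d)) (p ^ d) (p ^ d)) (cong (2 ^ (4 * d) *_) (sym (square-power p d)))
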